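{- For every tree poset $P$ of height $k\ge2$ and every $\varepsilon>0$, there exists a constant $K=K(\varepsilon,P)>0$ such that for all sufficiently large $n$ there is a fingerprint $(\mathcal{T},g,C)$ of $\mathcal{G}_P$ with: (a) every $T\in\mathcal{T}$ satisfies $|\widehat{T}|\le\frac{K}{n}\binom{n}{n/2}$; (b) for each $s$, the number of $T\in\mathcal{T}$ with $|\widehat{T}|=s$ is at most $\left(\frac{K\binom{n}{n/2}}{s}\right)^s\exp\left(\frac{K}{n}\binom{n}{n/2}\right)$; (c) $|C(g(I))|\le(k-1+\varepsilon)\binom{n}{n/2}$ for every $I\in\mathcal{I}(\mathcal{G}_P)$.
   Context: $\mathcal{B}_n$ is the power set of $[n]$; $\binom{n}{n/2}$ means $\binom{n}{\lfloor n/2\rfloor}$. $P$ is a tree poset if its Hasse diagram (as an undirected graph) is a tree; its height is the maximum size of a chain. $\mathcal{G}_P$ is the $|P|$-uniform hypergraph on vertex set $\mathcal{B}_n$ whose edges are the sets of $|P|$ members of $\mathcal{B}_n$ which, ordered by inclusion, form a poset isomorphic to $P$; $\mathcal{I}(\mathcal{G}_P)$ is its set of independent sets (the induced $P$-free families). A fingerprint of $\mathcal{G}_P$ is a triple $(\mathcal{T},g,C)$ where $\mathcal{T}$ is a collection of vectors $T=(T_1,\dots,T_m)$ of pairwise disjoint subsets of $V(\mathcal{G}_P)$ (with $\widehat{T}=\bigcup_iT_i$), $g:\mathcal{I}(\mathcal{G}_P)\to\mathcal{T}$ satisfies $\widehat{g(I)}\subseteq I$ for every $I$, and $C:\mathcal{T}\to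 2^{V(\mathcal{G}_P)}$ satisfies $I\subseteq C(g(I))$ for every $I\in\mathcal{I}(\mathcal{G}_P)$. -}

module Defs where

open import Data.Nat as ℕ using (ℕ; zero; suc; _!)
open import Data.Integer as ℤ using (ℤ)
open import Data.Rational as ℚ using (ℚ; 0ℚ; 1ℚ)
open import Data.Bool using (Bool; true; false; _∨_; if_then_else_)
open import Data.Fin using (Fin; zero; suc; inject₁; fromℕ)
open import Data.Fin.Subset using (Subset; inside; outside; _⊆_)
open import Data.Vec using (_∷_; [])
open import Data.List using (List; []; _∷_; map; _++_; foldr)
open import Data.Nat.ListAction using (sum)
open import Data.Nat.Combinatorics using (_C_)
open import Data.List.Membership.Propositional using (_∈_)
open import Data.List.Relation.Unary.AllPairs using (AllPairs)
open import Data.Product using (Σ; _×_; ∃)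
open import Data.Sum using (_⊎_)
open import Data.Empty using (⊥)
open import Relation.Nullary using (¬_; does)
open import Relation.Binary.PropositionalEquality using (_≡_; _≢_)
open import Relation.Binary.Structures using (IsPartialOrder)
open import Function.Definitions using (Injective)

record FinPoset : Set₁ where
  field
    size : ℕ
    _≼_  : Fin size → Fin size → Set
    isPartialOrder : IsPartialOrder _≡_ _≼_

module _ (P : FinPoset) where
  open FinPoset P

  Covers : Fin size → Fin size → Set
  Covers x y = x ≼ y × x ≢ y × (∀ z → x ≼ z → z ≼ y → z ≡ x ⊎ z ≡ y)

  HasseAdj : Fin size → Fin size → Set
  HasseAdj x y = Covers x y ⊎ Covers y x

  HasseConnected : Set
  HasseConnected = ∀ x y → Σ ℕ λ l → Σ (Fin (suc l) → Fin size) λ v →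
    v zero ≡ x × v (fromℕ l) ≡ y × (∀ (i : Fin l) → HasseAdj (v (inject₁ i)) (v (suc i)))

  HasseHasCycle : Set
  HasseHasCycle = Σ ℕ λ m → 2 ℕ.≤ m × Σ (Fin (suc m) → Fin size) λ v →
    Injective _≡_ _≡_ v × (∀ (i : Fin m) → HasseAdj (v (inject₁ i)) (v (suc i)))
      × HasseAdj (v (fromℕ m)) (v zero)

  IsTreePoset : Set
  IsTreePoset = HasseConnected × ¬ HasseHasCycle

  IsChain : (m : ℕ) → (Fin m → Fin size) → Set
  IsChain m c = Injective _≡_ _≡_ c × (∀ i j → c i ≼ c j ⊎ c j ≼ c i)

  HasHeight : ℕ → Set
  HasHeight k = (Σ (Fin k → Fin size) λ c → IsChain k c)
              × (∀ m (c : Fin m → Fin size) → IsChain m c → m ℕ.≤ k)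

allSubsets : (n : ℕ) → List (Subset n)
allSubsets zero = [] ∷ []
allSubsets (suc n) = map (inside ∷_) (allSubsets n) ++ map (outside ∷_) (allSubsets n)

Family : ℕ → Set
Family n = Subset n → Bool

_∈F_ : ∀ {n} → Subset n → Family n → Set
A ∈F F = F A ≡ true

_⊆F_ : ∀ {n} → Family n → Family n → Set
F ⊆F G = ∀ A → A ∈F F → A ∈F G

DisjointF : ∀ {n} → Family n → Family n → Set
DisjointF F G = ∀ A → A ∈F F → A ∈F G → ⊥

∣_∣F : ∀ {n} → Family n → ℕ
∣_∣F {n} F = sum (map (λ A → if F A then 1 else 0) (allSubsets n))

⋃ : ∀ {n} → List (Family n) → Family n
⋃ = foldr (λ F G A → F A ∨ G A) (λ _ → false)

ContainsInducedCopy : (P : FinPoset) → ∀ {n} → Family n → Set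
ContainsInducedCopy P {n} I =
  Σ (Fin (FinPoset.size P) → Subset n) λ φ →
    Injective _≡_ _≡_ φ × (∀ x → φ x ∈F I)
    × (∀ x y → (φ x ⊆ φ y → FinPoset._≼_ P x y) × (FinPoset._≼_ P x y → φ x ⊆ φ y))

-- independent sets of G_P (induced P-free families)
Independent : (P : FinPoset) → ∀ {n} → Family n → Set
Independent P I = ¬ ContainsInducedCopy P I

-- fingerprint (𝒯, g, C) of G_P on B_n; a vector T is a list of families
record Fingerprint (P : FinPoset) (n : ℕ) : Set where
  field
    𝒯 : List (List (Family n))
    𝒯-disjoint : ∀ T → T ∈ 𝒯 → AllPairs DisjointF T
    g : Family n → List (Family n)
    g-∈ : ∀ I → Independent P I → g I ∈ 𝒯
    g-⊆ : ∀ I → Independent P I → ⋃ (g I) ⊆F I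
    C : List (Family n) → Family n
    C-⊇ : ∀ I → Independent P I → I ⊆F C (g I)

countSize : ∀ {n} → List (List (Family n)) → ℕ → ℕ
countSize 𝒯 s = sum (map (λ T → if does (∣ ⋃ T ∣F ℕ.≟ s) then 1 else 0) 𝒯)

ℕ→ℚ : ℕ → ℚ
ℕ→ℚ a = ℤ.+ a ℚ./ 1

-- a / b  (only used with b ≥ 1; value 0 when b = 0)
frac : ℕ → ℕ → ℚ
frac a zero = 0ℚ
frac a (suc b) = ℤ.+ a ℚ./ suc b

_^ℚ_ : ℚ → ℕ → ℚ
x ^ℚ zero = 1ℚ
x ^ℚ suc m = x ℚ.* (x ^ℚ m)

B : ℕ → ℚ
B n = ℕ→ℚ (n C (n ℕ./ 2))

expPartial : ℕ → ℚ → ℚ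
expPartial zero x = 0ℚ
expPartial (suc N) x = expPartial N x ℚ.+ (x ^ℚ N) ℚ.* frac 1 (N !)

-- y ≤ a · exp(x), with exp(x) the limit of the partial sums:
-- for every δ > 0, eventually y ≤ a · S_N(x) + δ
LeMulExp : ℚ → ℚ → ℚ → Set
LeMulExp y a x = ∀ δ → 0ℚ ℚ.< δ → Σ ℕ λ N₀ → ∀ N → N₀ ℕ.≤ N →
  y ℚ.≤ a ℚ.* expPartial N x ℚ.+ δ

-- Measure a family by its weight, the expected number of its members on a random maximal chain.
-- A tree poset of height k embeds in a tree built by attaching one node at a time, with ranks
-- at most k. If a family of middle levels has weight at least k - 1 + τ, enough of it is rich:
-- random walks up and down from its members meet the family again as often as the ranks require.
-- Placing the tree by first hits of these walks yields a measure on induced copies which is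
-- dominated by products of reversible kernels with small entries.
--
-- A container step removes the leaves of the tree one at a time, visiting the possible positions
-- u of the leaf in turn. If the copies with leaf u would add much to a truncated measure on copies
-- of the smaller tree, ask whether u lies in I: if so, pick u and add them, otherwise delete u
-- from the container. The deleted weight and the accumulated measure then share the original
-- mass. With no leaf left, independence of I forbids the whole support. Each step deletes constant
-- weight. While the weight is at least 3k, one residue class of levels mod 3 suffices, whose
-- kernels are O(1/n^3), and O(B/n^2) picks per step do, where B is the central binomial
-- coefficient; afterwards the family has size O(B) and boundedly many steps with O(B/n) picks
-- remain. The fingerprint consists of the picks of the two phases, and the container is recovered
-- by replaying the procedure on the picks.

module Submission where

open import Defs
open import Data.Nat as ℕ using (ℕ; zero; suc; _∸_; z≤n; s≤s)
import Data.Nat.Properties as ℕₚ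
import Data.Nat.Combinatorics as Comb
open import Data.Nat.DivMod using (m%n<n; m/n*n≤m; m≡m%n+[m/n]*n; m/n*n≡m; m*n/n≡m; /-monoˡ-≤)
open import Data.Nat.Divisibility using (_∣_; ∣⇒≤)
open import Data.Integer as ℤ using (ℤ)
import Data.Integer.Properties as ℤₚ
open import Data.Rational as ℚ using (ℚ; 0ℚ; 1ℚ; _≤_; _<_; _⊓_)
open import Data.Rational.Properties as ℚₚ using (≤-refl; ≤-trans; ≤-reflexive)
open import Data.Rational.Unnormalised using (ℚᵘ; mkℚᵘ; *≡*; *≤*; *<*)
import Data.Rational.Unnormalised as ℚᵘ
import Data.Rational.Unnormalised.Properties as ℚᵘₚ
open import Data.Bool using (Bool; true; false; not; _∧_; _∨_; _xor_; if_then_else_)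
import Data.Bool.Properties as Boolₚ
open import Data.Fin using (Fin; zero; suc; inject₁; fromℕ)
import Data.Fin.Properties as Finₚ
import Data.Fin.Induction as Finᵢ
open import Induction.WellFounded using (Acc; acc)
open import Data.Fin.Subset using (Subset; _⊆_)
open import Data.Vec using (Vec; []; _∷_; lookup; _[_]%=_; here; there)
import Data.Vec.Properties as Vecₚ
open import Data.List using (List; []; _∷_; map; _++_; length; filterᵇ; concatMap; allFin; tabulate; upTo)
open import Data.Nat.ListAction using (sum)
import Data.List.Properties as Listₚ
open import Data.List.Membership.Propositional using (_∈_; find; lose)
open import Data.List.Membership.Propositional.Properties using (∈-++⁺ˡ; ∈-++⁺ʳ; ∈-++⁻; ∈-map⁺; ∈-map⁻; ∈-concatMap⁺; ∈-concatMap⁻; ∈-allFin; ∈-upTo⁺; ∈-upTo⁻)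
open import Data.List.Relation.Unary.Any using (here; there; any?)
open import Data.List.Relation.Unary.All using (All; []; _∷_)
import Data.List.Relation.Unary.All as All
import Data.List.Relation.Unary.Unique.Propositional.Properties as Unique
import Data.Nat.Tactic.RingSolver as ℕRing
open import Data.List.Relation.Unary.AllPairs using (AllPairs; []; _∷_)
open import Data.Product using (Σ; _×_; _,_; proj₁; proj₂)
open import Data.Sum using (_⊎_; inj₁; inj₂; [_,_]′)
open import Data.Empty using (⊥; ⊥-elim)
open import Function using (id; case_of_)
open import Function.Definitions using (Injective)
open import Relation.Nullary using (¬_; Dec; yes; no; does)
open import Relation.Nullary.Decidable using (dec⇒maybe; decidable-stable; dec-true; dec-false; ⌊_⌋; _×-dec_; _⊎-dec_; _→-dec_; ¬?)
open import Relation.Binary.PropositionalEquality using (_≡_; _≢_; refl; sym; trans; cong; cong₂; subst; subst₂; module ≡-Reasoning)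
open import Algebra.Bundles using (CommutativeRing)
open import Algebra.Structures using (IsCommutativeRing)
open import Relation.Binary.Structures using (IsPartialOrder)
open import Tactic.RingSolver using (solve-∀)
open import Tactic.RingSolver.Core.AlmostCommutativeRing using (AlmostCommutativeRing; fromCommutativeRing)

-- The count in (b) forces the two phases and the modulus 3. A pick of the first phase may be any of
-- the 2^n sets, so N₁ such picks cost a factor 2^((n+1)N₁); this is exp(O(B/n)) only if N₁ =
-- O(B/n^2). The window of middle levels has width linear in n, hence weight up to n + 1, and each
-- step deletes constant weight, so there are O(n) steps and each may pick weight O(1/n^3). The
-- picked weight is inversely proportional to `s`, the reciprocal of a bound on the kernel entries,
-- which is of order n^r when comparable members on different levels are at least r levels apart: r
-- = 3 is the first value that suffices. In the second phase the picks come from a pool of O(B)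
-- sets, which the main factor of (b) pays for, so r = 1 is enough. The window may be linear because
-- the embedding only needs its relative width, the drift, to be below a constant; by the fourth
-- moment the sets outside then number o(B). Weight replaces cardinality because the walks are
-- reversible with respect to it and every set weighs at least 1/B.

infixl 6 _+_ _-_
infixl 7 _*_
infix 8 -_

-- ℚ._+_ and ℚ._*_ normalise fractions; opaque copies never unfold to gcd computations.
opaque
  _+_ : ℚ → ℚ → ℚ
  _+_ = ℚ._+_

  _*_ : ℚ → ℚ → ℚ
  _*_ = ℚ._*_

  -_ : ℚ → ℚ
  -_ = ℚ.-_

_-_ : ℚ → ℚ → ℚ
p - q = p + (- q)

opaque
  unfolding _+_

  +-def : ∀ p q → p + q ≡ p ℚ.+ q
  +-def p q = refl

  *-def : ∀ p q → p * q ≡ p ℚ.* q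
  *-def p q = refl

  +-*-isCommutativeRing : IsCommutativeRing _≡_ _+_ _*_ -_ 0ℚ 1ℚ
  +-*-isCommutativeRing = ℚₚ.+-*-isCommutativeRing

  +-mono-≤ : ∀ {p q r s} → p ≤ q → r ≤ s → p + r ≤ q + s
  +-mono-≤ = ℚₚ.+-mono-≤

  *-monoˡ : ∀ r {p q} → 0ℚ ≤ r → p ≤ q → r * p ≤ r * q
  *-monoˡ r 0≤r h = ℚₚ.*-monoˡ-≤-nonNeg r {{ℚ.nonNegative 0≤r}} h

  *-monoʳ : ∀ r {p q} → 0ℚ ≤ r → p ≤ q → p * r ≤ q * r
  *-monoʳ r 0≤r h = ℚₚ.*-monoʳ-≤-nonNeg r {{ℚ.nonNegative 0≤r}} h

  *-pos : ∀ {p q} → 0ℚ < p → 0ℚ < q → 0ℚ < p * q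
  *-pos {p} {q} 0<p 0<q = subst (ℚ._< p ℚ.* q) (ℚₚ.*-zeroʳ p) (ℚₚ.*-monoʳ-<-pos p {{ℚ.positive 0<p}} 0<q)

  *-cancelˡ : ∀ r {p q} → 0ℚ < r → r * p ≤ r * q → p ≤ q
  *-cancelˡ r 0<r h = ℚₚ.*-cancelˡ-≤-pos r {{ℚ.positive 0<r}} h

  1/-inverse : ∀ q .{{_ : ℚ.NonZero q}} → ℚ.1/ q * q ≡ 1ℚ
  1/-inverse q = ℚₚ.*-inverseˡ q

+-*-commutativeRing : CommutativeRing _ _
+-*-commutativeRing = record { isCommutativeRing = +-*-isCommutativeRing }

open CommutativeRing +-*-commutativeRing public
  using (+-comm; +-assoc; *-comm; *-assoc; +-identityˡ; +-identityʳ; *-identityˡ; *-identityʳ)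
  renaming (zeroˡ to *-zeroˡ; zeroʳ to *-zeroʳ; distribˡ to *-distribˡ-+; distribʳ to *-distribʳ-+; -‿inverseʳ to +-inverseʳ)

ℚring : AlmostCommutativeRing _ _
ℚring = fromCommutativeRing +-*-commutativeRing (λ x → dec⇒maybe (0ℚ ℚₚ.≟ x))

opaque
  infix 4 _≤?_ _<?_

  _≤?_ : (p q : ℚ) → Dec (p ≤ q)
  _≤?_ = ℚₚ._≤?_

  _<?_ : (p q : ℚ) → Dec (p < q)
  _<?_ = ℚₚ._<?_

-- Naturals and their reciprocals inside the rationals

opaque
  ι : ℕ → ℚ
  ι = ℕ→ℚ

  rec : ℕ → ℚ
  rec = frac 1

opaque
  unfolding ι rec _+_

  ι-def : ∀ a → ι a ≡ ℕ→ℚ a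
  ι-def a = refl

  rec-def : ∀ a → rec a ≡ frac 1 a
  rec-def a = refl

  ι-0 : ι 0 ≡ 0ℚ
  ι-0 = refl

  ι-1 : ι 1 ≡ 1ℚ
  ι-1 = refl

  rec-0 : rec 0 ≡ 0ℚ
  rec-0 = refl

  toℚᵘ-ι : ∀ a → ℚ.toℚᵘ (ι a) ℚᵘ.≃ mkℚᵘ (ℤ.+ a) 0
  toℚᵘ-ι a = ℚₚ.toℚᵘ-fromℚᵘ (mkℚᵘ (ℤ.+ a) 0)

  ι-+ : ∀ a b → ι (a ℕ.+ b) ≡ ι a + ι b
  ι-+ a b = ℚₚ.toℚᵘ-injective (begin
    ℚ.toℚᵘ (ι (a ℕ.+ b))                  ≈⟨ toℚᵘ-ι (a ℕ.+ b) ⟩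
    mkℚᵘ (ℤ.+ (a ℕ.+ b)) 0                   ≈⟨ *≡* (cong (ℤ._* ℤ.+ 1) (trans (ℤₚ.pos-+ a b) (sym (cong₂ ℤ._+_ (ℤₚ.*-identityʳ (ℤ.+ a)) (ℤₚ.*-identityʳ (ℤ.+ b)))))) ⟩
    mkℚᵘ (ℤ.+ a) 0 ℚᵘ.+ mkℚᵘ (ℤ.+ b) 0         ≈⟨ ℚᵘₚ.≃-sym (ℚᵘₚ.+-cong (toℚᵘ-ι a) (toℚᵘ-ι b)) ⟩
    ℚ.toℚᵘ (ι a) ℚᵘ.+ ℚ.toℚᵘ (ι b)         ≈⟨ ℚᵘₚ.≃-sym (ℚₚ.toℚᵘ-homo-+ (ι a) (ι b)) ⟩
    ℚ.toℚᵘ (ι a + ι b)  ∎)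
    where open ℚᵘₚ.≃-Reasoning

  ι-* : ∀ a b → ι (a ℕ.* b) ≡ ι a * ι b
  ι-* a b = ℚₚ.toℚᵘ-injective (begin
    ℚ.toℚᵘ (ι (a ℕ.* b))                  ≈⟨ toℚᵘ-ι (a ℕ.* b) ⟩
    mkℚᵘ (ℤ.+ (a ℕ.* b)) 0                   ≈⟨ *≡* (cong (ℤ._* ℤ.+ 1) (ℤₚ.pos-* a b)) ⟩
    mkℚᵘ (ℤ.+ a) 0 ℚᵘ.* mkℚᵘ (ℤ.+ b) 0         ≈⟨ ℚᵘₚ.≃-sym (ℚᵘₚ.*-cong (toℚᵘ-ι a) (toℚᵘ-ι b)) ⟩
    ℚ.toℚᵘ (ι a) ℚᵘ.* ℚ.toℚᵘ (ι b)         ≈⟨ ℚᵘₚ.≃-sym (ℚₚ.toℚᵘ-homo-* (ι a) (ι b)) ⟩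
    ℚ.toℚᵘ (ι a * ι b)  ∎)
    where open ℚᵘₚ.≃-Reasoning

  ι-mono : ∀ {a b} → a ℕ.≤ b → ι a ≤ ι b
  ι-mono {a} {b} a≤b = ℚₚ.toℚᵘ-cancel-≤ (begin
    ℚ.toℚᵘ (ι a)    ≃⟨ toℚᵘ-ι a ⟩
    mkℚᵘ (ℤ.+ a) 0  ≤⟨ *≤* (ℤₚ.*-monoʳ-≤-nonNeg (ℤ.+ 1) (ℤ.+≤+ a≤b)) ⟩
    mkℚᵘ (ℤ.+ b) 0     ≃⟨ ℚᵘₚ.≃-sym (toℚᵘ-ι b) ⟩
    ℚ.toℚᵘ (ι b)  ∎)
    where open ℚᵘₚ.≤-Reasoning

  ι-mono-< : ∀ {a b} → a ℕ.< b → ι a < ι b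
  ι-mono-< {a} {b} a<b = ℚₚ.toℚᵘ-cancel-< (begin-strict
    ℚ.toℚᵘ (ι a)    ≃⟨ toℚᵘ-ι a ⟩
    mkℚᵘ (ℤ.+ a) 0  <⟨ *<* (ℤₚ.*-monoʳ-<-pos (ℤ.+ 1) (ℤ.+<+ a<b)) ⟩
    mkℚᵘ (ℤ.+ b) 0     ≃⟨ ℚᵘₚ.≃-sym (toℚᵘ-ι b) ⟩
    ℚ.toℚᵘ (ι b)  ∎)
    where open ℚᵘₚ.≤-Reasoning

  ι-cancel-≤ : ∀ {a b} → ι a ≤ ι b → a ℕ.≤ b
  ι-cancel-≤ {a} {b} h with a ℕ.≤? b
  ... | yes p = p
  ... | no ¬p = ⊥-elim (ℚₚ.<-irrefl refl (ℚₚ.<-≤-trans (ι-mono-< (ℕₚ.≰⇒> ¬p)) h))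

  frac≡ι*rec : ∀ a b → frac a b ≡ ι a * rec b
  frac≡ι*rec a zero = sym (*-zeroʳ (ι a))
  frac≡ι*rec a (suc b) = ℚₚ.toℚᵘ-injective (begin
    ℚ.toℚᵘ (frac a (suc b))               ≈⟨ ℚₚ.toℚᵘ-fromℚᵘ (mkℚᵘ (ℤ.+ a) b) ⟩
    mkℚᵘ (ℤ.+ a) b                           ≈⟨ *≡* (cong₂ ℤ._*_ (sym (ℤₚ.*-identityʳ (ℤ.+ a))) (cong ℤ.+_ (ℕₚ.*-identityˡ (suc b)))) ⟩
    mkℚᵘ (ℤ.+ a) 0 ℚᵘ.* mkℚᵘ (ℤ.+ 1) b         ≈⟨ ℚᵘₚ.≃-sym (ℚᵘₚ.*-cong (toℚᵘ-ι a) (ℚₚ.toℚᵘ-fromℚᵘ (mkℚᵘ (ℤ.+ 1) b))) ⟩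
    ℚ.toℚᵘ (ι a) ℚᵘ.* ℚ.toℚᵘ (rec (suc b)) ≈⟨ ℚᵘₚ.≃-sym (ℚₚ.toℚᵘ-homo-* (ι a) (rec (suc b))) ⟩
    ℚ.toℚᵘ (ι a * rec (suc b))  ∎)
    where open ℚᵘₚ.≃-Reasoning

  frac-self : ∀ b → frac (suc b) (suc b) ≡ 1ℚ
  frac-self b = ℚₚ.toℚᵘ-injective (ℚᵘₚ.≃-trans (ℚₚ.toℚᵘ-fromℚᵘ (mkℚᵘ (ℤ.+ suc b) b)) (*≡* (ℤₚ.*-comm (ℤ.+ suc b) (ℤ.+ 1))))

  ι*rec : ∀ b → 1 ℕ.≤ b → ι b * rec b ≡ 1ℚ
  ι*rec (suc b) _ = trans (sym (frac≡ι*rec (suc b) (suc b))) (frac-self b)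

  0<rec : ∀ {b} → 1 ℕ.≤ b → 0ℚ < rec b
  0<rec {suc b} _ = ℚₚ.positive⁻¹ (rec (suc b)) {{ℚₚ.normalize-pos 1 (suc b)}}

  0≤rec : ∀ b → 0ℚ ≤ rec b
  0≤rec zero = ≤-refl
  0≤rec (suc b) = ℚₚ.<⇒≤ (0<rec {suc b} (s≤s z≤n))

  archimedean : ∀ q → Σ ℕ λ N → q ≤ ι N
  archimedean q@(ℚ.mkℚ i d _) = ℤ.∣ i ∣ , ℚₚ.toℚᵘ-cancel-≤ (ℚᵘₚ.≤-respʳ-≃ (ℚᵘₚ.≃-sym (toℚᵘ-ι ℤ.∣ i ∣)) (*≤* (num≤ i)))
    where
      num≤ : ∀ i → i ℤ.* (ℤ.+ 1) ℤ.≤ (ℤ.+ ℤ.∣ i ∣) ℤ.* (ℤ.+ suc d)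
      num≤ (ℤ.+ a) = subst₂ ℤ._≤_ (ℤₚ.pos-* a 1) (ℤₚ.pos-* a (suc d)) (ℤ.+≤+ (ℕₚ.*-monoʳ-≤ a (s≤s z≤n)))
      num≤ (ℤ.-[1+ a ]) = subst (ℤ._≤ (ℤ.+ suc a) ℤ.* (ℤ.+ suc d)) (sym (ℤₚ.*-identityʳ ℤ.-[1+ a ])) (subst (ℤ.-[1+ a ] ℤ.≤_) (ℤₚ.pos-* (suc a) (suc d)) ℤ.-≤+)

0≤ι : ∀ a → 0ℚ ≤ ι a
0≤ι a = subst (_≤ ι a) ι-0 (ι-mono {0} {a} z≤n)

0≤1 : 0ℚ ≤ 1ℚ
0≤1 = subst (0ℚ ≤_) ι-1 (0≤ι 1)

0<ι : ∀ {a} → 1 ℕ.≤ a → 0ℚ < ι a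
0<ι {a} h = subst (_< ι a) ι-0 (ι-mono-< {0} {a} h)

*-nn : ∀ {p q} → 0ℚ ≤ p → 0ℚ ≤ q → 0ℚ ≤ p * q
*-nn {p} {q} 0≤p 0≤q = subst (_≤ p * q) (*-zeroʳ p) (*-monoˡ p 0≤p 0≤q)

+-nn : ∀ {p q} → 0ℚ ≤ p → 0ℚ ≤ q → 0ℚ ≤ p + q
+-nn {p} {q} 0≤p 0≤q = subst (_≤ p + q) (+-identityˡ 0ℚ) (+-mono-≤ 0≤p 0≤q)

*-mono2 : ∀ {a b c d} → 0ℚ ≤ b → 0ℚ ≤ c → a ≤ b → c ≤ d → a * c ≤ b * d
*-mono2 {a} {b} {c} {d} 0≤b 0≤c ab cd = ≤-trans (*-monoʳ c 0≤c ab) (*-monoˡ b 0≤b cd)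

≤-from-diff : ∀ {p q} e → 0ℚ ≤ e → q ≡ p + e → p ≤ q
≤-from-diff {p} {q} e 0≤e eq = subst (p ≤_) (sym eq) (subst (_≤ p + e) (+-identityʳ p) (+-mono-≤ (≤-refl {p}) 0≤e))

private
  sub-self : ∀ p → p - p ≡ 0ℚ
  sub-self = +-inverseʳ

0≤diff : ∀ {p q} → p ≤ q → 0ℚ ≤ q - p
0≤diff {p} {q} h = subst (_≤ q - p) (sub-self p) (+-mono-≤ h (≤-refl { - p}))

opaque
  unfolding _+_

  ring-1 : ∀ p q → q ≡ p + (q - p)
  ring-1 = solve-∀ ℚring

≤-of-0≤diff : ∀ {p q} → 0ℚ ≤ q - p → p ≤ q
≤-of-0≤diff {p} {q} h = ≤-from-diff (q - p) h (ring-1 p q)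

p≤p+q : ∀ {p q} → 0ℚ ≤ q → p ≤ p + q
p≤p+q {p} {q} h = ≤-from-diff q h refl

q≤p+q : ∀ {p q} → 0ℚ ≤ p → q ≤ p + q
q≤p+q {p} {q} h = ≤-from-diff p h (+-comm p q)

<⇒¬≤ : ∀ {p q} → p < q → ¬ (q ≤ p)
<⇒¬≤ h k = ℚₚ.<-irrefl refl (ℚₚ.<-≤-trans h k)

rec-anti : ∀ {a b} → 1 ℕ.≤ a → a ℕ.≤ b → rec b ≤ rec a
rec-anti {a} {b} 1≤a a≤b = *-cancelˡ (ι b) (0<ι 1≤b) (begin
  ι b * rec b  ≡⟨ ι*rec b 1≤b ⟩
  1ℚ  ≡⟨ sym (ι*rec a 1≤a) ⟩
  ι a * rec a  ≤⟨ *-monoʳ (rec a) (0≤rec a) (ι-mono a≤b) ⟩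
  ι b * rec a  ∎)
  where open ℚₚ.≤-Reasoning
        1≤b = ℕₚ.≤-trans 1≤a a≤b

opaque
  unfolding _+_

  ring-2 : ∀ x a ra b rb → x * ((a * ra) * (b * rb)) ≡ ((a * b) * x) * (ra * rb)
  ring-2 = solve-∀ ℚring

rec-* : ∀ a b → rec (a ℕ.* b) ≡ rec a * rec b
rec-* zero b = trans rec-0 (sym (trans (cong (_* rec b) rec-0) (*-zeroˡ (rec b))))
rec-* (suc a) zero = trans (cong rec (ℕₚ.*-zeroʳ (suc a))) (trans rec-0 (sym (trans (cong (rec (suc a) *_) rec-0) (*-zeroʳ (rec (suc a))))))
rec-* (suc a) (suc b) = begin
  rec ab  ≡⟨ sym (*-identityʳ (rec ab)) ⟩
  rec ab * 1ℚ  ≡⟨ cong (rec ab *_) (sym 1=) ⟩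
  rec ab * ((ι A * rec A) * (ι B' * rec B'))  ≡⟨ ring-2 (rec ab) (ι A) (rec A) (ι B') (rec B') ⟩
  ((ι A * ι B') * rec ab) * (rec A * rec B')  ≡⟨ cong (λ z → (z * rec ab) * (rec A * rec B')) (sym (ι-* A B')) ⟩
  (ι ab * rec ab) * (rec A * rec B')  ≡⟨ cong (_* (rec A * rec B')) (ι*rec ab (s≤s z≤n)) ⟩
  1ℚ * (rec A * rec B')  ≡⟨ *-identityˡ _ ⟩
  rec A * rec B'  ∎
  where
    open ≡-Reasoning
    A = suc a
    B' = suc b
    ab = A ℕ.* B'
    1= : (ι A * rec A) * (ι B' * rec B') ≡ 1ℚ
    1= = trans (cong₂ _*_ (ι*rec A (s≤s z≤n)) (ι*rec B' (s≤s z≤n))) (*-identityˡ 1ℚ)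

-- Finite sums and indicators

∑ : {X : Set} → List X → (X → ℚ) → ℚ
∑ [] f = 0ℚ
∑ (x ∷ xs) f = f x + ∑ xs f

opaque
  unfolding _+_

  +-interchange : ∀ a b c d → (a + b) + (c + d) ≡ (a + c) + (b + d)
  +-interchange = solve-∀ ℚring

module _ {X : Set} where

  ∑-cong∈ : (xs : List X) {f g : X → ℚ} → (∀ x → x ∈ xs → f x ≡ g x) → ∑ xs f ≡ ∑ xs g
  ∑-cong∈ [] h = refl
  ∑-cong∈ (x ∷ xs) h = cong₂ _+_ (h x (here refl)) (∑-cong∈ xs (λ y y∈ → h y (there y∈)))

  ∑-cong : (xs : List X) {f g : X → ℚ} → (∀ x → f x ≡ g x) → ∑ xs f ≡ ∑ xs g
  ∑-cong xs h = ∑-cong∈ xs (λ x _ → h x)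

  ∑-mono∈ : (xs : List X) {f g : X → ℚ} → (∀ x → x ∈ xs → f x ≤ g x) → ∑ xs f ≤ ∑ xs g
  ∑-mono∈ [] h = ≤-refl
  ∑-mono∈ (x ∷ xs) h = +-mono-≤ (h x (here refl)) (∑-mono∈ xs (λ y y∈ → h y (there y∈)))

  ∑-mono : (xs : List X) {f g : X → ℚ} → (∀ x → f x ≤ g x) → ∑ xs f ≤ ∑ xs g
  ∑-mono xs h = ∑-mono∈ xs (λ x _ → h x)

  ∑-+ : (xs : List X) (f g : X → ℚ) → ∑ xs (λ x → f x + g x) ≡ ∑ xs f + ∑ xs g
  ∑-+ [] f g = sym (+-identityˡ 0ℚ)
  ∑-+ (x ∷ xs) f g = trans (cong (f x + g x +_) (∑-+ xs f g)) (+-interchange (f x) (g x) (∑ xs f) (∑ xs g))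

  ∑-*ˡ : (xs : List X) (r : ℚ) (f : X → ℚ) → ∑ xs (λ x → r * f x) ≡ r * ∑ xs f
  ∑-*ˡ [] r f = sym (*-zeroʳ r)
  ∑-*ˡ (x ∷ xs) r f = trans (cong (r * f x +_) (∑-*ˡ xs r f)) (sym (*-distribˡ-+ r (f x) (∑ xs f)))

  ∑-*ʳ : (xs : List X) (r : ℚ) (f : X → ℚ) → ∑ xs (λ x → f x * r) ≡ ∑ xs f * r
  ∑-*ʳ xs r f = trans (∑-cong xs (λ x → *-comm (f x) r)) (trans (∑-*ˡ xs r f) (*-comm r (∑ xs f)))

  ∑-0 : (xs : List X) → ∑ xs (λ _ → 0ℚ) ≡ 0ℚ
  ∑-0 [] = refl
  ∑-0 (x ∷ xs) = trans (+-identityˡ _) (∑-0 xs)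

  ∑-nn : (xs : List X) {f : X → ℚ} → (∀ x → 0ℚ ≤ f x) → 0ℚ ≤ ∑ xs f
  ∑-nn xs h = subst (_≤ ∑ xs _) (∑-0 xs) (∑-mono xs h)

  ∑-++ : (xs ys : List X) (f : X → ℚ) → ∑ (xs ++ ys) f ≡ ∑ xs f + ∑ ys f
  ∑-++ [] ys f = sym (+-identityˡ _)
  ∑-++ (x ∷ xs) ys f = trans (cong (f x +_) (∑-++ xs ys f)) (sym (+-assoc (f x) (∑ xs f) (∑ ys f)))

  opaque
    unfolding _+_

    ring-3 : ∀ r a → r + a * r ≡ (1ℚ + a) * r
    ring-3 = solve-∀ ℚring

  ∑-const : (xs : List X) (r : ℚ) → ∑ xs (λ _ → r) ≡ ι (length xs) * r
  ∑-const [] r = sym (trans (cong (_* r) ι-0) (*-zeroˡ r))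
  ∑-const (x ∷ xs) r = begin
    r + ∑ xs (λ _ → r)  ≡⟨ cong (r +_) (∑-const xs r) ⟩
    r + ι (length xs) * r  ≡⟨ ring-3 r (ι (length xs)) ⟩
    (1ℚ + ι (length xs)) * r  ≡⟨ cong (_* r) (sym (trans (ι-+ 1 (length xs)) (cong (_+ ι (length xs)) ι-1))) ⟩
    ι (suc (length xs)) * r  ∎
    where open ≡-Reasoning

  ∑-term-≤ : (xs : List X) {f : X → ℚ} → (∀ x → 0ℚ ≤ f x) → ∀ {x} → x ∈ xs → f x ≤ ∑ xs f
  ∑-term-≤ (y ∷ xs) nn (here refl) = p≤p+q (∑-nn xs nn)
  ∑-term-≤ (y ∷ xs) nn (there h) = ≤-trans (∑-term-≤ xs nn h) (q≤p+q (nn y))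

∑-map : {X Y : Set} (g : X → Y) (xs : List X) (f : Y → ℚ) → ∑ (map g xs) f ≡ ∑ xs (λ x → f (g x))
∑-map g [] f = refl
∑-map g (x ∷ xs) f = cong (f (g x) +_) (∑-map g xs f)

∑-concatMap : {X Y : Set} (g : X → List Y) (xs : List X) (f : Y → ℚ) → ∑ (concatMap g xs) f ≡ ∑ xs (λ x → ∑ (g x) f)
∑-concatMap g [] f = refl
∑-concatMap g (x ∷ xs) f = trans (∑-++ (g x) (concatMap g xs) f) (cong (∑ (g x) f +_) (∑-concatMap g xs f))

∑-swap : {X Y : Set} (xs : List X) (ys : List Y) (f : X → Y → ℚ) →
  ∑ xs (λ x → ∑ ys (f x)) ≡ ∑ ys (λ y → ∑ xs (λ x → f x y))
∑-swap [] ys f = sym (∑-0 ys)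
∑-swap (x ∷ xs) ys f = trans (cong (∑ ys (f x) +_) (∑-swap xs ys f)) (sym (∑-+ ys (f x) (λ y → ∑ xs (λ z → f z y))))

𝟙 : Bool → ℚ
𝟙 true = 1ℚ
𝟙 false = 0ℚ

0≤𝟙 : ∀ b → 0ℚ ≤ 𝟙 b
0≤𝟙 true = 0≤1
0≤𝟙 false = ≤-refl

𝟙≤1 : ∀ b → 𝟙 b ≤ 1ℚ
𝟙≤1 true = ≤-refl
𝟙≤1 false = 0≤1

𝟙*≤ : ∀ b {p} → 0ℚ ≤ p → 𝟙 b * p ≤ p
𝟙*≤ b {p} h = subst (𝟙 b * p ≤_) (*-identityˡ p) (*-monoʳ p h (𝟙≤1 b))

𝟙-∧ : ∀ a b → 𝟙 (a ∧ b) ≡ 𝟙 a * 𝟙 b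
𝟙-∧ true b = sym (*-identityˡ (𝟙 b))
𝟙-∧ false b = sym (*-zeroˡ (𝟙 b))

𝟙-split : ∀ b p → p ≡ 𝟙 b * p + 𝟙 (not b) * p
𝟙-split true p = sym (trans (cong₂ _+_ (*-identityˡ p) (*-zeroˡ p)) (+-identityʳ p))
𝟙-split false p = sym (trans (cong₂ _+_ (*-zeroˡ p) (*-identityˡ p)) (+-identityˡ p))

rec-below : ∀ q → 0ℚ < q → Σ ℕ λ t → 1 ℕ.≤ t × rec t ≤ q
rec-below q 0<q = suc N , s≤s z≤n , *-cancelˡ (ι (suc N)) (0<ι (s≤s z≤n)) (begin
  ι (suc N) * rec (suc N)  ≡⟨ ι*rec (suc N) (s≤s z≤n) ⟩
  1ℚ  ≡⟨ sym (1/-inverse q) ⟩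
  ℚ.1/ q * q  ≤⟨ *-monoʳ q (ℚₚ.<⇒≤ 0<q) (≤-trans (proj₂ (archimedean (ℚ.1/ q))) (ι-mono (ℕₚ.n≤1+n N))) ⟩
  ι (suc N) * q  ∎)
  where
    open ℚₚ.≤-Reasoning
    instance
      q≢0 : ℚ.NonZero q
      q≢0 = ℚₚ.pos⇒nonZero q {{ℚ.positive 0<q}}
    N = proj₁ (archimedean (ℚ.1/ q))

-- Adaptive queries to an unknown set, and their replay

data Query (X R : Set) : Set where
  ret : R → Query X R
  ask : X → (Bool → Query X R) → Query X R

module _ {X : Set} where

  run : {R : Set} → (X → Bool) → Query X R → R
  run I (ret r) = r
  run I (ask u q) = run I (q (I u))

  -- Only positive answers are recorded. The negative ones need no record, because a subset of `I`
  -- answers no wherever `I` does.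
  picks : {R : Set} → (X → Bool) → Query X R → List X
  picks I (ret r) = []
  picks I (ask u q) = if I u then u ∷ picks I (q (I u)) else picks I (q (I u))

  infixl 1 _>>=_
  _>>=_ : {R S : Set} → Query X R → (R → Query X S) → Query X S
  ret r >>= k = k r
  ask u q >>= k = ask u (λ b → q b >>= k)

  run->>= : {R S : Set} (I : X → Bool) (q : Query X R) (k : R → Query X S) →
    run I (q >>= k) ≡ run I (k (run I q))
  run->>= I (ret r) k = refl
  run->>= I (ask u q) k = run->>= I (q (I u)) k

  picks->>= : {R S : Set} (I : X → Bool) (q : Query X R) (k : R → Query X S) →
    picks I (q >>= k) ≡ picks I q ++ picks I (k (run I q))
  picks->>= I (ret r) k = refl
  picks->>= I (ask u q) k with I u
  ... | true = cong (u ∷_) (picks->>= I (q true) k)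
  ... | false = picks->>= I (q false) k

  picks⊆ : {R : Set} (I : X → Bool) (q : Query X R) → ∀ v → v ∈ picks I q → I v ≡ true
  picks⊆ I (ask u q) v v∈ with I u in eq
  picks⊆ I (ask u q) .u (here refl) | true = eq
  picks⊆ I (ask u q) v (there v∈) | true = picks⊆ I (q true) v v∈
  ... | false = picks⊆ I (q false) v v∈

  -- A set lying between the picks and I answers every query of the run as I does.
  replay : {R : Set} (I F : X → Bool) (q : Query X R) →
    (∀ v → v ∈ picks I q → F v ≡ true) → (∀ v → F v ≡ true → I v ≡ true) → run F q ≡ run I q
  replay I F (ret r) h k = refl
  replay I F (ask u q) h k with I u in eqI
  ... | true rewrite h u (here refl) = replay I F (q true) (λ v v∈ → h v (there v∈)) k
  ... | false with F u in eqF
  ...   | true = case trans (sym eqI) (k u eqF) of λ ()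
  ...   | false = replay I F (q false) h k

-- Code m builds a tree with m + 1 nodes: ext joins a new node, numbered zero, to an earlier one,
-- above it (true) or below it (false).
data Code : ℕ → Set where
  root : Code 0
  ext  : ∀ {m} → Code m → Fin (suc m) → Bool → Code (suc m)

-- The entries of the kernels are at most `1/s`: the larger `s` is, the fewer picks a step makes.
-- `γ` is the threshold, in units of `s * c u`, above which a leaf position `u` is worth a query.
record WalkSystem (X : Set) : Set where
  field
    xs : List X
    c : X → ℚ
    h : Bool → X → X → ℚ
    s γ : ℚ
    0<s : 0ℚ < s
    0≤γ : 0ℚ ≤ γ
    0≤c : ∀ v → 0ℚ ≤ c v
    0≤h : ∀ d v w → 0ℚ ≤ h d v w
    h-substochastic : ∀ d v → ∑ xs (h d v) ≤ 1ℚ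
    h-subinvariant : ∀ d w → ∑ xs (λ v → c v * h d v w) ≤ c w
    h-small : ∀ d v w → s * h d v w ≤ 1ℚ

vecs : {X : Set} → List X → ∀ m → List (Vec X m)
vecs xs zero = [] ∷ []
vecs xs (suc m) = concatMap (λ w → map (w ∷_) (vecs xs m)) xs

∑-vecs : {X : Set} (xs : List X) (m : ℕ) (f : Vec X (suc m) → ℚ) →
  ∑ (vecs xs (suc m)) f ≡ ∑ xs (λ w → ∑ (vecs xs m) (λ t → f (w ∷ t)))
∑-vecs xs m f = trans (∑-concatMap _ xs f) (∑-cong xs (λ w → ∑-map (w ∷_) (vecs xs m) f))

-- Removing one leaf of the tree

module Container {X : Set} (S : WalkSystem X) where
  open WalkSystem S
  open ℚₚ.≤-Reasoning

  -- The unnormalised law of a walk indexed by the tree: the root is distributed as `c`, and every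
  -- further node is one `h`-step away from the node that it joins.
  base : ∀ {m} → Code m → Vec X (suc m) → ℚ
  base root (v ∷ []) = c v
  base (ext C par d) (w ∷ t) = base C t * h d (lookup t par) w

  0≤base : ∀ {m} (C : Code m) t → 0ℚ ≤ base C t
  0≤base root (v ∷ []) = 0≤c v
  0≤base (ext C par d) (w ∷ t) = *-nn (0≤base C t) (0≤h d (lookup t par) w)

  opaque
    unfolding _+_

    ring-4 : ∀ a b e → a * b * e ≡ (a * e) * b
    ring-4 = solve-∀ ℚring

  -- If the newest node is not the observed one, it is summed out by `h-substochastic`. If it is,
  -- induction replaces the law of its neighbour by `c`, and `h-subinvariant` carries `c` to `c`.
  base-marginal : ∀ {m} (C : Code m) (i : Fin (suc m)) (f : X → ℚ) → (∀ v → 0ℚ ≤ f v) →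
    ∑ (vecs xs (suc m)) (λ t → base C t * f (lookup t i)) ≤ ∑ xs (λ v → c v * f v)
  base-marginal root zero f 0≤f = ≤-reflexive (trans (∑-vecs xs 0 _) (∑-cong xs (λ v → +-identityʳ _)))
  base-marginal {suc m} (ext C par d) zero f 0≤f = begin
    ∑ (vecs xs (suc (suc m))) (λ t → base (ext C par d) t * f (lookup t zero))
      ≡⟨ ∑-vecs xs (suc m) _ ⟩
    ∑ xs (λ w → ∑ (vecs xs (suc m)) (λ t → base C t * h d (lookup t par) w * f w))
      ≡⟨ ∑-cong xs (λ w → ∑-*ʳ (vecs xs (suc m)) (f w) _) ⟩
    ∑ xs (λ w → ∑ (vecs xs (suc m)) (λ t → base C t * h d (lookup t par) w) * f w)
      ≤⟨ ∑-mono xs (λ w → *-monoʳ (f w) (0≤f w) (≤-trans (base-marginal C par (λ v → h d v w) (λ v → 0≤h d v w)) (h-subinvariant d w))) ⟩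
    ∑ xs (λ w → c w * f w) ∎
  base-marginal {suc m} (ext C par d) (suc i) f 0≤f = begin
    ∑ (vecs xs (suc (suc m))) (λ t → base (ext C par d) t * f (lookup t (suc i)))
      ≡⟨ ∑-vecs xs (suc m) _ ⟩
    ∑ xs (λ w → ∑ (vecs xs (suc m)) (λ t → base C t * h d (lookup t par) w * f (lookup t i)))
      ≡⟨ ∑-swap xs (vecs xs (suc m)) _ ⟩
    ∑ (vecs xs (suc m)) (λ t → ∑ xs (λ w → base C t * h d (lookup t par) w * f (lookup t i)))
      ≤⟨ ∑-mono (vecs xs (suc m)) inner ⟩
    ∑ (vecs xs (suc m)) (λ t → base C t * f (lookup t i))
      ≤⟨ base-marginal C i f 0≤f ⟩
    ∑ xs (λ v → c v * f v) ∎
    where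
      inner : ∀ t → ∑ xs (λ w → base C t * h d (lookup t par) w * f (lookup t i)) ≤ base C t * f (lookup t i)
      inner t = begin
        ∑ xs (λ w → base C t * h d (lookup t par) w * f (lookup t i))
          ≡⟨ ∑-cong xs (λ w → ring-4 (base C t) (h d (lookup t par) w) (f (lookup t i))) ⟩
        ∑ xs (λ w → base C t * f (lookup t i) * h d (lookup t par) w)
          ≡⟨ ∑-*ˡ xs (base C t * f (lookup t i)) (h d (lookup t par)) ⟩
        base C t * f (lookup t i) * ∑ xs (h d (lookup t par))
          ≤⟨ *-monoˡ _ (*-nn (0≤base C t) (0≤f (lookup t i))) (h-substochastic d (lookup t par)) ⟩
        base C t * f (lookup t i) * 1ℚ
          ≡⟨ *-identityʳ _ ⟩
        base C t * f (lookup t i) ∎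

  base-total : ∀ {m} (C : Code m) → ∑ (vecs xs (suc m)) (base C) ≤ ∑ xs c
  base-total C = begin
    ∑ (vecs xs _) (base C)  ≡⟨ ∑-cong (vecs xs _) (λ t → sym (*-identityʳ (base C t))) ⟩
    ∑ (vecs xs _) (λ t → base C t * 1ℚ)  ≤⟨ base-marginal C zero (λ _ → 1ℚ) (λ _ → 0≤1) ⟩
    ∑ xs (λ v → c v * 1ℚ)  ≡⟨ ∑-cong xs (λ v → *-identityʳ (c v)) ⟩
    ∑ xs c  ∎

  module Pass {m : ℕ} (C : Code m) (par : Fin (suc m)) (d : Bool) (W : Vec X (suc (suc m)) → ℚ) (K : ℚ) where

    ts : List (Vec X (suc m))
    ts = vecs xs (suc m)

    -- The cap is twice `K * base C t` so that one increment, which is at most `K * base C t`, fits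
    -- in full as long as `y t` is in the lower half.
    add : X → (Vec X (suc m) → ℚ) → Vec X (suc m) → ℚ
    add u y t = (y t + s * W (u ∷ t)) ⊓ ((K + K) * base C t)

    qualified? : (y : Vec X (suc m) → ℚ) (u : X) → Dec (γ * s * c u < ∑ ts (add u y) - ∑ ts y)
    qualified? y u = γ * s * c u <? (∑ ts (add u y) - ∑ ts y)

    pass : List X → (Vec X (suc m) → ℚ) → List X → Query X ((Vec X (suc m) → ℚ) × List X)
    pass [] y r = ret (y , r)
    pass (u ∷ us) y r = if does (qualified? y u)
      then ask u (λ b → if b then pass us (add u y) r else pass us y (u ∷ r))
      else pass us y r

    module _ (0≤W : ∀ t → 0ℚ ≤ W t) (W≤ : ∀ t → W t ≤ K * base (ext C par d) t) (0≤K : 0ℚ ≤ K) where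

      Bounded : (Vec X (suc m) → ℚ) → Set
      Bounded y = ∀ t → y t ≤ (K + K) * base C t

      opaque
        unfolding _+_

        ring-5 : ∀ s k b e → s * (k * (b * e)) ≡ k * b * (s * e)
        ring-5 = solve-∀ ℚring

      sW≤ : ∀ u t → s * W (u ∷ t) ≤ K * base C t
      sW≤ u t = begin
        s * W (u ∷ t)  ≤⟨ *-monoˡ s (ℚₚ.<⇒≤ 0<s) (W≤ (u ∷ t)) ⟩
        s * (K * (base C t * h d (lookup t par) u))  ≡⟨ ring-5 s K (base C t) (h d (lookup t par) u) ⟩
        K * base C t * (s * h d (lookup t par) u)  ≤⟨ *-monoˡ _ (*-nn 0≤K (0≤base C t)) (h-small d (lookup t par) u) ⟩
        K * base C t * 1ℚ  ≡⟨ *-identityʳ _ ⟩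
        K * base C t  ∎

      ∑sW≤ : ∀ u → ∑ ts (λ t → s * W (u ∷ t)) ≤ s * (K * c u)
      ∑sW≤ u = begin
        ∑ ts (λ t → s * W (u ∷ t))  ≡⟨ ∑-*ˡ ts s _ ⟩
        s * ∑ ts (λ t → W (u ∷ t))  ≤⟨ *-monoˡ s (ℚₚ.<⇒≤ 0<s) (∑-mono ts (λ t → W≤ (u ∷ t))) ⟩
        s * ∑ ts (λ t → K * (base C t * h d (lookup t par) u))  ≡⟨ cong (s *_) (∑-*ˡ ts K _) ⟩
        s * (K * ∑ ts (λ t → base C t * h d (lookup t par) u))  ≤⟨ *-monoˡ s (ℚₚ.<⇒≤ 0<s) (*-monoˡ K 0≤K (≤-trans (base-marginal C par (λ v → h d v u) (λ v → 0≤h d v u)) (h-subinvariant d u))) ⟩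
        s * (K * c u)  ∎

      add-bounded : ∀ u y → Bounded (add u y)
      add-bounded u y t = ℚₚ.p⊓q≤q (y t + s * W (u ∷ t)) _

      0≤sW : ∀ u t → 0ℚ ≤ s * W (u ∷ t)
      0≤sW u t = *-nn (ℚₚ.<⇒≤ 0<s) (0≤W (u ∷ t))

      add-≥ : ∀ u y → Bounded y → ∀ t → y t ≤ add u y t
      add-≥ u y by t = ℚₚ.⊓-glb (p≤p+q (0≤sW u t)) (by t)

      opaque
        unfolding _+_

        ring-6 : ∀ a b → a + b - a ≡ b
        ring-6 = solve-∀ ℚring

      gain≤ : ∀ u y → ∑ ts (add u y) - ∑ ts y ≤ s * (K * c u)
      gain≤ u y = begin
        ∑ ts (add u y) - ∑ ts y  ≤⟨ +-mono-≤ (∑-mono ts (λ t → ℚₚ.p⊓q≤p (y t + s * W (u ∷ t)) _)) (≤-refl { - ∑ ts y}) ⟩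
        ∑ ts (λ t → y t + s * W (u ∷ t)) - ∑ ts y  ≡⟨ cong (_- ∑ ts y) (∑-+ ts y _) ⟩
        ∑ ts y + ∑ ts (λ t → s * W (u ∷ t)) - ∑ ts y  ≡⟨ ring-6 (∑ ts y) _ ⟩
        ∑ ts (λ t → s * W (u ∷ t))  ≤⟨ ∑sW≤ u ⟩
        s * (K * c u)  ∎

      -- The gain is at most `s * (K * c u)`, so the strict threshold excludes positions with `c u`
      -- zero. This later keeps all picks inside the family that the step works on.
      qualified-pos : ∀ u y → γ * s * c u < ∑ ts (add u y) - ∑ ts y → 0ℚ < c u
      qualified-pos u y q with 0ℚ <? c u
      ... | yes p = p
      ... | no ¬p = ⊥-elim (<⇒¬≤ q (≤-trans (gain≤ u y) (subst₂ _≤_ (sym eqL) (sym eqR) ≤-refl)))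
        where
          cu≡0 : c u ≡ 0ℚ
          cu≡0 = ℚₚ.≤-antisym (ℚₚ.≮⇒≥ ¬p) (0≤c u)
          eqL : s * (K * c u) ≡ 0ℚ
          eqL = trans (cong (s *_) (trans (cong (K *_) cu≡0) (*-zeroʳ K))) (*-zeroʳ s)
          eqR : γ * s * c u ≡ 0ℚ
          eqR = trans (cong (γ * s *_) cu≡0) (*-zeroʳ (γ * s))

      unsat : (Vec X (suc m) → ℚ) → Vec X (suc m) → Bool
      unsat y t = does (y t ≤? K * base C t)

      opaque
        unfolding _+_

        ring-7 : ∀ a b → b ≡ a + b - a
        ring-7 = solve-∀ ℚring

      -- `Y` is the final measure. Measures only grow, so an entry that ends in the lower half of
      -- its allowance was there all along, and the cap never cut its increments.
      unsat-gain : ∀ u y Y → Bounded y → (∀ t → y t ≤ Y t) → ∀ t →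
        𝟙 (unsat Y t) * (s * W (u ∷ t)) ≤ add u y t - y t
      unsat-gain u y Y by yY t with Y t ≤? K * base C t
      ... | no _ = subst (_≤ add u y t - y t) (sym (*-zeroˡ (s * W (u ∷ t)))) (0≤diff (add-≥ u y by t))
      ... | yes p = ≤-reflexive (trans (*-identityˡ _) (trans (ring-7 (y t) (s * W (u ∷ t))) (cong (_- y t) (sym (ℚₚ.p≤q⇒p⊓q≡p fits)))))
        where
          fits : y t + s * W (u ∷ t) ≤ (K + K) * base C t
          fits = subst (y t + s * W (u ∷ t) ≤_) (sym (*-distribʳ-+ (base C t) K K)) (+-mono-≤ (≤-trans (yY t) p) (sW≤ u t))

      result : (X → Bool) → List X → (Vec X (suc m) → ℚ) → List X → Vec X (suc m) → ℚ
      result I us y r = proj₁ (run I (pass us y r))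

      removed : (X → Bool) → List X → (Vec X (suc m) → ℚ) → List X → List X
      removed I us y r = proj₂ (run I (pass us y r))

      taken : (X → Bool) → List X → (Vec X (suc m) → ℚ) → List X → List X
      taken I us y r = picks I (pass us y r)

      module _ (I : X → Bool) where

        result-≥ : ∀ us y r → Bounded y → ∀ t → y t ≤ result I us y r t
        result-≥ [] y r by t = ≤-refl
        result-≥ (u ∷ us) y r by t with qualified? y u
        ... | no _ = result-≥ us y r by t
        ... | yes _ with I u
        ...   | true = ≤-trans (add-≥ u y by t) (result-≥ us (add u y) r (add-bounded u y) t)
        ...   | false = result-≥ us y (u ∷ r) by t

        result-bounded : ∀ us y r → Bounded y → Bounded (result I us y r)
        result-bounded [] y r by = by
        result-bounded (u ∷ us) y r by with qualified? y u
        ... | no _ = result-bounded us y r by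
        ... | yes _ with I u
        ...   | true = result-bounded us (add u y) r (add-bounded u y)
        ...   | false = result-bounded us y (u ∷ r) by

        -- Mass enters only through positions in `I`. Hence, starting from 0, a copy of the smaller
        -- tree that has received mass extends by a leaf in `I` to a copy in the support of `W`.
        result-support : ∀ us y r t → 0ℚ < result I us y r t → 0ℚ < y t ⊎ Σ X λ u → I u ≡ true × 0ℚ < W (u ∷ t)
        result-support [] y r t p = inj₁ p
        result-support (u ∷ us) y r t p with qualified? y u
        ... | no _ = result-support us y r t p
        ... | yes _ with I u in eq
        ...   | false = result-support us y (u ∷ r) t p
        ...   | true with result-support us (add u y) r t p
        ...     | inj₂ q = inj₂ q
        ...     | inj₁ q with 0ℚ <? y t | 0ℚ <? W (u ∷ t)
        ...       | yes a | _ = inj₁ a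
        ...       | no _ | yes b = inj₂ (u , eq , b)
        ...       | no a | no b = ⊥-elim (<⇒¬≤ q (≤-trans (ℚₚ.p⊓q≤p _ _) (subst (y t + s * W (u ∷ t) ≤_) (trans (+-identityˡ _) (*-zeroʳ s)) (+-mono-≤ (ℚₚ.≮⇒≥ a) (*-monoˡ s (ℚₚ.<⇒≤ 0<s) (ℚₚ.≮⇒≥ b))))))

        removed-∉ : ∀ us y r v → v ∈ removed I us y r → v ∈ r ⊎ I v ≡ false
        removed-∉ [] y r v v∈ = inj₁ v∈
        removed-∉ (u ∷ us) y r v v∈ with qualified? y u
        ... | no _ = removed-∉ us y r v v∈
        ... | yes _ with I u in eq
        ...   | true = removed-∉ us (add u y) r v v∈
        ...   | false with removed-∉ us y (u ∷ r) v v∈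
        ...     | inj₁ (here refl) = inj₂ eq
        ...     | inj₁ (there v∈r) = inj₁ v∈r
        ...     | inj₂ e = inj₂ e

        removed-⊇ : ∀ us y r v → v ∈ r → v ∈ removed I us y r
        removed-⊇ [] y r v v∈ = v∈
        removed-⊇ (u ∷ us) y r v v∈ with qualified? y u
        ... | no _ = removed-⊇ us y r v v∈
        ... | yes _ with I u
        ...   | true = removed-⊇ us (add u y) r v v∈
        ...   | false = removed-⊇ us y (u ∷ r) v (there v∈)

        taken-pos : ∀ us y r v → v ∈ taken I us y r → 0ℚ < c v
        taken-pos (u ∷ us) y r v v∈ with qualified? y u
        ... | no _ = taken-pos us y r v v∈
        ... | yes q with I u
        taken-pos (u ∷ us) y r .u (here refl) | yes q | true = qualified-pos u y q
        taken-pos (u ∷ us) y r v (there v∈) | yes q | true = taken-pos us (add u y) r v v∈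
        ...   | false = taken-pos us y (u ∷ r) v v∈

        opaque
          unfolding _+_

          ring-8 : ∀ a b e → a + b + e ≡ b + (a + e)
          ring-8 = solve-∀ ℚring

        -- The comparison is with a predicate because lists removed in different passes may overlap;
        -- within one pass every entry of `us` is removed at most once.
        removed-weight : ∀ us y r (φ : X → Bool) → (∀ v → v ∈ removed I us y r → φ v ≡ true) →
          ∑ (removed I us y r) c ≤ ∑ r c + ∑ us (λ v → 𝟙 (φ v) * c v)
        removed-weight [] y r φ hφ = ≤-reflexive (sym (+-identityʳ _))
        removed-weight (u ∷ us) y r φ hφ with qualified? y u
        ... | no _ = ≤-trans (removed-weight us y r φ hφ) (+-mono-≤ (≤-refl {∑ r c}) (q≤p+q (*-nn (0≤𝟙 (φ u)) (0≤c u))))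
        ... | yes _ with I u
        ...   | true = ≤-trans (removed-weight us (add u y) r φ hφ) (+-mono-≤ (≤-refl {∑ r c}) (q≤p+q (*-nn (0≤𝟙 (φ u)) (0≤c u))))
        ...   | false = ≤-trans (removed-weight us y (u ∷ r) φ hφ) (≤-reflexive (trans (ring-8 (c u) (∑ r c) _) (cong (λ z → ∑ r c + (z + ∑ us (λ v → 𝟙 (φ v) * c v))) (sym eq))))
          where
            eq : 𝟙 (φ u) * c u ≡ c u
            eq = trans (cong (λ z → 𝟙 z * c u) (hφ u (removed-⊇ us y (u ∷ r) u (here refl)))) (*-identityˡ (c u))

        opaque
          unfolding _+_

          ring-9 : ∀ a b p e → a * (b + p) + e ≡ a * p + (a * b + e)
          ring-9 = solve-∀ ℚring

          ring-10 : ∀ a b → a - b + b ≡ a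
          ring-10 = solve-∀ ℚring

        -- Every pick raises the total measure by more than `γ * s * c u`. As the total is capped, a
        -- large `s` leaves room for few picks.
        taken-weight : ∀ us y r → Bounded y → γ * s * ∑ (taken I us y r) c + ∑ ts y ≤ ∑ ts (result I us y r)
        taken-weight [] y r by = ≤-reflexive (trans (cong (_+ ∑ ts y) (*-zeroʳ (γ * s))) (+-identityˡ _))
        taken-weight (u ∷ us) y r by with qualified? y u
        ... | no _ = taken-weight us y r by
        ... | yes q with I u
        ...   | false = taken-weight us y (u ∷ r) by
        ...   | true = begin
          γ * s * (c u + P) + ∑ ts y  ≡⟨ ring-9 (γ * s) (c u) P (∑ ts y) ⟩
          γ * s * P + (γ * s * c u + ∑ ts y)  ≤⟨ +-mono-≤ (≤-refl {γ * s * P}) (+-mono-≤ (ℚₚ.<⇒≤ q) (≤-refl {∑ ts y})) ⟩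
          γ * s * P + (∑ ts (add u y) - ∑ ts y + ∑ ts y)  ≡⟨ cong (γ * s * P +_) (ring-10 (∑ ts (add u y)) (∑ ts y)) ⟩
          γ * s * P + ∑ ts (add u y)  ≤⟨ taken-weight us (add u y) r (add-bounded u y) ⟩
          ∑ ts (result I us (add u y) r)  ∎
          where
            P = ∑ (taken I us (add u y) r) c

        opaque
          unfolding _+_

          ring-11 : ∀ a → - a ≡ (- 1ℚ) * a
          ring-11 = solve-∀ ℚring

          ring-12 : ∀ e s k a g r p → e + (s * (k * a) + (g + s * (k * (r + p)))) ≡ e + g + s * (k * (r + (a + p)))
          ring-12 = solve-∀ ℚring

          ring-13 : ∀ s k a b r → s * (k * a) + b + s * (k * r) ≡ b + s * (k * (a + r))
          ring-13 = solve-∀ ℚring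

        -- A skipped position contributes to unsaturated entries at most its gain, which does not
        -- exceed the threshold. A queried position contributes at most `s * (K * c u)`, which is
        -- charged to the removed or the taken weight.
        unsat-estimate : ∀ us y r → Bounded y →
          ∑ us (λ u → ∑ ts (λ t → 𝟙 (unsat (result I us y r) t) * (s * W (u ∷ t)))) + s * (K * ∑ r c)
            ≤ ∑ us (λ u → γ * s * c u) + s * (K * (∑ (removed I us y r) c + ∑ (taken I us y r) c))
        unsat-estimate [] y r by = ≤-reflexive (cong (λ z → 0ℚ + s * (K * z)) (sym (+-identityʳ _)))
        unsat-estimate (u ∷ us) y r by with qualified? y u
        ... | no ¬q = begin
          A + D + R₀  ≡⟨ +-assoc A D R₀ ⟩
          A + (D + R₀)  ≤⟨ +-mono-≤ A≤ (unsat-estimate us y r by) ⟩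
          γ * s * c u + (G + R₁) ≡⟨ sym (+-assoc (γ * s * c u) G R₁) ⟩
          γ * s * c u + G + R₁ ∎
          where
            Y = result I us y r
            A = ∑ ts (λ t → 𝟙 (unsat Y t) * (s * W (u ∷ t)))
            D = ∑ us (λ u → ∑ ts (λ t → 𝟙 (unsat Y t) * (s * W (u ∷ t))))
            R₀ = s * (K * ∑ r c)
            G = ∑ us (λ u → γ * s * c u)
            R₁ = s * (K * (∑ (removed I us y r) c + ∑ (taken I us y r) c))
            A≤ : A ≤ γ * s * c u
            A≤ = begin
              A  ≤⟨ ∑-mono ts (unsat-gain u y Y by (result-≥ us y r by)) ⟩
              ∑ ts (λ t → add u y t - y t)  ≡⟨ ∑-+ ts (add u y) _ ⟩
              ∑ ts (add u y) + ∑ ts (λ t → - y t)  ≡⟨ cong (∑ ts (add u y) +_) (∑-neg ts y) ⟩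
              ∑ ts (add u y) - ∑ ts y  ≤⟨ ℚₚ.≮⇒≥ ¬q ⟩
              γ * s * c u  ∎
              where
                ∑-neg : ∀ (l : List (Vec X (suc m))) f → ∑ l (λ t → - f t) ≡ - ∑ l f
                ∑-neg l f = trans (∑-cong l (λ t → ring-11 (f t))) (trans (∑-*ˡ l (- 1ℚ) f) (sym (ring-11 (∑ l f))))
        ... | yes _ with I u
        ...   | true = begin
          A + D + R₀  ≡⟨ +-assoc A D R₀ ⟩
          A + (D + R₀)  ≤⟨ +-mono-≤ A≤ (unsat-estimate us (add u y) r (add-bounded u y)) ⟩
          s * (K * c u) + (G + s * (K * (R + P)))  ≤⟨ q≤p+q {γ * s * c u} (*-nn (*-nn 0≤γ (ℚₚ.<⇒≤ 0<s)) (0≤c u)) ⟩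
          γ * s * c u + (s * (K * c u) + (G + s * (K * (R + P))))  ≡⟨ ring-12 (γ * s * c u) s K (c u) G R P ⟩
          γ * s * c u + G + s * (K * (R + (c u + P)))  ∎
          where
            Y = result I us (add u y) r
            A = ∑ ts (λ t → 𝟙 (unsat Y t) * (s * W (u ∷ t)))
            D = ∑ us (λ u → ∑ ts (λ t → 𝟙 (unsat Y t) * (s * W (u ∷ t))))
            R₀ = s * (K * ∑ r c)
            G = ∑ us (λ u → γ * s * c u)
            R = ∑ (removed I us (add u y) r) c
            P = ∑ (taken I us (add u y) r) c
            A≤ : A ≤ s * (K * c u)
            A≤ = ≤-trans (∑-mono ts (λ t → 𝟙*≤ (unsat Y t) (0≤sW u t))) (∑sW≤ u)
        ...   | false = begin
          A + D + R₀  ≤⟨ +-mono-≤ (+-mono-≤ A≤ (≤-refl {D})) (≤-refl {R₀}) ⟩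
          s * (K * c u) + D + s * (K * ∑ r c)  ≡⟨ ring-13 s K (c u) D (∑ r c) ⟩
          D + s * (K * (c u + ∑ r c))  ≤⟨ unsat-estimate us y (u ∷ r) by ⟩
          G + R₁  ≤⟨ q≤p+q {γ * s * c u} (*-nn (*-nn 0≤γ (ℚₚ.<⇒≤ 0<s)) (0≤c u)) ⟩
          γ * s * c u + (G + R₁)  ≡⟨ sym (+-assoc (γ * s * c u) G R₁) ⟩
          γ * s * c u + G + R₁  ∎
          where
            Y = result I us y (u ∷ r)
            A = ∑ ts (λ t → 𝟙 (unsat Y t) * (s * W (u ∷ t)))
            D = ∑ us (λ u → ∑ ts (λ t → 𝟙 (unsat Y t) * (s * W (u ∷ t))))
            R₀ = s * (K * ∑ r c)
            G = ∑ us (λ u → γ * s * c u)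
            R₁ = s * (K * (∑ (removed I us y (u ∷ r)) c + ∑ (taken I us y (u ∷ r)) c))
            A≤ : A ≤ s * (K * c u)
            A≤ = ≤-trans (∑-mono ts (λ t → 𝟙*≤ (unsat Y t) (0≤sW u t))) (∑sW≤ u)

        opaque
          unfolding _+_

          ring-14 : ∀ s k b e → s * (k * (b * e)) ≡ s * (k * b) * e
          ring-14 = solve-∀ ℚring

        -- A saturated entry holds more than `K * base C t`, while `W` gives to `t`, over all leaf
        -- positions together, at most that much.
        sat-estimate : ∀ (Y : Vec X (suc m) → ℚ) → (∀ t → 0ℚ ≤ Y t) →
          ∑ xs (λ u → ∑ ts (λ t → 𝟙 (not (unsat Y t)) * (s * W (u ∷ t)))) ≤ s * ∑ ts Y
        sat-estimate Y 0≤Y = begin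
          ∑ xs (λ u → ∑ ts (λ t → 𝟙 (not (unsat Y t)) * (s * W (u ∷ t))))
            ≡⟨ ∑-swap xs ts _ ⟩
          ∑ ts (λ t → ∑ xs (λ u → 𝟙 (not (unsat Y t)) * (s * W (u ∷ t))))
            ≤⟨ ∑-mono ts inner ⟩
          ∑ ts (λ t → s * Y t)
            ≡⟨ ∑-*ˡ ts s Y ⟩
          s * ∑ ts Y ∎
          where
            0≤s = ℚₚ.<⇒≤ 0<s
            all : ∀ t → ∑ xs (λ u → s * W (u ∷ t)) ≤ s * (K * base C t)
            all t = begin
              ∑ xs (λ u → s * W (u ∷ t))  ≤⟨ ∑-mono xs (λ u → *-monoˡ s 0≤s (W≤ (u ∷ t))) ⟩
              ∑ xs (λ u → s * (K * (base C t * h d (lookup t par) u)))  ≡⟨ ∑-cong xs (λ u → ring-14 s K (base C t) _) ⟩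
              ∑ xs (λ u → s * (K * base C t) * h d (lookup t par) u)  ≡⟨ ∑-*ˡ xs (s * (K * base C t)) (h d (lookup t par)) ⟩
              s * (K * base C t) * ∑ xs (h d (lookup t par))  ≤⟨ *-monoˡ _ (*-nn 0≤s (*-nn 0≤K (0≤base C t))) (h-substochastic d (lookup t par)) ⟩
              s * (K * base C t) * 1ℚ  ≡⟨ *-identityʳ _ ⟩
              s * (K * base C t)  ∎
            inner : ∀ t → ∑ xs (λ u → 𝟙 (not (unsat Y t)) * (s * W (u ∷ t))) ≤ s * Y t
            inner t with Y t ≤? K * base C t
            ... | yes _ = begin
              ∑ xs (λ u → 0ℚ * (s * W (u ∷ t)))  ≡⟨ ∑-cong xs (λ u → *-zeroˡ (s * W (u ∷ t))) ⟩
              ∑ xs (λ u → 0ℚ)  ≡⟨ ∑-0 xs ⟩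
              0ℚ  ≤⟨ *-nn 0≤s (0≤Y t) ⟩
              s * Y t  ∎
            ... | no ¬p = begin
              ∑ xs (λ u → 1ℚ * (s * W (u ∷ t)))  ≡⟨ ∑-cong xs (λ u → *-identityˡ (s * W (u ∷ t))) ⟩
              ∑ xs (λ u → s * W (u ∷ t))  ≤⟨ all t ⟩
              s * (K * base C t)  ≤⟨ *-monoˡ s 0≤s (ℚₚ.<⇒≤ (ℚₚ.≰⇒> ¬p)) ⟩
              s * Y t  ∎

        opaque
          unfolding _+_

          ring-15 : ∀ g s a b e → g * s * a + s * b + s * e ≡ s * (g * a + b + e)
          ring-15 = solve-∀ ℚring

        -- The three terms are the three fates of the mass of `W`: lost at skipped positions,
        -- charged to removed or picked positions, or inherited by the measure on the smaller tree.
        pass-estimate : let Y = result I xs (λ _ → 0ℚ) [] in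
          ∑ (vecs xs (suc (suc m))) W ≤
            γ * ∑ xs c + K * (∑ (removed I xs (λ _ → 0ℚ) []) c + ∑ (taken I xs (λ _ → 0ℚ) []) c) + ∑ ts Y
        pass-estimate = *-cancelˡ s 0<s (begin
          s * ∑ (vecs xs (suc (suc m))) W
            ≡⟨ cong (s *_) (∑-vecs xs (suc m) W) ⟩
          s * ∑ xs (λ u → ∑ ts (λ t → W (u ∷ t)))
            ≡⟨ trans (sym (∑-*ˡ xs s _)) (∑-cong xs (λ u → sym (∑-*ˡ ts s _))) ⟩
          ∑ xs (λ u → ∑ ts (λ t → s * W (u ∷ t)))
            ≡⟨ ∑-cong xs (λ u → trans (∑-cong ts (λ t → 𝟙-split (unsat Y t) (s * W (u ∷ t)))) (∑-+ ts _ _)) ⟩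
          ∑ xs (λ u → ∑ ts (λ t → 𝟙 (unsat Y t) * (s * W (u ∷ t))) + ∑ ts (λ t → 𝟙 (not (unsat Y t)) * (s * W (u ∷ t))))
            ≡⟨ ∑-+ xs _ _ ⟩
          U + ∑ xs (λ u → ∑ ts (λ t → 𝟙 (not (unsat Y t)) * (s * W (u ∷ t))))
            ≤⟨ +-mono-≤ U≤ (sat-estimate Y 0≤Y) ⟩
          ∑ xs (λ u → γ * s * c u) + s * (K * (R + P)) + s * ∑ ts Y
            ≡⟨ cong (λ z → z + s * (K * (R + P)) + s * ∑ ts Y) (∑-*ˡ xs (γ * s) c) ⟩
          γ * s * ∑ xs c + s * (K * (R + P)) + s * ∑ ts Y
            ≡⟨ ring-15 γ s (∑ xs c) (K * (R + P)) (∑ ts Y) ⟩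
          s * (γ * ∑ xs c + K * (R + P) + ∑ ts Y) ∎)
          where
            y₀ : Vec X (suc m) → ℚ
            y₀ _ = 0ℚ
            by₀ : Bounded y₀
            by₀ t = *-nn (+-nn 0≤K 0≤K) (0≤base C t)
            Y = result I xs y₀ []
            0≤Y : ∀ t → 0ℚ ≤ Y t
            0≤Y = result-≥ xs y₀ [] by₀
            R = ∑ (removed I xs y₀ []) c
            P = ∑ (taken I xs y₀ []) c
            U = ∑ xs (λ u → ∑ ts (λ t → 𝟙 (unsat Y t) * (s * W (u ∷ t))))
            U≤ : U ≤ ∑ xs (λ u → γ * s * c u) + s * (K * (R + P))
            U≤ = ≤-trans (p≤p+q (subst (0ℚ ≤_) (sym (trans (cong (s *_) (*-zeroʳ K)) (*-zeroʳ s))) ≤-refl)) (unsat-estimate xs y₀ [] by₀)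

-- Removing all leaves: one container step

filterᵇ-∈ : {X : Set} (p : X → Bool) (xs : List X) → ∀ {v} → v ∈ filterᵇ p xs → v ∈ xs × p v ≡ true
filterᵇ-∈ p (x ∷ xs) v∈ with p x in eq
filterᵇ-∈ p (x ∷ xs) (here refl) | true = here refl , eq
filterᵇ-∈ p (x ∷ xs) (there v∈) | true = let (a , b) = filterᵇ-∈ p xs v∈ in there a , b
... | false = let (a , b) = filterᵇ-∈ p xs v∈ in there a , b

filterᵇ-∈⁺ : {X : Set} (p : X → Bool) (xs : List X) → ∀ {v} → v ∈ xs → p v ≡ true → v ∈ filterᵇ p xs
filterᵇ-∈⁺ p (x ∷ xs) (here refl) pv rewrite pv = here refl
filterᵇ-∈⁺ p (x ∷ xs) (there v∈) pv with p x
... | true = there (filterᵇ-∈⁺ p xs v∈ pv)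
... | false = filterᵇ-∈⁺ p xs v∈ pv

∑-filterᵇ : {X : Set} (p : X → Bool) (xs : List X) (f : X → ℚ) → ∑ (filterᵇ p xs) f ≡ ∑ xs (λ v → 𝟙 (p v) * f v)
∑-filterᵇ p [] f = refl
∑-filterᵇ p (x ∷ xs) f with p x
... | true = cong₂ _+_ (sym (*-identityˡ (f x))) (∑-filterᵇ p xs f)
... | false = trans (∑-filterᵇ p xs f) (sym (trans (cong (_+ ∑ xs (λ v → 𝟙 (p v) * f v)) (*-zeroˡ (f x))) (+-identityˡ _)))

dec-true⁻ : {P : Set} (d : Dec P) → does d ≡ true → P
dec-true⁻ (yes p) _ = p

module Round {X : Set} (S : WalkSystem X) where
  open WalkSystem S
  open Container S public
  open ℚₚ.≤-Reasoning

  positives : (Vec X 1 → ℚ) → List X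
  positives W = filterᵇ (λ v → does (0ℚ <? W (v ∷ []))) xs

  -- `K` doubles with every leaf because a pass caps its measure at `K + K` times `base`; this is
  -- the origin of all powers of two below.
  round : ∀ {m} → Code m → (Vec X (suc m) → ℚ) → ℚ → Query X (List X)
  round root W K = ret (positives W)
  round (ext C par d) W K = Pass.pass C par d W K xs (λ _ → 0ℚ) [] >>= λ yr →
    round C (proj₁ yr) (K + K) >>= λ R → ret (proj₂ yr ++ R)

  Admissible : ∀ {m} → Code m → (Vec X (suc m) → ℚ) → ℚ → Set
  Admissible C W K = (∀ t → 0ℚ ≤ W t) × (∀ t → W t ≤ K * base C t) × 0ℚ ≤ K

  module Step {m} (C : Code m) (par : Fin (suc m)) (d : Bool) (W : Vec X (suc (suc m)) → ℚ) (K : ℚ)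
              (adm : Admissible (ext C par d) W K) (I : X → Bool) where
    open Pass C par d W K

    0≤W = proj₁ adm
    W≤ = proj₁ (proj₂ adm)
    0≤K = proj₂ (proj₂ adm)

    y₀ : Vec X (suc m) → ℚ
    y₀ _ = 0ℚ

    by₀ : Bounded 0≤W W≤ 0≤K y₀
    by₀ t = *-nn (+-nn 0≤K 0≤K) (0≤base C t)

    Y = result 0≤W W≤ 0≤K I xs y₀ []
    R = removed 0≤W W≤ 0≤K I xs y₀ []
    T = taken 0≤W W≤ 0≤K I xs y₀ []

    Y-admissible : Admissible C Y (K + K)
    Y-admissible = result-≥ 0≤W W≤ 0≤K I xs y₀ [] by₀ , result-bounded 0≤W W≤ 0≤K I xs y₀ [] by₀ , +-nn 0≤K 0≤K

    run-round : run I (round (ext C par d) W K) ≡ R ++ run I (round C Y (K + K))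
    run-round = trans (run->>= I (pass xs y₀ []) _) (run->>= I (round C Y (K + K)) _)

    picks-round : picks I (round (ext C par d) W K) ≡ T ++ picks I (round C Y (K + K))
    picks-round = trans (picks->>= I (pass xs y₀ []) _) (cong (T ++_) (trans (picks->>= I (round C Y (K + K)) _) (Listₚ.++-identityʳ _)))

    ∑Y≤ : ∑ ts Y ≤ (K + K) * ∑ xs c
    ∑Y≤ = begin
      ∑ ts Y  ≤⟨ ∑-mono ts (proj₁ (proj₂ Y-admissible)) ⟩
      ∑ ts (λ t → (K + K) * base C t)  ≡⟨ ∑-*ˡ ts (K + K) (base C) ⟩
      (K + K) * ∑ ts (base C)  ≤⟨ *-monoˡ (K + K) (+-nn 0≤K 0≤K) (base-total C) ⟩
      (K + K) * ∑ xs c  ∎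

    ∑T≤ : γ * s * ∑ T c ≤ (K + K) * ∑ xs c
    ∑T≤ = begin
      γ * s * ∑ T c  ≡⟨ sym (+-identityʳ _) ⟩
      γ * s * ∑ T c + 0ℚ  ≡⟨ cong (γ * s * ∑ T c +_) (sym (∑-0 ts)) ⟩
      γ * s * ∑ T c + ∑ ts y₀  ≤⟨ taken-weight 0≤W W≤ 0≤K I xs y₀ [] by₀ ⟩
      ∑ ts Y  ≤⟨ ∑Y≤ ⟩
      (K + K) * ∑ xs c  ∎

  pow2 : ℕ → ℚ
  pow2 m = ι (2 ℕ.^ m)

  pow2-suc : ∀ m → pow2 (suc m) ≡ pow2 m + pow2 m
  pow2-suc m = trans (cong ι (cong (2 ℕ.^ m ℕ.+_) (ℕₚ.+-identityʳ (2 ℕ.^ m)))) (ι-+ (2 ℕ.^ m) (2 ℕ.^ m))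

  1≤pow2 : ∀ m → 1ℚ ≤ pow2 m
  1≤pow2 m = subst (_≤ pow2 m) ι-1 (ι-mono (ℕₚ.m^n>0 2 m))

  opaque
    unfolding _+_

    ring-16 : ∀ k p g → k * p ≡ 0ℚ * g + 1ℚ * k * (p + 0ℚ)
    ring-16 = solve-∀ ℚring

    ring-17 : ∀ g k r t i p r' t' → g + k * (r + t) + (i * g + p * (k + k) * (r' + t')) ≡ (1ℚ + i) * g + (1ℚ * (k * (r + t)) + (p + p) * (k * (r' + t')))
    ring-17 = solve-∀ ℚring

    ring-18 : ∀ e q k r t r' t' → e + (q * (k * (r + t)) + q * (k * (r' + t'))) ≡ e + q * k * ((r + r') + (t + t'))
    ring-18 = solve-∀ ℚring

  round-estimate : ∀ {m} (C : Code m) W K → Admissible C W K → ∀ I →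
    ∑ (vecs xs (suc m)) W ≤
      ι m * (γ * ∑ xs c) + pow2 m * K * (∑ (run I (round C W K)) c + ∑ (picks I (round C W K)) c)
  round-estimate root W K (0≤W , W≤ , 0≤K) I = begin
    ∑ (vecs xs 1) W  ≡⟨ ∑-vecs xs 0 W ⟩
    ∑ xs (λ v → W (v ∷ []) + 0ℚ)  ≤⟨ ∑-mono xs bound ⟩
    ∑ xs (λ v → 𝟙 (pos v) * (K * c v))  ≡⟨ sym (∑-filterᵇ pos xs (λ v → K * c v)) ⟩
    ∑ (positives W) (λ v → K * c v)  ≡⟨ ∑-*ˡ (positives W) K c ⟩
    K * ∑ (positives W) c  ≡⟨ ring-16 K (∑ (positives W) c) (γ * ∑ xs c) ⟩
    0ℚ * (γ * ∑ xs c) + 1ℚ * K * (∑ (positives W) c + 0ℚ)  ≡⟨ cong₂ (λ a b → a * (γ * ∑ xs c) + b * K * (∑ (positives W) c + 0ℚ)) (sym ι-0) (sym ι-1) ⟩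
    ι 0 * (γ * ∑ xs c) + pow2 0 * K * (∑ (positives W) c + 0ℚ)  ∎
    where
      pos : X → Bool
      pos v = does (0ℚ <? W (v ∷ []))
      bound : ∀ v → W (v ∷ []) + 0ℚ ≤ 𝟙 (pos v) * (K * c v)
      bound v with 0ℚ <? W (v ∷ [])
      ... | yes _ = subst₂ _≤_ (sym (+-identityʳ (W (v ∷ [])))) (sym (*-identityˡ (K * c v))) (W≤ (v ∷ []))
      ... | no ¬p = subst₂ _≤_ (sym (+-identityʳ (W (v ∷ [])))) (sym (*-zeroˡ (K * c v))) (ℚₚ.≮⇒≥ ¬p)
  round-estimate {suc m} (ext C par d) W K adm I = begin
    ∑ (vecs xs (suc (suc m))) W
      ≤⟨ Pass.pass-estimate C par d W K 0≤W W≤ 0≤K I ⟩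
    γ * ∑ xs c + K * (∑ R c + ∑ T c) + ∑ (vecs xs (suc m)) Y
      ≤⟨ +-mono-≤ (≤-refl {γ * ∑ xs c + K * (∑ R c + ∑ T c)}) (round-estimate C Y (K + K) Y-admissible I) ⟩
    γ * ∑ xs c + K * (∑ R c + ∑ T c) + (ι m * (γ * ∑ xs c) + pow2 m * (K + K) * (∑ R' c + ∑ T' c))
      ≡⟨ ring-17 (γ * ∑ xs c) K (∑ R c) (∑ T c) (ι m) (pow2 m) (∑ R' c) (∑ T' c) ⟩
    (1ℚ + ι m) * (γ * ∑ xs c) + (1ℚ * (K * (∑ R c + ∑ T c)) + (pow2 m + pow2 m) * (K * (∑ R' c + ∑ T' c)))
      ≤⟨ +-mono-≤ (≤-refl {(1ℚ + ι m) * (γ * ∑ xs c)}) (+-mono-≤ (*-monoʳ (K * (∑ R c + ∑ T c)) (*-nn 0≤K (+-nn (∑-nn R 0≤c) (∑-nn T 0≤c))) 1≤) (≤-refl {(pow2 m + pow2 m) * (K * (∑ R' c + ∑ T' c))})) ⟩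
    (1ℚ + ι m) * (γ * ∑ xs c) + ((pow2 m + pow2 m) * (K * (∑ R c + ∑ T c)) + (pow2 m + pow2 m) * (K * (∑ R' c + ∑ T' c)))
      ≡⟨ ring-18 ((1ℚ + ι m) * (γ * ∑ xs c)) (pow2 m + pow2 m) K (∑ R c) (∑ T c) (∑ R' c) (∑ T' c) ⟩
    (1ℚ + ι m) * (γ * ∑ xs c) + (pow2 m + pow2 m) * K * ((∑ R c + ∑ R' c) + (∑ T c + ∑ T' c))
      ≡⟨ cong₂ (λ a b → (1ℚ + ι m) * (γ * ∑ xs c) + (pow2 m + pow2 m) * K * (a + b)) (sym (trans (cong (λ l → ∑ l c) run-round) (∑-++ R R' c))) (sym (trans (cong (λ l → ∑ l c) picks-round) (∑-++ T T' c))) ⟩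
    (1ℚ + ι m) * (γ * ∑ xs c) + (pow2 m + pow2 m) * K * (∑ (run I (round (ext C par d) W K)) c + ∑ (picks I (round (ext C par d) W K)) c)
      ≡⟨ cong₂ (λ a b → a * (γ * ∑ xs c) + b * K * (∑ (run I (round (ext C par d) W K)) c + ∑ (picks I (round (ext C par d) W K)) c)) (sym (trans (ι-+ 1 m) (cong (_+ ι m) ι-1))) (sym (pow2-suc m)) ⟩
    ι (suc m) * (γ * ∑ xs c) + pow2 (suc m) * K * (∑ (run I (round (ext C par d) W K)) c + ∑ (picks I (round (ext C par d) W K)) c) ∎
    where
      open Step C par d W K adm I
      R' = run I (round C Y (K + K))
      T' = picks I (round C Y (K + K))
      1≤ : 1ℚ ≤ pow2 m + pow2 m
      1≤ = ≤-trans (1≤pow2 m) (p≤p+q (≤-trans 0≤1 (1≤pow2 m)))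

  opaque
    unfolding _+_

    ring-19 : ∀ g k x → g * 0ℚ + (k + k) * x ≡ (1ℚ + 1ℚ) * k * x
    ring-19 = solve-∀ ℚring

    ring-20 : ∀ g a b e → g * (a + b) + e ≡ g * a + (g * b + e)
    ring-20 = solve-∀ ℚring

    ring-21 : ∀ k x b → k * x + (b + k * x) ≡ b + (k + k) * x
    ring-21 = solve-∀ ℚring

    ring-22 : ∀ p k x → p * (k + k) * x ≡ (p + p) * k * x
    ring-22 = solve-∀ ℚring

  -- The second summand on the left strengthens the induction. In units of `∑ xs c`, the passes cost
  -- 2K, 4K, 8K and so on, and one more 2K completes this geometric sum to a power of two.
  round-picks-weight : ∀ {m} (C : Code m) W K → Admissible C W K → ∀ I →
    γ * s * ∑ (picks I (round C W K)) c + (K + K) * ∑ xs c ≤ pow2 (suc m) * K * ∑ xs c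
  round-picks-weight root W K adm I = ≤-reflexive (trans (ring-19 (γ * s) K (∑ xs c)) (cong (λ z → z * K * ∑ xs c) (sym (trans (pow2-suc 0) (cong₂ _+_ ι-1 ι-1)))))
  round-picks-weight {suc m} (ext C par d) W K adm I = begin
    γ * s * ∑ (picks I (round (ext C par d) W K)) c + (K + K) * ∑ xs c
      ≡⟨ cong (λ z → γ * s * z + (K + K) * ∑ xs c) (trans (cong (λ l → ∑ l c) picks-round) (∑-++ T T' c)) ⟩
    γ * s * (∑ T c + ∑ T' c) + (K + K) * ∑ xs c
      ≡⟨ ring-20 (γ * s) (∑ T c) (∑ T' c) ((K + K) * ∑ xs c) ⟩
    γ * s * ∑ T c + (γ * s * ∑ T' c + (K + K) * ∑ xs c)
      ≤⟨ +-mono-≤ ∑T≤ (≤-refl {γ * s * ∑ T' c + (K + K) * ∑ xs c}) ⟩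
    (K + K) * ∑ xs c + (γ * s * ∑ T' c + (K + K) * ∑ xs c)
      ≡⟨ ring-21 (K + K) (∑ xs c) (γ * s * ∑ T' c) ⟩
    γ * s * ∑ T' c + ((K + K) + (K + K)) * ∑ xs c
      ≤⟨ round-picks-weight C Y (K + K) Y-admissible I ⟩
    pow2 (suc m) * (K + K) * ∑ xs c
      ≡⟨ ring-22 (pow2 (suc m)) K (∑ xs c) ⟩
    (pow2 (suc m) + pow2 (suc m)) * K * ∑ xs c
      ≡⟨ cong (λ z → z * K * ∑ xs c) (sym (pow2-suc (suc m))) ⟩
    pow2 (suc (suc m)) * K * ∑ xs c ∎
    where
      open Step C par d W K adm I
      T' = picks I (round C Y (K + K))

  round-sound : ∀ {m} (C : Code m) W K → Admissible C W K → ∀ I →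
    (∀ t → (∀ i → I (lookup t i) ≡ true) → ¬ (0ℚ < W t)) →
    ∀ v → v ∈ run I (round C W K) → I v ≡ false
  round-sound root W K adm I free v v∈ with I v in eq
  ... | false = refl
  ... | true = ⊥-elim (free (v ∷ []) (λ { zero → eq }) (dec-true⁻ (0ℚ <? W (v ∷ [])) (proj₂ (filterᵇ-∈ _ xs v∈))))
  round-sound (ext C par d) W K adm I free v v∈ with ∈-++⁻ R (subst (v ∈_) run-round v∈)
    where open Step C par d W K adm I
  ... | inj₂ v∈' = round-sound C Y (K + K) Y-admissible I free' v v∈'
    where
      open Step C par d W K adm I
      free' : ∀ t → (∀ i → I (lookup t i) ≡ true) → ¬ (0ℚ < Y t)
      free' t all p with Pass.result-support C par d W K 0≤W W≤ 0≤K I xs y₀ [] t p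
      ... | inj₁ q = ℚₚ.<-irrefl refl q
      ... | inj₂ (u , Iu , q) = free (u ∷ t) (λ { zero → Iu ; (suc i) → all i }) q
  ... | inj₁ v∈R with Pass.removed-∉ C par d W K (proj₁ adm) (proj₁ (proj₂ adm)) (proj₂ (proj₂ adm)) I xs _ [] v v∈R
  ...   | inj₂ e = e

  round-picks-pos : ∀ {m} (C : Code m) W K → Admissible C W K → ∀ I → ∀ v → v ∈ picks I (round C W K) → 0ℚ < c v
  round-picks-pos (ext C par d) W K adm I v v∈ with ∈-++⁻ T (subst (v ∈_) picks-round v∈)
    where open Step C par d W K adm I
  ... | inj₁ v∈T = Pass.taken-pos C par d W K (proj₁ adm) (proj₁ (proj₂ adm)) (proj₂ (proj₂ adm)) I xs _ [] v v∈T
  ... | inj₂ v∈' = round-picks-pos C Y (K + K) Y-admissible I v v∈'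
    where open Step C par d W K adm I

  opaque
    unfolding _+_

    ring-23 : ∀ f i → f + i * f ≡ (1ℚ + i) * f
    ring-23 = solve-∀ ℚring

  -- The same position may be removed once in each of the `m` passes and once more at the root.
  round-weight : ∀ {m} (C : Code m) W K → Admissible C W K → ∀ I (φ : X → Bool) →
    (∀ v → v ∈ run I (round C W K) → φ v ≡ true) →
    ∑ (run I (round C W K)) c ≤ ι (suc m) * ∑ xs (λ v → 𝟙 (φ v) * c v)
  round-weight root W K adm I φ hφ = begin
    ∑ (positives W) c  ≡⟨ ∑-filterᵇ pos xs c ⟩
    ∑ xs (λ v → 𝟙 (pos v) * c v)  ≤⟨ ∑-mono∈ xs bound ⟩
    ∑ xs (λ v → 𝟙 (φ v) * c v)  ≡⟨ sym (trans (cong (_* ∑ xs (λ v → 𝟙 (φ v) * c v)) ι-1) (*-identityˡ _)) ⟩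
    ι 1 * ∑ xs (λ v → 𝟙 (φ v) * c v)  ∎
    where
      pos : X → Bool
      pos v = does (0ℚ <? W (v ∷ []))
      bound : ∀ v → v ∈ xs → 𝟙 (pos v) * c v ≤ 𝟙 (φ v) * c v
      bound v v∈ with pos v in eq
      ... | false = subst (_≤ 𝟙 (φ v) * c v) (sym (*-zeroˡ (c v))) (*-nn (0≤𝟙 (φ v)) (0≤c v))
      ... | true = ≤-reflexive (cong (λ z → 𝟙 z * c v) (sym (hφ v (filterᵇ-∈⁺ pos xs v∈ eq))))
  round-weight {suc m} (ext C par d) W K adm I φ hφ = begin
    ∑ (run I (round (ext C par d) W K)) c  ≡⟨ trans (cong (λ l → ∑ l c) run-round) (∑-++ R R' c) ⟩
    ∑ R c + ∑ R' c  ≤⟨ +-mono-≤ R≤ (round-weight C Y (K + K) Y-admissible I φ (λ v v∈ → hφ v (subst (v ∈_) (sym run-round) (∈-++⁺ʳ R v∈)))) ⟩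
    Φ + ι (suc m) * Φ  ≡⟨ ring-23 Φ (ι (suc m)) ⟩
    (1ℚ + ι (suc m)) * Φ  ≡⟨ cong (_* Φ) (sym (trans (ι-+ 1 (suc m)) (cong (_+ ι (suc m)) ι-1))) ⟩
    ι (suc (suc m)) * Φ  ∎
    where
      open Step C par d W K adm I
      R' = run I (round C Y (K + K))
      Φ = ∑ xs (λ v → 𝟙 (φ v) * c v)
      R≤ : ∑ R c ≤ Φ
      R≤ = ≤-trans (Pass.removed-weight C par d W K 0≤W W≤ 0≤K I xs y₀ [] φ (λ v v∈ → hφ v (subst (v ∈_) (sym run-round) (∈-++⁺ˡ v∈)))) (≤-reflexive (+-identityˡ Φ))

-- Subsets as bit vectors; `d` is `true` for the upward and `false` for the downward direction

co : ∀ {n} → Bool → Subset n → ℕ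
co d [] = 0
co d (b ∷ v) = if d xor b then suc (co d v) else co d v

flip : ∀ {n} → Fin n → Subset n → Subset n
flip i v = v [ i ]%= not

δ : ∀ {n} → Subset n → Subset n → ℚ
δ [] [] = 1ℚ
δ (true ∷ w) (true ∷ v) = δ w v
δ (false ∷ w) (false ∷ v) = δ w v
δ (true ∷ w) (false ∷ v) = 0ℚ
δ (false ∷ w) (true ∷ v) = 0ℚ

0≤δ : ∀ {n} (w v : Subset n) → 0ℚ ≤ δ w v
0≤δ [] [] = 0≤1
0≤δ (true ∷ w) (true ∷ v) = 0≤δ w v
0≤δ (false ∷ w) (false ∷ v) = 0≤δ w v
0≤δ (true ∷ w) (false ∷ v) = ≤-refl
0≤δ (false ∷ w) (true ∷ v) = ≤-refl

δ≤1 : ∀ {n} (w v : Subset n) → δ w v ≤ 1ℚ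
δ≤1 [] [] = ≤-refl
δ≤1 (true ∷ w) (true ∷ v) = δ≤1 w v
δ≤1 (false ∷ w) (false ∷ v) = δ≤1 w v
δ≤1 (true ∷ w) (false ∷ v) = 0≤1
δ≤1 (false ∷ w) (true ∷ v) = 0≤1

δ-refl : ∀ {n} (v : Subset n) → δ v v ≡ 1ℚ
δ-refl [] = refl
δ-refl (true ∷ v) = δ-refl v
δ-refl (false ∷ v) = δ-refl v

δ-cases : ∀ {n} (w v : Subset n) → (w ≡ v) ⊎ (δ w v ≡ 0ℚ)
δ-cases [] [] = inj₁ refl
δ-cases (true ∷ w) (true ∷ v) = [ (λ e → inj₁ (cong (true ∷_) e)) , inj₂ ]′ (δ-cases w v)
δ-cases (false ∷ w) (false ∷ v) = [ (λ e → inj₁ (cong (false ∷_) e)) , inj₂ ]′ (δ-cases w v)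
δ-cases (true ∷ w) (false ∷ v) = inj₂ refl
δ-cases (false ∷ w) (true ∷ v) = inj₂ refl

∑-all-suc : ∀ n (f : Subset (suc n) → ℚ) →
  ∑ (allSubsets (suc n)) f ≡ ∑ (allSubsets n) (λ v → f (true ∷ v)) + ∑ (allSubsets n) (λ v → f (false ∷ v))
∑-all-suc n f = trans (∑-++ (map (true ∷_) (allSubsets n)) _ f) (cong₂ _+_ (∑-map (true ∷_) (allSubsets n) f) (∑-map (false ∷_) (allSubsets n) f))

∑-δ : ∀ {n} (x : Subset n) (f : Subset n → ℚ) → ∑ (allSubsets n) (λ w → δ w x * f w) ≡ f x
∑-δ {zero} [] f = trans (+-identityʳ _) (*-identityˡ (f []))
∑-δ {suc n} (true ∷ x) f = begin
  ∑ (allSubsets (suc n)) (λ w → δ w (true ∷ x) * f w)  ≡⟨ ∑-all-suc n _ ⟩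
  ∑ (allSubsets n) (λ w → δ w x * f (true ∷ w)) + ∑ (allSubsets n) (λ w → 0ℚ * f (false ∷ w))
    ≡⟨ cong₂ _+_ (∑-δ x (λ w → f (true ∷ w))) (trans (∑-cong (allSubsets n) (λ w → *-zeroˡ (f (false ∷ w)))) (∑-0 (allSubsets n))) ⟩
  f (true ∷ x) + 0ℚ  ≡⟨ +-identityʳ _ ⟩
  f (true ∷ x)  ∎
  where open ≡-Reasoning
∑-δ {suc n} (false ∷ x) f = begin
  ∑ (allSubsets (suc n)) (λ w → δ w (false ∷ x) * f w)  ≡⟨ ∑-all-suc n _ ⟩
  ∑ (allSubsets n) (λ w → 0ℚ * f (true ∷ w)) + ∑ (allSubsets n) (λ w → δ w x * f (false ∷ w))
    ≡⟨ cong₂ _+_ (trans (∑-cong (allSubsets n) (λ w → *-zeroˡ (f (true ∷ w)))) (∑-0 (allSubsets n))) (∑-δ x (λ w → f (false ∷ w))) ⟩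
  0ℚ + f (false ∷ x)  ≡⟨ +-identityˡ _ ⟩
  f (false ∷ x)  ∎
  where open ≡-Reasoning

δ-sym : ∀ {n} (w v : Subset n) → δ w v ≡ δ v w
δ-sym [] [] = refl
δ-sym (true ∷ w) (true ∷ v) = δ-sym w v
δ-sym (false ∷ w) (false ∷ v) = δ-sym w v
δ-sym (true ∷ w) (false ∷ v) = refl
δ-sym (false ∷ w) (true ∷ v) = refl

∑-flip : ∀ {n} (i : Fin n) (f : Subset n → ℚ) → ∑ (allSubsets n) (λ v → f (flip i v)) ≡ ∑ (allSubsets n) f
∑-flip {suc n} zero f = trans (∑-all-suc n _) (trans (+-comm _ _) (sym (∑-all-suc n f)))
∑-flip {suc n} (suc i) f = trans (∑-all-suc n _) (trans (cong₂ _+_ (∑-flip i (λ v → f (true ∷ v))) (∑-flip i (λ v → f (false ∷ v)))) (sym (∑-all-suc n f)))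

∈-allSubsets : ∀ {n} (v : Subset n) → v ∈ allSubsets n
∈-allSubsets [] = here refl
∈-allSubsets (true ∷ v) = ∈-++⁺ˡ (∈-map⁺ (true ∷_) (∈-allSubsets v))
∈-allSubsets {suc n} (false ∷ v) = ∈-++⁺ʳ (map (true ∷_) (allSubsets n)) (∈-map⁺ (false ∷_) (∈-allSubsets v))

∑-allFin-suc : ∀ n (f : Fin (suc n) → ℚ) → ∑ (allFin (suc n)) f ≡ f zero + ∑ (allFin n) (λ i → f (suc i))
∑-allFin-suc n f = cong (f zero +_) (trans (cong (λ l → ∑ l f) (sym (Listₚ.map-tabulate id suc))) (∑-map suc (allFin n) f))

∑-co : ∀ {n} d (v : Subset n) → ∑ (allFin n) (λ i → 𝟙 (d xor lookup v i)) ≡ ι (co d v)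
∑-co d [] = sym ι-0
∑-co {suc n} d (b ∷ v) = trans (∑-allFin-suc n _) (trans (cong (𝟙 (d xor b) +_) (∑-co d v)) (lem (d xor b)))
  where
    lem : ∀ e → 𝟙 e + ι (co d v) ≡ ι (if e then suc (co d v) else co d v)
    lem true = trans (cong (_+ ι (co d v)) (sym ι-1)) (sym (ι-+ 1 (co d v)))
    lem false = +-identityˡ _

co≤n : ∀ {n} d (v : Subset n) → co d v ℕ.≤ n
co≤n d [] = z≤n
co≤n d (b ∷ v) with d xor b
... | true = s≤s (co≤n d v)
... | false = ℕₚ.m≤n⇒m≤1+n (co≤n d v)

co-not : ∀ {n} d (v : Subset n) → co d v ℕ.+ co (not d) v ≡ n
co-not d [] = refl
co-not true (true ∷ v) = trans (ℕₚ.+-suc _ _) (cong suc (co-not true v))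
co-not true (false ∷ v) = cong suc (co-not true v)
co-not false (true ∷ v) = cong suc (co-not false v)
co-not false (false ∷ v) = trans (ℕₚ.+-suc _ _) (cong suc (co-not false v))

co-flip : ∀ {n} d (v : Subset n) i → d xor lookup v i ≡ true → suc (co d (flip i v)) ≡ co d v
co-flip true (false ∷ v) zero e = refl
co-flip false (true ∷ v) zero e = refl
co-flip d (b ∷ v) (suc i) e with d xor b
... | true = cong suc (co-flip d v i e)
... | false = co-flip d v i e

co-not-flip : ∀ {n} d (v : Subset n) i → d xor lookup v i ≡ true → co (not d) (flip i v) ≡ suc (co (not d) v)
co-not-flip true (false ∷ v) zero e = refl
co-not-flip false (true ∷ v) zero e = refl
co-not-flip d (b ∷ v) (suc i) e with not d xor b
... | true = cong suc (co-not-flip d v i e)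
... | false = co-not-flip d v i e

flip-flip : ∀ {n} i (v : Subset n) → flip i (flip i v) ≡ v
flip-flip zero (b ∷ v) = cong (_∷ v) (Boolₚ.not-involutive b)
flip-flip (suc i) (b ∷ v) = cong (b ∷_) (flip-flip i v)

lookup-flip : ∀ {n} i (v : Subset n) → lookup (flip i v) i ≡ not (lookup v i)
lookup-flip i v = Vecₚ.lookup∘updateAt i v

lookup-flip-≢ : ∀ {n} (i j : Fin n) (v : Subset n) → j ≢ i → lookup (flip i v) j ≡ lookup v j
lookup-flip-≢ i j v j≢i = Vecₚ.lookup∘updateAt′ j i j≢i v

-- The probability that a uniformly random maximal chain passes through v.
chainWeight : ∀ {n} → Subset n → ℚ
chainWeight {n} v = ι (co true v ℕ.!) * ι (co false v ℕ.!) * rec (n ℕ.!)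

private
  cw : ∀ {n} d (v : Subset n) → chainWeight v ≡ ι (co d v ℕ.!) * ι (co (not d) v ℕ.!) * rec (n ℕ.!)
  cw true v = refl
  cw {n} false v = cong (_* rec (n ℕ.!)) (*-comm (ι (co true v ℕ.!)) (ι (co false v ℕ.!)))

  opaque
    unfolding _+_

    ring-24 : ∀ x y z → x * y * z ≡ x * z * y
    ring-24 = solve-∀ ℚring

  suc!-rec : ∀ a → ι (suc a ℕ.!) * rec (suc a) ≡ ι (a ℕ.!)
  suc!-rec a = begin
    ι (suc a ℕ.!) * rec (suc a)  ≡⟨ cong (_* rec (suc a)) (ι-* (suc a) (a ℕ.!)) ⟩
    ι (suc a) * ι (a ℕ.!) * rec (suc a)  ≡⟨ ring-24 (ι (suc a)) (ι (a ℕ.!)) (rec (suc a)) ⟩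
    ι (suc a) * rec (suc a) * ι (a ℕ.!)  ≡⟨ cong (_* ι (a ℕ.!)) (ι*rec (suc a) (s≤s z≤n)) ⟩
    1ℚ * ι (a ℕ.!)  ≡⟨ *-identityˡ _ ⟩
    ι (a ℕ.!)  ∎
    where open ≡-Reasoning

1≤! : ∀ a → 1 ℕ.≤ a ℕ.!
1≤! a = ℕ.>-nonZero⁻¹ (a ℕ.!) {{ℕₚ._!≢0 a}}

0<chainWeight : ∀ {n} (v : Subset n) → 0ℚ < chainWeight v
0<chainWeight {n} v = *-pos (*-pos (0<ι (1≤! (co true v))) (0<ι (1≤! (co false v)))) (0<rec (1≤! n))

opaque
  unfolding _+_

  ring-25 : ∀ x y z t → x * y * z * t ≡ x * t * y * z
  ring-25 = solve-∀ ℚring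

  ring-26 : ∀ x y z t → x * (y * z) * t ≡ x * y * t * z
  ring-26 = solve-∀ ℚring

-- Detailed balance: both sides are the probability that a random maximal chain contains both `v`
-- and `flip i v`.
chainWeight-balance : ∀ {n} d (v : Subset n) i → d xor lookup v i ≡ true →
  chainWeight v * rec (co d v) ≡ chainWeight (flip i v) * rec (co (not d) (flip i v))
chainWeight-balance {n} d v i e = begin
  chainWeight v * rec (co d v)  ≡⟨ cong₂ _*_ (cw d v) refl ⟩
  ι (co d v ℕ.!) * ι (b ℕ.!) * r * rec (co d v)  ≡⟨ cong (λ z → ι (z ℕ.!) * ι (b ℕ.!) * r * rec z) (sym (co-flip d v i e)) ⟩
  ι (suc a ℕ.!) * ι (b ℕ.!) * r * rec (suc a)  ≡⟨ ring-25 (ι (suc a ℕ.!)) (ι (b ℕ.!)) r (rec (suc a)) ⟩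
  ι (suc a ℕ.!) * rec (suc a) * ι (b ℕ.!) * r  ≡⟨ cong (λ z → z * ι (b ℕ.!) * r) (suc!-rec a) ⟩
  ι (a ℕ.!) * ι (b ℕ.!) * r  ≡⟨ cong (λ z → ι (a ℕ.!) * z * r) (sym (suc!-rec b)) ⟩
  ι (a ℕ.!) * (ι (suc b ℕ.!) * rec (suc b)) * r  ≡⟨ ring-26 (ι (a ℕ.!)) (ι (suc b ℕ.!)) (rec (suc b)) r ⟩
  ι (a ℕ.!) * ι (suc b ℕ.!) * r * rec (suc b)  ≡⟨ cong (λ z → ι (a ℕ.!) * ι (z ℕ.!) * r * rec z) (sym (co-not-flip d v i e)) ⟩
  ι (a ℕ.!) * ι (co (not d) w ℕ.!) * r * rec (co (not d) w)  ≡⟨ cong (_* rec (co (not d) w)) (sym (cw d w)) ⟩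
  chainWeight w * rec (co (not d) w)  ∎
  where
    open ≡-Reasoning
    w = flip i v
    a = co d w
    b = co (not d) v
    r = rec (n ℕ.!)

-- The reversible walk and its first hits

mix : Bool → ℚ → ℚ → ℚ
mix true a b = a
mix false a b = b

mix-split : ∀ x a b → mix x a b ≡ 𝟙 x * a + 𝟙 (not x) * b
mix-split true a b = sym (trans (cong₂ _+_ (*-identityˡ a) (*-zeroˡ b)) (+-identityʳ a))
mix-split false a b = sym (trans (cong₂ _+_ (*-zeroˡ a) (*-identityˡ b)) (+-identityˡ b))

mix-mono : ∀ x {a a' b b'} → a ≤ a' → b ≤ b' → mix x a b ≤ mix x a' b'
mix-mono true p q = p
mix-mono false p q = q

mix-≤ : ∀ x {a b r} → a ≤ r → b ≤ r → mix x a b ≤ r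
mix-≤ true p q = p
mix-≤ false p q = q

0≤mix : ∀ x {a b} → 0ℚ ≤ a → 0ℚ ≤ b → 0ℚ ≤ mix x a b
0≤mix true p q = p
0≤mix false p q = q

module _ {n : ℕ} where
  open ℚₚ.≤-Reasoning

  all : List (Subset n)
  all = allSubsets n

  -- One step of the random walk that turns a uniformly chosen coordinate different from d into d.
  P : Bool → (Subset n → ℚ) → Subset n → ℚ
  P d g v = rec (co d v) * ∑ (allFin n) (λ i → 𝟙 (d xor lookup v i) * g (flip i v))

  infix 5 ⟨_,_⟩
  ⟨_,_⟩ : (Subset n → ℚ) → (Subset n → ℚ) → ℚ
  ⟨ f , g ⟩ = ∑ all (λ v → chainWeight v * (f v * g v))

  opaque
    unfolding _+_

    ring-27 : ∀ c a r o b → c * (a * r) * (o * b) ≡ o * (c * r) * (a * b)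
    ring-27 = solve-∀ ℚring

    ring-28 : ∀ c a r b → c * (a * (r * b)) ≡ c * (a * r) * b
    ring-28 = solve-∀ ℚring

  -- For each coordinate, `∑-flip` re-indexes the sum by the other endpoint of the edge; detailed
  -- balance then exchanges the two step probabilities.
  P-adjoint : ∀ d f g → ⟨ f , P d g ⟩ ≡ ⟨ g , P (not d) f ⟩
  P-adjoint d f g = begin-equality
    ⟨ f , P d g ⟩  ≡⟨ expand d f g ⟩
    ∑ all (λ v → ∑ (allFin n) (λ i → T d f g i v))  ≡⟨ ∑-swap all (allFin n) _ ⟩
    ∑ (allFin n) (λ i → ∑ all (T d f g i))  ≡⟨ ∑-cong (allFin n) (λ i → sym (∑-flip i (T d f g i))) ⟩
    ∑ (allFin n) (λ i → ∑ all (λ v → T d f g i (flip i v)))  ≡⟨ ∑-cong (allFin n) (λ i → ∑-cong all (λ v → reverse i v)) ⟩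
    ∑ (allFin n) (λ i → ∑ all (T (not d) g f i))  ≡⟨ sym (∑-swap all (allFin n) _) ⟩
    ∑ all (λ v → ∑ (allFin n) (λ i → T (not d) g f i v))  ≡⟨ sym (expand (not d) g f) ⟩
    ⟨ g , P (not d) f ⟩  ∎
    where
      T : Bool → (Subset n → ℚ) → (Subset n → ℚ) → Fin n → Subset n → ℚ
      T d f g i v = 𝟙 (d xor lookup v i) * (chainWeight v * rec (co d v)) * (f v * g (flip i v))
      expand : ∀ d f g → ⟨ f , P d g ⟩ ≡ ∑ all (λ v → ∑ (allFin n) (λ i → T d f g i v))
      expand d f g = ∑-cong all (λ v → trans (ring-28 (chainWeight v) (f v) (rec (co d v)) _) (trans (sym (∑-*ˡ (allFin n) (chainWeight v * (f v * rec (co d v))) _)) (∑-cong (allFin n) (λ i → ring-27 (chainWeight v) (f v) (rec (co d v)) (𝟙 (d xor lookup v i)) (g (flip i v))))))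
      xor-not : ∀ d b → d xor not b ≡ not d xor b
      xor-not true b = Boolₚ.not-involutive b
      xor-not false b = refl
      reverse : ∀ i v → T d f g i (flip i v) ≡ T (not d) g f i v
      reverse i v with not d xor lookup v i in eq
      ... | false rewrite lookup-flip i v | trans (xor-not d (lookup v i)) eq = trans (cong (_* (f w * g (flip i w))) (*-zeroˡ (chainWeight w * rec (co d w)))) (trans (*-zeroˡ _) (sym (trans (cong (_* (g v * f w)) (*-zeroˡ (chainWeight v * rec (co (not d) v)))) (*-zeroˡ _))))
        where w = flip i v
      ... | true rewrite lookup-flip i v | trans (xor-not d (lookup v i)) eq = cong₂ _*_ (cong (1ℚ *_) bal) (trans (cong (λ z → f w * g z) (flip-flip i v)) (*-comm (f w) (g v)))
        where
          w = flip i v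
          bal : chainWeight w * rec (co d w) ≡ chainWeight v * rec (co (not d) v)
          bal = sym (trans (chainWeight-balance (not d) v i eq) (cong (λ z → chainWeight w * rec (co z w)) (Boolₚ.not-involutive d)))

  P-mono : ∀ d {f g} → (∀ v → f v ≤ g v) → ∀ v → P d f v ≤ P d g v
  P-mono d h v = *-monoˡ (rec (co d v)) (0≤rec (co d v)) (∑-mono (allFin n) (λ i → *-monoˡ _ (0≤𝟙 (d xor lookup v i)) (h (flip i v))))

  P-cong-open : ∀ d {f g} v → (∀ i → d xor lookup v i ≡ true → f (flip i v) ≡ g (flip i v)) → P d f v ≡ P d g v
  P-cong-open d {f} {g} v h = cong (rec (co d v) *_) (∑-cong (allFin n) term)
    where
      term : ∀ i → 𝟙 (d xor lookup v i) * f (flip i v) ≡ 𝟙 (d xor lookup v i) * g (flip i v)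
      term i with d xor lookup v i in eq
      ... | true = cong (1ℚ *_) (h i eq)
      ... | false = trans (*-zeroˡ _) (sym (*-zeroˡ _))

  P-cong : ∀ d {f g} → (∀ v → f v ≡ g v) → ∀ v → P d f v ≡ P d g v
  P-cong d {f} {g} h v = P-cong-open d {f} {g} v (λ i _ → h (flip i v))

  0≤P : ∀ d {f} → (∀ v → 0ℚ ≤ f v) → ∀ v → 0ℚ ≤ P d f v
  0≤P d h v = *-nn (0≤rec (co d v)) (∑-nn (allFin n) (λ i → *-nn (0≤𝟙 (d xor lookup v i)) (h (flip i v))))

  P-∑ : {X : Set} (d : Bool) (xs : List X) (F : X → Subset n → ℚ) (f : X → ℚ) (v : Subset n) →
    P d (λ w → ∑ xs (λ x → F x w * f x)) v ≡ ∑ xs (λ x → P d (F x) v * f x)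
  P-∑ {X} d xs F f v = begin-equality
    r * ∑ (allFin n) (λ i → o i * ∑ xs (λ x → F x (flip i v) * f x))  ≡⟨ cong (r *_) (∑-cong (allFin n) (λ i → sym (∑-*ˡ xs (o i) _))) ⟩
    r * ∑ (allFin n) (λ i → ∑ xs (λ x → o i * (F x (flip i v) * f x)))  ≡⟨ cong (r *_) (∑-swap (allFin n) xs _) ⟩
    r * ∑ xs (λ x → ∑ (allFin n) (λ i → o i * (F x (flip i v) * f x)))  ≡⟨ sym (∑-*ˡ xs r _) ⟩
    ∑ xs (λ x → r * ∑ (allFin n) (λ i → o i * (F x (flip i v) * f x)))  ≡⟨ ∑-cong xs inner ⟩
    ∑ xs (λ x → P d (F x) v * f x)  ∎
    where
      r = rec (co d v)
      o : Fin n → ℚ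
      o i = 𝟙 (d xor lookup v i)
      inner : ∀ x → r * ∑ (allFin n) (λ i → o i * (F x (flip i v) * f x)) ≡ P d (F x) v * f x
      inner x = trans (cong (r *_) (trans (∑-cong (allFin n) (λ i → sym (*-assoc (o i) _ (f x)))) (∑-*ʳ (allFin n) (f x) _))) (sym (*-assoc r _ (f x)))

  P-1 : ∀ d v → P d (λ _ → 1ℚ) v ≡ rec (co d v) * ι (co d v)
  P-1 d v = cong (rec (co d v) *_) (trans (∑-cong (allFin n) (λ i → *-identityʳ _)) (∑-co d v))

  P-1-pos : ∀ d v → 1 ℕ.≤ co d v → P d (λ _ → 1ℚ) v ≡ 1ℚ
  P-1-pos d v h = trans (P-1 d v) (trans (*-comm _ _) (ι*rec (co d v) h))

  P-≤-open : ∀ d {f} v r → 0ℚ ≤ r → (∀ i → d xor lookup v i ≡ true → f (flip i v) ≤ r) → P d f v ≤ r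
  P-≤-open d {f} v r 0≤r h = begin
    rec m * ∑ (allFin n) (λ i → 𝟙 (d xor lookup v i) * f (flip i v))  ≤⟨ *-monoˡ (rec m) (0≤rec m) (∑-mono (allFin n) term) ⟩
    rec m * ∑ (allFin n) (λ i → 𝟙 (d xor lookup v i) * r)  ≡⟨ cong (rec m *_) (trans (∑-*ʳ (allFin n) r _) (cong (_* r) (∑-co d v))) ⟩
    rec m * (ι m * r)  ≡⟨ trans (sym (*-assoc (rec m) (ι m) r)) (cong (_* r) (*-comm (rec m) (ι m))) ⟩
    ι m * rec m * r  ≤⟨ *-monoʳ r 0≤r (ι*rec≤1 m) ⟩
    1ℚ * r  ≡⟨ *-identityˡ r ⟩
    r  ∎
    where
      m = co d v
      ι*rec≤1 : ∀ m → ι m * rec m ≤ 1ℚ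
      ι*rec≤1 zero = subst (_≤ 1ℚ) (sym (trans (cong (ι 0 *_) rec-0) (*-zeroʳ (ι 0)))) 0≤1
      ι*rec≤1 (suc m) = ≤-reflexive (ι*rec (suc m) (s≤s z≤n))
      term : ∀ i → 𝟙 (d xor lookup v i) * f (flip i v) ≤ 𝟙 (d xor lookup v i) * r
      term i with d xor lookup v i in eq
      ... | true = *-monoˡ 1ℚ 0≤1 (h i eq)
      ... | false = ≤-reflexive (trans (*-zeroˡ _) (sym (*-zeroˡ r)))

  P-0 : ∀ d f v → co d v ≡ 0 → P d f v ≡ 0ℚ
  P-0 d f v e = trans (cong (λ z → rec z * ∑ (allFin n) (λ i → 𝟙 (d xor lookup v i) * f (flip i v))) e) (trans (cong (_* ∑ (allFin n) (λ i → 𝟙 (d xor lookup v i) * f (flip i v))) rec-0) (*-zeroˡ _))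

-- U d f v is the expected value of f at the first member of A that the walk from v towards d visits.
module FirstHit {n : ℕ} (A : Family n) where
  open ℚₚ.≤-Reasoning

  -- The first argument counts steps; `n` of them suffice because each step lowers `co d`. The start
  -- is not tested for membership, so from a member of `A` the walk looks for the next member.
  U′ : ℕ → Bool → (Subset n → ℚ) → Subset n → ℚ
  U′ zero d f v = 0ℚ
  U′ (suc t) d f v = P d (λ w → mix (A w) (f w) (U′ t d f w)) v

  U : Bool → (Subset n → ℚ) → Subset n → ℚ
  U = U′ n

  U′-stable : ∀ t d f v → co d v ℕ.≤ t → U′ t d f v ≡ U′ (suc t) d f v
  U′-stable zero d f v h = sym (P-0 d (λ w → mix (A w) (f w) (U′ 0 d f w)) v (ℕₚ.n≤0⇒n≡0 h))
  U′-stable (suc t) d f v h = P-cong-open d {λ w → mix (A w) (f w) (U′ t d f w)} {λ w → mix (A w) (f w) (U′ (suc t) d f w)} v (λ i e → cong (mix (A (flip i v)) (f (flip i v))) (U′-stable t d f (flip i v) (ℕₚ.≤-pred (subst (ℕ._≤ suc t) (sym (co-flip d v i e)) h))))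

  U-fix : ∀ d f v → U d f v ≡ P d (λ w → mix (A w) (f w) (U d f w)) v
  U-fix d f v = U′-stable n d f v (co≤n d v)

  U′-≤ : ∀ t d (f G : Subset n → ℚ) → (∀ v → 0ℚ ≤ G v) → (∀ v → P d (λ w → mix (A w) (f w) (G w)) v ≤ G v) → ∀ v → U′ t d f v ≤ G v
  U′-≤ zero d f G 0≤G h v = 0≤G v
  U′-≤ (suc t) d f G 0≤G h v = ≤-trans (P-mono d {λ w → mix (A w) (f w) (U′ t d f w)} {λ w → mix (A w) (f w) (G w)} (λ w → mix-mono (A w) ≤-refl (U′-≤ t d f G 0≤G h w)) v) (h v)

  -- Comparison principle: a nonnegative supersolution dominates U d f.
  U-≤ : ∀ d (f G : Subset n → ℚ) → (∀ v → 0ℚ ≤ G v) → (∀ v → P d (λ w → mix (A w) (f w) (G w)) v ≤ G v) → ∀ v → U d f v ≤ G v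
  U-≤ = U′-≤ n

  U′-mono : ∀ t d {f g} → (∀ v → A v ≡ true → f v ≤ g v) → ∀ v → U′ t d f v ≤ U′ t d g v
  U′-mono zero d h v = ≤-refl
  U′-mono (suc t) d {f} {g} h v = P-mono d step v
    where
      step : ∀ w → mix (A w) (f w) (U′ t d f w) ≤ mix (A w) (g w) (U′ t d g w)
      step w with A w in eq
      ... | true = h w eq
      ... | false = U′-mono t d h w

  U-mono : ∀ d {f g} → (∀ v → A v ≡ true → f v ≤ g v) → ∀ v → U d f v ≤ U d g v
  U-mono = U′-mono n

  U-cong : ∀ d {f g} → (∀ v → A v ≡ true → f v ≡ g v) → ∀ v → U d f v ≡ U d g v
  U-cong d h v = ℚₚ.≤-antisym (U-mono d (λ w e → ≤-reflexive (h w e)) v) (U-mono d (λ w e → ≤-reflexive (sym (h w e))) v)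

  0≤U′ : ∀ t d {f} → (∀ v → 0ℚ ≤ f v) → ∀ v → 0ℚ ≤ U′ t d f v
  0≤U′ zero d h v = ≤-refl
  0≤U′ (suc t) d {f} h v = 0≤P d {λ w → mix (A w) (f w) (U′ t d f w)} (λ w → 0≤mix (A w) (h w) (0≤U′ t d h w)) v

  0≤U : ∀ d {f} → (∀ v → 0ℚ ≤ f v) → ∀ v → 0ℚ ≤ U d f v
  0≤U = 0≤U′ n

  U≤1 : ∀ d {f} → (∀ v → f v ≤ 1ℚ) → ∀ v → U d f v ≤ 1ℚ
  U≤1 d {f} h = U-≤ d f (λ _ → 1ℚ) (λ _ → 0≤1) (λ v → P-≤-open d {λ w → mix (A w) (f w) 1ℚ} v 1ℚ 0≤1 (λ i _ → mix-≤ (A (flip i v)) (h (flip i v)) ≤-refl))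

  U′-expand : ∀ t d f v → U′ t d f v ≡ ∑ all (λ w → U′ t d (δ w) v * f w)
  U′-expand zero d f v = sym (trans (∑-cong all (λ w → *-zeroˡ (f w))) (∑-0 (all {n})))
  U′-expand (suc t) d f v = trans (P-cong d step v) (P-∑ d all (λ w x → mix (A x) (δ w x) (U′ t d (δ w) x)) f v)
    where
      step : ∀ x → mix (A x) (f x) (U′ t d f x) ≡ ∑ all (λ w → mix (A x) (δ w x) (U′ t d (δ w) x) * f w)
      step x with A x
      ... | true = sym (∑-δ x f)
      ... | false = U′-expand t d f x

  U-expand : ∀ d f v → U d f v ≡ ∑ all (λ w → U d (δ w) v * f w)
  U-expand = U′-expand n

  opaque
    unfolding _+_

    ring-29 : ∀ c a x y → c * (a * x * y) ≡ c * (a * y * x)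
    ring-29 = solve-∀ ℚring

    ring-30 : ∀ p r → p + r - r ≡ p
    ring-30 = solve-∀ ℚring

    ring-31 : ∀ c a b e → c * ((a + b) * e) ≡ c * (a * e) + c * (b * e)
    ring-31 = solve-∀ ℚring

  -- Excursions between consecutive members of `A` can be reversed. `P-adjoint` is applied to `F`
  -- and `G`, which are `f` and `g` on `A` and the continued walks elsewhere; the contributions
  -- outside `A` agree on both sides and cancel.
  U-adjoint : ∀ d f g → ⟨ (λ v → 𝟙 (A v) * f v) , U d g ⟩ ≡ ⟨ (λ v → 𝟙 (A v) * g v) , U (not d) f ⟩
  U-adjoint d f g = cancel (begin-equality
    ⟨ (λ v → 𝟙 (A v) * f v) , x ⟩ + Z  ≡⟨ sym (split f y x) ⟩
    ⟨ F , x ⟩  ≡⟨ ∑-cong all (λ v → cong (λ z → chainWeight v * (F v * z)) (U-fix d g v)) ⟩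
    ⟨ F , P d G ⟩  ≡⟨ P-adjoint d F G ⟩
    ⟨ G , P (not d) F ⟩  ≡⟨ ∑-cong all (λ v → cong (λ z → chainWeight v * (G v * z)) (sym (U-fix (not d) f v))) ⟩
    ⟨ G , y ⟩  ≡⟨ split g x y ⟩
    ⟨ (λ v → 𝟙 (A v) * g v) , y ⟩ + Z'  ≡⟨ cong (⟨ (λ v → 𝟙 (A v) * g v) , y ⟩ +_) (∑-cong all (λ v → ring-29 (chainWeight v) (𝟙 (not (A v))) (x v) (y v))) ⟩
    ⟨ (λ v → 𝟙 (A v) * g v) , y ⟩ + Z  ∎)
    where
      x y F G : Subset n → ℚ
      x = U d g
      y = U (not d) f
      F w = mix (A w) (f w) (y w)
      G w = mix (A w) (g w) (x w)
      Z = ∑ all (λ v → chainWeight v * (𝟙 (not (A v)) * y v * x v))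
      Z' = ∑ all (λ v → chainWeight v * (𝟙 (not (A v)) * x v * y v))
      cancel : ∀ {p q r} → p + r ≡ q + r → p ≡ q
      cancel {p} {q} {r} e = trans (sym (ring-30 p r)) (trans (cong (_- r) e) (ring-30 q r))
      split : ∀ f y x → ⟨ (λ w → mix (A w) (f w) (y w)) , x ⟩ ≡ ⟨ (λ v → 𝟙 (A v) * f v) , x ⟩ + ∑ all (λ v → chainWeight v * (𝟙 (not (A v)) * y v * x v))
      split f y x = trans (∑-cong all (λ v → trans (cong (λ z → chainWeight v * (z * x v)) (mix-split (A v) (f v) (y v))) (ring-31 (chainWeight v) (𝟙 (A v) * f v) (𝟙 (not (A v)) * y v) (x v)))) (∑-+ (all {n}) _ _)

-- Windows of consecutive hits, and the pruning of layers

_≟ⱽ_ : ∀ {n} (v w : Subset n) → Dec (v ≡ w)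
_≟ⱽ_ = Vecₚ.≡-dec Boolₚ._≟_

∅ : ∀ n → Subset n
∅ zero = []
∅ (suc n) = false ∷ ∅ n

co-false≡0 : ∀ {n} (v : Subset n) → co false v ≡ 0 → v ≡ ∅ n
co-false≡0 [] e = refl
co-false≡0 (false ∷ v) e = cong (false ∷_) (co-false≡0 v e)

co-true-∅ : ∀ n → co true (∅ n) ≡ n
co-true-∅ zero = refl
co-true-∅ (suc n) = cong suc (co-true-∅ n)

co-false-∅ : ∀ n → co false (∅ n) ≡ 0
co-false-∅ zero = refl
co-false-∅ (suc n) = co-false-∅ n

chainWeight-∅ : ∀ n → chainWeight (∅ n) ≡ 1ℚ
chainWeight-∅ n rewrite co-true-∅ n | co-false-∅ n =
  trans (cong (λ z → ι (n ℕ.!) * z * rec (n ℕ.!)) ι-1) (trans (cong (_* rec (n ℕ.!)) (*-identityʳ (ι (n ℕ.!)))) (ι*rec (n ℕ.!) (1≤! n)))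

opaque
  unfolding _+_

  ring-32 : ∀ p r → p + r - r ≡ p
  ring-32 = solve-∀ ℚring

≤-cancelʳ : ∀ r {p q} → p + r ≤ q + r → p ≤ q
≤-cancelʳ r {p} {q} h = subst₂ _≤_ (ring-32 p r) (ring-32 q r) (+-mono-≤ h (≤-refl { - r}))

opaque
  unfolding _+_

  ring-33 : ∀ a b e → a + b + e ≡ a + e + b
  ring-33 = solve-∀ ℚring

∑-drop : {X : Set} (xs : List X) {f g : X → ℚ} (e : ℚ) → (∀ x → f x ≤ g x) → ∀ {y} → y ∈ xs → f y + e ≤ g y → ∑ xs f + e ≤ ∑ xs g
∑-drop (x ∷ xs) {f} {g} e h (here refl) k = begin
  f x + ∑ xs f + e  ≡⟨ ring-33 (f x) (∑ xs f) e ⟩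
  f x + e + ∑ xs f  ≤⟨ +-mono-≤ k (∑-mono xs h) ⟩
  g x + ∑ xs g  ∎
  where
    open ℚₚ.≤-Reasoning
∑-drop (x ∷ xs) {f} {g} e h (there y∈) k = ≤-trans (≤-reflexive (+-assoc (f x) (∑ xs f) e)) (+-mono-≤ (h x) (∑-drop xs e h y∈ k))

𝟙-idem-⊆ : ∀ a b {p} → (b ≡ true → a ≡ true) → 𝟙 a * (𝟙 b * p) ≡ 𝟙 b * p
𝟙-idem-⊆ a true {p} h rewrite h refl = *-identityˡ _
𝟙-idem-⊆ a false {p} h = trans (cong (𝟙 a *_) (*-zeroˡ p)) (trans (*-zeroʳ (𝟙 a)) (sym (*-zeroˡ p)))

𝟙-mono : ∀ {a b} → (a ≡ true → b ≡ true) → 𝟙 a ≤ 𝟙 b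
𝟙-mono {true} h rewrite h refl = ≤-refl
𝟙-mono {false} {b} h = 0≤𝟙 b

-- The chain measure of a family; a full level has measure 1.
weight : ∀ {n} → Family n → ℚ
weight {n} F = ∑ all (λ v → 𝟙 (F v) * chainWeight v)

module Windows {n : ℕ} (A : Family n) where
  open FirstHit A
  open ℚₚ.≤-Reasoning

  0≤cw : ∀ (v : Subset n) → 0ℚ ≤ chainWeight v
  0≤cw v = ℚₚ.<⇒≤ (0<chainWeight v)

  -- reach j v is the probability that at least j members of A lie above v on a random maximal chain through v.
  reach : ℕ → Subset n → ℚ
  reach zero v = 1ℚ
  reach (suc j) v = U true (reach j) v

  reach≤1 : ∀ j v → reach j v ≤ 1ℚ
  reach≤1 zero v = ≤-refl
  reach≤1 (suc j) v = U≤1 true (reach≤1 j) v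

  0≤reach : ∀ j v → 0ℚ ≤ reach j v
  0≤reach zero v = 0≤1
  0≤reach (suc j) v = 0≤U true (0≤reach j) v

  hits : ℕ → ℚ
  hits j = ∑ all (λ v → chainWeight v * (𝟙 (A v) * reach j v))

  opaque
    unfolding _+_

    ring-34 : ∀ a b e → a + b + e ≡ a + e + b
    ring-34 = solve-∀ ℚring

  -- On a chain with more than `j` members of `A` exactly one has exactly `j` members above it.
  -- Formally this is conservation of flow: `P false` maps 1 to 1 except at the empty set, where at
  -- most its chain weight 1 is lost.
  hits-suc : ∀ j → hits j ≤ hits (suc j) + 1ℚ
  hits-suc j = ≤-cancelʳ Z (begin
    hits j + Z  ≡⟨ sym (∑-+ (all {n}) _ _) ⟩
    ∑ all (λ v → c v * (𝟙 (A v) * reach j v) + c v * (𝟙 (not (A v)) * x v))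
                                                                     ≡⟨ ∑-cong all (λ v → trans (sym (*-distribˡ-+ (c v) _ _)) (cong (c v *_) (sym (mix-split (A v) (reach j v) (x v))))) ⟩
    ∑ all (λ v → c v * G v)  ≤⟨ ∑-mono all pointwise ⟩
    ∑ all (λ v → c v * (G v * P false (λ _ → 1ℚ) v) + δ v (∅ n) * c v)  ≡⟨ ∑-+ (all {n}) _ _ ⟩
    ⟨ G , P false (λ _ → 1ℚ) ⟩ + ∑ all (λ v → δ v (∅ n) * c v)  ≡⟨ cong₂ _+_ (sym (P-adjoint true (λ _ → 1ℚ) G)) (trans (∑-δ (∅ n) c) (chainWeight-∅ n)) ⟩
    ⟨ (λ _ → 1ℚ) , P true G ⟩ + 1ℚ  ≡⟨ cong (_+ 1ℚ) (∑-cong all (λ v → cong (c v *_) (trans (*-identityˡ _) (sym (U-fix true (reach j) v))))) ⟩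
    ∑ all (λ v → c v * x v) + 1ℚ  ≡⟨ cong (_+ 1ℚ) (trans (∑-cong all (λ v → trans (cong (c v *_) (𝟙-split (A v) (x v))) (*-distribˡ-+ (c v) _ _))) (∑-+ (all {n}) _ _)) ⟩
    hits (suc j) + Z + 1ℚ  ≡⟨ ring-34 (hits (suc j)) Z 1ℚ ⟩
    hits (suc j) + 1ℚ + Z  ∎)
    where
      c : Subset n → ℚ
      c = chainWeight
      x : Subset n → ℚ
      x = reach (suc j)
      G : Subset n → ℚ
      G w = mix (A w) (reach j w) (x w)
      Z = ∑ all (λ v → c v * (𝟙 (not (A v)) * x v))
      pointwise : ∀ v → c v * G v ≤ c v * (G v * P false (λ _ → 1ℚ) v) + δ v (∅ n) * c v
      pointwise v with co false v ℕ.≟ 0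
      ... | no ≢0 = begin
        c v * G v  ≡⟨ cong (c v *_) (sym (trans (cong (G v *_) (P-1-pos false v (ℕₚ.n≢0⇒n>0 ≢0))) (*-identityʳ (G v)))) ⟩
        c v * (G v * P false (λ _ → 1ℚ) v)  ≤⟨ p≤p+q (*-nn (0≤δ v (∅ n)) (0≤cw v)) ⟩
        c v * (G v * P false (λ _ → 1ℚ) v) + δ v (∅ n) * c v  ∎
      ... | yes e = begin
        c v * G v  ≤⟨ *-monoˡ (c v) (0≤cw v) (mix-≤ (A v) (reach≤1 j v) (reach≤1 (suc j) v)) ⟩
        c v * 1ℚ  ≡⟨ trans (*-comm (c v) 1ℚ) (cong (_* c v) (sym (trans (cong (λ z → δ z (∅ n)) (co-false≡0 v e)) (δ-refl (∅ n))))) ⟩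
        δ v (∅ n) * c v  ≤⟨ q≤p+q (*-nn (0≤cw v) (*-nn (0≤mix (A v) (0≤reach j v) (0≤reach (suc j) v)) (0≤P false (λ _ → 0≤1) v))) ⟩
        c v * (G v * P false (λ _ → 1ℚ) v) + δ v (∅ n) * c v  ∎

  hits-≥ : ∀ j → weight A ≤ hits j + ι j
  hits-≥ zero = ≤-reflexive (trans (∑-cong (all {n}) (λ v → trans (*-comm (𝟙 (A v)) (chainWeight v)) (cong (chainWeight v *_) (sym (*-identityʳ (𝟙 (A v))))))) (sym (trans (cong (hits 0 +_) ι-0) (+-identityʳ (hits 0)))))
  hits-≥ (suc j) = begin
    weight A  ≤⟨ hits-≥ j ⟩
    hits j + ι j  ≤⟨ +-mono-≤ (hits-suc j) (≤-refl {ι j}) ⟩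
    hits (suc j) + 1ℚ + ι j  ≡⟨ trans (+-assoc (hits (suc j)) 1ℚ (ι j)) (cong (hits (suc j) +_) (sym (trans (ι-+ 1 j) (cong (_+ ι j) ι-1)))) ⟩
    hits (suc j) + ι (suc j)  ∎

  module Prune (k : ℕ) (ε : ℚ) (0≤ε : 0ℚ ≤ ε) where

    Layers : Set
    Layers = ℕ → Family n

    Inside : Layers → Set
    Inside S = ∀ i v → S i v ≡ true → A v ≡ true

    down : Layers → ℕ → Subset n → ℚ
    down S zero v = 1ℚ
    down S (suc i) v = U false (λ w → 𝟙 (S i w) * down S i w) v

    up : Layers → ℕ → ℕ → Subset n → ℚ
    up S i zero v = 1ℚ
    up S i (suc r) v = U true (λ w → 𝟙 (S (suc i) w) * up S (suc i) r w) v

    -- The expected number of windows of `i + r + 1` consecutive members of `A` on a random maximal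
    -- chain whose member number j, counted upwards from 0, lies in layer j. The window is read from
    -- its member in layer `i`.
    mass : Layers → ℕ → ℕ → ℚ
    mass S i r = ∑ all (λ v → chainWeight v * (𝟙 (S i v) * (down S i v * up S i r v)))

    0≤𝟙* : ∀ b {p} → 0ℚ ≤ p → 0ℚ ≤ 𝟙 b * p
    0≤𝟙* b h = *-nn (0≤𝟙 b) h

    𝟙*≤1 : ∀ b {p} → p ≤ 1ℚ → 𝟙 b * p ≤ 1ℚ
    𝟙*≤1 true {p} h = subst (_≤ 1ℚ) (sym (*-identityˡ p)) h
    𝟙*≤1 false {p} h = subst (_≤ 1ℚ) (sym (*-zeroˡ p)) 0≤1

    0≤down : ∀ S i v → 0ℚ ≤ down S i v
    0≤down S zero v = 0≤1
    0≤down S (suc i) v = 0≤U false (λ w → 0≤𝟙* (S i w) (0≤down S i w)) v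

    0≤up : ∀ S i r v → 0ℚ ≤ up S i r v
    0≤up S i zero v = 0≤1
    0≤up S i (suc r) v = 0≤U true (λ w → 0≤𝟙* (S (suc i) w) (0≤up S (suc i) r w)) v

    down≤1 : ∀ S i v → down S i v ≤ 1ℚ
    down≤1 S zero v = ≤-refl
    down≤1 S (suc i) v = U≤1 false (λ w → 𝟙*≤1 (S i w) (down≤1 S i w)) v

    up≤1 : ∀ S i r v → up S i r v ≤ 1ℚ
    up≤1 S i zero v = ≤-refl
    up≤1 S i (suc r) v = U≤1 true (λ w → 𝟙*≤1 (S (suc i) w) (up≤1 S (suc i) r w)) v

    opaque
      unfolding _+_

      ring-35 : ∀ a b e → a * b * e ≡ a * (e * b)
      ring-35 = solve-∀ ℚring

    -- The same windows are counted from the next member; `U-adjoint` reverses the excursion between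
    -- the two.
    mass-shift : ∀ S → Inside S → ∀ i r → mass S i (suc r) ≡ mass S (suc i) r
    mass-shift S ins i r = begin-equality
      mass S i (suc r)  ≡⟨ ∑-cong all (λ v → cong (chainWeight v *_) (trans (sym (*-assoc (𝟙 (S i v)) _ _)) (cong (_* U true g v) (sym (𝟙-idem-⊆ (A v) (S i v) (ins i v)))))) ⟩
      ⟨ (λ v → 𝟙 (A v) * f v) , U true g ⟩  ≡⟨ U-adjoint true f g ⟩
      ⟨ (λ v → 𝟙 (A v) * g v) , U false f ⟩  ≡⟨ ∑-cong all (λ v → cong (chainWeight v *_) (trans (cong (_* U false f v) (𝟙-idem-⊆ (A v) (S (suc i) v) (ins (suc i) v))) (ring-35 (𝟙 (S (suc i) v)) (up S (suc i) r v) (U false f v)))) ⟩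
      mass S (suc i) r  ∎
      where
        f g : Subset n → ℚ
        f w = 𝟙 (S i w) * down S i w
        g w = 𝟙 (S (suc i) w) * up S (suc i) r w

    mass-at : ∀ S → Inside S → ∀ i r → mass S 0 (i ℕ.+ r) ≡ mass S i r
    mass-at S ins zero r = refl
    mass-at S ins (suc i) r = trans (cong (mass S 0) (sym (ℕₚ.+-suc i r))) (trans (mass-at S ins i (suc r)) (mass-shift S ins i r))

    mass≤weight : ∀ S i r → mass S i r ≤ weight (S i)
    mass≤weight S i r = ∑-mono (all {n}) (λ v → begin
      chainWeight v * (𝟙 (S i v) * (down S i v * up S i r v))  ≤⟨ *-monoˡ _ (0≤cw v) (*-monoˡ _ (0≤𝟙 (S i v)) (≤-trans (*-mono2 0≤1 (0≤up S i r v) (down≤1 S i v) (up≤1 S i r v)) (≤-reflexive (*-identityˡ 1ℚ)))) ⟩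
      chainWeight v * (𝟙 (S i v) * 1ℚ)  ≡⟨ trans (cong (chainWeight v *_) (*-identityʳ _)) (*-comm _ _) ⟩
      𝟙 (S i v) * chainWeight v  ∎)

    opaque
      delete : ℕ → Subset n → Layers → Layers
      delete i x S j v = if does (j ℕ.≟ i) ∧ does (v ≟ⱽ x) then false else S j v

      delete-⊆ : ∀ i x S j v → delete i x S j v ≡ true → S j v ≡ true
      delete-⊆ i x S j v e with does (j ℕ.≟ i) ∧ does (v ≟ⱽ x)
      ... | false = e

      delete-other : ∀ i x S j v → j ≢ i → delete i x S j v ≡ S j v
      delete-other i x S j v j≢i rewrite dec-false (j ℕ.≟ i) j≢i = refl

      delete-≢ : ∀ i x S v → v ≢ x → delete i x S i v ≡ S i v
      delete-≢ i x S v v≢x rewrite dec-false (v ≟ⱽ x) v≢x | Boolₚ.∧-zeroʳ (does (i ℕ.≟ i)) = refl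

      delete-self : ∀ i x S → delete i x S i x ≡ false
      delete-self i x S rewrite dec-true (i ℕ.≟ i) refl | dec-true (x ≟ⱽ x) refl = refl

    down-local : ∀ S S' i → (∀ j v → j ℕ.< i → S' j v ≡ S j v) → ∀ v → down S' i v ≡ down S i v
    down-local S S' zero h v = refl
    down-local S S' (suc i) h v = U-cong false (λ w _ → cong₂ _*_ (cong 𝟙 (h i w ℕₚ.≤-refl)) (down-local S S' i (λ j x j<i → h j x (ℕₚ.m≤n⇒m≤1+n j<i)) w)) v

    up-local : ∀ S S' i r → (∀ j v → i ℕ.< j → S' j v ≡ S j v) → ∀ v → up S' i r v ≡ up S i r v
    up-local S S' i zero h v = refl
    up-local S S' i (suc r) h v = U-cong true (λ w _ → cong₂ _*_ (cong 𝟙 (h (suc i) w ℕₚ.≤-refl)) (up-local S S' (suc i) r (λ j x i<j → h j x (ℕₚ.<-trans ℕₚ.≤-refl i<j)) w)) v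

    -- Read from layer `i` itself, the deletion affects only the indicator: `down` consults lower
    -- layers and `up` higher ones.
    mass-delete : ∀ S i r x → mass S i r ≤ mass (delete i x S) i r + chainWeight x * (down S i x * up S i r x)
    mass-delete S i r x = begin
      mass S i r  ≤⟨ ∑-mono all pointwise ⟩
      ∑ all (λ v → chainWeight v * (𝟙 (S' i v) * (down S' i v * up S' i r v)) + δ v x * f v)  ≡⟨ ∑-+ (all {n}) _ _ ⟩
      mass S' i r + ∑ all (λ v → δ v x * f v)  ≡⟨ cong (mass S' i r +_) (∑-δ x f) ⟩
      mass S' i r + f x  ∎
      where
        S' = delete i x S
        f : Subset n → ℚ
        f v = chainWeight v * (down S i v * up S i r v)
        0≤f : ∀ v → 0ℚ ≤ f v
        0≤f v = *-nn (0≤cw v) (*-nn (0≤down S i v) (0≤up S i r v))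
        d≡ : ∀ v → down S' i v * up S' i r v ≡ down S i v * up S i r v
        d≡ v = cong₂ _*_ (down-local S S' i (λ j w j<i → delete-other i x S j w (ℕₚ.<⇒≢ j<i)) v) (up-local S S' i r (λ j w i<j → delete-other i x S j w (λ e → ℕₚ.<⇒≢ i<j (sym e))) v)
        pointwise : ∀ v → chainWeight v * (𝟙 (S i v) * (down S i v * up S i r v)) ≤ chainWeight v * (𝟙 (S' i v) * (down S' i v * up S' i r v)) + δ v x * f v
        pointwise v rewrite d≡ v with v ≟ⱽ x
        ... | no v≢x rewrite delete-≢ i x S v v≢x = p≤p+q (*-nn (0≤δ v x) (0≤f v))
        ... | yes refl = begin
          chainWeight v * (𝟙 (S i v) * (down S i v * up S i r v))  ≤⟨ *-monoˡ _ (0≤cw v) (𝟙*≤ (S i v) (*-nn (0≤down S i v) (0≤up S i r v))) ⟩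
          f v  ≡⟨ sym (trans (cong (_* f v) (δ-refl v)) (*-identityˡ (f v))) ⟩
          δ v v * f v  ≤⟨ q≤p+q (*-nn (0≤cw v) (*-nn (0≤𝟙 (S' i v)) (*-nn (0≤down S i v) (0≤up S i r v)))) ⟩
          chainWeight v * (𝟙 (S' i v) * (down S i v * up S i r v)) + δ v v * f v ∎

    Φ : Layers → (Subset n → ℚ) → ℚ
    Φ S f = ∑ (upTo (suc k)) (λ i → ∑ all (λ v → 𝟙 (S i v) * f v))

    Φ-delete : ∀ S i x f → (∀ v → 0ℚ ≤ f v) → i ℕ.≤ k → S i x ≡ true → Φ (delete i x S) f + f x ≤ Φ S f
    Φ-delete S i x f 0≤f i≤k Six = ∑-drop (upTo (suc k)) (f x) (λ j → ∑-mono all (mono j)) (∈-upTo⁺ (s≤s i≤k)) (∑-drop all (f x) (mono i) (∈-allSubsets x) (≤-reflexive eq))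
      where
        mono : ∀ j v → 𝟙 (delete i x S j v) * f v ≤ 𝟙 (S j v) * f v
        mono j v = *-monoʳ (f v) (0≤f v) (𝟙-mono (delete-⊆ i x S j v))
        eq : 𝟙 (delete i x S i x) * f x + f x ≡ 𝟙 (S i x) * f x
        eq rewrite delete-self i x S | Six = trans (cong (_+ f x) (*-zeroˡ (f x))) (trans (+-identityˡ (f x)) (sym (*-identityˡ (f x))))

    LowUp : Layers → ℕ → Subset n → Set
    LowUp S i v = i ℕ.< k × U true (λ w → 𝟙 (S (suc i) w)) v < ε

    LowDown : Layers → ℕ → Subset n → Set
    LowDown S zero v = ⊥
    LowDown S (suc i) v = U false (λ w → 𝟙 (S i w)) v < ε

    lowDown? : ∀ S i v → Dec (LowDown S i v)
    lowDown? S zero v = no (λ ())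
    lowDown? S (suc i) v = U false (λ w → 𝟙 (S i w)) v <? ε

    Bad : Layers → ℕ → Subset n → Set
    Bad S i v = S i v ≡ true × (LowUp S i v ⊎ LowDown S i v)

    bad? : ∀ S i v → Dec (Bad S i v)
    bad? S i v = (S i v Boolₚ.≟ true) ×-dec (((i ℕ.<? k) ×-dec (U true (λ w → 𝟙 (S (suc i) w)) v <? ε)) ⊎-dec lowDown? S i v)

    find-bad : ∀ S → (Σ ℕ λ i → Σ (Subset n) λ v → i ℕ.≤ k × Bad S i v) ⊎ (∀ i v → i ℕ.≤ k → ¬ Bad S i v)
    find-bad S with any? (λ i → any? (bad? S i) (all {n})) (upTo (suc k))
    ... | yes p = let (i , i∈ , q) = find p
                      (v , _ , b) = find q
                  in inj₁ (i , v , ℕₚ.≤-pred (∈-upTo⁻ i∈) , b)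
    ... | no ¬p = inj₂ (λ i v i≤k b → ¬p (lose (∈-upTo⁺ (s≤s i≤k)) (lose (∈-allSubsets v) b)))

    bad-loss : ∀ S i r x → i ℕ.+ r ≡ k → Bad S i x → down S i x * up S i r x ≤ ε
    bad-loss S i zero x e (_ , inj₁ (i<k , _)) = ⊥-elim (ℕₚ.<-irrefl (trans (sym (ℕₚ.+-identityʳ i)) e) i<k)
    bad-loss S i (suc r) x e (_ , inj₁ (_ , low)) = ≤-trans (*-mono2 0≤1 (0≤up S i (suc r) x) (down≤1 S i x) (≤-trans (U-mono true (λ w _ → subst (𝟙 (S (suc i) w) * up S (suc i) r w ≤_) (*-identityʳ _) (*-monoˡ _ (0≤𝟙 (S (suc i) w)) (up≤1 S (suc i) r w))) x) (ℚₚ.<⇒≤ low))) (≤-reflexive (*-identityˡ ε))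
    bad-loss S (suc i) r x e (_ , inj₂ low) = ≤-trans (*-mono2 0≤ε (0≤up S (suc i) r x) (≤-trans (U-mono false (λ w _ → subst (𝟙 (S i w) * down S i w ≤_) (*-identityʳ _) (*-monoˡ _ (0≤𝟙 (S i w)) (down≤1 S i w))) x) (ℚₚ.<⇒≤ low)) (up≤1 S (suc i) r x)) (≤-reflexive (*-identityʳ ε))

    opaque
      unfolding _+_

      ring-36 : ∀ a b e → a + b + e ≡ a + e + b
      ring-36 = solve-∀ ℚring

      ring-37 : ∀ m e a b → m + e * a + e * b ≡ m + e * (a + b)
      ring-37 = solve-∀ ℚring

    -- Deleting a bad pair costs at most `ε * chainWeight x` of mass and lowers `Φ` by at least
    -- `chainWeight x`, so the whole loss is paid by `ε` times the drop of `Φ`. The number of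
    -- remaining pairs, bounded by `ι t`, makes the process stop.
    prune : ∀ t S → Inside S → Φ S (λ _ → 1ℚ) ≤ ι t →
      Σ Layers λ S' → Inside S' × (∀ i v → i ℕ.≤ k → ¬ Bad S' i v) ×
        mass S 0 k + ε * Φ S' chainWeight ≤ mass S' 0 k + ε * Φ S chainWeight
    prune t S ins fuel with find-bad S
    ... | inj₂ good = S , ins , good , ≤-refl
    prune zero S ins fuel | inj₁ (i , x , i≤k , b@(Six , _)) = ⊥-elim (<⇒¬≤ (0<ι {1} ℕₚ.≤-refl) (begin
      ι 1  ≡⟨ ι-1 ⟩
      1ℚ  ≤⟨ q≤p+q (∑-nn (upTo (suc k)) (λ j → ∑-nn (all {n}) (λ v → *-nn (0≤𝟙 (delete i x S j v)) 0≤1))) ⟩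
      Φ (delete i x S) (λ _ → 1ℚ) + 1ℚ  ≤⟨ Φ-delete S i x (λ _ → 1ℚ) (λ _ → 0≤1) i≤k Six ⟩
      Φ S (λ _ → 1ℚ)  ≤⟨ fuel ⟩
      ι 0  ≡⟨ ι-0 ⟩
      0ℚ  ∎))
    prune (suc t) S ins fuel | inj₁ (i , x , i≤k , b@(Six , _)) =
      let (S'' , ins'' , good , ineq) = prune t S' ins' fuel' in S'' , ins'' , good , step S'' ineq
      where
        S' = delete i x S
        r = k ∸ i
        i+r : i ℕ.+ r ≡ k
        i+r = ℕₚ.m+[n∸m]≡n i≤k
        ins' : Inside S'
        ins' j v e = ins j v (delete-⊆ i x S j v e)
        fuel' : Φ S' (λ _ → 1ℚ) ≤ ι t
        fuel' = ≤-cancelʳ 1ℚ (≤-trans (Φ-delete S i x (λ _ → 1ℚ) (λ _ → 0≤1) i≤k Six) (≤-trans fuel (≤-reflexive (trans (cong ι (ℕₚ.+-comm 1 t)) (trans (ι-+ t 1) (cong (ι t +_) ι-1))))))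
        mass≤ : mass S 0 k ≤ mass S' 0 k + ε * chainWeight x
        mass≤ = begin
          mass S 0 k  ≡⟨ trans (cong (mass S 0) (sym i+r)) (mass-at S ins i r) ⟩
          mass S i r  ≤⟨ mass-delete S i r x ⟩
          mass S' i r + chainWeight x * (down S i x * up S i r x)  ≤⟨ +-mono-≤ (≤-reflexive (sym (trans (cong (mass S' 0) (sym i+r)) (mass-at S' ins' i r)))) (*-monoˡ _ (0≤cw x) (bad-loss S i r x i+r b)) ⟩
          mass S' 0 k + chainWeight x * ε  ≡⟨ cong (mass S' 0 k +_) (*-comm _ ε) ⟩
          mass S' 0 k + ε * chainWeight x  ∎
        step : ∀ S'' → mass S' 0 k + ε * Φ S'' chainWeight ≤ mass S'' 0 k + ε * Φ S' chainWeight →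
          mass S 0 k + ε * Φ S'' chainWeight ≤ mass S'' 0 k + ε * Φ S chainWeight
        step S'' ineq = begin
          mass S 0 k + ε * Φ S'' chainWeight  ≤⟨ +-mono-≤ mass≤ (≤-refl {ε * Φ S'' chainWeight}) ⟩
          mass S' 0 k + ε * chainWeight x + ε * Φ S'' chainWeight  ≡⟨ ring-36 (mass S' 0 k) (ε * chainWeight x) (ε * Φ S'' chainWeight) ⟩
          mass S' 0 k + ε * Φ S'' chainWeight + ε * chainWeight x  ≤⟨ +-mono-≤ ineq (≤-refl {ε * chainWeight x}) ⟩
          mass S'' 0 k + ε * Φ S' chainWeight + ε * chainWeight x  ≡⟨ ring-37 (mass S'' 0 k) ε (Φ S' chainWeight) (chainWeight x) ⟩
          mass S'' 0 k + ε * (Φ S' chainWeight + chainWeight x)  ≤⟨ +-mono-≤ (≤-refl {mass S'' 0 k}) (*-monoˡ ε 0≤ε (Φ-delete S i x chainWeight 0≤cw i≤k Six)) ⟩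
          mass S'' 0 k + ε * Φ S chainWeight  ∎

    up-reach : ∀ i r v → up (λ _ → A) i r v ≡ reach r v
    up-reach i zero v = refl
    up-reach i (suc r) v = U-cong true (λ w e → trans (cong₂ _*_ (cong 𝟙 e) (up-reach (suc i) r w)) (*-identityˡ _)) v

    mass-initial : mass (λ _ → A) 0 k ≡ hits k
    mass-initial = ∑-cong all (λ v → cong (λ z → chainWeight v * (𝟙 (A v) * z)) (trans (*-identityˡ _) (up-reach 0 k v)))

    record RichLayers : Set where
      field
        S : Layers
        inside : Inside S
        rich-up : ∀ i v → i ℕ.< k → S i v ≡ true → ε ≤ U true (λ w → 𝟙 (S (suc i) w)) v
        rich-down : ∀ i v → suc i ℕ.≤ k → S (suc i) v ≡ true → ε ≤ U false (λ w → 𝟙 (S i w)) v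
        heavy : ∀ i → i ℕ.≤ k → weight A ≤ weight (S i) + (ι k + ε * (ι (suc k) * weight A))

    opaque
      unfolding _+_

      ring-38 : ∀ a b e → a + b + e ≡ a + (e + b)
      ring-38 = solve-∀ ℚring

    richLayers : RichLayers
    richLayers = record
      { S = S'
      ; inside = ins'
      ; rich-up = λ i v i<k Siv → ℚₚ.≮⇒≥ (λ low → good i v (ℕₚ.<⇒≤ i<k) (Siv , inj₁ (i<k , low)))
      ; rich-down = λ i v i<k Siv → ℚₚ.≮⇒≥ (λ low → good (suc i) v i<k (Siv , inj₂ low))
      ; heavy = heavy
      }
      where
        fuel = proj₁ (archimedean (Φ (λ _ → A) (λ _ → 1ℚ)))
        pruned = prune fuel (λ _ → A) (λ _ v e → e) (proj₂ (archimedean (Φ (λ _ → A) (λ _ → 1ℚ))))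
        S' = proj₁ pruned
        ins' = proj₁ (proj₂ pruned)
        good = proj₁ (proj₂ (proj₂ pruned))
        Φ₀ : Φ (λ _ → A) chainWeight ≡ ι (suc k) * weight A
        Φ₀ = trans (∑-const (upTo (suc k)) (weight A)) (cong (λ z → ι z * weight A) (Listₚ.length-upTo (suc k)))
        heavy : ∀ i → i ℕ.≤ k → weight A ≤ weight (S' i) + (ι k + ε * (ι (suc k) * weight A))
        heavy i i≤k = begin
          weight A  ≤⟨ hits-≥ k ⟩
          hits k + ι k  ≡⟨ cong (_+ ι k) (sym mass-initial) ⟩
          mass (λ _ → A) 0 k + ι k  ≤⟨ +-mono-≤ (≤-trans (p≤p+q (*-nn 0≤ε (∑-nn (upTo (suc k)) (λ j → ∑-nn (all {n}) (λ v → *-nn (0≤𝟙 (S' j v)) (0≤cw v)))))) (proj₂ (proj₂ (proj₂ pruned)))) (≤-refl {ι k}) ⟩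
          mass S' 0 k + ε * Φ (λ _ → A) chainWeight + ι k  ≤⟨ +-mono-≤ (+-mono-≤ (≤-trans (≤-reflexive (trans (cong (mass S' 0) (sym (ℕₚ.m+[n∸m]≡n i≤k))) (mass-at S' ins' i (k ∸ i)))) (mass≤weight S' i (k ∸ i))) (≤-reflexive (cong (ε *_) Φ₀))) (≤-refl {ι k}) ⟩
          weight (S' i) + ε * (ι (suc k) * weight A) + ι k  ≡⟨ ring-38 (weight (S' i)) (ε * (ι (suc k) * weight A)) (ι k) ⟩
          weight (S' i) + (ι k + ε * (ι (suc k) * weight A))  ∎

-- Sub d is inclusion for d = true and reverse inclusion for d = false.
Sub : ∀ {n} → Bool → Subset n → Subset n → Set
Sub d v w = ∀ i → lookup v i ≡ d → lookup w i ≡ d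

opaque
  sub? : ∀ {n} d (v w : Subset n) → Dec (Sub d v w)
  sub? d v w = Finₚ.all? (λ i → (lookup v i Boolₚ.≟ d) →-dec (lookup w i Boolₚ.≟ d))

opaque
  infix 4 _<ᴺ?_

  _<ᴺ?_ : (a b : ℕ) → Dec (a ℕ.< b)
  _<ᴺ?_ = ℕ._<?_

subᵇ : ∀ {n} → Bool → Subset n → Subset n → Bool
subᵇ d v w = does (sub? d v w)

xor-true : ∀ d b → d xor b ≡ true → b ≢ d
xor-true true false e ()
xor-true false true e ()

xor-false : ∀ d b → d xor b ≡ false → b ≡ d
xor-false true true e = refl
xor-false false false e = refl

≡⇒xor-false : ∀ d b → b ≡ d → d xor b ≡ false
≡⇒xor-false true b refl = refl
≡⇒xor-false false b refl = refl

≢⇒not : ∀ {a b : Bool} → a ≢ b → a ≡ not b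
≢⇒not {true} {true} h = ⊥-elim (h refl)
≢⇒not {true} {false} h = refl
≢⇒not {false} {true} h = refl
≢⇒not {false} {false} h = ⊥-elim (h refl)

Sub-refl : ∀ {n} d (v : Subset n) → Sub d v v
Sub-refl d v i e = e

Sub-trans : ∀ {n} d (u v w : Subset n) → Sub d u v → Sub d v w → Sub d u w
Sub-trans d u v w p q i e = q i (p i e)

Sub-not : ∀ {n} d (v w : Subset n) → Sub d v w → Sub (not d) w v
Sub-not d v w h i e with lookup v i Boolₚ.≟ d
... | yes p = ⊥-elim (Boolₚ.not-¬ refl (trans (sym (h i p)) e))
... | no ¬p = ≢⇒not ¬p

Sub-flip : ∀ {n} d (v : Subset n) i → d xor lookup v i ≡ true → Sub d v (flip i v)
Sub-flip d v i o j e = trans (lookup-flip-≢ i j v (λ { refl → xor-true d (lookup v j) o e })) e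

flip-open : ∀ {n} d (v : Subset n) i → d xor lookup v i ≡ true → lookup (flip i v) i ≡ d
flip-open d v i o = trans (lookup-flip i v) (trans (cong not (≢⇒not (xor-true d (lookup v i) o))) (Boolₚ.not-involutive d))

¬Sub-witness : ∀ {n} d (v w : Subset n) → ¬ Sub d v w → Σ (Fin n) λ i → lookup v i ≡ d × lookup w i ≢ d
¬Sub-witness d v w ¬s with Finₚ.¬∀⟶∃¬ _ (λ i → lookup v i ≡ d → lookup w i ≡ d) (λ i → (lookup v i Boolₚ.≟ d) →-dec (lookup w i Boolₚ.≟ d)) ¬s
... | i , ¬p = i , decidable-stable (lookup v i Boolₚ.≟ d) (λ ¬q → ¬p (λ q → ⊥-elim (¬q q))) , (λ q → ¬p (λ _ → q))

∑-open-below : ∀ {n} d (v w : Subset n) → Sub d v w →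
  ∑ (allFin n) (λ i → 𝟙 (d xor lookup v i) * 𝟙 (not (d xor lookup w i))) + ι (co d w) ≡ ι (co d v)
∑-open-below {n} d v w s = begin
  ∑ (allFin n) (λ i → 𝟙 (d xor lookup v i) * 𝟙 (not (d xor lookup w i))) + ι (co d w)
    ≡⟨ cong (∑ (allFin n) (λ i → 𝟙 (d xor lookup v i) * 𝟙 (not (d xor lookup w i))) +_) (sym (∑-co d w)) ⟩
  ∑ (allFin n) (λ i → 𝟙 (d xor lookup v i) * 𝟙 (not (d xor lookup w i))) + ∑ (allFin n) (λ i → 𝟙 (d xor lookup w i))
    ≡⟨ sym (∑-+ (allFin n) _ _) ⟩
  ∑ (allFin n) (λ i → 𝟙 (d xor lookup v i) * 𝟙 (not (d xor lookup w i)) + 𝟙 (d xor lookup w i))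
    ≡⟨ ∑-cong (allFin n) term ⟩
  ∑ (allFin n) (λ i → 𝟙 (d xor lookup v i))
    ≡⟨ ∑-co d v ⟩
  ι (co d v) ∎
  where
    open ≡-Reasoning
    term : ∀ i → 𝟙 (d xor lookup v i) * 𝟙 (not (d xor lookup w i)) + 𝟙 (d xor lookup w i) ≡ 𝟙 (d xor lookup v i)
    term i with d xor lookup w i in ew | d xor lookup v i in ev
    ... | false | a = trans (+-identityʳ _) (*-identityʳ (𝟙 a))
    ... | true | true = trans (cong (_+ 1ℚ) (*-zeroʳ 1ℚ)) (+-identityˡ 1ℚ)
    ... | true | false = ⊥-elim (xor-true d (lookup w i) ew (s i (xor-false d (lookup v i) ev)))

∑-allFin-δ : ∀ {n} (i : Fin n) → ∑ (allFin n) (λ j → 𝟙 (does (j Finₚ.≟ i))) ≡ 1ℚ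
∑-allFin-δ {suc n} zero = trans (∑-allFin-suc n _) (trans (cong (1ℚ +_) (∑-0 (allFin n))) (+-identityʳ 1ℚ))
∑-allFin-δ {suc n} (suc i) = trans (∑-allFin-suc n _) (trans (+-identityˡ _) (∑-allFin-δ i))

ι*rec≤1 : ∀ m → ι m * rec m ≤ 1ℚ
ι*rec≤1 zero = subst (_≤ 1ℚ) (sym (trans (cong (ι 0 *_) rec-0) (*-zeroʳ (ι 0)))) 0≤1
ι*rec≤1 (suc m) = ≤-reflexive (ι*rec (suc m) (s≤s z≤n))

-- Hitting estimates inside a window of middle levels

record Central {n : ℕ} (A : Family n) (lo hi : ℕ) : Set where
  field
    1≤lo : 1 ℕ.≤ lo
    lo≤ : ∀ d v → A v ≡ true → lo ℕ.≤ co d v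
    ≤hi : ∀ d v → A v ≡ true → co d v ℕ.≤ hi

Gap : ∀ {n} → Family n → ℕ → Set
Gap A r = ∀ d v w → A v ≡ true → A w ≡ true → Sub d v w → 1 ℕ.≤ co d v ∸ co d w → r ℕ.≤ co d v ∸ co d w

-- Bounds the probability that the walk hits a prescribed set g levels away.
passing : ℕ → ℕ → ℚ
passing lo zero = 1ℚ
passing lo (suc g) = ι (suc g) * rec (lo ℕ.+ suc g) * passing lo g

0≤passing : ∀ lo g → 0ℚ ≤ passing lo g
0≤passing lo zero = 0≤1
0≤passing lo (suc g) = *-nn (*-nn (0≤ι (suc g)) (0≤rec (lo ℕ.+ suc g))) (0≤passing lo g)

passing-suc-≤ : ∀ lo g → passing lo (suc g) ≤ passing lo g
passing-suc-≤ lo g = begin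
  ι (suc g) * rec (lo ℕ.+ suc g) * passing lo g  ≤⟨ *-monoʳ (passing lo g) (0≤passing lo g) (*-monoˡ (ι (suc g)) (0≤ι (suc g)) (rec-anti (s≤s z≤n) (ℕₚ.m≤n+m (suc g) lo))) ⟩
  ι (suc g) * rec (suc g) * passing lo g  ≡⟨ trans (cong (_* passing lo g) (ι*rec (suc g) (s≤s z≤n))) (*-identityˡ _) ⟩
  passing lo g  ∎
  where open ℚₚ.≤-Reasoning

passing-anti : ∀ lo {g g'} → g ℕ.≤ g' → passing lo g' ≤ passing lo g
passing-anti lo {g} {g'} h = go (ℕₚ.≤⇒≤′ h)
  where
    go : ∀ {g'} → g ℕ.≤′ g' → passing lo g' ≤ passing lo g
    go (ℕ.≤′-reflexive refl) = ≤-refl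
    go (ℕ.≤′-step p) = ≤-trans (passing-suc-≤ lo _) (go p)

module WalkBounds {n : ℕ} (A : Family n) (lo hi : ℕ) (central : Central A lo hi) where
  open FirstHit A
  open Central central
  open ℚₚ.≤-Reasoning

  -- Inside the window a walk makes at most `hi - lo` steps, each choosing among at least `lo`
  -- coordinates, so this bounds the chance that a prescribed coordinate is ever turned there.
  drift : ℚ
  drift = ι (hi ∸ lo) * rec lo

  0≤drift : 0ℚ ≤ drift
  0≤drift = *-nn (0≤ι (hi ∸ lo)) (0≤rec lo)

  not-low : ∀ d w → co d w ℕ.< lo → A w ≡ false
  not-low d w h with A w in eq
  ... | false = refl
  ... | true = ⊥-elim (ℕₚ.<⇒≱ h (lo≤ d w eq))

  module _ (d : Bool) (i : Fin n) where

    private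
      f : Subset n → ℚ
      f w = 𝟙 (not (d xor lookup w i))

      -- The union bound over the remaining steps, written as a supersolution for `U-≤`. The value 0
      -- below the window records that no member of `A` is met there; at level `lo`, where the bound
      -- is already 0, the inequality depends on it.
      G : Subset n → ℚ
      G w = if does (co d w <ᴺ? lo) then 0ℚ else (if d xor lookup w i then ι (co d w ∸ lo) * rec lo else 1ℚ)

      0≤G : ∀ w → 0ℚ ≤ G w
      0≤G w with co d w <ᴺ? lo
      ... | yes _ = ≤-refl
      ... | no _ with d xor lookup w i
      ...   | true = *-nn (0≤ι (co d w ∸ lo)) (0≤rec lo)
      ...   | false = 0≤1

      G-low : ∀ w → co d w ℕ.< lo → G w ≡ 0ℚ
      G-low w h rewrite dec-true (co d w <ᴺ? lo) h = refl

      G-closed : ∀ w → d xor lookup w i ≡ false → G w ≤ 1ℚ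
      G-closed w e with co d w <ᴺ? lo
      ... | yes _ = 0≤1
      ... | no _ rewrite e = ≤-refl

      G-open : ∀ w → d xor lookup w i ≡ true → G w ≤ ι (co d w ∸ lo) * rec lo
      G-open w e with co d w <ᴺ? lo
      ... | yes _ = *-nn (0≤ι (co d w ∸ lo)) (0≤rec lo)
      ... | no _ rewrite e = ≤-refl

      closed-flip : ∀ v j → d xor lookup v j ≡ true → j ≢ i ⊎ j ≡ i → d xor lookup v i ≡ false → d xor lookup (flip j v) i ≡ false
      closed-flip v j o c e = trans (cong (d xor_) (lookup-flip-≢ j i v (λ { refl → case trans (sym e) o of λ () }))) e

      opaque
        unfolding _+_

        ring-39 : ∀ r i q → r * (1ℚ + i * q) ≡ r + i * r * q
        ring-39 = solve-∀ ℚring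

        ring-40 : ∀ r x → r + 1ℚ * (x * r) ≡ (1ℚ + x) * r
        ring-40 = solve-∀ ℚring

      super : ∀ v → P d (λ w → mix (A w) (f w) (G w)) v ≤ G v
      super v with co d v <ᴺ? lo
      ... | yes low = P-≤-open d {λ w → mix (A w) (f w) (G w)} v 0ℚ ≤-refl (λ j o →
              let low' = ℕₚ.<-trans (ℕₚ.≤-reflexive (co-flip d v j o)) low
              in ≤-reflexive (trans (cong (λ z → mix z (f (flip j v)) (G (flip j v))) (not-low d (flip j v) low')) (G-low (flip j v) low')))
      ... | no ¬low with d xor lookup v i in oi
      ...   | false = P-≤-open d {λ w → mix (A w) (f w) (G w)} v 1ℚ 0≤1 (λ j o → mix-≤ (A (flip j v)) (𝟙≤1 (not (d xor lookup (flip j v) i))) (G-closed (flip j v) (closed-flip v j o (inj₁ (λ { refl → case trans (sym oi) o of λ () })) oi)))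
      ...   | true with co d v ℕ.≟ lo
      ...     | yes e = ≤-trans (P-≤-open d {λ w → mix (A w) (f w) (G w)} v 0ℚ ≤-refl (λ j o →
                let low' = ℕₚ.≤-reflexive (trans (co-flip d v j o) e)
                in ≤-reflexive (trans (cong (λ z → mix z (f (flip j v)) (G (flip j v))) (not-low d (flip j v) low')) (G-low (flip j v) low'))))
                (*-nn (0≤ι (co d v ∸ lo)) (0≤rec lo))
      ...     | no ≢lo = begin
        rec m * ∑ (allFin n) (λ j → 𝟙 (d xor lookup v j) * F (flip j v))  ≤⟨ *-monoˡ (rec m) (0≤rec m) (∑-mono (allFin n) term) ⟩
        rec m * ∑ (allFin n) (λ j → 𝟙 (does (j Finₚ.≟ i)) + 𝟙 (d xor lookup v j) * q)  ≡⟨ cong (rec m *_) (trans (∑-+ (allFin n) _ _) (cong₂ _+_ (∑-allFin-δ i) (trans (∑-*ʳ (allFin n) q _) (cong (_* q) (∑-co d v))))) ⟩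
        rec m * (1ℚ + ι m * q)  ≡⟨ ring-39 (rec m) (ι m) q ⟩
        rec m + ι m * rec m * q  ≤⟨ +-mono-≤ (rec-anti 1≤lo lo≤m) (*-monoʳ q 0≤q (ι*rec≤1 m)) ⟩
        rec lo + 1ℚ * (ι (m ∸ suc lo) * rec lo)  ≡⟨ ring-40 (rec lo) (ι (m ∸ suc lo)) ⟩
        (1ℚ + ι (m ∸ suc lo)) * rec lo  ≡⟨ cong (_* rec lo) (trans (cong (_+ ι (m ∸ suc lo)) (sym ι-1)) (trans (sym (ι-+ 1 (m ∸ suc lo))) (cong ι (trans (sym (ℕₚ.+-∸-assoc 1 lo<m)) refl)))) ⟩
        ι (m ∸ lo) * rec lo  ∎
        where
          m = co d v
          F : Subset n → ℚ
          F w = mix (A w) (f w) (G w)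
          lo≤m : lo ℕ.≤ m
          lo≤m = ℕₚ.≮⇒≥ ¬low
          lo<m : lo ℕ.< m
          lo<m = ℕₚ.≤∧≢⇒< lo≤m (λ e → ≢lo (sym e))
          q = ι (m ∸ suc lo) * rec lo
          0≤q : 0ℚ ≤ q
          0≤q = *-nn (0≤ι (m ∸ suc lo)) (0≤rec lo)
          term : ∀ j → 𝟙 (d xor lookup v j) * F (flip j v) ≤ 𝟙 (does (j Finₚ.≟ i)) + 𝟙 (d xor lookup v j) * q
          term j with j Finₚ.≟ i
          ... | yes refl rewrite oi = ≤-trans (≤-reflexive (*-identityˡ _)) (≤-trans (mix-≤ (A (flip j v)) (𝟙≤1 (not (d xor lookup (flip j v) i))) (G-closed (flip j v) (≡⇒xor-false d _ (flip-open d v j oi)))) (p≤p+q (*-nn 0≤1 0≤q)))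
          ... | no j≢i with d xor lookup v j in oj
          ...   | false = ≤-trans (≤-reflexive (*-zeroˡ _)) (+-nn ≤-refl (*-nn ≤-refl 0≤q))
          ...   | true = ≤-trans (*-monoˡ 1ℚ 0≤1 bound) (q≤p+q ≤-refl)
            where
              o' : d xor lookup (flip j v) i ≡ true
              o' = trans (cong (d xor_) (lookup-flip-≢ j i v (λ e → j≢i (sym e)))) oi
              bound : F (flip j v) ≤ q
              bound = mix-≤ (A (flip j v)) (subst (_≤ q) (sym (cong (λ z → 𝟙 (not z)) o')) 0≤q) (≤-trans (G-open (flip j v) o') (≤-reflexive (cong (λ z → ι z * rec lo) (cong (_∸ suc lo) (co-flip d v j oj)))))

    hit-coordinate : ∀ v → co d v ℕ.≤ hi → lookup v i ≢ d → U d f v ≤ drift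
    hit-coordinate v ≤h open-i = ≤-trans (U-≤ d f G 0≤G super v) (≤-trans (G-open v o) (*-monoʳ (rec lo) (0≤rec lo) (ι-mono (ℕₚ.∸-monoˡ-≤ lo ≤h))))
      where
        o : d xor lookup v i ≡ true
        o with d xor lookup v i in e
        ... | true = refl
        ... | false = ⊥-elim (open-i (xor-false d (lookup v i) e))

  subᵇ-mono : ∀ d (v v' w : Subset n) → Sub d v v' → 𝟙 (subᵇ d v' w) ≤ 𝟙 (subᵇ d v w)
  subᵇ-mono d v v' w s = 𝟙-mono (λ e → dec-true (sub? d v w) (Sub-trans d v v' w s (dec-true⁻ (sub? d v' w) e)))

  -- Once the walk turns a coordinate that `z` lacks, it never returns below `z`. So the first step
  -- alone gives the bound: at most `hi - lo` of at least `lo` choices stay below `z`.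
  hit-below : ∀ d z v → A z ≡ true → A v ≡ true → U d (λ w → 𝟙 (subᵇ d w z)) v ≤ drift
  hit-below d z v Az Av = ≤-trans (≤-reflexive (U-fix d f v)) (≤-trans (P-mono d {λ w → mix (A w) (f w) (U d f w)} {f} (λ w → mix-≤ (A w) ≤-refl (U≤f w)) v) Pf≤)
    where
      f : Subset n → ℚ
      f w = 𝟙 (subᵇ d w z)
      U≤f : ∀ w → U d f w ≤ f w
      U≤f = U-≤ d f f (λ w → 0≤𝟙 (subᵇ d w z)) (λ w → P-≤-open d {λ x → mix (A x) (f x) (f x)} w (f w) (0≤𝟙 (subᵇ d w z)) (λ i o → mix-≤ (A (flip i w)) (subᵇ-mono d w (flip i w) z (Sub-flip d w i o)) (subᵇ-mono d w (flip i w) z (Sub-flip d w i o))))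
      Pf≤ : P d f v ≤ drift
      Pf≤ with sub? d v z
      ... | no ¬s = ≤-trans (P-≤-open d {f} v 0ℚ ≤-refl (λ i o → ≤-reflexive (cong 𝟙 (dec-false (sub? d (flip i v) z) (λ s → ¬s (Sub-trans d v (flip i v) z (Sub-flip d v i o) s)))))) 0≤drift
      ... | yes s = begin
        rec m * ∑ (allFin n) (λ i → 𝟙 (d xor lookup v i) * f (flip i v))  ≤⟨ *-monoˡ (rec m) (0≤rec m) (∑-mono (allFin n) term) ⟩
        rec m * ∑ (allFin n) (λ i → 𝟙 (d xor lookup v i) * 𝟙 (not (d xor lookup z i)))  ≤⟨ *-mono2 (0≤rec lo) (∑-nn (allFin n) (λ i → *-nn (0≤𝟙 (d xor lookup v i)) (0≤𝟙 (not (d xor lookup z i))))) (rec-anti 1≤lo (lo≤ d v Av)) count ⟩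
        rec lo * ι (hi ∸ lo)  ≡⟨ *-comm _ _ ⟩
        drift  ∎
        where
          m = co d v
          term : ∀ i → 𝟙 (d xor lookup v i) * f (flip i v) ≤ 𝟙 (d xor lookup v i) * 𝟙 (not (d xor lookup z i))
          term i with d xor lookup v i in o
          ... | false = ≤-reflexive (trans (*-zeroˡ _) (sym (*-zeroˡ _)))
          ... | true = *-monoˡ 1ℚ 0≤1 (𝟙-mono (λ e → cong not (≡⇒xor-false d _ (dec-true⁻ (sub? d (flip i v) z) e i (flip-open d v i o)))))
          count : ∑ (allFin n) (λ i → 𝟙 (d xor lookup v i) * 𝟙 (not (d xor lookup z i))) ≤ ι (hi ∸ lo)
          count = ≤-cancelʳ (ι (co d z)) (begin
            ∑ (allFin n) (λ i → 𝟙 (d xor lookup v i) * 𝟙 (not (d xor lookup z i))) + ι (co d z)  ≡⟨ ∑-open-below d v z s ⟩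
            ι (co d v)  ≤⟨ ι-mono (ℕₚ.≤-trans (≤hi d v Av) (ℕₚ.≤-trans (ℕₚ.m≤n+m∸n hi lo) (ℕₚ.≤-trans (ℕₚ.+-monoˡ-≤ (hi ∸ lo) (lo≤ d z Az)) (ℕₚ.≤-reflexive (ℕₚ.+-comm (co d z) (hi ∸ lo)))))) ⟩
            ι (hi ∸ lo ℕ.+ co d z)  ≡⟨ ι-+ (hi ∸ lo) (co d z) ⟩
            ι (hi ∸ lo) + ι (co d z)  ∎)

  module _ (d : Bool) (w : Subset n) (Aw : A w ≡ true) where

    private
      G : Subset n → ℚ
      G v = 𝟙 (subᵇ d v w) * passing lo (co d v ∸ co d w)

      0≤G : ∀ v → 0ℚ ≤ G v
      0≤G v = *-nn (0≤𝟙 (subᵇ d v w)) (0≤passing lo (co d v ∸ co d w))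

      δ≤G : ∀ v → δ w v ≤ G v
      δ≤G v with δ-cases w v
      ... | inj₂ e = subst (_≤ G v) (sym e) (0≤G v)
      ... | inj₁ refl rewrite dec-true (sub? d w w) (Sub-refl d w) | ℕₚ.n∸n≡0 (co d w) = subst (δ w w ≤_) (sym (*-identityˡ 1ℚ)) (δ≤1 w w)

    -- Of the `co d v` coordinates that can be turned, only `co d v ∸ co d w` lead towards `w`. The
    -- walk always makes this step, even when it starts in `w`.
    first-step : Subset n → ℚ
    first-step v = 𝟙 (subᵇ d v w) * (rec (co d v) * (ι (co d v ∸ co d w) * passing lo (co d v ∸ co d w ∸ 1)))

    P-G≤ : ∀ v → P d G v ≤ first-step v
    P-G≤ v with sub? d v w
    ... | no ¬s = ≤-trans (P-≤-open d {G} v 0ℚ ≤-refl (λ i o → ≤-reflexive (trans (cong (λ b → 𝟙 b * passing lo (co d (flip i v) ∸ co d w)) (dec-false (sub? d (flip i v) w) (λ s → ¬s (Sub-trans d v (flip i v) w (Sub-flip d v i o) s)))) (*-zeroˡ _)))) (≤-reflexive (sym (*-zeroˡ _)))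
    ... | yes s = begin
      rec m * ∑ (allFin n) (λ i → 𝟙 (d xor lookup v i) * G (flip i v))  ≤⟨ *-monoˡ (rec m) (0≤rec m) (∑-mono (allFin n) term) ⟩
      rec m * ∑ (allFin n) (λ i → 𝟙 (d xor lookup v i) * 𝟙 (not (d xor lookup w i)) * p)  ≡⟨ cong (rec m *_) (∑-*ʳ (allFin n) p _) ⟩
      rec m * (∑ (allFin n) (λ i → 𝟙 (d xor lookup v i) * 𝟙 (not (d xor lookup w i))) * p)  ≤⟨ *-monoˡ (rec m) (0≤rec m) (*-monoʳ p 0≤p count) ⟩
      rec m * (ι g * p)  ≡⟨ sym (*-identityˡ _) ⟩
      1ℚ * (rec m * (ι g * p))  ∎
      where
        m = co d v
        g = co d v ∸ co d w
        p = passing lo (g ∸ 1)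
        0≤p : 0ℚ ≤ p
        0≤p = 0≤passing lo (g ∸ 1)
        count : ∑ (allFin n) (λ i → 𝟙 (d xor lookup v i) * 𝟙 (not (d xor lookup w i))) ≤ ι g
        count = ≤-cancelʳ (ι (co d w)) (≤-trans (≤-reflexive (∑-open-below d v w s)) (≤-trans (ι-mono (ℕₚ.≤-trans (ℕₚ.m≤n+m∸n (co d v) (co d w)) (ℕₚ.≤-reflexive (ℕₚ.+-comm (co d w) (co d v ∸ co d w))))) (≤-reflexive (ι-+ g (co d w)))))
        term : ∀ i → 𝟙 (d xor lookup v i) * G (flip i v) ≤ 𝟙 (d xor lookup v i) * 𝟙 (not (d xor lookup w i)) * p
        term i with d xor lookup v i in o
        ... | false = ≤-reflexive (trans (*-zeroˡ _) (sym (trans (cong (_* p) (*-zeroˡ _)) (*-zeroˡ p))))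
        ... | true = ≤-trans (≤-reflexive (*-identityˡ _)) (≤-trans (≤-reflexive (cong (λ z → 𝟙 (subᵇ d (flip i v) w) * passing lo z) drop)) (*-monoʳ p 0≤p (≤-trans (𝟙-mono (λ e → cong not (≡⇒xor-false d _ (dec-true⁻ (sub? d (flip i v) w) e i (flip-open d v i o))))) (≤-reflexive (sym (*-identityˡ _))))))
          where
            drop : co d (flip i v) ∸ co d w ≡ g ∸ 1
            drop = trans (cong (_∸ suc (co d w)) (co-flip d v i o)) (trans (sym (ℕₚ.∸-+-assoc (co d v) 1 (co d w))) (trans (ℕₚ.∸-+-assoc (co d v) 1 (co d w)) (trans (cong (co d v ∸_) (ℕₚ.+-comm 1 (co d w))) (sym (ℕₚ.∸-+-assoc (co d v) (co d w) 1)))))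

    opaque
      unfolding _+_

      ring-41 : ∀ r i p → r * (i * p) ≡ i * r * p
      ring-41 = solve-∀ ℚring

    first-step≤G : ∀ v → first-step v ≤ G v
    first-step≤G v with sub? d v w
    ... | no ¬s = ≤-reflexive (trans (*-zeroˡ _) (sym (*-zeroˡ _)))
    ... | yes s = *-monoˡ 1ℚ 0≤1 (bound (co d v ∸ co d w) refl)
      where
        bound : ∀ g → co d v ∸ co d w ≡ g → rec (co d v) * (ι g * passing lo (g ∸ 1)) ≤ passing lo g
        bound zero e = ≤-trans (≤-reflexive (trans (cong (rec (co d v) *_) (trans (cong (_* passing lo 0) ι-0) (*-zeroˡ _))) (*-zeroʳ _))) 0≤1
        bound (suc g) e = ≤-trans (*-monoʳ _ (*-nn (0≤ι (suc g)) (0≤passing lo g)) (rec-anti (ℕₚ.≤-trans (s≤s z≤n) (ℕₚ.m≤n+m (suc g) lo)) far)) (≤-reflexive (ring-41 (rec (lo ℕ.+ suc g)) (ι (suc g)) (passing lo g)))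
          where
            far : lo ℕ.+ suc g ℕ.≤ co d v
            far = ℕₚ.≤-trans (ℕₚ.+-monoˡ-≤ (suc g) (lo≤ d w Aw)) (ℕₚ.≤-reflexive (trans (cong (co d w ℕ.+_) (sym e)) (ℕₚ.m+[n∸m]≡n {co d w} (ℕₚ.<⇒≤ (ℕₚ.m∸n≢0⇒n<m {co d v} {co d w} (λ e0 → case trans (sym e) e0 of λ ()))))))

    U-δ≤ : ∀ v → U d (δ w) v ≤ first-step v
    U-δ≤ v = ≤-trans (≤-reflexive (U-fix d (δ w) v)) (≤-trans (P-mono d {λ x → mix (A x) (δ w x) (U d (δ w) x)} {G} (λ x → mix-≤ (A x) (δ≤G x) (U≤G x)) v) (P-G≤ v))
      where
        U≤G : ∀ x → U d (δ w) x ≤ G x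
        U≤G = U-≤ d (δ w) G 0≤G (λ x → ≤-trans (P-mono d {λ y → mix (A y) (δ w y) (G y)} {G} (λ y → mix-≤ (A y) (δ≤G y) ≤-refl) x) (≤-trans (P-G≤ x) (first-step≤G x)))

    U-δ-outside : ∀ v → ¬ Sub d v w → U d (δ w) v ≤ 0ℚ
    U-δ-outside v ¬s = ≤-trans (U-δ≤ v) (≤-reflexive (trans (cong (λ b → 𝟙 b * (rec (co d v) * (ι (co d v ∸ co d w) * passing lo (co d v ∸ co d w ∸ 1)))) (dec-false (sub? d v w) ¬s)) (*-zeroˡ _)))

    U-δ-gap : ∀ r v → Gap A r → A v ≡ true → U d (δ w) v ≤ passing lo r
    U-δ-gap r v gap Av with sub? d v w
    ... | no ¬s = ≤-trans (U-δ-outside v ¬s) (0≤passing lo r)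
    ... | yes s = by-gap (co d v ∸ co d w) refl
      where
        by-gap : ∀ g → co d v ∸ co d w ≡ g → U d (δ w) v ≤ passing lo r
        -- `Gap` says nothing about sets on the same level, but there no coordinate leads to `w` and
        -- `first-step` vanishes.
        by-gap zero e = ≤-trans (U-δ≤ v) (≤-trans (≤-reflexive zero-step) (0≤passing lo r))
          where
            zero-step : first-step v ≡ 0ℚ
            zero-step rewrite e = trans (cong (𝟙 (subᵇ d v w) *_) (trans (cong (rec (co d v) *_) (trans (cong (_* passing lo 0) ι-0) (*-zeroˡ _))) (*-zeroʳ _))) (*-zeroʳ _)
        by-gap (suc g) e = ≤-trans (U-δ≤ v) (≤-trans (first-step≤G v) (≤-trans (𝟙*≤ (subᵇ d v w) (0≤passing lo (co d v ∸ co d w))) (passing-anti lo (gap d v w Av Aw s (subst (1 ℕ.≤_) (sym e) (s≤s z≤n))))))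

-- Codes as ranked posets

rel : ∀ {m} → Code m → Fin (suc m) → Fin (suc m) → Bool
rel root a b = true
rel (ext C par d) zero zero = true
rel (ext C par true) zero (suc b) = false
rel (ext C par true) (suc a) zero = rel C a par
rel (ext C par false) zero (suc b) = rel C par b
rel (ext C par false) (suc a) zero = false
rel (ext C par d) (suc a) (suc b) = rel C a b

-- The rank of a node is the index of the layer in which it will be placed. Since consecutive hits
-- move between adjacent layers, ranks change by exactly one along each edge.
Ranked : ∀ {m} → ℕ → Code m → (Fin (suc m) → ℕ) → Set
Ranked k root ρ = ρ zero ℕ.≤ k
Ranked k (ext C par true) ρ = ρ zero ≡ suc (ρ (suc par)) × ρ zero ℕ.≤ k × Ranked k C (λ i → ρ (suc i))
Ranked k (ext C par false) ρ = suc (ρ zero) ≡ ρ (suc par) × Ranked k C (λ i → ρ (suc i))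

Ranked-≤ : ∀ {m} k (C : Code m) ρ → Ranked k C ρ → ∀ i → ρ i ℕ.≤ k
Ranked-≤ k root ρ h zero = h
Ranked-≤ k (ext C par true) ρ (_ , h , _) zero = h
Ranked-≤ k (ext C par true) ρ (_ , _ , r) (suc i) = Ranked-≤ k C _ r i
Ranked-≤ k (ext C par false) ρ (e , r) zero = ℕₚ.<⇒≤ (ℕₚ.≤-trans (ℕₚ.≤-reflexive e) (Ranked-≤ k C _ r par))
Ranked-≤ k (ext C par false) ρ (_ , r) (suc i) = Ranked-≤ k C _ r i

rootRank : ∀ {m} → Code m → (Fin (suc m) → ℕ) → ℕ
rootRank root ρ = ρ zero
rootRank (ext C par d) ρ = rootRank C (λ i → ρ (suc i))

rootRank-≤ : ∀ {m} k (C : Code m) ρ → Ranked k C ρ → rootRank C ρ ℕ.≤ k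
rootRank-≤ k root ρ h = h
rootRank-≤ k (ext C par true) ρ (_ , _ , r) = rootRank-≤ k C _ r
rootRank-≤ k (ext C par false) ρ (_ , r) = rootRank-≤ k C _ r

powℚ : ℚ → ℕ → ℚ
powℚ x zero = 1ℚ
powℚ x (suc m) = x * powℚ x m

-- The measure on induced copies

module Embedding {n : ℕ} (A : Family n) (lo hi : ℕ) (central : Central A lo hi)
    (r : ℕ) (gap : Gap A r) (s γ : ℚ) (0<s : 0ℚ < s) (0≤γ : 0ℚ ≤ γ) (s-small : s * passing lo r ≤ 1ℚ)
    (k : ℕ) (ε : ℚ) (0≤ε : 0ℚ ≤ ε) where
  open FirstHit A
  open WalkBounds A lo hi central
  open Windows A using (0≤cw; module Prune)
  open Prune k ε 0≤ε using (RichLayers; richLayers)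
  open RichLayers richLayers
  open ℚₚ.≤-Reasoning

  c : Subset n → ℚ
  c v = 𝟙 (A v) * chainWeight v

  0≤c : ∀ v → 0ℚ ≤ c v
  0≤c v = *-nn (0≤𝟙 (A v)) (0≤cw v)

  h : Bool → Subset n → Subset n → ℚ
  h d v w = 𝟙 (A v) * (𝟙 (A w) * U d (δ w) v)

  0≤Uδ : ∀ d v w → 0ℚ ≤ U d (δ w) v
  0≤Uδ d v w = 0≤U d (λ x → 0≤δ w x) v

  0≤h : ∀ d v w → 0ℚ ≤ h d v w
  0≤h d v w = *-nn (0≤𝟙 (A v)) (*-nn (0≤𝟙 (A w)) (0≤Uδ d v w))

  h≤Uδ : ∀ d v w → h d v w ≤ U d (δ w) v
  h≤Uδ d v w = ≤-trans (𝟙*≤ (A v) (*-nn (0≤𝟙 (A w)) (0≤Uδ d v w))) (𝟙*≤ (A w) (0≤Uδ d v w))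

  ∑h≤U : ∀ d v (f : Subset n → ℚ) → (∀ w → 0ℚ ≤ f w) → ∑ all (λ w → h d v w * f w) ≤ U d f v
  ∑h≤U d v f 0≤f = ≤-trans (∑-mono (all {n}) (λ w → *-monoʳ (f w) (0≤f w) (h≤Uδ d v w))) (≤-reflexive (sym (U-expand d f v)))

  h-substochastic : ∀ d v → ∑ all (h d v) ≤ 1ℚ
  h-substochastic d v = begin
    ∑ all (h d v)  ≡⟨ ∑-cong (all {n}) (λ w → sym (*-identityʳ (h d v w))) ⟩
    ∑ all (λ w → h d v w * 1ℚ)  ≤⟨ ∑h≤U d v (λ _ → 1ℚ) (λ _ → 0≤1) ⟩
    U d (λ _ → 1ℚ) v  ≤⟨ U≤1 d (λ _ → ≤-refl) v ⟩
    1ℚ  ∎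

  𝟙-idem : ∀ b p → 𝟙 b * (𝟙 b * p) ≡ 𝟙 b * p
  𝟙-idem b p = 𝟙-idem-⊆ b b id

  opaque
    unfolding _+_

    ring-42 : ∀ a x b u → a * x * (a * (b * u)) ≡ b * (x * (a * (a * u)))
    ring-42 = solve-∀ ℚring

  -- By `U-adjoint` the flow into `w` is `c w` times the probability that the reversed walk from `w`
  -- meets `A` at all.
  h-subinvariant : ∀ d w → ∑ all (λ v → c v * h d v w) ≤ c w
  h-subinvariant d w = begin
    ∑ all (λ v → c v * h d v w)
      ≡⟨ ∑-cong (all {n}) (λ v → trans (ring-42 (𝟙 (A v)) (chainWeight v) (𝟙 (A w)) (U d (δ w) v)) (cong (λ z → 𝟙 (A w) * (chainWeight v * z)) (trans (𝟙-idem (A v) (U d (δ w) v)) (cong (_* U d (δ w) v) (sym (*-identityʳ (𝟙 (A v)))))))) ⟩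
    ∑ all (λ v → 𝟙 (A w) * (chainWeight v * (𝟙 (A v) * 1ℚ * U d (δ w) v)))
      ≡⟨ ∑-*ˡ (all {n}) (𝟙 (A w)) _ ⟩
    𝟙 (A w) * ⟨ (λ v → 𝟙 (A v) * 1ℚ) , U d (δ w) ⟩
      ≡⟨ cong (𝟙 (A w) *_) (U-adjoint d (λ _ → 1ℚ) (δ w)) ⟩
    𝟙 (A w) * ⟨ (λ v → 𝟙 (A v) * δ w v) , U (not d) (λ _ → 1ℚ) ⟩
      ≤⟨ *-monoˡ (𝟙 (A w)) (0≤𝟙 (A w)) (∑-mono (all {n}) term) ⟩
    𝟙 (A w) * ∑ all (λ v → δ v w * chainWeight v)
      ≡⟨ cong (𝟙 (A w) *_) (∑-δ w chainWeight) ⟩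
    c w ∎
    where
      term : ∀ v → chainWeight v * (𝟙 (A v) * δ w v * U (not d) (λ _ → 1ℚ) v) ≤ δ v w * chainWeight v
      term v = begin
        chainWeight v * (𝟙 (A v) * δ w v * U (not d) (λ _ → 1ℚ) v)  ≤⟨ *-monoˡ (chainWeight v) (0≤cw v) (*-mono2 (0≤δ w v) (0≤U (not d) (λ _ → 0≤1) v) (𝟙*≤ (A v) (0≤δ w v)) (U≤1 (not d) (λ _ → ≤-refl) v)) ⟩
        chainWeight v * (δ w v * 1ℚ)  ≡⟨ trans (cong (chainWeight v *_) (trans (*-identityʳ (δ w v)) (δ-sym w v))) (*-comm _ _) ⟩
        δ v w * chainWeight v  ∎

  h-small : ∀ d v w → s * h d v w ≤ 1ℚ
  h-small d v w with A v in Av | A w in Aw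
  ... | false | _ = ≤-trans (≤-reflexive (trans (cong (s *_) (*-zeroˡ _)) (*-zeroʳ s))) 0≤1
  ... | true | false = ≤-trans (≤-reflexive (trans (cong (s *_) (trans (*-identityˡ _) (*-zeroˡ _))) (*-zeroʳ s))) 0≤1
  ... | true | true = begin
    s * (1ℚ * (1ℚ * U d (δ w) v))  ≡⟨ cong (s *_) (trans (*-identityˡ _) (*-identityˡ _)) ⟩
    s * U d (δ w) v  ≤⟨ *-monoˡ s (ℚₚ.<⇒≤ 0<s) (U-δ-gap d w Aw r v gap Av) ⟩
    s * passing lo r  ≤⟨ s-small ⟩
    1ℚ  ∎

  system : WalkSystem (Subset n)
  system = record
    { xs = all ; c = c ; h = h ; s = s ; γ = γ ; 0<s = 0<s ; 0≤γ = 0≤γ ; 0≤c = 0≤c ; 0≤h = 0≤h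
    ; h-substochastic = h-substochastic ; h-subinvariant = h-subinvariant ; h-small = h-small }

  open Round system public

  -- The two ways in which placing `w` next to `v` creates a relation with an earlier `z` that the
  -- code does not have: `z` gets below `w` without being below `v`, or `w` falls below or onto `z`.
  -- Here below is meant in direction `d`.
  badᵇ : Bool → Subset n → Subset n → Subset n → Bool
  badᵇ d v z w = (subᵇ d z w ∧ not (subᵇ d z v)) ∨ subᵇ d w z

  opaque
    good? : ∀ {m} d v (t : Vec (Subset n) m) w → Dec (∀ a → badᵇ d v (lookup t a) w ≡ false)
    good? d v t w = Finₚ.all? (λ a → badᵇ d v (lookup t a) w Boolₚ.≟ false)

  goodᵇ : ∀ {m} → Bool → Subset n → Vec (Subset n) m → Subset n → Bool
  goodᵇ d v t w = does (good? d v t w)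

  good-or-bad : ∀ {m} d v (t : Vec (Subset n) m) w → 1ℚ ≤ 𝟙 (goodᵇ d v t w) + ∑ (allFin m) (λ a → 𝟙 (badᵇ d v (lookup t a) w))
  good-or-bad {m} d v t w with good? d v t w
  ... | yes _ = p≤p+q (∑-nn (allFin m) (λ a → 0≤𝟙 (badᵇ d v (lookup t a) w)))
  ... | no ¬g with Finₚ.¬∀⟶∃¬ m (λ a → badᵇ d v (lookup t a) w ≡ false) (λ a → badᵇ d v (lookup t a) w Boolₚ.≟ false) ¬g
  ...   | a , b = ≤-trans (≤-reflexive (cong 𝟙 (sym (≢⇒not b)))) (≤-trans (∑-term-≤ (allFin m) (λ a → 0≤𝟙 (badᵇ d v (lookup t a) w)) (∈-allFin a)) (≤-reflexive (sym (+-identityˡ _))))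

  -- In the first case the walk has to turn a fixed coordinate, one in which `z` has the value `d`
  -- and `v` has not; the second case is `hit-below`.
  bad-mass : ∀ d v z → A v ≡ true → A z ≡ true → ∑ all (λ w → h d v w * 𝟙 (badᵇ d v z w)) ≤ drift + drift
  bad-mass d v z Av Az = begin
    ∑ all (λ w → h d v w * 𝟙 (badᵇ d v z w))
      ≤⟨ ∑-mono (all {n}) (λ w → ≤-trans (*-monoˡ (h d v w) (0≤h d v w) (𝟙-∨ (subᵇ d z w ∧ not (subᵇ d z v)) (subᵇ d w z))) (≤-reflexive (*-distribˡ-+ (h d v w) _ _))) ⟩
    ∑ all (λ w → h d v w * 𝟙 (subᵇ d z w ∧ not (subᵇ d z v)) + h d v w * 𝟙 (subᵇ d w z))
      ≡⟨ ∑-+ (all {n}) _ _ ⟩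
    ∑ all (λ w → h d v w * 𝟙 (subᵇ d z w ∧ not (subᵇ d z v))) + ∑ all (λ w → h d v w * 𝟙 (subᵇ d w z))
      ≤⟨ +-mono-≤ above (≤-trans (∑h≤U d v _ (λ w → 0≤𝟙 (subᵇ d w z))) (hit-below d z v Az Av)) ⟩
    drift + drift ∎
    where
      𝟙-∨ : ∀ a b → 𝟙 (a ∨ b) ≤ 𝟙 a + 𝟙 b
      𝟙-∨ true b = p≤p+q (0≤𝟙 b)
      𝟙-∨ false b = ≤-reflexive (sym (+-identityˡ (𝟙 b)))
      above : ∑ all (λ w → h d v w * 𝟙 (subᵇ d z w ∧ not (subᵇ d z v))) ≤ drift
      above with sub? d z v
      ... | yes _ = ≤-trans (≤-reflexive (trans (∑-cong (all {n}) (λ w → trans (cong (λ b → h d v w * 𝟙 b) (Boolₚ.∧-zeroʳ (subᵇ d z w))) (*-zeroʳ (h d v w)))) (∑-0 (all {n})))) 0≤drift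
      ... | no ¬s = let (i , zi , vi) = ¬Sub-witness d z v ¬s in begin
        ∑ all (λ w → h d v w * 𝟙 (subᵇ d z w ∧ true))  ≤⟨ ∑-mono (all {n}) (λ w → *-monoˡ (h d v w) (0≤h d v w) (𝟙-mono (λ e → cong not (≡⇒xor-false d (lookup w i) (dec-true⁻ (sub? d z w) (trans (sym (Boolₚ.∧-identityʳ (subᵇ d z w))) e) i zi))))) ⟩
        ∑ all (λ w → h d v w * 𝟙 (not (d xor lookup w i)))  ≤⟨ ∑h≤U d v _ (λ w → 0≤𝟙 (not (d xor lookup w i))) ⟩
        U d (λ w → 𝟙 (not (d xor lookup w i))) v  ≤⟨ hit-coordinate d i v (Central.≤hi central d v Av) vi ⟩
        drift  ∎

  factor : ∀ {m} → Code m → Fin (suc m) → Bool → (Fin (suc (suc m)) → ℕ) → Vec (Subset n) (suc m) → Subset n → ℚ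
  factor C par d ρ t w = h d (lookup t par) w * (𝟙 (S (ρ zero) w) * 𝟙 (goodᵇ d (lookup t par) t w))

  -- The layer indicators guarantee that every placed node can be extended with probability at least
  -- `ε`; the factors `goodᵇ` make the copy induced.
  W : ∀ {m} → Code m → (Fin (suc m) → ℕ) → Vec (Subset n) (suc m) → ℚ
  W root ρ (v ∷ []) = c v * 𝟙 (S (ρ zero) v)
  W (ext C par d) ρ (w ∷ t) = W C (λ i → ρ (suc i)) t * factor C par d ρ t w

  0≤factor : ∀ {m} (C : Code m) par d ρ t w → 0ℚ ≤ factor C par d ρ t w
  0≤factor C par d ρ t w = *-nn (0≤h d _ w) (*-nn (0≤𝟙 (S (ρ zero) w)) (0≤𝟙 (goodᵇ d _ t w)))

  0≤W : ∀ {m} (C : Code m) ρ t → 0ℚ ≤ W C ρ t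
  0≤W root ρ (v ∷ []) = *-nn (0≤c v) (0≤𝟙 (S (ρ zero) v))
  0≤W (ext C par d) ρ (w ∷ t) = *-nn (0≤W C _ t) (0≤factor C par d ρ t w)

  factor≤h : ∀ {m} (C : Code m) par d ρ t w → factor C par d ρ t w ≤ h d (lookup t par) w
  factor≤h C par d ρ t w = subst (factor C par d ρ t w ≤_) (*-identityʳ _) (*-monoˡ _ (0≤h d _ w) (≤-trans (𝟙*≤ (S (ρ zero) w) (0≤𝟙 (goodᵇ d (lookup t par) t w))) (𝟙≤1 (goodᵇ d (lookup t par) t w))))

  W≤base : ∀ {m} (C : Code m) ρ t → W C ρ t ≤ base C t
  W≤base root ρ (v ∷ []) = subst (c v * 𝟙 (S (ρ zero) v) ≤_) (*-identityʳ (c v)) (*-monoˡ (c v) (0≤c v) (𝟙≤1 (S (ρ zero) v)))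
  W≤base (ext C par d) ρ (w ∷ t) = *-mono2 (0≤base C t) (0≤factor C par d ρ t w) (W≤base C _ t) (factor≤h C par d ρ t w)

  W-admissible : ∀ {m} (C : Code m) ρ → Admissible C (W C ρ) 1ℚ
  W-admissible C ρ = 0≤W C ρ , (λ t → subst (W C ρ t ≤_) (sym (*-identityˡ _)) (W≤base C ρ t)) , 0≤1

  *-pos⁻ˡ : ∀ {p q} → 0ℚ ≤ q → 0ℚ < p * q → 0ℚ < p
  *-pos⁻ˡ {p} {q} 0≤q h with 0ℚ <? p
  ... | yes 0<p = 0<p
  ... | no ¬p = ⊥-elim (<⇒¬≤ h (subst (p * q ≤_) (*-zeroˡ q) (*-monoʳ q 0≤q (ℚₚ.≮⇒≥ ¬p))))

  *-pos⁻ʳ : ∀ {p q} → 0ℚ ≤ p → 0ℚ < p * q → 0ℚ < q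
  *-pos⁻ʳ {p} {q} 0≤p h = *-pos⁻ˡ 0≤p (subst (0ℚ <_) (*-comm p q) h)

  𝟙-pos : ∀ b → 0ℚ < 𝟙 b → b ≡ true
  𝟙-pos true h = refl
  𝟙-pos false h = ⊥-elim (ℚₚ.<-irrefl refl h)

  W-layers : ∀ {m} (C : Code m) ρ t → 0ℚ < W C ρ t → ∀ a → S (ρ a) (lookup t a) ≡ true
  W-layers root ρ (v ∷ []) p zero = 𝟙-pos (S (ρ zero) v) (*-pos⁻ʳ (0≤c v) p)
  W-layers (ext C par d) ρ (w ∷ t) p zero = 𝟙-pos (S (ρ zero) w) (*-pos⁻ˡ (0≤𝟙 (goodᵇ d (lookup t par) t w)) (*-pos⁻ʳ (0≤h d (lookup t par) w) (*-pos⁻ʳ (0≤W C _ t) p)))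
  W-layers (ext C par d) ρ (w ∷ t) p (suc a) = W-layers C _ t (*-pos⁻ˡ (0≤factor C par d ρ t w) p) a

  -- A step of positive probability puts `w` beyond `v`, which gives the relations of the code by
  -- transitivity, and goodness excludes all others. For `d = false` the inclusions are turned
  -- around by `Sub-not`.
  W-embeds : ∀ {m} (C : Code m) ρ t → 0ℚ < W C ρ t → ∀ a b → subᵇ true (lookup t a) (lookup t b) ≡ rel C a b
  W-embeds root ρ (v ∷ []) p zero zero = dec-true (sub? true v v) (Sub-refl true v)
  W-embeds {suc m} (ext C par d) ρ (w ∷ t) p = go d refl
    where
      v = lookup t par
      pW : 0ℚ < W C (λ i → ρ (suc i)) t
      pW = *-pos⁻ˡ (0≤factor C par d ρ t w) p
      pf : 0ℚ < factor C par d ρ t w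
      pf = *-pos⁻ʳ (0≤W C _ t) p
      good : ∀ a → badᵇ d v (lookup t a) w ≡ false
      good = dec-true⁻ (good? d v t w) (𝟙-pos _ (*-pos⁻ʳ (0≤𝟙 (S (ρ zero) w)) (*-pos⁻ʳ (0≤h d v w) pf)))
      ph : 0ℚ < h d v w
      ph = *-pos⁻ˡ (*-nn (0≤𝟙 (S (ρ zero) w)) (0≤𝟙 (goodᵇ d v t w))) pf
      Aw : A w ≡ true
      Aw = 𝟙-pos (A w) (*-pos⁻ˡ (0≤Uδ d v w) (*-pos⁻ʳ (0≤𝟙 (A v)) ph))
      v⊑w : Sub d v w
      v⊑w = decidable-stable (sub? d v w) (λ ¬s → <⇒¬≤ (ℚₚ.<-≤-trans ph (h≤Uδ d v w)) (U-δ-outside d w Aw v ¬s))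
      IH = W-embeds C (λ i → ρ (suc i)) t pW
      not-above : ∀ a → ¬ Sub d w (lookup t a)
      not-above a s with subᵇ d (lookup t a) w ∧ not (subᵇ d (lookup t a) v) | good a
      ... | false | e = case trans (sym (dec-true (sub? d w (lookup t a)) s)) e of λ ()
      through : ∀ a → Sub d (lookup t a) w → Sub d (lookup t a) v
      through a s = decidable-stable (sub? d (lookup t a) v) (λ ¬s → case trans (sym (cong₂ (λ x y → (x ∧ not y) ∨ subᵇ d w (lookup t a)) (dec-true (sub? d (lookup t a) w) s) (dec-false (sub? d (lookup t a) v) ¬s))) (good a) of λ ())
      dec-⇔ : ∀ {P Q : Set} (p? : Dec P) (q? : Dec Q) → (P → Q) → (Q → P) → does p? ≡ does q?
      dec-⇔ (yes p) (yes q) f g = refl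
      dec-⇔ (yes p) (no ¬q) f g = ⊥-elim (¬q (f p))
      dec-⇔ (no ¬p) (yes q) f g = ⊥-elim (¬p (g q))
      dec-⇔ (no ¬p) (no ¬q) f g = refl
      go : ∀ d' → d ≡ d' → ∀ a b → subᵇ true (lookup (w ∷ t) a) (lookup (w ∷ t) b) ≡ rel (ext C par d') a b
      go d' e zero zero = dec-true (sub? true w w) (Sub-refl true w)
      go true refl zero (suc b) = dec-false (sub? true w (lookup t b)) (not-above b)
      go true refl (suc a) zero = trans (dec-⇔ (sub? true (lookup t a) w) (sub? true (lookup t a) v) (through a) (λ s → Sub-trans true (lookup t a) v w s v⊑w)) (IH a par)
      go true refl (suc a) (suc b) = IH a b
      go false refl zero (suc b) = trans (dec-⇔ (sub? true w (lookup t b)) (sub? true v (lookup t b)) (λ s → Sub-not false (lookup t b) v (through b (Sub-not true w (lookup t b) s))) (λ s → Sub-not false (lookup t b) w (Sub-trans false (lookup t b) v w (Sub-not true v (lookup t b) s) v⊑w))) (IH par b)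
      go false refl (suc a) zero = dec-false (sub? true (lookup t a) w) (λ s → not-above a (Sub-not true (lookup t a) w s))
      go false refl (suc a) (suc b) = IH a b

  module _ (κ : ℚ) (0≤κ : 0ℚ ≤ κ) where

    Enough : ℕ → Set
    Enough m = κ + ι (suc m) * (drift + drift) ≤ ε

    rich : ∀ {m} (C : Code m) par d ρ t → Ranked k (ext C par d) ρ → 0ℚ < W C (λ i → ρ (suc i)) t →
      ε ≤ U d (λ w → 𝟙 (S (ρ zero) w)) (lookup t par)
    rich C par true ρ t (e , ≤k , _) p = subst (λ z → ε ≤ U true (λ w → 𝟙 (S z w)) (lookup t par)) (sym e) (rich-up (ρ (suc par)) (lookup t par) (subst (ℕ._≤ k) e ≤k) (W-layers C _ t p par))
    rich C par false ρ t (e , rk) p = rich-down (ρ zero) (lookup t par) (ℕₚ.≤-trans (ℕₚ.≤-reflexive e) (Ranked-≤ k C _ rk par)) (subst (λ z → S z (lookup t par) ≡ true) (sym e) (W-layers C _ t p par))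

    opaque
      unfolding _+_

      ring-43 : ∀ h s g z → h * s * (g + z) ≡ h * (s * g) + h * (s * z)
      ring-43 = solve-∀ ℚring

    -- Richness puts at least `ε` on the required layer, and each of the `m + 1` earlier nodes
    -- spoils at most `drift + drift` of it; `Enough` says that `κ` remains.
    factor-total : ∀ {m} (C : Code m) par d ρ t → Ranked k (ext C par d) ρ → Enough m → 0ℚ < W C (λ i → ρ (suc i)) t →
      κ ≤ ∑ all (factor C par d ρ t)
    factor-total {m} C par d ρ t rk enough p = ≤-cancelʳ (ι (suc m) * (drift + drift)) (begin
      κ + ι (suc m) * (drift + drift)  ≤⟨ enough ⟩
      ε  ≤⟨ rich C par d ρ t rk p ⟩
      U d (λ w → 𝟙 (S' w)) v  ≡⟨ U-expand d (λ w → 𝟙 (S' w)) v ⟩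
      ∑ all (λ w → U d (δ w) v * 𝟙 (S' w))  ≡⟨ ∑-cong (all {n}) to-h ⟩
      ∑ all (λ w → h d v w * 𝟙 (S' w))  ≤⟨ ∑-mono (all {n}) split ⟩
      ∑ all (λ w → factor C par d ρ t w + ∑ (allFin (suc m)) (λ a → h d v w * 𝟙 (badᵇ d v (lookup t a) w)))  ≡⟨ ∑-+ (all {n}) _ _ ⟩
      ∑ all (factor C par d ρ t) + ∑ all (λ w → ∑ (allFin (suc m)) (λ a → h d v w * 𝟙 (badᵇ d v (lookup t a) w)))  ≤⟨ +-mono-≤ (≤-refl {∑ all (factor C par d ρ t)}) bad ⟩
      ∑ all (factor C par d ρ t) + ι (suc m) * (drift + drift)  ∎)
      where
        v = lookup t par
        S' = S (ρ zero)
        layers = W-layers C (λ i → ρ (suc i)) t p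
        in-A : ∀ a → A (lookup t a) ≡ true
        in-A a = inside (ρ (suc a)) (lookup t a) (layers a)
        to-h : ∀ w → U d (δ w) v * 𝟙 (S' w) ≡ h d v w * 𝟙 (S' w)
        to-h w with S' w in e
        ... | false = trans (*-zeroʳ _) (sym (*-zeroʳ _))
        ... | true rewrite in-A par | inside (ρ zero) w e = cong (_* 1ℚ) (sym (trans (*-identityˡ _) (*-identityˡ _)))
        split : ∀ w → h d v w * 𝟙 (S' w) ≤ factor C par d ρ t w + ∑ (allFin (suc m)) (λ a → h d v w * 𝟙 (badᵇ d v (lookup t a) w))
        split w = begin
          h d v w * 𝟙 (S' w)  ≡⟨ sym (*-identityʳ _) ⟩
          h d v w * 𝟙 (S' w) * 1ℚ  ≤⟨ *-monoˡ _ (*-nn (0≤h d v w) (0≤𝟙 (S' w))) (good-or-bad d v t w) ⟩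
          h d v w * 𝟙 (S' w) * (𝟙 (goodᵇ d v t w) + Z)  ≡⟨ ring-43 (h d v w) (𝟙 (S' w)) (𝟙 (goodᵇ d v t w)) Z ⟩
          factor C par d ρ t w + h d v w * (𝟙 (S' w) * Z)  ≤⟨ +-mono-≤ (≤-refl {factor C par d ρ t w}) (*-monoˡ (h d v w) (0≤h d v w) (𝟙*≤ (S' w) (∑-nn (allFin (suc m)) (λ a → 0≤𝟙 (badᵇ d v (lookup t a) w))))) ⟩
          factor C par d ρ t w + h d v w * Z  ≡⟨ cong (factor C par d ρ t w +_) (sym (∑-*ˡ (allFin (suc m)) (h d v w) _)) ⟩
          factor C par d ρ t w + ∑ (allFin (suc m)) (λ a → h d v w * 𝟙 (badᵇ d v (lookup t a) w)) ∎
          where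
            Z = ∑ (allFin (suc m)) (λ a → 𝟙 (badᵇ d v (lookup t a) w))
        bad : ∑ all (λ w → ∑ (allFin (suc m)) (λ a → h d v w * 𝟙 (badᵇ d v (lookup t a) w))) ≤ ι (suc m) * (drift + drift)
        bad = begin
          ∑ all (λ w → ∑ (allFin (suc m)) (λ a → h d v w * 𝟙 (badᵇ d v (lookup t a) w)))  ≡⟨ ∑-swap (all {n}) (allFin (suc m)) _ ⟩
          ∑ (allFin (suc m)) (λ a → ∑ all (λ w → h d v w * 𝟙 (badᵇ d v (lookup t a) w)))  ≤⟨ ∑-mono (allFin (suc m)) (λ a → bad-mass d v (lookup t a) (in-A par) (in-A a)) ⟩
          ∑ (allFin (suc m)) (λ _ → drift + drift)  ≡⟨ ∑-const (allFin (suc m)) _ ⟩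
          ι (length (allFin (suc m))) * (drift + drift)  ≡⟨ cong (λ z → ι z * (drift + drift)) (Listₚ.length-tabulate id) ⟩
          ι (suc m) * (drift + drift)  ∎

    Enough-pred : ∀ m → Enough (suc m) → Enough m
    Enough-pred m e = ≤-trans (+-mono-≤ (≤-refl {κ}) (*-monoʳ _ (+-nn 0≤drift 0≤drift) (ι-mono (ℕₚ.n≤1+n (suc m))))) e

    opaque
      unfolding _+_

      ring-44 : ∀ a c s → a * c * s ≡ a * (s * c)
      ring-44 = solve-∀ ℚring

    W-total : ∀ {m} (C : Code m) ρ → Ranked k C ρ → Enough m →
      powℚ κ m * weight (S (rootRank C ρ)) ≤ ∑ (vecs all (suc m)) (W C ρ)
    W-total root ρ rk enough = ≤-reflexive (trans (*-identityˡ _) (sym (trans (∑-vecs all 0 (W root ρ)) (∑-cong (all {n}) term))))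
      where
        term : ∀ v → c v * 𝟙 (S (ρ zero) v) + 0ℚ ≡ 𝟙 (S (ρ zero) v) * chainWeight v
        term v = trans (+-identityʳ _) (trans (ring-44 (𝟙 (A v)) (chainWeight v) (𝟙 (S (ρ zero) v))) (𝟙-idem-⊆ (A v) (S (ρ zero) v) (inside (ρ zero) v)))
    W-total {suc m} (ext C par d) ρ rk enough = begin
      κ * powℚ κ m * weight (S (rootRank C ρ'))  ≡⟨ *-assoc κ _ _ ⟩
      κ * (powℚ κ m * weight (S (rootRank C ρ')))  ≤⟨ *-monoˡ κ 0≤κ (W-total C ρ' (tail d rk) (Enough-pred m enough)) ⟩
      κ * ∑ ts (W C ρ')  ≡⟨ trans (sym (∑-*ˡ ts κ (W C ρ'))) (∑-cong ts (λ t → *-comm κ _)) ⟩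
      ∑ ts (λ t → W C ρ' t * κ)  ≤⟨ ∑-mono ts pointwise ⟩
      ∑ ts (λ t → ∑ all (λ w → W C ρ' t * factor C par d ρ t w))  ≡⟨ sym (∑-swap (all {n}) ts _) ⟩
      ∑ all (λ w → ∑ ts (λ t → W C ρ' t * factor C par d ρ t w))  ≡⟨ sym (∑-vecs all (suc m) (W (ext C par d) ρ)) ⟩
      ∑ (vecs all (suc (suc m))) (W (ext C par d) ρ)  ∎
      where
        ρ' : Fin (suc m) → ℕ
        ρ' i = ρ (suc i)
        ts = vecs (all {n}) (suc m)
        tail : ∀ d → Ranked k (ext C par d) ρ → Ranked k C ρ'
        tail true (_ , _ , r) = r
        tail false (_ , r) = r
        pointwise : ∀ t → W C ρ' t * κ ≤ ∑ all (λ w → W C ρ' t * factor C par d ρ t w)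
        pointwise t with 0ℚ <? W C ρ' t
        ... | yes p = ≤-trans (*-monoˡ _ (0≤W C ρ' t) (factor-total C par d ρ t rk (Enough-pred m enough) p)) (≤-reflexive (sym (∑-*ˡ (all {n}) (W C ρ' t) _)))
        ... | no ¬p = ≤-trans (subst (W C ρ' t * κ ≤_) (*-zeroˡ κ) (*-monoʳ κ 0≤κ (ℚₚ.≮⇒≥ ¬p))) (∑-nn (all {n}) (λ w → *-nn (0≤W C ρ' t) (0≤factor C par d ρ t w)))

-- Encoding a tree poset by a code

¬¬-∀ : ∀ n {Q : Fin n → Set} → (∀ i → ¬ ¬ Q i) → ¬ ¬ (∀ i → Q i)
¬¬-∀ zero h k = k (λ ())
¬¬-∀ (suc n) h k = h zero (λ q → ¬¬-∀ n (λ i → h (suc i)) (λ qs → k (λ { zero → q ; (suc i) → qs i })))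

¬¬-Dec : {Q : Set} → ¬ ¬ Dec Q
¬¬-Dec k = k (no (λ q → k (yes q)))

-- Extending a code by a chain of nodes of consecutive ranks, from node p to rank target.
record Joined {m : ℕ} (k : ℕ) (C : Code m) (ρ : Fin (suc m) → ℕ) (p : Fin (suc m)) (d : Bool) (target : ℕ) : Set where
  field
    m′ : ℕ
    C′ : Code m′
    ρ′ : Fin (suc m′) → ℕ
    old : Fin (suc m) → Fin (suc m′)
    new : Fin (suc m′)
    ranked : Ranked k C′ ρ′
    ρ-old : ∀ a → ρ′ (old a) ≡ ρ a
    ρ-new : ρ′ new ≡ target
    rel-old : ∀ a b → rel C′ (old a) (old b) ≡ rel C a b
    rel-new : rel C′ new new ≡ true
    rel-along : ∀ a → (if d then rel C′ (old a) new else rel C′ new (old a)) ≡ (if d then rel C a p else rel C p a)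
    rel-against : ∀ a → (if d then rel C′ new (old a) else rel C′ (old a) new) ≡ false

cons : ∀ {m} → ℕ → (Fin m → ℕ) → Fin (suc m) → ℕ
cons r ρ zero = r
cons r ρ (suc i) = ρ i

-- A cover of the poset may raise the rank by more than one, an edge of a code may not. The
-- intermediate nodes belong to the code only.
join-up : ∀ {m} k (C : Code m) ρ p j → Ranked k C ρ → suc j ℕ.+ ρ p ℕ.≤ k → Joined k C ρ p true (suc j ℕ.+ ρ p)
join-up k C ρ p zero rk h = record
  { C′ = ext C p true ; ρ′ = cons (suc (ρ p)) ρ ; old = suc ; new = zero ; ranked = refl , h , rk
  ; ρ-old = λ _ → refl ; ρ-new = refl ; rel-old = λ _ _ → refl ; rel-new = refl
  ; rel-along = λ _ → refl ; rel-against = λ _ → refl }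
join-up k C ρ p (suc j) rk h = record
  { C′ = ext C′ new true ; ρ′ = cons (suc (suc (j ℕ.+ ρ p))) ρ′ ; old = λ a → suc (old a) ; new = zero
  ; ranked = cong suc (sym ρ-new) , h , ranked
  ; ρ-old = ρ-old ; ρ-new = refl ; rel-old = rel-old ; rel-new = refl
  ; rel-along = rel-along ; rel-against = λ _ → refl }
  where open Joined (join-up k C ρ p j rk (ℕₚ.<⇒≤ h))

join-down : ∀ {m} k (C : Code m) ρ p j t → Ranked k C ρ → suc j ℕ.+ t ≡ ρ p → Joined k C ρ p false t
join-down k C ρ p zero t rk h = record
  { C′ = ext C p false ; ρ′ = cons t ρ ; old = suc ; new = zero ; ranked = h , rk
  ; ρ-old = λ _ → refl ; ρ-new = refl ; rel-old = λ _ _ → refl ; rel-new = refl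
  ; rel-along = λ _ → refl ; rel-against = λ _ → refl }
join-down k C ρ p (suc j) t rk h = record
  { C′ = ext C′ new false ; ρ′ = cons t ρ′ ; old = λ a → suc (old a) ; new = zero
  ; ranked = sym ρ-new , ranked
  ; ρ-old = ρ-old ; ρ-new = refl ; rel-old = rel-old ; rel-new = refl
  ; rel-along = rel-along ; rel-against = λ _ → refl }
  where open Joined (join-down k C ρ p j (suc t) rk (trans (cong suc (ℕₚ.+-suc j t)) h))

module TreeCode (Po : FinPoset) (tree : IsTreePoset Po) (k : ℕ) (height : ∀ m (c : Fin m → Fin (FinPoset.size Po)) → IsChain Po m c → m ℕ.≤ suc k) where
  open FinPoset Po
  open IsPartialOrder isPartialOrder using () renaming (refl to ≼-refl; trans to ≼-trans; antisym to ≼-antisym)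

  X : Set
  X = Fin size

  Cov : X → X → Set
  Cov = Covers Po

  Adj : X → X → Set
  Adj = HasseAdj Po

  Adj-sym : ∀ {x y} → Adj x y → Adj y x
  Adj-sym (inj₁ c) = inj₂ c
  Adj-sym (inj₂ c) = inj₁ c

  data Walk (Q : X → Set) : X → X → Set where
    stop : ∀ {x} → Q x → Walk Q x x
    step : ∀ {x y z} → Q x → Adj x y → Walk Q y z → Walk Q x z

  _◅◅_ : ∀ {Q x y z} → Walk Q x y → Walk Q y z → Walk Q x z
  stop _ ◅◅ q = q
  step a e p ◅◅ q = step a e (p ◅◅ q)

  Walk-map : ∀ {Q R x y} → (∀ z → Q z → R z) → Walk Q x y → Walk R x y
  Walk-map f (stop q) = stop (f _ q)
  Walk-map f (step q e p) = step (f _ q) e (Walk-map f p)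

  Walk-start : ∀ {Q x y} → Walk Q x y → Q x
  Walk-start (stop q) = q
  Walk-start (step q _ _) = q

  Walk-rev : ∀ {Q x y} → Walk Q x y → Walk Q y x
  Walk-rev (stop q) = stop q
  Walk-rev (step q e p) = Walk-rev p ◅◅ step (Walk-start p) (Adj-sym e) (stop q)

  data Path (Q : X → Set) : X → X → ℕ → Set
  vertex : ∀ {Q x z l} → Path Q x z l → Fin (suc l) → X

  data Path Q where
    stop : ∀ {x} → Q x → Path Q x x 0
    step : ∀ {x y z l} → Q x → Adj x y → (p : Path Q y z l) → (∀ i → vertex p i ≢ x) → Path Q x z (suc l)

  vertex (stop {x} _) zero = x
  vertex (step {x} _ _ _ _) zero = x
  vertex (step _ _ p _) (suc i) = vertex p i

  vertex-first : ∀ {Q x z l} (p : Path Q x z l) → vertex p zero ≡ x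
  vertex-first (stop _) = refl
  vertex-first (step _ _ _ _) = refl

  vertex-last : ∀ {Q x z l} (p : Path Q x z l) → vertex p (fromℕ l) ≡ z
  vertex-last (stop _) = refl
  vertex-last (step _ _ p _) = vertex-last p

  vertex-Q : ∀ {Q x z l} (p : Path Q x z l) i → Q (vertex p i)
  vertex-Q (stop q) zero = q
  vertex-Q (step q _ _ _) zero = q
  vertex-Q (step _ _ p _) (suc i) = vertex-Q p i

  vertex-injective : ∀ {Q x z l} (p : Path Q x z l) → Injective _≡_ _≡_ (vertex p)
  vertex-injective (stop _) {zero} {zero} e = refl
  vertex-injective (step _ _ p f) {zero} {zero} e = refl
  vertex-injective (step _ _ p f) {zero} {suc j} e = ⊥-elim (f j (sym e))
  vertex-injective (step _ _ p f) {suc i} {zero} e = ⊥-elim (f i e)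
  vertex-injective (step _ _ p f) {suc i} {suc j} e = cong suc (vertex-injective p e)

  vertex-adj : ∀ {Q x z l} (p : Path Q x z l) (i : Fin l) → Adj (vertex p (inject₁ i)) (vertex p (suc i))
  vertex-adj (step {x} _ e p _) zero = subst (Adj x) (sym (vertex-first p)) e
  vertex-adj (step _ _ p _) (suc i) = vertex-adj p i

  suffix : ∀ {Q x z l} (p : Path Q x z l) i → Σ ℕ (Path Q (vertex p i) z)
  suffix (stop q) zero = 0 , stop q
  suffix (step {l = l} q e p f) zero = suc l , step q e p f
  suffix (step _ _ p _) (suc i) = suffix p i

  Walk⇒Path : ∀ {Q x z} → Walk Q x z → Σ ℕ (Path Q x z)
  Walk⇒Path (stop q) = 0 , stop q
  Walk⇒Path {Q} {x} {z} (step q e w) with Walk⇒Path w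
  ... | l , p with Finₚ.any? (λ i → vertex p i Finₚ.≟ x)
  ...   | yes (i , eq) = subst (λ v → Σ ℕ (Path Q v z)) eq (suffix p i)
  ...   | no ¬any = suc l , step q e p (λ i eq → ¬any (i , eq))

  -- Loop erasure turns the walk into a path, which `y` closes to a cycle; `z ≢ x` ensures at least
  -- three vertices.
  no-cycle : ∀ {y z x} → z ≢ x → Adj y z → Adj y x → Walk (λ u → u ≢ y) z x → ⊥
  no-cycle {y} {z} {x} z≢x yz yx w with Walk⇒Path w
  ... | zero , stop _ = z≢x refl
  ... | suc l , p = proj₂ tree (suc (suc l) , s≤s (s≤s z≤n) , v , v-inj , v-adj , subst (λ u → Adj u y) (sym (vertex-last p)) (Adj-sym yx))
    where
      v : Fin (suc (suc (suc l))) → X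
      v zero = y
      v (suc i) = vertex p i
      v-inj : Injective _≡_ _≡_ v
      v-inj {zero} {zero} e = refl
      v-inj {zero} {suc j} e = ⊥-elim (vertex-Q p j (sym e))
      v-inj {suc i} {zero} e = ⊥-elim (vertex-Q p i e)
      v-inj {suc i} {suc j} e = cong suc (vertex-injective p e)
      v-adj : ∀ i → Adj (v (inject₁ i)) (v (suc i))
      v-adj zero = subst (Adj y) (sym (vertex-first p)) yz
      v-adj (suc i) = vertex-adj p i

  data CoverChain : X → X → Set where
    nil : ∀ {x} → CoverChain x x
    _◃_ : ∀ {x y z} → Cov x y → CoverChain y z → CoverChain x z

  _▹▹_ : ∀ {x y z} → CoverChain x y → CoverChain y z → CoverChain x z
  nil ▹▹ q = q
  (c ◃ p) ▹▹ q = c ◃ (p ▹▹ q)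

  CoverChain⇒≼ : ∀ {x y} → CoverChain x y → x ≼ y
  CoverChain⇒≼ nil = ≼-refl
  CoverChain⇒≼ (c ◃ p) = ≼-trans (proj₁ c) (CoverChain⇒≼ p)

  CoverChain⇒Walk : ∀ {Q a b} → CoverChain a b → (∀ u → a ≼ u → u ≼ b → Q u) → Walk Q a b
  CoverChain⇒Walk nil h = stop (h _ ≼-refl ≼-refl)
  CoverChain⇒Walk (c ◃ p) h = step (h _ ≼-refl (CoverChain⇒≼ (c ◃ p))) (inj₁ c) (CoverChain⇒Walk p (λ u yu ub → h u (≼-trans (proj₁ c) yu) ub))

  unsnoc : ∀ {a b} → CoverChain a b → a ≢ b → Σ X λ z → CoverChain a z × Cov z b
  unsnoc nil a≢b = ⊥-elim (a≢b refl)
  unsnoc (c ◃ nil) _ = _ , nil , c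
  unsnoc (c ◃ (c' ◃ p)) _ with unsnoc (c' ◃ p) (λ { refl → proj₁ (proj₂ c') (≼-antisym (proj₁ c') (CoverChain⇒≼ p)) })
  ... | z , q , e = z , c ◃ q , e

  uncons : ∀ {a b} → CoverChain a b → a ≢ b → Σ X λ z → Cov a z × CoverChain z b
  uncons nil a≢b = ⊥-elim (a≢b refl)
  uncons (c ◃ p) _ = _ , c , p

  module _ (_≼?_ : ∀ x y → Dec (x ≼ y)) where

    coverChain : ∀ a b → a ≼ b → CoverChain a b
    coverChain a b = go a b (Finᵢ.po-wellFounded isPartialOrder b) (Finᵢ.po-noetherian isPartialOrder a)
      where
        go : ∀ a b → Acc (λ x y → x ≼ y × x ≢ y) b → Acc (λ x y → y ≼ x × y ≢ x) a → a ≼ b → CoverChain a b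
        go a b (acc rb) (acc ra) a≼b with a Finₚ.≟ b
        ... | yes refl = nil
        ... | no a≢b with Finₚ.any? (λ z → (a ≼? z) ×-dec (z ≼? b) ×-dec (¬? (z Finₚ.≟ a)) ×-dec (¬? (z Finₚ.≟ b)))
        ...   | yes (z , az , zb , z≢a , z≢b) = go a z (rb (zb , z≢b)) (acc ra) az ▹▹ go z b (acc rb) (ra (az , (λ e → z≢a (sym e)))) zb
        ...   | no none = (a≼b , a≢b , between) ◃ nil
          where
            between : ∀ z → a ≼ z → z ≼ b → z ≡ a ⊎ z ≡ b
            between z az zb with z Finₚ.≟ a | z Finₚ.≟ b
            ... | yes e | _ = inj₁ e
            ... | no _ | yes e = inj₂ e
            ... | no e | no e' = ⊥-elim (none (z , az , zb , e , e'))

    -- A chain of covers from `a` up to `y` must enter `y` from `x`: from another lower neighbour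
    -- one could go down to `a` and on to `x` without meeting `y`.
    up-through : ∀ {x y a} → Cov x y → a ≢ y → Walk (λ u → u ≢ y) a x → a ≼ y → a ≼ x
    up-through {x} {y} {a} c a≢y w a≼y with unsnoc (coverChain a y a≼y) a≢y
    ... | z , p , e with z Finₚ.≟ x
    ...   | yes refl = CoverChain⇒≼ p
    ...   | no z≢x = ⊥-elim (no-cycle z≢x (inj₂ e) (inj₂ c) (Walk-rev (CoverChain⇒Walk p (λ u _ uz uy → proj₁ (proj₂ e) (≼-antisym (proj₁ e) (subst (_≼ z) uy uz)))) ◅◅ w))

    up-not-below : ∀ {x y a} → Cov x y → a ≢ y → Walk (λ u → u ≢ y) a x → y ≼ a → ⊥
    up-not-below {x} {y} {a} c a≢y w y≼a with uncons (coverChain y a y≼a) (λ e → a≢y (sym e))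
    ... | z , e , p with z Finₚ.≟ x
    ...   | yes refl = proj₁ (proj₂ c) (≼-antisym (proj₁ c) (proj₁ e))
    ...   | no z≢x = no-cycle z≢x (inj₁ e) (inj₂ c) (CoverChain⇒Walk p (λ u zu _ uy → proj₁ (proj₂ e) (≼-antisym (proj₁ e) (subst (z ≼_) uy zu))) ◅◅ w)

    down-through : ∀ {x y a} → Cov y x → a ≢ y → Walk (λ u → u ≢ y) a x → y ≼ a → x ≼ a
    down-through {x} {y} {a} c a≢y w y≼a with uncons (coverChain y a y≼a) (λ e → a≢y (sym e))
    ... | z , e , p with z Finₚ.≟ x
    ...   | yes refl = CoverChain⇒≼ p
    ...   | no z≢x = ⊥-elim (no-cycle z≢x (inj₁ e) (inj₁ c) (CoverChain⇒Walk p (λ u zu _ uy → proj₁ (proj₂ e) (≼-antisym (proj₁ e) (subst (z ≼_) uy zu))) ◅◅ w))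

    down-not-above : ∀ {x y a} → Cov y x → a ≢ y → Walk (λ u → u ≢ y) a x → a ≼ y → ⊥
    down-not-above {x} {y} {a} c a≢y w a≼y with unsnoc (coverChain a y a≼y) a≢y
    ... | z , p , e with z Finₚ.≟ x
    ...   | yes refl = proj₁ (proj₂ c) (≼-antisym (proj₁ c) (proj₁ e))
    ...   | no z≢x = no-cycle z≢x (inj₂ e) (inj₁ c) (Walk-rev (CoverChain⇒Walk p (λ u _ uz uy → proj₁ (proj₂ e) (≼-antisym (proj₁ e) (subst (_≼ z) uy uz)))) ◅◅ w)

  -- Order is decidable up to double negation, which suffices for a stable conclusion.
  with-dec : {R : Set} → Dec R → ((∀ x y → Dec (x ≼ y)) → R) → R
  with-dec R? f = decidable-stable R? (λ ¬r → ¬¬-∀ size (λ x → ¬¬-∀ size (λ y → ¬¬-Dec)) (λ dec → ¬r (f dec)))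

  Edge : Set
  Edge = Σ X λ x → Σ X λ y → Cov x y

  orient : ∀ {a b} → Adj a b → Edge
  orient {a} {b} (inj₁ c) = a , b , c
  orient {a} {b} (inj₂ c) = b , a , c

  pathEdges : X → X → List Edge
  pathEdges x y = let (l , v , _ , _ , adj) = proj₁ tree x y in map (λ i → orient (adj i)) (allFin l)

  -- Covers need not be decidable, so they cannot be enumerated. Those on the given connecting paths
  -- suffice to reach every element.
  edges : List Edge
  edges = concatMap (λ x → concatMap (pathEdges x) (allFin size)) (allFin size)

  pathEdge-∈ : ∀ x y (i : Fin (proj₁ (proj₁ tree x y))) → orient (proj₂ (proj₂ (proj₂ (proj₂ (proj₁ tree x y)))) i) ∈ edges
  pathEdge-∈ x y i = ∈-concatMap⁺ _ (lose (∈-allFin x) (∈-concatMap⁺ _ (lose (∈-allFin y) (∈-map⁺ _ (∈-allFin i)))))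

  longest : (X → ℕ) → List Edge → X → ℕ
  longest r [] z = 0
  longest r ((x , y , _) ∷ es) z = if does (y Finₚ.≟ z) then suc (r x) ℕ.⊔ longest r es z else longest r es z

  longest-≥ : ∀ r es {x y c} → (x , y , c) ∈ es → r x ℕ.< longest r es y
  longest-≥ r ((x , y , c) ∷ es) (here refl) rewrite dec-true (y Finₚ.≟ y) refl = ℕₚ.m≤m⊔n (suc (r x)) (longest r es y)
  longest-≥ r ((x' , y' , c') ∷ es) {x} {y} (there e∈) with y' Finₚ.≟ y
  ... | yes _ = ℕₚ.≤-trans (longest-≥ r es e∈) (ℕₚ.m≤n⊔m (suc (r x')) (longest r es y))
  ... | no _ = longest-≥ r es e∈

  longest-attained : ∀ r es z → longest r es z ≡ 0 ⊎ Σ X λ x → Σ (Cov x z) λ c → (x , z , c) ∈ es × longest r es z ≡ suc (r x)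
  longest-attained r [] z = inj₁ refl
  longest-attained r ((x , y , c) ∷ es) z with y Finₚ.≟ z
  ... | no _ = [ inj₁ , (λ (x , c , e∈ , eq) → inj₂ (x , c , there e∈ , eq)) ]′ (longest-attained r es z)
  ... | yes refl with ℕₚ.⊔-sel (suc (r x)) (longest r es z)
  ...   | inj₁ e = inj₂ (x , c , here refl , e)
  ...   | inj₂ e = [ (λ e0 → inj₁ (trans e e0)) , (λ (x , c , e∈ , eq) → inj₂ (x , c , there e∈ , trans e eq)) ]′ (longest-attained r es z)

  -- The length of the longest upward path in `edges` that ends in `z` and has at most the given
  -- number of edges.
  level : ℕ → X → ℕ
  level zero z = 0
  level (suc t) z = longest (level t) edges z

  record Descent (z : X) (s : ℕ) : Set where
    field
      c : Fin (suc s) → X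
      top : c zero ≡ z
      below : ∀ i → c i ≼ z
      chain : IsChain Po (suc s) c

  descent : ∀ t z → Descent z (level t z)
  descent zero z = record { c = λ _ → z ; top = refl ; below = λ _ → ≼-refl ; chain = (λ { {zero} {zero} _ → refl }) , λ _ _ → inj₁ ≼-refl }
  descent (suc t) z with longest-attained (level t) edges z
  ... | inj₁ e rewrite e = record { c = λ _ → z ; top = refl ; below = λ _ → ≼-refl ; chain = (λ { {zero} {zero} _ → refl }) , λ _ _ → inj₁ ≼-refl }
  ... | inj₂ (x , cov , _ , e) rewrite e = record { c = c' ; top = refl ; below = below' ; chain = inj , cmp }
    where
      open Descent (descent t x)
      c' : Fin (suc (suc (level t x))) → X
      c' zero = z
      c' (suc i) = c i
      below' : ∀ i → c' i ≼ z
      below' zero = ≼-refl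
      below' (suc i) = ≼-trans (below i) (proj₁ cov)
      ≢z : ∀ i → c i ≢ z
      ≢z i e = proj₁ (proj₂ cov) (≼-antisym (proj₁ cov) (subst (_≼ x) e (below i)))
      inj : Injective _≡_ _≡_ c'
      inj {zero} {zero} e = refl
      inj {zero} {suc j} e = ⊥-elim (≢z j (sym e))
      inj {suc i} {zero} e = ⊥-elim (≢z i e)
      inj {suc i} {suc j} e = cong suc (proj₁ chain e)
      cmp : ∀ i j → c' i ≼ c' j ⊎ c' j ≼ c' i
      cmp zero j = inj₂ (below' j)
      cmp (suc i) zero = inj₁ (below' (suc i))
      cmp (suc i) (suc j) = proj₂ chain i j

  level≤k : ∀ t z → level t z ℕ.≤ k
  level≤k t z = ℕₚ.≤-pred (height _ (Descent.c (descent t z)) (Descent.chain (descent t z)))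

  -- An increase in round `t + 1` comes from a path with `t + 1` edges. Such a path is a chain, so
  -- by the height bound `level k` has stabilised.
  level-stable-or-long : ∀ t z → level (suc t) z ℕ.≤ level t z ⊎ t ℕ.< level (suc t) z
  level-stable-or-long zero z with level 1 z
  ... | zero = inj₁ z≤n
  ... | suc a = inj₂ (s≤s z≤n)
  level-stable-or-long (suc t) z with longest-attained (level (suc t)) edges z
  ... | inj₁ e = inj₁ (subst (ℕ._≤ level (suc t) z) (sym e) z≤n)
  ... | inj₂ (x , c , e∈ , e) with level-stable-or-long t x
  ...   | inj₁ h = inj₁ (subst (ℕ._≤ level (suc t) z) (sym e) (ℕₚ.≤-trans (s≤s h) (longest-≥ (level t) edges e∈)))
  ...   | inj₂ h = inj₂ (subst (suc t ℕ.<_) (sym e) (s≤s h))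

  rank : X → ℕ
  rank = level k

  rank-edge : ∀ {x y c} → (x , y , c) ∈ edges → rank x ℕ.< rank y
  rank-edge {x} {y} e∈ with level-stable-or-long k y
  ... | inj₁ h = ℕₚ.≤-trans (longest-≥ (level k) edges e∈) h
  ... | inj₂ h = ⊥-elim (ℕₚ.<⇒≱ h (level≤k (suc k) y))

  -- The encoding of the elements marked by `inc`. Connectedness is demanded within the marked set,
  -- so that the connecting walks avoid any element added later.
  record Partial : Set where
    field
      m : ℕ
      code : Code m
      ρ : Fin (suc m) → ℕ
      inc : X → Bool
      loc : X → Fin (suc m)
      ranked : Ranked k code ρ
      ρ-loc : ∀ x → inc x ≡ true → ρ (loc x) ≡ rank x
      sound : ∀ x y → inc x ≡ true → inc y ≡ true → rel code (loc x) (loc y) ≡ true → x ≼ y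
      complete : ∀ x y → inc x ≡ true → inc y ≡ true → x ≼ y → rel code (loc x) (loc y) ≡ true
      connected : ∀ x y → inc x ≡ true → inc y ≡ true → Walk (λ u → inc u ≡ true) x y

  open Partial

  _⊑_ : Partial → Partial → Set
  S ⊑ T = ∀ x → inc S x ≡ true → inc T x ≡ true

  start : X → Partial
  start x₀ = record
    { m = 0 ; code = root ; ρ = λ _ → rank x₀ ; inc = λ x → does (x Finₚ.≟ x₀) ; loc = λ _ → zero
    ; ranked = level≤k k x₀
    ; ρ-loc = λ x e → cong rank (sym (dec-true⁻ (x Finₚ.≟ x₀) e))
    ; sound = λ x y e e' _ → subst₂ _≼_ (sym (dec-true⁻ (x Finₚ.≟ x₀) e)) (sym (dec-true⁻ (y Finₚ.≟ x₀) e')) ≼-refl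
    ; complete = λ _ _ _ _ _ → refl
    ; connected = λ x y e e' → subst (Walk _ x) (trans (dec-true⁻ (x Finₚ.≟ x₀) e) (sym (dec-true⁻ (y Finₚ.≟ x₀) e'))) (stop e)
    }

  module Grow (S : Partial) (x y : X) (xin : inc S x ≡ true) (yout : inc S y ≡ false) (adj : Adj x y)
              (d : Bool) (J : Joined k (code S) (ρ S) (loc S x) d (rank y))
              (along⁺ : ∀ a → inc S a ≡ true → rel (code S) (loc S (if d then a else x)) (loc S (if d then x else a)) ≡ true → (if d then a else y) ≼ (if d then y else a))
              (along⁻ : ∀ a → inc S a ≡ true → (if d then a else y) ≼ (if d then y else a) → rel (code S) (loc S (if d then a else x)) (loc S (if d then x else a)) ≡ true)
              (against : ∀ a → inc S a ≡ true → (if d then y else a) ≼ (if d then a else y) → ⊥) where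
    open Joined J renaming (ranked to ranked′)

    inc′ : X → Bool
    inc′ z = does (z Finₚ.≟ y) ∨ inc S z

    loc′ : X → Fin (suc m′)
    loc′ z = if does (z Finₚ.≟ y) then new else old (loc S z)

    inc′-old : ∀ z → inc S z ≡ true → inc′ z ≡ true
    inc′-old z e with does (z Finₚ.≟ y)
    ... | true = refl
    ... | false = e

    ρ-loc′ : ∀ z → inc′ z ≡ true → ρ′ (loc′ z) ≡ rank z
    ρ-loc′ z e with z Finₚ.≟ y
    ... | yes refl = ρ-new
    ... | no _ = trans (ρ-old (loc S z)) (ρ-loc S z e)

    sound-new : ∀ d' → d ≡ d' → ∀ a → inc S a ≡ true → (rel C′ (old (loc S a)) new ≡ true → a ≼ y) × (rel C′ new (old (loc S a)) ≡ true → y ≼ a)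
    sound-new true refl a e = (λ r → along⁺ a e (trans (sym (rel-along (loc S a))) r)) , (λ r → case trans (sym r) (rel-against (loc S a)) of λ ())
    sound-new false refl a e = (λ r → case trans (sym r) (rel-against (loc S a)) of λ ()) , (λ r → along⁺ a e (trans (sym (rel-along (loc S a))) r))

    complete-new : ∀ d' → d ≡ d' → ∀ a → inc S a ≡ true → (a ≼ y → rel C′ (old (loc S a)) new ≡ true) × (y ≼ a → rel C′ new (old (loc S a)) ≡ true)
    complete-new true refl a e = (λ r → trans (rel-along (loc S a)) (along⁻ a e r)) , (λ r → ⊥-elim (against a e r))
    complete-new false refl a e = (λ r → ⊥-elim (against a e r)) , (λ r → trans (rel-along (loc S a)) (along⁻ a e r))

    sound′ : ∀ a b → inc′ a ≡ true → inc′ b ≡ true → rel C′ (loc′ a) (loc′ b) ≡ true → a ≼ b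
    sound′ a b ea eb r with a Finₚ.≟ y | b Finₚ.≟ y
    ... | yes refl | yes refl = ≼-refl
    ... | yes refl | no _ = proj₂ (sound-new d refl b eb) r
    ... | no _ | yes refl = proj₁ (sound-new d refl a ea) r
    ... | no _ | no _ = sound S a b ea eb (trans (sym (rel-old (loc S a) (loc S b))) r)

    complete′ : ∀ a b → inc′ a ≡ true → inc′ b ≡ true → a ≼ b → rel C′ (loc′ a) (loc′ b) ≡ true
    complete′ a b ea eb r with a Finₚ.≟ y | b Finₚ.≟ y
    ... | yes refl | yes refl = rel-new
    ... | yes refl | no _ = proj₂ (complete-new d refl b eb) r
    ... | no _ | yes refl = proj₁ (complete-new d refl a ea) r
    ... | no _ | no _ = trans (rel-old (loc S a) (loc S b)) (complete S a b ea eb r)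

    to-x : ∀ a → inc′ a ≡ true → Walk (λ u → inc′ u ≡ true) a x
    to-x a e with a Finₚ.≟ y
    ... | yes refl = step yin (Adj-sym adj) (stop (inc′-old x xin))
      where yin : inc′ y ≡ true
            yin rewrite dec-true (y Finₚ.≟ y) refl = refl
    ... | no _ = Walk-map inc′-old (connected S a x e xin)

    grown : Partial
    grown = record
      { m = m′ ; code = C′ ; ρ = ρ′ ; inc = inc′ ; loc = loc′ ; ranked = ranked′ ; ρ-loc = ρ-loc′
      ; sound = sound′ ; complete = complete′
      ; connected = λ a b ea eb → to-x a ea ◅◅ Walk-rev (to-x b eb) }

    grown-y : inc grown y ≡ true
    grown-y rewrite dec-true (y Finₚ.≟ y) refl = refl

  -- Every marked element is joined to `x` by a walk avoiding `y`. Hence all its relations with `y`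
  -- pass through `x`, just as the code makes the relations of a new node pass through the one it
  -- joins.
  add : (S : Partial) (x y : X) → inc S x ≡ true → inc S y ≡ false → (adj : Adj x y) → orient adj ∈ edges →
    Σ Partial λ T → S ⊑ T × inc T y ≡ true
  add S x y xin yout adj@(inj₁ c) e∈ = Grow.grown S x y xin yout adj true J along⁺ along⁻ against , Grow.inc′-old S x y xin yout adj true J along⁺ along⁻ against , Grow.grown-y S x y xin yout adj true J along⁺ along⁻ against
    where
      j = rank y ∸ suc (rank x)
      eq : suc j ℕ.+ ρ S (loc S x) ≡ rank y
      eq = trans (cong (suc j ℕ.+_) (ρ-loc S x xin)) (trans (sym (ℕₚ.+-suc j (rank x))) (ℕₚ.m∸n+n≡m (rank-edge e∈)))
      J : Joined k (code S) (ρ S) (loc S x) true (rank y)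
      J = subst (Joined k (code S) (ρ S) (loc S x) true) eq (join-up k (code S) (ρ S) (loc S x) j (ranked S) (subst (ℕ._≤ k) (sym eq) (level≤k k y)))
      a≢y : ∀ a → inc S a ≡ true → a ≢ y
      a≢y a e refl = case trans (sym e) yout of λ ()
      w : ∀ a → inc S a ≡ true → Walk (λ u → u ≢ y) a x
      w a e = Walk-map a≢y (connected S a x e xin)
      along⁺ : ∀ a → inc S a ≡ true → rel (code S) (loc S a) (loc S x) ≡ true → a ≼ y
      along⁺ a e r = ≼-trans (sound S a x e xin r) (proj₁ c)
      along⁻ : ∀ a → inc S a ≡ true → a ≼ y → rel (code S) (loc S a) (loc S x) ≡ true
      along⁻ a e r = with-dec (_ Boolₚ.≟ _) (λ dec → complete S a x e xin (up-through dec c (a≢y a e) (w a e) r))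
      against : ∀ a → inc S a ≡ true → y ≼ a → ⊥
      against a e r = with-dec (no id) (λ dec → up-not-below dec c (a≢y a e) (w a e) r)
  add S x y xin yout adj@(inj₂ c) e∈ = Grow.grown S x y xin yout adj false J along⁺ along⁻ against , Grow.inc′-old S x y xin yout adj false J along⁺ along⁻ against , Grow.grown-y S x y xin yout adj false J along⁺ along⁻ against
    where
      j = rank x ∸ suc (rank y)
      eq : suc j ℕ.+ rank y ≡ ρ S (loc S x)
      eq = trans (trans (sym (ℕₚ.+-suc j (rank y))) (ℕₚ.m∸n+n≡m (rank-edge e∈))) (sym (ρ-loc S x xin))
      J : Joined k (code S) (ρ S) (loc S x) false (rank y)
      J = join-down k (code S) (ρ S) (loc S x) j (rank y) (ranked S) eq
      a≢y : ∀ a → inc S a ≡ true → a ≢ y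
      a≢y a e refl = case trans (sym e) yout of λ ()
      w : ∀ a → inc S a ≡ true → Walk (λ u → u ≢ y) a x
      w a e = Walk-map a≢y (connected S a x e xin)
      along⁺ : ∀ a → inc S a ≡ true → rel (code S) (loc S x) (loc S a) ≡ true → y ≼ a
      along⁺ a e r = ≼-trans (proj₁ c) (sound S x a xin e r)
      along⁻ : ∀ a → inc S a ≡ true → y ≼ a → rel (code S) (loc S x) (loc S a) ≡ true
      along⁻ a e r = with-dec (_ Boolₚ.≟ _) (λ dec → complete S x a xin e (down-through dec c (a≢y a e) (w a e) r))
      against : ∀ a → inc S a ≡ true → a ≼ y → ⊥
      against a e r = with-dec (no id) (λ dec → down-not-above dec c (a≢y a e) (w a e) r)

  follow : ∀ l (v : Fin (suc l) → X) (adj : ∀ (i : Fin l) → Adj (v (inject₁ i)) (v (suc i))) → (∀ i → orient (adj i) ∈ edges) →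
    (S : Partial) → inc S (v zero) ≡ true → Σ Partial λ T → S ⊑ T × inc T (v (fromℕ l)) ≡ true
  follow zero v adj e∈ S h = S , (λ _ e → e) , h
  follow (suc l) v adj e∈ S h with inc S (v (suc zero)) in eq
  ... | true = follow l (λ i → v (suc i)) (λ i → adj (suc i)) (λ i → e∈ (suc i)) S eq
  ... | false with add S (v zero) (v (suc zero)) h eq (adj zero) (e∈ zero)
  ...   | T , S⊑T , h' with follow l (λ i → v (suc i)) (λ i → adj (suc i)) (λ i → e∈ (suc i)) T h'
  ...     | T' , T⊑T' , h'' = T' , (λ x e → T⊑T' x (S⊑T x e)) , h''

  include : (x y : X) (S : Partial) → inc S x ≡ true → Σ Partial λ T → S ⊑ T × inc T y ≡ true
  include x y S h with proj₁ tree x y | pathEdge-∈ x y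
  ... | l , v , v0 , vl , adj | e∈ with follow l v adj e∈ S (subst (λ z → inc S z ≡ true) (sym v0) h)
  ...   | T , S⊑T , h' = T , S⊑T , subst (λ z → inc T z ≡ true) vl h'

  include-all : (x : X) (ys : List X) (S : Partial) → inc S x ≡ true → Σ Partial λ T → S ⊑ T × (∀ y → y ∈ ys → inc T y ≡ true)
  include-all x [] S h = S , (λ _ e → e) , (λ _ ())
  include-all x (y ∷ ys) S h with include x y S h
  ... | T , S⊑T , hy with include-all x ys T (S⊑T x h)
  ...   | T' , T⊑T' , hys = T' , (λ z e → T⊑T' z (S⊑T z e)) , (λ { z (here refl) → T⊑T' y hy ; z (there z∈) → hys z z∈ })

  record Encoding : Set where
    field
      {nodes} : ℕ
      code : Code nodes
      ρ : Fin (suc nodes) → ℕ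
      ranked : Ranked k code ρ
      node : X → Fin (suc nodes)
      rel⇒≼ : ∀ x y → rel code (node x) (node y) ≡ true → x ≼ y
      ≼⇒rel : ∀ x y → x ≼ y → rel code (node x) (node y) ≡ true

  encoding : X → Encoding
  encoding x₀ with include-all x₀ (allFin size) (start x₀) (dec-true (x₀ Finₚ.≟ x₀) refl)
  ... | T , _ , h = record
    { code = code T ; ρ = ρ T ; ranked = ranked T ; node = loc T
    ; rel⇒≼ = λ x y → sound T x y (h x (∈-allFin x)) (h y (∈-allFin y))
    ; ≼⇒rel = λ x y → complete T x y (h x (∈-allFin x)) (h y (∈-allFin y)) }

  embedded-copy : (E : Encoding) {n : ℕ} (I : Family n) (t : Vec (Subset n) (suc (Encoding.nodes E))) →
    (∀ a → I (lookup t a) ≡ true) → (∀ a b → subᵇ true (lookup t a) (lookup t b) ≡ rel (Encoding.code E) a b) → ContainsInducedCopy Po I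
  embedded-copy E {n} I t h e = φ , φ-inj , (λ x → h (Encoding.node E x)) , (λ x y → reflects x y , preserves x y)
    where
      open Encoding E using (node; rel⇒≼; ≼⇒rel)
      φ : X → Subset n
      φ x = lookup t (node x)
      reflects : ∀ x y → φ x ⊆ φ y → x ≼ y
      reflects x y s = rel⇒≼ x y (trans (sym (e (node x) (node y))) (dec-true (sub? true (φ x) (φ y)) (λ i p → Vecₚ.[]=⇒lookup (s (Vecₚ.lookup⇒[]= i (φ x) p)))))
      preserves : ∀ x y → x ≼ y → φ x ⊆ φ y
      preserves x y r {i} i∈ = Vecₚ.lookup⇒[]= i (φ y) (dec-true⁻ (sub? true (φ x) (φ y)) (trans (e (node x) (node y)) (≼⇒rel x y r)) i (Vecₚ.[]=⇒lookup i∈))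
      φ-inj : Injective _≡_ _≡_ φ
      φ-inj {x} {y} eq = ≼-antisym (reflects x y (subst (λ z → φ x ⊆ z) eq id)) (reflects y x (subst (_⊆ φ x) eq id))

-- The constants of one container step

rec-cancel : ∀ a b → 1 ℕ.≤ a → ι a * rec (a ℕ.* b) ≡ rec b
rec-cancel a b 1≤a = begin
  ι a * rec (a ℕ.* b)  ≡⟨ cong (ι a *_) (rec-* a b) ⟩
  ι a * (rec a * rec b)  ≡⟨ sym (*-assoc (ι a) (rec a) (rec b)) ⟩
  ι a * rec a * rec b  ≡⟨ cong (_* rec b) (ι*rec a 1≤a) ⟩
  1ℚ * rec b  ≡⟨ *-identityˡ (rec b) ⟩
  rec b  ∎
  where open ≡-Reasoning

opaque
  unfolding _+_

  ring-45 : ∀ x → (1ℚ + 1ℚ) * x ≡ x + x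
  ring-45 = solve-∀ ℚring

rec-half : ∀ a → rec a ≡ rec (2 ℕ.* a) + rec (2 ℕ.* a)
rec-half a = begin
  rec a  ≡⟨ sym (rec-cancel 2 a (s≤s z≤n)) ⟩
  ι 2 * rec (2 ℕ.* a)  ≡⟨ cong (_* rec (2 ℕ.* a)) (trans (ι-+ 1 1) (cong₂ _+_ ι-1 ι-1)) ⟩
  (1ℚ + 1ℚ) * rec (2 ℕ.* a)  ≡⟨ ring-45 (rec (2 ℕ.* a)) ⟩
  rec (2 ℕ.* a) + rec (2 ℕ.* a)  ∎
  where
    open ≡-Reasoning

powℚ-rec : ∀ a m → powℚ (rec a) m ≡ rec (a ℕ.^ m)
powℚ-rec a zero = sym (trans (sym (*-identityˡ (rec 1))) (trans (cong (_* rec 1) (sym ι-1)) (ι*rec 1 (s≤s z≤n))))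
powℚ-rec a (suc m) = trans (cong (rec a *_) (powℚ-rec a m)) (sym (rec-* a (a ℕ.^ m)))

1≤* : ∀ {a b} → 1 ℕ.≤ a → 1 ℕ.≤ b → 1 ℕ.≤ a ℕ.* b
1≤* = ℕₚ.*-mono-≤

1≤^ : ∀ {a} m → 1 ℕ.≤ a → 1 ℕ.≤ a ℕ.^ m
1≤^ zero h = ℕₚ.≤-refl
1≤^ (suc m) h = 1≤* h (1≤^ m h)

opaque
  mem : ∀ {n} → List (Subset n) → Family n
  mem xs v = does (any? (v ≟ⱽ_) xs)

  mem⁺ : ∀ {n} {v : Subset n} {xs} → v ∈ xs → mem xs v ≡ true
  mem⁺ {v = v} {xs} h = dec-true (any? (v ≟ⱽ_) xs) h

  mem⁻ : ∀ {n} {v : Subset n} {xs} → mem xs v ≡ true → v ∈ xs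
  mem⁻ {v = v} {xs} h = dec-true⁻ (any? (v ≟ⱽ_) xs) h

-- The container step for a central family A of weight between K + 1/t and Λ. None of the
-- constants depends on the dimension n.
module RoundLemma {m : ℕ} (C : Code m) (ρ : Fin (suc m) → ℕ) (K : ℕ) (rk : Ranked K C ρ)
                  (t Λ : ℕ) (1≤t : 1 ℕ.≤ t) (1≤Λ : 1 ℕ.≤ Λ) where
  -- Mostly reciprocals. `1/εN` keeps the pruning loss within `1/(2t)`; half of it is `κ`, and the
  -- other half pays for bad placements once the drift is at most `1/dN`. Then `W` has mass at least
  -- `1/θN`: one half of this is reserved for skipped positions, which fixes `γN`, one quarter for
  -- picks, which fixes `s₀`, and the last quarter must be removed weight, which gives `ηN`.
  q εN κN dN θN γN Q ηN s₀ : ℕ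
  q = suc m
  εN = (suc K ℕ.* Λ) ℕ.* (2 ℕ.* t)
  κN = 2 ℕ.* εN
  dN = q ℕ.* (2 ℕ.* κN)
  θN = κN ℕ.^ m ℕ.* (2 ℕ.* t)
  γN = (q ℕ.* Λ) ℕ.* (2 ℕ.* θN)
  Q = 2 ℕ.^ suc m ℕ.* Λ ℕ.* γN
  ηN = (2 ℕ.^ m ℕ.* q) ℕ.* (2 ℕ.* (2 ℕ.* θN))
  s₀ = (2 ℕ.* (2 ℕ.* θN)) ℕ.* (2 ℕ.^ m ℕ.* Q)

  1≤2* : ∀ {a} → 1 ℕ.≤ a → 1 ℕ.≤ 2 ℕ.* a
  1≤2* {a} = 1≤* {2} {a} (s≤s z≤n)

  1≤εN : 1 ℕ.≤ εN
  1≤εN = 1≤* {suc K ℕ.* Λ} (1≤* {suc K} (s≤s z≤n) 1≤Λ) (1≤2* 1≤t)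

  1≤κN : 1 ℕ.≤ κN
  1≤κN = 1≤2* 1≤εN

  1≤dN : 1 ℕ.≤ dN
  1≤dN = 1≤* {q} (s≤s z≤n) (1≤2* 1≤κN)

  1≤θN : 1 ℕ.≤ θN
  1≤θN = 1≤* (1≤^ m 1≤κN) (1≤2* 1≤t)

  1≤γN : 1 ℕ.≤ γN
  1≤γN = 1≤* (1≤* {q} (s≤s z≤n) 1≤Λ) (1≤2* 1≤θN)

  1≤ηN : 1 ℕ.≤ ηN
  1≤ηN = 1≤* (1≤* (1≤^ m (s≤s z≤n)) (s≤s {n = m} z≤n)) (1≤2* (1≤2* 1≤θN))

  ε κ γ : ℚ
  ε = rec εN
  κ = rec κN
  γ = rec γN

  module For {n : ℕ} (A : Family n) (lo hi : ℕ) (central : Central A lo hi) (r : ℕ) (gap : Gap A r)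
             (s : ℚ) (0<s : 0ℚ < s) (s-small : s * passing lo r ≤ 1ℚ) (s₀≤s : ι s₀ ≤ s)
             (small-drift : ι (hi ∸ lo) * rec lo ≤ rec dN)
             (heavy-A : ι K + rec t ≤ weight A) (light-A : weight A ≤ ι Λ) where
    open WalkBounds A lo hi central using (drift; 0≤drift)
    open Windows A using (module Prune; 0≤cw)
    open Prune K ε (0≤rec εN) using (richLayers; module RichLayers)
    open RichLayers richLayers using (S; heavy)
    open Embedding A lo hi central r gap s γ 0<s (0≤rec γN) s-small K ε (0≤rec εN)
    open ℚₚ.≤-Reasoning

    query : Query (Subset n) (List (Subset n))
    query = round C (W C ρ) 1ℚ

    r₀ : ℕ
    r₀ = rootRank C ρ

    opaque
      unfolding _+_

      ring-46 : ∀ x y → x + (y + x) ≡ y + (x + x)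
      ring-46 = solve-∀ ℚring

    -- Of the surplus `1/t` over `K` half is lost in the pruning.
    root-heavy : rec (2 ℕ.* t) ≤ weight (S r₀)
    root-heavy = ≤-cancelʳ (ι K + rec (2 ℕ.* t)) (begin
      rec (2 ℕ.* t) + (ι K + rec (2 ℕ.* t))  ≡⟨ ring-46 (rec (2 ℕ.* t)) (ι K) ⟩
      ι K + (rec (2 ℕ.* t) + rec (2 ℕ.* t))  ≡⟨ cong (ι K +_) (sym (rec-half t)) ⟩
      ι K + rec t  ≤⟨ heavy-A ⟩
      weight A  ≤⟨ heavy r₀ (rootRank-≤ K C ρ rk) ⟩
      weight (S r₀) + (ι K + ε * (ι (suc K) * weight A))  ≤⟨ +-mono-≤ (≤-refl {weight (S r₀)}) (+-mono-≤ (≤-refl {ι K}) loss) ⟩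
      weight (S r₀) + (ι K + rec (2 ℕ.* t))  ∎)
      where
        loss : ε * (ι (suc K) * weight A) ≤ rec (2 ℕ.* t)
        loss = begin
          ε * (ι (suc K) * weight A)  ≤⟨ *-monoˡ ε (0≤rec εN) (*-monoˡ (ι (suc K)) (0≤ι (suc K)) light-A) ⟩
          ε * (ι (suc K) * ι Λ)  ≡⟨ trans (*-comm ε _) (cong (_* ε) (sym (ι-* (suc K) Λ))) ⟩
          ι (suc K ℕ.* Λ) * ε  ≡⟨ rec-cancel (suc K ℕ.* Λ) (2 ℕ.* t) (1≤* {suc K} (s≤s z≤n) 1≤Λ) ⟩
          rec (2 ℕ.* t)  ∎

    opaque
      unfolding _+_

      ring-47 : ∀ a b → a * (b + b) ≡ a * b + a * b
      ring-47 = solve-∀ ℚring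

    enough : Enough κ (0≤rec κN) m
    enough = begin
      κ + ι q * (drift + drift)  ≤⟨ +-mono-≤ (≤-refl {κ}) (*-monoˡ (ι q) (0≤ι q) (+-mono-≤ small-drift small-drift)) ⟩
      κ + ι q * (rec dN + rec dN)  ≡⟨ cong (κ +_) (trans (ring-47 (ι q) (rec dN)) (cong₂ _+_ halves halves)) ⟩
      κ + (rec (2 ℕ.* κN) + rec (2 ℕ.* κN))  ≡⟨ cong (κ +_) (sym (rec-half κN)) ⟩
      κ + κ  ≡⟨ sym (rec-half εN) ⟩
      ε  ∎
      where
        halves : ι q * rec dN ≡ rec (2 ℕ.* κN)
        halves = rec-cancel q (2 ℕ.* κN) (s≤s z≤n)

    θ≤W : rec θN ≤ ∑ (vecs all (suc m)) (W C ρ)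
    θ≤W = begin
      rec θN  ≡⟨ trans (rec-* (κN ℕ.^ m) (2 ℕ.* t)) (cong (_* rec (2 ℕ.* t)) (sym (powℚ-rec κN m))) ⟩
      powℚ κ m * rec (2 ℕ.* t)  ≤⟨ *-monoˡ (powℚ κ m) (subst (0ℚ ≤_) (sym (powℚ-rec κN m)) (0≤rec (κN ℕ.^ m))) root-heavy ⟩
      powℚ κ m * weight (S r₀)  ≤⟨ W-total κ (0≤rec κN) C ρ rk enough ⟩
      ∑ (vecs all (suc m)) (W C ρ)  ∎

    module _ (I : Family n) where

      R T : List (Subset n)
      R = run I query
      T = picks I query

      picks-⊆ : ∀ v → v ∈ T → A v ≡ true
      picks-⊆ v v∈ with A v | round-picks-pos C (W C ρ) 1ℚ (W-admissible C ρ) I v v∈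
      ... | true | _ = refl
      ... | false | p = ⊥-elim (<⇒¬≤ p (≤-reflexive (*-zeroˡ (chainWeight v))))

      picks-c : ∑ T c ≡ ∑ T chainWeight
      picks-c = ∑-cong∈ T (λ v v∈ → trans (cong (λ b → 𝟙 b * chainWeight v) (picks-⊆ v v∈)) (*-identityˡ (chainWeight v)))

      opaque
        unfolding _+_

        ring-48 : ∀ a g s x → a * g * (s * x) ≡ a * (g * s * x)
        ring-48 = solve-∀ ℚring

        ring-49 : ∀ a p l → a * (p * 1ℚ * l) ≡ p * l * a
        ring-49 = solve-∀ ℚring

      picks-weight : s * ∑ T chainWeight ≤ ι Q
      picks-weight = subst (λ z → s * z ≤ ι Q) picks-c (begin
        s * ∑ T c  ≡⟨ sym (trans (cong (_* (s * ∑ T c)) (ι*rec γN 1≤γN)) (*-identityˡ _)) ⟩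
        ι γN * γ * (s * ∑ T c)  ≡⟨ ring-48 (ι γN) γ s (∑ T c) ⟩
        ι γN * (γ * s * ∑ T c)  ≤⟨ *-monoˡ (ι γN) (0≤ι γN) (≤-trans (p≤p+q (*-nn (+-nn 0≤1 0≤1) (∑-nn (all {n}) 0≤c))) (round-picks-weight C (W C ρ) 1ℚ (W-admissible C ρ) I)) ⟩
        ι γN * (pow2 (suc m) * 1ℚ * weight A)  ≤⟨ *-monoˡ (ι γN) (0≤ι γN) (*-monoˡ (pow2 (suc m) * 1ℚ) (*-nn (0≤ι (2 ℕ.^ suc m)) 0≤1) light-A) ⟩
        ι γN * (pow2 (suc m) * 1ℚ * ι Λ)  ≡⟨ ring-49 (ι γN) (pow2 (suc m)) (ι Λ) ⟩
        pow2 (suc m) * ι Λ * ι γN  ≡⟨ trans (cong (_* ι γN) (sym (ι-* (2 ℕ.^ suc m) Λ))) (sym (ι-* (2 ℕ.^ suc m ℕ.* Λ) γN)) ⟩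
        ι Q  ∎)

      opaque
        unfolding _+_

        ring-50 : ∀ s p x → s * (p * x) ≡ p * (s * x)
        ring-50 = solve-∀ ℚring

        ring-51 : ∀ x y z → x * (y * z) ≡ y * x * z
        ring-51 = solve-∀ ℚring

      picks-light : pow2 m * ∑ T c ≤ rec (2 ℕ.* (2 ℕ.* θN))
      picks-light = *-cancelˡ s 0<s (begin
        s * (pow2 m * ∑ T c)  ≡⟨ ring-50 s (pow2 m) (∑ T c) ⟩
        pow2 m * (s * ∑ T c)  ≤⟨ *-monoˡ (pow2 m) (0≤ι (2 ℕ.^ m)) (subst (λ z → s * z ≤ ι Q) (sym picks-c) picks-weight) ⟩
        pow2 m * ι Q  ≡⟨ sym (ι-* (2 ℕ.^ m) Q) ⟩
        ι (2 ℕ.^ m ℕ.* Q)  ≡⟨ sym (trans (cong (ι (2 ℕ.^ m ℕ.* Q) *_) (ι*rec a (1≤2* (1≤2* 1≤θN)))) (*-identityʳ _)) ⟩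
        ι (2 ℕ.^ m ℕ.* Q) * (ι a * rec a)  ≡⟨ ring-51 (ι (2 ℕ.^ m ℕ.* Q)) (ι a) (rec a) ⟩
        ι a * ι (2 ℕ.^ m ℕ.* Q) * rec a  ≡⟨ cong (_* rec a) (sym (ι-* a (2 ℕ.^ m ℕ.* Q))) ⟩
        ι s₀ * rec a  ≤⟨ *-monoʳ (rec a) (0≤rec a) s₀≤s ⟩
        s * rec a  ∎)
        where
          a = 2 ℕ.* (2 ℕ.* θN)

      opaque
        unfolding _+_

        ring-52 : ∀ a b e → a * (b * e) ≡ a * e * b
        ring-52 = solve-∀ ℚring

        ring-53 : ∀ a b → a + (b + a) ≡ b + (a + a)
        ring-53 = solve-∀ ℚring

        ring-54 : ∀ x p r t → x + p * 1ℚ * (r + t) ≡ p * r + (x + p * t)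
        ring-54 = solve-∀ ℚring

      progress : rec ηN ≤ ∑ all (λ v → 𝟙 (mem R v) * c v)
      progress = *-cancelˡ (ι (2 ℕ.^ m ℕ.* q)) (0<ι 1≤2^mq) (begin
        ι (2 ℕ.^ m ℕ.* q) * rec ηN  ≡⟨ rec-cancel (2 ℕ.^ m ℕ.* q) (2 ℕ.* (2 ℕ.* θN)) 1≤2^mq ⟩
        r4  ≤⟨ ≤-cancelʳ (r2 + r4) main ⟩
        pow2 m * (ι q * Φ)  ≡⟨ trans (sym (*-assoc (pow2 m) (ι q) Φ)) (cong (_* Φ) (sym (ι-* (2 ℕ.^ m) q))) ⟩
        ι (2 ℕ.^ m ℕ.* q) * Φ  ∎)
        where
          Φ = ∑ all (λ v → 𝟙 (mem R v) * c v)
          r2 = rec (2 ℕ.* θN)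
          r4 = rec (2 ℕ.* (2 ℕ.* θN))
          1≤2^mq : 1 ℕ.≤ 2 ℕ.^ m ℕ.* q
          1≤2^mq = 1≤* (1≤^ m (s≤s z≤n)) (s≤s {n = m} z≤n)
          first : ι m * (γ * weight A) ≤ r2
          first = begin
            ι m * (γ * weight A)  ≤⟨ *-mono2 (0≤ι q) (*-nn (0≤rec γN) (∑-nn (all {n}) 0≤c)) (ι-mono (ℕₚ.n≤1+n m)) (*-monoˡ γ (0≤rec γN) light-A) ⟩
            ι q * (γ * ι Λ)  ≡⟨ ring-52 (ι q) γ (ι Λ) ⟩
            ι q * ι Λ * γ  ≡⟨ cong (_* γ) (sym (ι-* q Λ)) ⟩
            ι (q ℕ.* Λ) * γ  ≡⟨ rec-cancel (q ℕ.* Λ) (2 ℕ.* θN) (1≤* {q} (s≤s z≤n) 1≤Λ) ⟩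
            r2  ∎
          main : r4 + (r2 + r4) ≤ pow2 m * (ι q * Φ) + (r2 + r4)
          main = begin
            r4 + (r2 + r4)  ≡⟨ ring-53 r4 r2 ⟩
            r2 + (r4 + r4)  ≡⟨ cong (r2 +_) (sym (rec-half (2 ℕ.* θN))) ⟩
            r2 + r2  ≡⟨ sym (rec-half θN) ⟩
            rec θN  ≤⟨ θ≤W ⟩
            ∑ (vecs all (suc m)) (W C ρ)  ≤⟨ round-estimate C (W C ρ) 1ℚ (W-admissible C ρ) I ⟩
            ι m * (γ * weight A) + pow2 m * 1ℚ * (∑ R c + ∑ T c)  ≡⟨ ring-54 (ι m * (γ * weight A)) (pow2 m) (∑ R c) (∑ T c) ⟩
            pow2 m * ∑ R c + (ι m * (γ * weight A) + pow2 m * ∑ T c)  ≤⟨ +-mono-≤ (*-monoˡ (pow2 m) (0≤ι (2 ℕ.^ m)) (round-weight C (W C ρ) 1ℚ (W-admissible C ρ) I (mem R) (λ v → mem⁺))) (+-mono-≤ first picks-light) ⟩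
            pow2 m * (ι q * Φ) + (r2 + r4)  ∎

      sound : (∀ t → (∀ a → I (lookup t a) ≡ true) → ¬ (∀ a b → subᵇ true (lookup t a) (lookup t b) ≡ rel C a b)) →
        ∀ v → v ∈ R → I v ≡ false
      sound free = round-sound C (W C ρ) 1ℚ (W-admissible C ρ) I (λ t h p → free t h (W-embeds C ρ t p))

-- Iterating the step in two phases

infixl 6 _∖_
_∖_ : ∀ {n} → Family n → List (Subset n) → Family n
(F ∖ xs) v = F v ∧ not (mem xs v)

-- A step may work on a subfamily `F'` of the current container `F`; what it removes from `F'` is
-- also lost by `F`.
weight-∖ : ∀ {n} (F F' : Family n) xs → (∀ v → F' v ≡ true → F v ≡ true) →
  weight (F ∖ xs) + ∑ all (λ v → 𝟙 (mem xs v) * (𝟙 (F' v) * chainWeight v)) ≤ weight F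
weight-∖ {n} F F' xs sub = ≤-trans (≤-reflexive (sym (∑-+ (all {n}) _ _))) (∑-mono (all {n}) term)
  where
    term : ∀ v → 𝟙 ((F ∖ xs) v) * chainWeight v + 𝟙 (mem xs v) * (𝟙 (F' v) * chainWeight v) ≤ 𝟙 (F v) * chainWeight v
    term v with mem xs v | F v in eF | F' v in eq
    ... | true | true | b = ≤-trans (≤-reflexive (trans (cong₂ _+_ (*-zeroˡ _) (*-identityˡ _)) (+-identityˡ _))) (*-monoʳ _ (ℚₚ.<⇒≤ (0<chainWeight v)) (𝟙≤1 b))
    ... | true | false | false = ≤-reflexive (trans (cong (0ℚ * chainWeight v +_) (*-identityˡ _)) (trans (cong (0ℚ * chainWeight v +_) (*-zeroˡ (chainWeight v))) (+-identityʳ _)))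
    ... | true | false | true = case trans (sym eF) (sub v eq) of λ ()
    ... | false | a | b = ≤-reflexive (trans (cong (𝟙 (a ∧ true) * chainWeight v +_) (*-zeroˡ _)) (trans (+-identityʳ _) (cong (λ z → 𝟙 z * chainWeight v) (Boolₚ.∧-identityʳ a))))

-- One loop serves both phases; they differ in the weights at which they act and in how much they
-- pick per step.
record Reducer {n : ℕ} (Mid : Family n) (Free : Family n → Set) : Set₁ where
  field
    Active : Family n → Set
    active? : ∀ S → Dec (Active S)
    π η : ℚ
    0≤π : 0ℚ ≤ π
    query : ∀ S → S ⊆F Mid → Active S → Query (Subset n) (List (Subset n))
    picks-in : ∀ S sub a I v → v ∈ picks I (query S sub a) → S v ≡ true
    picks-light : ∀ S sub a I → ∑ (picks I (query S sub a)) chainWeight ≤ π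
    excluded : ∀ S sub a I → Free I → ∀ v → v ∈ run I (query S sub a) → I v ≡ false
    decrease : ∀ S sub a I → Free I → weight (S ∖ run I (query S sub a)) + η ≤ weight S

module Loop {n : ℕ} {Mid : Family n} {Free : Family n → Set} (Red : Reducer Mid Free) where
  open Reducer Red
  open ℚₚ.≤-Reasoning

  ∖-⊆ : ∀ (S : Family n) xs → S ⊆F Mid → (S ∖ xs) ⊆F Mid
  ∖-⊆ S xs sub v e = sub v (Boolₚ.∧-conicalˡ (S v) _ e)

  loop : ℕ → (S : Family n) → S ⊆F Mid → Query (Subset n) (Σ (Family n) (_⊆F Mid))
  loop zero S sub = ret (S , sub)
  loop (suc f) S sub with active? S
  ... | no _ = ret (S , sub)
  ... | yes a = query S sub a >>= λ R → loop f (S ∖ R) (∖-⊆ S R sub)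

  module _ (I : Family n) where

    final : ℕ → (S : Family n) → S ⊆F Mid → Family n
    final f S sub = proj₁ (run I (loop f S sub))

    final-⊆ : ∀ f S sub → final f S sub ⊆F S
    final-⊆ zero S sub v e = e
    final-⊆ (suc f) S sub v e with active? S
    ... | no _ = e
    ... | yes a rewrite run->>= I (query S sub a) (λ R → loop f (S ∖ R) (∖-⊆ S R sub)) =
      Boolₚ.∧-conicalˡ (S v) _ (final-⊆ f (S ∖ run I (query S sub a)) (∖-⊆ S (run I (query S sub a)) sub) v e)

    loop-picks-in : ∀ f S sub v → v ∈ picks I (loop f S sub) → S v ≡ true
    loop-picks-in (suc f) S sub v v∈ with active? S
    ... | yes a with ∈-++⁻ (picks I (query S sub a)) (subst (v ∈_) (picks->>= I (query S sub a) (λ R → loop f (S ∖ R) (∖-⊆ S R sub))) v∈)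
    ...   | inj₁ h = picks-in S sub a I v h
    ...   | inj₂ h = Boolₚ.∧-conicalˡ (S v) _ (loop-picks-in f (S ∖ run I (query S sub a)) (∖-⊆ S (run I (query S sub a)) sub) v h)

    opaque
      unfolding _+_

      ring-55 : ∀ p i → p + i * p ≡ (1ℚ + i) * p
      ring-55 = solve-∀ ℚring

    loop-picks-light : ∀ f S sub → ∑ (picks I (loop f S sub)) chainWeight ≤ ι f * π
    loop-picks-light zero S sub = ≤-reflexive (sym (trans (cong (_* π) ι-0) (*-zeroˡ π)))
    loop-picks-light (suc f) S sub with active? S
    ... | no _ = *-nn (0≤ι (suc f)) 0≤π
    ... | yes a = begin
      ∑ (picks I (query S sub a >>= k)) chainWeight  ≡⟨ trans (cong (λ l → ∑ l chainWeight) (picks->>= I (query S sub a) k)) (∑-++ (picks I (query S sub a)) _ chainWeight) ⟩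
      ∑ (picks I (query S sub a)) chainWeight + ∑ (picks I (k (run I (query S sub a)))) chainWeight  ≤⟨ +-mono-≤ (picks-light S sub a I) (loop-picks-light f (S ∖ run I (query S sub a)) (∖-⊆ S (run I (query S sub a)) sub)) ⟩
      π + ι f * π  ≡⟨ ring-55 π (ι f) ⟩
      (1ℚ + ι f) * π  ≡⟨ cong (_* π) (sym (trans (ι-+ 1 f) (cong (_+ ι f) ι-1))) ⟩
      ι (suc f) * π  ∎
      where
        k : List (Subset n) → Query (Subset n) (Σ (Family n) (_⊆F Mid))
        k R = loop f (S ∖ R) (∖-⊆ S R sub)

    final-⊇ : Free I → ∀ f S sub v → I v ≡ true → S v ≡ true → final f S sub v ≡ true
    final-⊇ free zero S sub v Iv Sv = Sv
    final-⊇ free (suc f) S sub v Iv Sv with active? S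
    ... | no _ = Sv
    ... | yes a rewrite run->>= I (query S sub a) (λ R → loop f (S ∖ R) (∖-⊆ S R sub)) =
      final-⊇ free f (S ∖ R) (∖-⊆ S R sub) v Iv kept
      where
        R = run I (query S sub a)
        kept : (S ∖ R) v ≡ true
        kept with mem R v in e
        ... | false = trans (Boolₚ.∧-identityʳ (S v)) Sv
        ... | true = case trans (sym Iv) (excluded S sub a I free v (mem⁻ e)) of λ ()

    opaque
      unfolding _+_

      ring-56 : ∀ w i e → w + (1ℚ + i) * e ≡ w + i * e + e
      ring-56 = solve-∀ ℚring

    -- If the loop never became inactive, every unit of fuel has cost weight `η`; with the fuel
    -- chosen later this leaves no weight at all.
    final-inactive : Free I → ∀ f S sub → ¬ Active (final f S sub) ⊎ weight (final f S sub) + ι f * η ≤ weight S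
    final-inactive free zero S sub = inj₂ (≤-reflexive (trans (cong (weight S +_) (trans (cong (_* η) ι-0) (*-zeroˡ η))) (+-identityʳ _)))
    final-inactive free (suc f) S sub with active? S
    ... | no ¬a = inj₁ ¬a
    ... | yes a rewrite run->>= I (query S sub a) (λ R → loop f (S ∖ R) (∖-⊆ S R sub)) =
      [ inj₁ , (λ h → inj₂ (begin
        weight F + ι (suc f) * η  ≡⟨ cong (λ z → weight F + z * η) (trans (ι-+ 1 f) (cong (_+ ι f) ι-1)) ⟩
        weight F + (1ℚ + ι f) * η  ≡⟨ ring-56 (weight F) (ι f) η ⟩
        weight F + ι f * η + η  ≤⟨ +-mono-≤ h (≤-refl {η}) ⟩
        weight (S ∖ R) + η  ≤⟨ decrease S sub a I free ⟩
        weight S  ∎)) ]′ (final-inactive free f (S ∖ R) (∖-⊆ S R sub))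
      where
        R = run I (query S sub a)
        F = final f (S ∖ R) (∖-⊆ S R sub)

data ℤ₃ : Set where
  z₀ z₁ z₂ : ℤ₃

next : ℤ₃ → ℤ₃
next z₀ = z₁
next z₁ = z₂
next z₂ = z₀

residue : ℕ → ℤ₃
residue zero = z₀
residue (suc a) = next (residue a)

_≟₃_ : (x y : ℤ₃) → Dec (x ≡ y)
z₀ ≟₃ z₀ = yes refl
z₀ ≟₃ z₁ = no (λ ())
z₀ ≟₃ z₂ = no (λ ())
z₁ ≟₃ z₀ = no (λ ())
z₁ ≟₃ z₁ = yes refl
z₁ ≟₃ z₂ = no (λ ())
z₂ ≟₃ z₀ = no (λ ())
z₂ ≟₃ z₁ = no (λ ())
z₂ ≟₃ z₂ = yes refl

residue-gap : ∀ a g → residue (g ℕ.+ a) ≡ residue a → 1 ℕ.≤ g → 3 ℕ.≤ g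
residue-gap a 1 e _ with residue a
residue-gap a 1 () _ | z₀
residue-gap a 1 () _ | z₁
residue-gap a 1 () _ | z₂
residue-gap a 2 e _ with residue a
residue-gap a 2 () _ | z₀
residue-gap a 2 () _ | z₁
residue-gap a 2 () _ | z₂
residue-gap a (suc (suc (suc g))) e _ = s≤s (s≤s (s≤s z≤n))

opaque
  unfolding _+_

  ring-57 : ∀ t s → t ≡ t - s + s
  ring-57 = solve-∀ ℚring

  ring-58 : ∀ s t → s + (t - s) ≡ t
  ring-58 = solve-∀ ℚring

  ring-59 : ∀ s t → s + (t - s + 1ℚ) ≡ t + 1ℚ
  ring-59 = solve-∀ ℚring

-- Greedy choice of a set of indices whose sum overshoots the target by at most one term.
truncate : ∀ n (f : Subset n → ℚ) (τ : ℚ) → (∀ v → 0ℚ ≤ f v) → (∀ v → f v ≤ 1ℚ) → 0ℚ ≤ τ → τ ≤ ∑ all f →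
  Σ (Family n) λ χ → τ ≤ ∑ all (λ v → 𝟙 (χ v) * f v) × ∑ all (λ v → 𝟙 (χ v) * f v) ≤ τ + 1ℚ
truncate zero f τ 0≤f f≤1 0≤τ h = (λ _ → true) , subst (τ ≤_) eq h , subst (_≤ τ + 1ℚ) eq (subst (_≤ τ + 1ℚ) (sym (+-identityʳ (f []))) (≤-trans (f≤1 []) (q≤p+q 0≤τ)))
  where
    eq : f [] + 0ℚ ≡ 1ℚ * f [] + 0ℚ
    eq = cong (_+ 0ℚ) (sym (*-identityˡ (f [])))
truncate (suc n) f τ 0≤f f≤1 0≤τ h with τ ≤? ∑ (all {n}) (λ v → f (true ∷ v))
... | yes p with truncate n (λ v → f (true ∷ v)) τ (λ v → 0≤f (true ∷ v)) (λ v → f≤1 (true ∷ v)) 0≤τ p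
...   | χ , lower , upper = χ' , subst (τ ≤_) (sym eq) lower , subst (_≤ τ + 1ℚ) (sym eq) upper
  where
    χ' : Family (suc n)
    χ' (true ∷ v) = χ v
    χ' (false ∷ v) = false
    eq : ∑ all (λ v → 𝟙 (χ' v) * f v) ≡ ∑ (all {n}) (λ v → 𝟙 (χ v) * f (true ∷ v))
    eq = trans (∑-all-suc n _) (trans (cong (∑ (all {n}) (λ v → 𝟙 (χ v) * f (true ∷ v)) +_) (trans (∑-cong (all {n}) (λ v → *-zeroˡ (f (false ∷ v)))) (∑-0 (all {n})))) (+-identityʳ _))
truncate (suc n) f τ 0≤f f≤1 0≤τ h | no ¬p with truncate n (λ v → f (false ∷ v)) (τ - s) (λ v → 0≤f (false ∷ v)) (λ v → f≤1 (false ∷ v)) (0≤diff (ℚₚ.<⇒≤ (ℚₚ.≰⇒> ¬p))) rest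
  where
    s = ∑ (all {n}) (λ v → f (true ∷ v))
    s' = ∑ (all {n}) (λ v → f (false ∷ v))
    rest : τ - s ≤ s'
    rest = ≤-cancelʳ s (subst₂ _≤_ (ring-57 τ s) (trans (∑-all-suc n f) (+-comm s s')) h)
... | χ , lower , upper = χ' , subst₂ _≤_ (ring-58 s τ) (sym eq) (+-mono-≤ (≤-refl {s}) lower) , subst₂ _≤_ (sym eq) (ring-59 s τ) (+-mono-≤ (≤-refl {s}) upper)
  where
    s = ∑ (all {n}) (λ v → f (true ∷ v))
    χ' : Family (suc n)
    χ' (true ∷ v) = true
    χ' (false ∷ v) = χ v
    eq : ∑ all (λ v → 𝟙 (χ' v) * f v) ≡ s + ∑ (all {n}) (λ v → 𝟙 (χ v) * f (false ∷ v))
    eq = trans (∑-all-suc n _) (cong (_+ ∑ (all {n}) (λ v → 𝟙 (χ v) * f (false ∷ v))) (∑-cong (all {n}) (λ v → *-identityˡ (f (true ∷ v)))))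

chainWeight≤1 : ∀ {n} (v : Subset n) → chainWeight v ≤ 1ℚ
chainWeight≤1 {n} v = begin
  ι (a ℕ.!) * ι (b ℕ.!) * rec (n ℕ.!)  ≡⟨ cong (_* rec (n ℕ.!)) (sym (ι-* (a ℕ.!) (b ℕ.!))) ⟩
  ι (a ℕ.! ℕ.* b ℕ.!) * rec (n ℕ.!)  ≤⟨ *-monoʳ (rec (n ℕ.!)) (0≤rec (n ℕ.!)) (ι-mono a!b!≤n!) ⟩
  ι (n ℕ.!) * rec (n ℕ.!)  ≡⟨ ι*rec (n ℕ.!) (1≤! n) ⟩
  1ℚ  ∎
  where
    open ℚₚ.≤-Reasoning
    a = co true v
    b = co false v
    n∸a : n ∸ a ≡ b
    n∸a = trans (cong (_∸ a) (sym (co-not true v))) (ℕₚ.m+n∸m≡n a b)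
    a!b!≤n! : a ℕ.! ℕ.* b ℕ.! ℕ.≤ n ℕ.!
    a!b!≤n! = ∣⇒≤ {{ℕₚ._!≢0 n}} (subst (λ z → a ℕ.! ℕ.* z ℕ.! ∣ n ℕ.!) n∸a (Comb.k![n∸k]!∣n! (co≤n true v)))

-- A maximal chain has n + 1 members.
weight≤ : ∀ {n} (A : Family n) → weight A ≤ ι (suc n)
weight≤ {n} A = begin
  weight A  ≤⟨ hits-≥ (suc n) ⟩
  hits (suc n) + ι (suc n)  ≡⟨ cong (_+ ι (suc n)) (trans (∑-cong (all {n}) (λ v → trans (cong (λ z → chainWeight v * (𝟙 (A v) * z)) (ℚₚ.≤-antisym (vanish (suc n) v (s≤s (co≤n true v))) (0≤reach (suc n) v))) (trans (cong (chainWeight v *_) (*-zeroʳ _)) (*-zeroʳ _)))) (∑-0 (all {n}))) ⟩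
  0ℚ + ι (suc n)  ≡⟨ +-identityˡ _ ⟩
  ι (suc n)  ∎
  where
    open ℚₚ.≤-Reasoning
    open Windows A
    open FirstHit A
    vanish : ∀ j v → co true v ℕ.< j → reach j v ≤ 0ℚ
    vanish (suc j) v (s≤s h) = ≤-trans (U-≤ true (reach j) G 0≤G super v) (≤-reflexive (G-low v h))
      where
        G : Subset n → ℚ
        G w = if does (j <ᴺ? co true w) then 1ℚ else 0ℚ
        0≤G : ∀ w → 0ℚ ≤ G w
        0≤G w with j <ᴺ? co true w
        ... | yes _ = 0≤1
        ... | no _ = ≤-refl
        G≤1 : ∀ w → G w ≤ 1ℚ
        G≤1 w with j <ᴺ? co true w
        ... | yes _ = ≤-refl
        ... | no _ = 0≤1
        G-low : ∀ w → co true w ℕ.≤ j → G w ≡ 0ℚ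
        G-low w h rewrite dec-false (j <ᴺ? co true w) (ℕₚ.≤⇒≯ h) = refl
        super : ∀ w → P true (λ x → mix (A x) (reach j x) (G x)) w ≤ G w
        super w with j <ᴺ? co true w
        ... | yes _ = P-≤-open true {λ x → mix (A x) (reach j x) (G x)} w 1ℚ 0≤1 (λ i o → mix-≤ (A (flip i w)) (reach≤1 j (flip i w)) (G≤1 (flip i w)))
        ... | no ¬j< = P-≤-open true {λ x → mix (A x) (reach j x) (G x)} w 0ℚ ≤-refl (λ i o →
          let lower = ℕₚ.≤-trans (ℕₚ.≤-reflexive (co-flip true w i o)) (ℕₚ.≮⇒≥ ¬j<)
          in mix-≤ (A (flip i w)) (vanish j (flip i w) lower) (≤-reflexive (G-low (flip i w) (ℕₚ.<⇒≤ lower))))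

weight-mono : ∀ {n} {F G : Family n} → F ⊆F G → weight F ≤ weight G
weight-mono {n} h = ∑-mono (all {n}) (λ v → *-monoʳ (chainWeight v) (ℚₚ.<⇒≤ (0<chainWeight v)) (𝟙-mono (h v)))

module Select {n : ℕ} (S : Family n) (k : ℕ) (heavy : ι (3 ℕ.* k) ≤ weight S) where

  class : ℤ₃ → Family n
  class z v = S v ∧ does (residue (co true v) ≟₃ z)

  opaque
    unfolding _+_

    ring-60 : ∀ c → 1ℚ * c + 0ℚ * c + 0ℚ * c ≡ 1ℚ * c
    ring-60 = solve-∀ ℚring

    ring-61 : ∀ c → 0ℚ * c + 1ℚ * c + 0ℚ * c ≡ 1ℚ * c
    ring-61 = solve-∀ ℚring

    ring-62 : ∀ c → 0ℚ * c + 0ℚ * c + 1ℚ * c ≡ 1ℚ * c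
    ring-62 = solve-∀ ℚring

    ring-63 : ∀ c → 0ℚ * c + 0ℚ * c + 0ℚ * c ≡ 0ℚ * c
    ring-63 = solve-∀ ℚring

  classes : weight S ≡ weight (class z₀) + weight (class z₁) + weight (class z₂)
  classes = sym (trans (cong (_+ weight (class z₂)) (sym (∑-+ (all {n}) _ _))) (trans (sym (∑-+ (all {n}) _ _)) (∑-cong (all {n}) term)))
    where
      term : ∀ v → 𝟙 (class z₀ v) * chainWeight v + 𝟙 (class z₁ v) * chainWeight v + 𝟙 (class z₂ v) * chainWeight v ≡ 𝟙 (S v) * chainWeight v
      term v with S v | residue (co true v)
      ... | true | z₀ = ring-60 (chainWeight v)
      ... | true | z₁ = ring-61 (chainWeight v)
      ... | true | z₂ = ring-62 (chainWeight v)
      ... | false | _ = ring-63 (chainWeight v)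

  heavy-class : Σ ℤ₃ λ z → ι k ≤ weight (class z)
  heavy-class with ι k ≤? weight (class z₀) | ι k ≤? weight (class z₁)
  ... | yes p | _ = z₀ , p
  ... | no _ | yes p = z₁ , p
  ... | no p | no q = z₂ , ≤-cancelʳ (ι k + ι k) (begin
    ι k + (ι k + ι k)  ≡⟨ sym (trans (ι-+ k (k ℕ.+ (k ℕ.+ 0))) (cong (ι k +_) (trans (ι-+ k (k ℕ.+ 0)) (cong (λ z → ι k + ι z) (ℕₚ.+-identityʳ k))))) ⟩
    ι (3 ℕ.* k)  ≤⟨ heavy ⟩
    weight S  ≡⟨ classes ⟩
    weight (class z₀) + weight (class z₁) + weight (class z₂)  ≤⟨ +-mono-≤ (+-mono-≤ (ℚₚ.<⇒≤ (ℚₚ.≰⇒> p)) (ℚₚ.<⇒≤ (ℚₚ.≰⇒> q))) (≤-refl {weight (class z₂)}) ⟩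
    ι k + ι k + weight (class z₂)  ≡⟨ +-comm _ _ ⟩
    weight (class z₂) + (ι k + ι k)  ∎)
    where open ℚₚ.≤-Reasoning

  z : ℤ₃
  z = proj₁ heavy-class

  -- A residue class may have weight of order `n`, whereas the constants of a step depend on an
  -- upper bound for the weight; hence the truncation.
  cut : Σ (Family n) λ χ → ι k ≤ ∑ all (λ v → 𝟙 (χ v) * (𝟙 (class z v) * chainWeight v)) × ∑ all (λ v → 𝟙 (χ v) * (𝟙 (class z v) * chainWeight v)) ≤ ι k + 1ℚ
  cut = truncate n (λ v → 𝟙 (class z v) * chainWeight v) (ι k) (λ v → *-nn (0≤𝟙 (class z v)) (ℚₚ.<⇒≤ (0<chainWeight v))) (λ v → ≤-trans (𝟙*≤ (class z v) (ℚₚ.<⇒≤ (0<chainWeight v))) (chainWeight≤1 v)) (0≤ι k) (proj₂ heavy-class)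

  chosen : Family n
  chosen v = proj₁ cut v ∧ class z v

  weight-chosen : weight chosen ≡ ∑ all (λ v → 𝟙 (proj₁ cut v) * (𝟙 (class z v) * chainWeight v))
  weight-chosen = ∑-cong (all {n}) (λ v → trans (cong (_* chainWeight v) (𝟙-∧ (proj₁ cut v) (class z v))) (*-assoc _ _ _))

  chosen-heavy : ι k ≤ weight chosen
  chosen-heavy = subst (ι k ≤_) (sym weight-chosen) (proj₁ (proj₂ cut))

  chosen-light : weight chosen ≤ ι k + 1ℚ
  chosen-light = subst (_≤ ι k + 1ℚ) (sym weight-chosen) (proj₂ (proj₂ cut))

  chosen-⊆ : chosen ⊆F S
  chosen-⊆ v e = Boolₚ.∧-conicalˡ (S v) _ (Boolₚ.∧-conicalʳ (proj₁ cut v) _ e)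

  chosen-residue : ∀ v → chosen v ≡ true → residue (co true v) ≡ z
  chosen-residue v e = dec-true⁻ (residue (co true v) ≟₃ z) (Boolₚ.∧-conicalʳ (S v) _ (Boolₚ.∧-conicalʳ (proj₁ cut v) _ e))

  chosen-gap : Gap chosen 3
  chosen-gap true v w ev ew s g≥1 = residue-gap (co true w) g (trans (cong residue split) (trans (chosen-residue v ev) (sym (chosen-residue w ew)))) g≥1
    where
      g = co true v ∸ co true w
      split : g ℕ.+ co true w ≡ co true v
      split = ℕₚ.m∸n+n≡m (ℕₚ.<⇒≤ (ℕₚ.m∸n≢0⇒n<m {co true v} {co true w} (λ e → ℕₚ.1+n≰n (subst (1 ℕ.≤_) e g≥1))))
  -- Going down exchanges the roles of `v` and `w`, since `co true` and `co false` add up to `n`.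
  chosen-gap false v w ev ew s g≥1 = residue-gap (co true v) g (trans (cong residue split) (trans (chosen-residue w ew) (sym (chosen-residue v ev)))) g≥1
    where
      g = co false v ∸ co false w
      split′ : g ℕ.+ co false w ≡ co false v
      split′ = ℕₚ.m∸n+n≡m (ℕₚ.<⇒≤ (ℕₚ.m∸n≢0⇒n<m {co false v} {co false w} (λ e → ℕₚ.1+n≰n (subst (1 ℕ.≤_) e g≥1))))
      split : g ℕ.+ co true v ≡ co true w
      split = ℕₚ.+-cancelˡ-≡ (co false w) _ _ (begin
        co false w ℕ.+ (g ℕ.+ co true v)  ≡⟨ sym (ℕₚ.+-assoc (co false w) g (co true v)) ⟩
        co false w ℕ.+ g ℕ.+ co true v  ≡⟨ cong (ℕ._+ co true v) (trans (ℕₚ.+-comm (co false w) g) split′) ⟩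
        co false v ℕ.+ co true v  ≡⟨ co-not false v ⟩
        n  ≡⟨ sym (co-not false w) ⟩
        co false w ℕ.+ co true w  ∎)
        where open ≡-Reasoning

module Phases {m : ℕ} (C : Code m) (ρ : Fin (suc m) → ℕ) (K : ℕ) (rk : Ranked K C ρ) (t : ℕ) (1≤t : 1 ℕ.≤ t) where
  -- At this weight one of the three residue classes has weight at least `K + 1`, hence at least the
  -- `K + 1/t` that a step requires.
  Λ : ℕ
  Λ = 3 ℕ.* suc K

  1≤Λ : 1 ℕ.≤ Λ
  1≤Λ = s≤s z≤n

  open RoundLemma C ρ K rk t Λ 1≤t 1≤Λ public using (dN; ηN; Q; s₀; 1≤dN; 1≤ηN)
  module RL = RoundLemma C ρ K rk t Λ 1≤t 1≤Λ

  Free : ∀ {n} → Family n → Set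
  Free I = ∀ t → (∀ a → I (lookup t a) ≡ true) → ¬ (∀ a b → subᵇ true (lookup t a) (lookup t b) ≡ rel C a b)

  rec1≡1 : rec 1 ≡ 1ℚ
  rec1≡1 = sym (powℚ-rec 1 0)

  module At (n lo : ℕ) (1≤lo : 1 ℕ.≤ lo) (small-drift : ι ((n ∸ lo) ∸ lo) * rec lo ≤ rec dN) (s₀≤ : 6 ℕ.* s₀ ℕ.≤ lo) where
    open ℚₚ.≤-Reasoning

    opaque
      Mid : Family n
      Mid v = does (lo ℕ.≤? co true v) ∧ does (lo ℕ.≤? co false v)

      Mid-≥ : ∀ d v → Mid v ≡ true → lo ℕ.≤ co d v
      Mid-≥ true v e = dec-true⁻ (lo ℕ.≤? co true v) (Boolₚ.∧-conicalˡ _ _ e)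
      Mid-≥ false v e = dec-true⁻ (lo ℕ.≤? co false v) (Boolₚ.∧-conicalʳ (does (lo ℕ.≤? co true v)) _ e)

      Mid-intro : ∀ v → lo ℕ.≤ co true v → lo ℕ.≤ co false v → Mid v ≡ true
      Mid-intro v p q = cong₂ _∧_ (dec-true (lo ℕ.≤? co true v) p) (dec-true (lo ℕ.≤? co false v) q)

    central : ∀ A → A ⊆F Mid → Central A lo (n ∸ lo)
    central A sub = record
      { 1≤lo = 1≤lo
      ; lo≤ = λ d v e → Mid-≥ d v (sub v e)
      ; ≤hi = λ d v e → ℕₚ.≤-trans (ℕₚ.≤-reflexive (trans (sym (ℕₚ.m+n∸n≡m (co d v) (co (not d) v))) (cong (_∸ co (not d) v) (co-not d v)))) (ℕₚ.∸-monoʳ-≤ n (Mid-≥ (not d) v (sub v e)))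
      }

    passing₁ : passing lo 1 ≤ rec lo
    passing₁ = begin
      ι 1 * rec (lo ℕ.+ 1) * 1ℚ  ≡⟨ trans (*-identityʳ _) (trans (cong (_* rec (lo ℕ.+ 1)) ι-1) (*-identityˡ _)) ⟩
      rec (lo ℕ.+ 1)  ≤⟨ rec-anti 1≤lo (ℕₚ.m≤m+n lo 1) ⟩
      rec lo  ∎

    lo³ : ℕ
    lo³ = lo ℕ.* (lo ℕ.* lo)

    1≤lo³ : 1 ℕ.≤ lo³
    1≤lo³ = 1≤* 1≤lo (1≤* 1≤lo 1≤lo)

    opaque
      unfolding _+_

      ring-64 : ∀ a b r → a * r * (b * r * r) ≡ a * b * (r * (r * r))
      ring-64 = solve-∀ ℚring

    passing₃ : passing lo 3 ≤ ι 6 * rec lo³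
    passing₃ = begin
      ι 3 * rec (lo ℕ.+ 3) * (ι 2 * rec (lo ℕ.+ 2) * passing lo 1)  ≤⟨ *-mono2 (*-nn (0≤ι 3) (0≤rec lo)) (0≤passing lo 2) (*-monoˡ (ι 3) (0≤ι 3) (rec-anti 1≤lo (ℕₚ.m≤m+n lo 3))) (*-mono2 (*-nn (0≤ι 2) (0≤rec lo)) (0≤passing lo 1) (*-monoˡ (ι 2) (0≤ι 2) (rec-anti 1≤lo (ℕₚ.m≤m+n lo 2))) passing₁) ⟩
      ι 3 * rec lo * (ι 2 * rec lo * rec lo)  ≡⟨ ring-64 (ι 3) (ι 2) (rec lo) ⟩
      ι 3 * ι 2 * (rec lo * (rec lo * rec lo))  ≡⟨ cong₂ _*_ (sym (ι-* 3 2)) (sym (trans (rec-* lo (lo ℕ.* lo)) (cong (rec lo *_) (rec-* lo lo)))) ⟩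
      ι 6 * rec lo³  ∎

    -- The reciprocals of the kernel bounds `6/lo³` for gap 3 and `1/lo` for gap 1.
    s₁ s₂ : ℚ
    s₁ = ι lo³ * rec 6
    s₂ = ι lo

    opaque
      unfolding _+_

      ring-65 : ∀ a b c d → a * b * (c * d) ≡ a * d * (c * b)
      ring-65 = solve-∀ ℚring

    s₁-small : s₁ * passing lo 3 ≤ 1ℚ
    s₁-small = begin
      s₁ * passing lo 3  ≤⟨ *-monoˡ s₁ (*-nn (0≤ι lo³) (0≤rec 6)) passing₃ ⟩
      ι lo³ * rec 6 * (ι 6 * rec lo³)  ≡⟨ ring-65 (ι lo³) (rec 6) (ι 6) (rec lo³) ⟩
      ι lo³ * rec lo³ * (ι 6 * rec 6)  ≡⟨ trans (cong₂ _*_ (ι*rec lo³ 1≤lo³) (ι*rec 6 (s≤s z≤n))) (*-identityˡ 1ℚ) ⟩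
      1ℚ  ∎

    s₂-small : s₂ * passing lo 1 ≤ 1ℚ
    s₂-small = ≤-trans (*-monoˡ s₂ (0≤ι lo) passing₁) (ι*rec≤1 lo)

    s₀≤s₂ : ι s₀ ≤ s₂
    s₀≤s₂ = ι-mono (ℕₚ.≤-trans (ℕₚ.m≤n*m s₀ 6) s₀≤)

    opaque
      unfolding _+_

      ring-66 : ∀ a b c → a * (b * c) ≡ b * a * c
      ring-66 = solve-∀ ℚring

    s₀≤s₁ : ι s₀ ≤ s₁
    s₀≤s₁ = begin
      ι s₀  ≡⟨ sym (trans (cong (ι s₀ *_) (ι*rec 6 (s≤s z≤n))) (*-identityʳ _)) ⟩
      ι s₀ * (ι 6 * rec 6)  ≡⟨ trans (ring-66 (ι s₀) (ι 6) (rec 6)) (cong (_* rec 6) (sym (ι-* 6 s₀))) ⟩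
      ι (6 ℕ.* s₀) * rec 6  ≤⟨ *-monoʳ (rec 6) (0≤rec 6) (ι-mono (ℕₚ.≤-trans s₀≤ (ℕₚ.m≤m*n lo (lo ℕ.* lo) {{ℕ.>-nonZero (1≤* 1≤lo 1≤lo)}}))) ⟩
      s₁  ∎

    1≤6 : 1 ℕ.≤ 6
    1≤6 = s≤s z≤n

    0<s₁ : 0ℚ < s₁
    0<s₁ = *-pos (0<ι 1≤lo³) (0<rec 1≤6)

    0<s₂ : 0ℚ < s₂
    0<s₂ = 0<ι 1≤lo

    module For₁ (S : Family n) (sub : S ⊆F Mid) (a : ι Λ ≤ weight S) where
      open Select S (suc K) a public
      heavy-enough : ι K + rec t ≤ weight chosen
      heavy-enough = begin
        ι K + rec t  ≤⟨ +-mono-≤ (≤-refl {ι K}) (subst (rec t ≤_) rec1≡1 (rec-anti ℕₚ.≤-refl 1≤t)) ⟩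
        ι K + 1ℚ  ≡⟨ sym (trans (cong ι (ℕₚ.+-comm 1 K)) (trans (ι-+ K 1) (cong (ι K +_) ι-1))) ⟩
        ι (suc K)  ≤⟨ chosen-heavy ⟩
        weight chosen  ∎
      light-enough : weight chosen ≤ ι Λ
      light-enough = begin
        weight chosen  ≤⟨ chosen-light ⟩
        ι (suc K) + 1ℚ  ≡⟨ sym (trans (ι-+ (suc K) 1) (cong (ι (suc K) +_) ι-1)) ⟩
        ι (suc K ℕ.+ 1)  ≤⟨ ι-mono (ℕₚ.+-monoʳ-≤ (suc K) (s≤s z≤n)) ⟩
        ι Λ  ∎
      open RL.For chosen lo (n ∸ lo) (central chosen (λ v e → sub v (chosen-⊆ v e))) 3 chosen-gap s₁ 0<s₁ s₁-small s₀≤s₁ small-drift heavy-enough light-enough public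

    module For₂ (S : Family n) (sub : S ⊆F Mid) (a : ι K + rec t ≤ weight S × weight S ≤ ι Λ) where
      open RL.For S lo (n ∸ lo) (central S sub) 1 (λ d v w _ _ _ h → h) s₂ 0<s₂ s₂-small s₀≤s₂ small-drift (proj₁ a) (proj₂ a) public

    π₁ π₂ : ℚ
    π₁ = ι (6 ℕ.* Q) * rec lo³
    π₂ = ι Q * rec lo

    opaque
      unfolding _+_

      ring-67 : ∀ a y r → a * (y * r) ≡ y * (a * r)
      ring-67 = solve-∀ ℚring

    divide : ∀ a (1≤a : 1 ℕ.≤ a) x y → ι a * x ≤ y → x ≤ y * rec a
    divide a 1≤a x y h = *-cancelˡ (ι a) (0<ι 1≤a) (≤-trans h (≤-reflexive (sym (trans (ring-67 (ι a) y (rec a)) (trans (cong (y *_) (ι*rec a 1≤a)) (*-identityʳ y))))))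

    opaque
      unfolding _+_

      ring-68 : ∀ a x b r → a * x * (b * r) ≡ b * (a * r * x)
      ring-68 = solve-∀ ℚring

    phase₁ : Reducer Mid Free
    phase₁ = record
      { Active = λ S → ι Λ ≤ weight S
      ; active? = λ S → ι Λ ≤? weight S
      ; π = π₁ ; η = rec ηN ; 0≤π = *-nn (0≤ι (6 ℕ.* Q)) (0≤rec lo³)
      ; query = λ S sub a → For₁.query S sub a
      ; picks-in = λ S sub a I v v∈ → For₁.chosen-⊆ S sub a v (For₁.picks-⊆ S sub a I v v∈)
      ; picks-light = λ S sub a I → divide lo³ 1≤lo³ _ _ (scale (∑ (picks I (For₁.query S sub a)) chainWeight) (For₁.picks-weight S sub a I))
      ; excluded = λ S sub a I free → For₁.sound S sub a I free
      ; decrease = λ S sub a I free → ≤-trans (+-mono-≤ ≤-refl (For₁.progress S sub a I)) (weight-∖ S (For₁.chosen S sub a) (run I (For₁.query S sub a)) (For₁.chosen-⊆ S sub a))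
      }
      where
        scale : ∀ x → s₁ * x ≤ ι Q → ι lo³ * x ≤ ι (6 ℕ.* Q)
        scale x h = begin
          ι lo³ * x  ≡⟨ sym (trans (cong (ι lo³ * x *_) (ι*rec 6 1≤6)) (*-identityʳ _)) ⟩
          ι lo³ * x * (ι 6 * rec 6)  ≡⟨ ring-68 (ι lo³) x (ι 6) (rec 6) ⟩
          ι 6 * (s₁ * x)  ≤⟨ *-monoˡ (ι 6) (0≤ι 6) h ⟩
          ι 6 * ι Q  ≡⟨ sym (ι-* 6 Q) ⟩
          ι (6 ℕ.* Q)  ∎

    phase₂ : Reducer Mid Free
    phase₂ = record
      { Active = λ S → ι K + rec t ≤ weight S × weight S ≤ ι Λ
      ; active? = λ S → (ι K + rec t ≤? weight S) ×-dec (weight S ≤? ι Λ)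
      ; π = π₂ ; η = rec ηN ; 0≤π = *-nn (0≤ι Q) (0≤rec lo)
      ; query = λ S sub a → For₂.query S sub a
      ; picks-in = λ S sub a I → For₂.picks-⊆ S sub a I
      ; picks-light = λ S sub a I → divide lo 1≤lo _ _ (For₂.picks-weight S sub a I)
      ; excluded = λ S sub a I free → For₂.sound S sub a I free
      ; decrease = λ S sub a I free → ≤-trans (+-mono-≤ ≤-refl (For₂.progress S sub a I)) (weight-∖ S S (run I (For₂.query S sub a)) (λ v e → e))
      }

    module L₁ = Loop phase₁
    module L₂ = Loop phase₂

    -- So many steps of size `1/ηN` would use up the initial weight, which is at most `n + 1` in the
    -- first phase and at most `Λ` in the second.
    fuel₁ fuel₂ : ℕ
    fuel₁ = ηN ℕ.* suc n
    fuel₂ = ηN ℕ.* Λ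

    opaque
      alg₁ : Query (Subset n) (Σ (Family n) (_⊆F Mid))
      alg₁ = L₁.loop fuel₁ Mid (λ v e → e)

      alg₂ : Σ (Family n) (_⊆F Mid) → Query (Subset n) (Σ (Family n) (_⊆F Mid))
      alg₂ (S , sub) = L₂.loop fuel₂ S sub

    opaque
      unfolding _+_

      ring-69 : ∀ a b c → a * b * c ≡ a * c * b
      ring-69 = solve-∀ ℚring

    fuel-η : ∀ a → ι (ηN ℕ.* a) * rec ηN ≡ ι a
    fuel-η a = trans (cong (_* rec ηN) (ι-* ηN a)) (trans (ring-69 (ι ηN) (ι a) (rec ηN)) (trans (cong (_* ι a) (ι*rec ηN 1≤ηN)) (*-identityˡ _)))

    exhausted : ∀ x a y → 0ℚ ≤ y → x + ι (ηN ℕ.* a) * rec ηN ≤ ι a → x ≤ y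
    exhausted x a y 0≤y h = ≤-trans (≤-cancelʳ (ι a) (subst₂ _≤_ (cong (x +_) (fuel-η a)) (sym (+-identityˡ (ι a))) h)) 0≤y

    opaque
      unfolding alg₁

      alg₁-picks : ∀ I → ∑ (picks I alg₁) chainWeight ≤ ι fuel₁ * π₁
      alg₁-picks I = L₁.loop-picks-light I fuel₁ Mid (λ v e → e)

      alg₂-picks : ∀ I S → ∑ (picks I (alg₂ S)) chainWeight ≤ ι fuel₂ * π₂
      alg₂-picks I (S , sub) = L₂.loop-picks-light I fuel₂ S sub

      alg₂-picks-in : ∀ I S v → v ∈ picks I (alg₂ S) → proj₁ S v ≡ true
      alg₂-picks-in I (S , sub) = L₂.loop-picks-in I fuel₂ S sub

    module _ (I : Family n) (free : Free I) where

      out₁ out₂ : Family n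
      out₁ = proj₁ (run I alg₁)
      out₂ = proj₁ (run I (alg₂ (run I alg₁)))

      opaque
        unfolding alg₁

        out₁-light : weight out₁ ≤ ι Λ
        out₁-light with L₁.final-inactive I free fuel₁ Mid (λ v e → e)
        ... | inj₁ ¬a = ℚₚ.<⇒≤ (ℚₚ.≰⇒> ¬a)
        ... | inj₂ h = exhausted _ (suc n) (ι Λ) (0≤ι Λ) (≤-trans h (weight≤ Mid))

        out₂-light : weight out₂ ≤ ι K + rec t
        out₂-light with L₂.final-inactive I free fuel₂ out₁ (proj₂ (run I alg₁))
        ... | inj₁ ¬a = ℚₚ.<⇒≤ (ℚₚ.≰⇒> (λ h → ¬a (h , ≤-trans (weight-mono (L₂.final-⊆ I fuel₂ out₁ (proj₂ (run I alg₁)))) out₁-light)))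
        ... | inj₂ h = exhausted _ Λ (ι K + rec t) (+-nn (0≤ι K) (0≤rec t)) (≤-trans h out₁-light)

        out₂-⊇ : ∀ v → I v ≡ true → Mid v ≡ true → out₂ v ≡ true
        out₂-⊇ v Iv Mv = L₂.final-⊇ I free fuel₂ out₁ (proj₂ (run I alg₁)) v Iv (L₁.final-⊇ I free fuel₁ Mid (λ v e → e) v Iv Mv)

-- The central binomial coefficient and the outer levels

opaque
  central : ℕ → ℕ
  central n = n Comb.C (n ℕ./ 2)

  central-def : ∀ n → central n ≡ n Comb.C (n ℕ./ 2)
  central-def n = refl

module CentralBinomial (n : ℕ) where
  h : ℕ
  h = n ℕ./ 2

  2h≤n : h ℕ.+ h ℕ.≤ n
  2h≤n = ℕₚ.≤-trans (ℕₚ.≤-reflexive (trans (cong (h ℕ.+_) (sym (ℕₚ.+-identityʳ h))) (ℕₚ.*-comm 2 h))) (m/n*n≤m n 2)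

  n≤2h+1 : n ℕ.≤ suc (h ℕ.+ h)
  n≤2h+1 = ℕₚ.≤-trans (ℕₚ.≤-reflexive (m≡m%n+[m/n]*n n 2)) (ℕₚ.+-mono-≤ (ℕₚ.≤-pred (m%n<n n 2)) (ℕₚ.≤-reflexive (trans (ℕₚ.*-comm h 2) (cong (h ℕ.+_) (ℕₚ.+-identityʳ h)))))

  h≤n : h ℕ.≤ n
  h≤n = ℕₚ.≤-trans (ℕₚ.m≤m+n h h) 2h≤n

  f : ℕ → ℕ
  f a = a ℕ.! ℕ.* (n ∸ a) ℕ.!

  f-suc : ∀ a → suc a ℕ.≤ n ∸ a → f (suc a) ℕ.≤ f a
  f-suc a le = ℕₚ.≤-trans (ℕₚ.≤-reflexive (rearr (suc a) (a ℕ.!) (x ℕ.!))) (ℕₚ.≤-trans (ℕₚ.*-monoʳ-≤ (a ℕ.!) (ℕₚ.*-monoˡ-≤ (x ℕ.!) (subst (suc a ℕ.≤_) n∸a le))) (ℕₚ.≤-reflexive (cong (λ z → a ℕ.! ℕ.* z ℕ.!) (sym n∸a))))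
    where
      x = n ∸ suc a
      n∸a : n ∸ a ≡ suc x
      n∸a = ℕₚ.+-∸-assoc 1 {n} {suc a} (ℕₚ.m∸n≢0⇒n<m {n} {a} (λ e → ℕₚ.1+n≰n (ℕₚ.≤-trans (s≤s z≤n) (subst (suc a ℕ.≤_) e le))))
      rearr : ∀ p q r → p ℕ.* q ℕ.* r ≡ q ℕ.* (p ℕ.* r)
      rearr p q r = trans (cong (ℕ._* r) (ℕₚ.*-comm p q)) (ℕₚ.*-assoc q p r)

  f-min-below : ∀ {a b} → a ℕ.≤′ b → b ℕ.≤ h → f b ℕ.≤ f a
  f-min-below (ℕ.≤′-reflexive refl) _ = ℕₚ.≤-refl
  f-min-below {a} (ℕ.≤′-step {b} p) b<h = ℕₚ.≤-trans (f-suc b (ℕₚ.m+n≤o⇒m≤o∸n (suc b) (ℕₚ.≤-trans (ℕₚ.+-mono-≤ b<h (ℕₚ.<⇒≤ b<h)) 2h≤n))) (f-min-below p (ℕₚ.<⇒≤ b<h))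

  -- The product of the two factorials is symmetric and does not increase up to the middle.
  f-min : ∀ i j → i ℕ.+ j ≡ n → f h ℕ.≤ i ℕ.! ℕ.* j ℕ.!
  f-min i j e with i ℕ.≤? h
  ... | yes i≤h = subst (λ z → f h ℕ.≤ i ℕ.! ℕ.* z ℕ.!) (trans (cong (_∸ i) (sym e)) (ℕₚ.m+n∸m≡n i j)) (f-min-below (ℕₚ.≤⇒≤′ i≤h) ℕₚ.≤-refl)
  ... | no i≰h = subst (f h ℕ.≤_) (trans (cong (λ z → j ℕ.! ℕ.* z ℕ.!) (trans (cong (_∸ j) (sym e)) (ℕₚ.m+n∸n≡m i j))) (ℕₚ.*-comm (j ℕ.!) (i ℕ.!))) (f-min-below (ℕₚ.≤⇒≤′ j≤h) ℕₚ.≤-refl)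
    where
      j≤h : j ℕ.≤ h
      j≤h = ℕₚ.+-cancelˡ-≤ (suc h) j h (ℕₚ.≤-trans (ℕₚ.+-monoˡ-≤ j (ℕₚ.≰⇒> i≰h)) (ℕₚ.≤-trans (ℕₚ.≤-reflexive e) n≤2h+1))

  central-factorial : central n ℕ.* f h ≡ n ℕ.!
  central-factorial = trans (cong (ℕ._* f h) (trans (central-def n) (Comb.nCk≡n!/k![n-k]! h≤n))) (m/n*n≡m (Comb.k![n∸k]!∣n! h≤n))
    where
      instance
        f≢0 : ℕ.NonZero (f h)
        f≢0 = ℕₚ.m*n≢0 (h ℕ.!) ((n ∸ h) ℕ.!) {{ℕₚ._!≢0 h}} {{ℕₚ._!≢0 (n ∸ h)}}

  -- `chainWeight v` is the reciprocal of the binomial coefficient of its level. This converts every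
  -- bound on weights into one on cardinalities.
  1≤central*chainWeight : ∀ (v : Subset n) → 1ℚ ≤ ι (central n) * chainWeight v
  1≤central*chainWeight v = begin
    1ℚ  ≡⟨ sym (ι*rec (n ℕ.!) (1≤! n)) ⟩
    ι (n ℕ.!) * rec (n ℕ.!)  ≡⟨ cong (λ z → ι z * rec (n ℕ.!)) (sym central-factorial) ⟩
    ι (central n ℕ.* f h) * rec (n ℕ.!)  ≤⟨ *-monoʳ (rec (n ℕ.!)) (0≤rec (n ℕ.!)) (ι-mono (ℕₚ.*-monoʳ-≤ (central n) (f-min (co true v) (co false v) (co-not true v)))) ⟩
    ι (central n ℕ.* (co true v ℕ.! ℕ.* co false v ℕ.!)) * rec (n ℕ.!)  ≡⟨ cong (_* rec (n ℕ.!)) (trans (ι-* (central n) _) (cong (ι (central n) *_) (ι-* (co true v ℕ.!) (co false v ℕ.!)))) ⟩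
    ι (central n) * (ι (co true v ℕ.!) * ι (co false v ℕ.!)) * rec (n ℕ.!)  ≡⟨ *-assoc _ _ _ ⟩
    ι (central n) * chainWeight v  ∎
    where open ℚₚ.≤-Reasoning

  length≤ : ∀ (xs : List (Subset n)) → ι (length xs) ≤ ι (central n) * ∑ xs chainWeight
  length≤ xs = begin
    ι (length xs)  ≡⟨ sym (trans (∑-const xs 1ℚ) (*-identityʳ _)) ⟩
    ∑ xs (λ _ → 1ℚ)  ≤⟨ ∑-mono xs 1≤central*chainWeight ⟩
    ∑ xs (λ v → ι (central n) * chainWeight v)  ≡⟨ ∑-*ˡ xs (ι (central n)) chainWeight ⟩
    ι (central n) * ∑ xs chainWeight  ∎
    where open ℚₚ.≤-Reasoning

  opaque
    unfolding _+_

    ring-70 : ∀ a b c → a * (b * c) ≡ b * (a * c)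
    ring-70 = solve-∀ ℚring

  ∑𝟙≤ : ∀ (F : Family n) → ∑ all (λ v → 𝟙 (F v)) ≤ ι (central n) * weight F
  ∑𝟙≤ F = begin
    ∑ all (λ v → 𝟙 (F v))  ≡⟨ ∑-cong (all {n}) (λ v → sym (*-identityʳ (𝟙 (F v)))) ⟩
    ∑ all (λ v → 𝟙 (F v) * 1ℚ)  ≤⟨ ∑-mono (all {n}) (λ v → *-monoˡ (𝟙 (F v)) (0≤𝟙 (F v)) (1≤central*chainWeight v)) ⟩
    ∑ all (λ v → 𝟙 (F v) * (ι (central n) * chainWeight v))  ≡⟨ ∑-cong (all {n}) (λ v → ring-70 (𝟙 (F v)) (ι (central n)) (chainWeight v)) ⟩
    ∑ all (λ v → ι (central n) * (𝟙 (F v) * chainWeight v))  ≡⟨ ∑-*ˡ (all {n}) (ι (central n)) _ ⟩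
    ι (central n) * weight F  ∎
    where
      open ℚₚ.≤-Reasoning

ι-card : ∀ {n} (F : Family n) → ι ∣ F ∣F ≡ ∑ all (λ v → 𝟙 (F v))
ι-card {n} F = go (allSubsets n)
  where
    go : ∀ xs → ι (sum (map (λ A → if F A then 1 else 0) xs)) ≡ ∑ xs (λ v → 𝟙 (F v))
    go [] = ι-0
    go (x ∷ xs) with F x
    ... | true = trans (ι-+ 1 _) (cong₂ _+_ ι-1 (go xs))
    ... | false = trans (go xs) (sym (+-identityˡ _))

length-allSubsets : ∀ n → length (allSubsets n) ≡ 2 ℕ.^ n
length-allSubsets zero = refl
length-allSubsets (suc n) = trans (Listₚ.length-++ (map (true ∷_) (allSubsets n))) (trans (cong₂ ℕ._+_ (trans (Listₚ.length-map (true ∷_) (allSubsets n)) (length-allSubsets n)) (trans (Listₚ.length-map (false ∷_) (allSubsets n)) (length-allSubsets n))) (cong (2 ℕ.^ n ℕ.+_) (sym (ℕₚ.+-identityʳ (2 ℕ.^ n)))))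

2^n≤ : ∀ n → ι (2 ℕ.^ n) ≤ ι (central n) * ι (suc n)
2^n≤ n = begin
  ι (2 ℕ.^ n)  ≡⟨ trans (cong ι (sym (length-allSubsets n))) (sym (trans (∑-const (all {n}) 1ℚ) (*-identityʳ _))) ⟩
  ∑ all (λ (_ : Subset n) → 1ℚ)  ≤⟨ CentralBinomial.∑𝟙≤ n (λ _ → true) ⟩
  ι (central n) * weight {n} (λ _ → true)  ≤⟨ *-monoˡ (ι (central n)) (0≤ι (central n)) (weight≤ {n} (λ _ → true)) ⟩
  ι (central n) * ι (suc n)  ∎
  where open ℚₚ.≤-Reasoning

deviation : ∀ {n} → Subset n → ℚ
deviation v = ι (co true v) - ι (co false v)

sq : ℚ → ℚ
sq x = x * x

module Moments where
  open ℚₚ.≤-Reasoning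

  two three : ℚ
  two = 1ℚ + 1ℚ
  three = two + 1ℚ

  opaque
    unfolding _+_

    ring-71 : ∀ a b → a - (1ℚ + b) ≡ a - b - 1ℚ
    ring-71 = solve-∀ ℚring

  dev-true : ∀ {n} (v : Subset n) → deviation (true ∷ v) ≡ deviation v - 1ℚ
  dev-true v = trans (cong (λ z → ι (co true v) - z) (trans (ι-+ 1 (co false v)) (cong (_+ ι (co false v)) ι-1))) (ring-71 (ι (co true v)) (ι (co false v)))

  opaque
    unfolding _+_

    ring-72 : ∀ a b → 1ℚ + a - b ≡ a - b + 1ℚ
    ring-72 = solve-∀ ℚring

  dev-false : ∀ {n} (v : Subset n) → deviation (false ∷ v) ≡ deviation v + 1ℚ
  dev-false v = trans (cong (_- ι (co false v)) (trans (ι-+ 1 (co true v)) (cong (_+ ι (co true v)) ι-1))) (ring-72 (ι (co true v)) (ι (co false v)))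

  E N : ℕ → ℚ
  E n = ι (2 ℕ.^ n)
  N n = ι n

  E-suc : ∀ n → E (suc n) ≡ two * E n
  E-suc n = trans (ι-* 2 (2 ℕ.^ n)) (cong (_* E n) (trans (ι-+ 1 1) (cong₂ _+_ ι-1 ι-1)))

  N-suc : ∀ n → N (suc n) ≡ 1ℚ + N n
  N-suc n = trans (ι-+ 1 n) (cong (_+ N n) ι-1)

  ∑1 : ∀ n → ∑ (all {n}) (λ _ → 1ℚ) ≡ E n
  ∑1 n = trans (∑-const (all {n}) 1ℚ) (trans (*-identityʳ _) (cong ι (length-allSubsets n)))

  opaque
    unfolding _+_

    ring-73 : ∀ x → (x - x) * (x - x) + 0ℚ ≡ 0ℚ * x
    ring-73 = solve-∀ ℚring

    ring-74 : ∀ x → (x - 1ℚ) * (x - 1ℚ) + (x + 1ℚ) * (x + 1ℚ) ≡ (1ℚ + 1ℚ) * (x * x) + (1ℚ + 1ℚ) * 1ℚ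
    ring-74 = solve-∀ ℚring

    ring-75 : ∀ m e → (1ℚ + 1ℚ) * (m * e) + (1ℚ + 1ℚ) * e ≡ (1ℚ + m) * ((1ℚ + 1ℚ) * e)
    ring-75 = solve-∀ ℚring

  second : ∀ n → ∑ (all {n}) (λ v → sq (deviation v)) ≡ N n * E n
  second zero = trans (cong (λ z → sq (z - z) + 0ℚ) ι-0) (trans zero-sq (sym (trans (cong (_* E 0) ι-0) (*-zeroˡ _))))
    where
      zero-sq : sq (0ℚ - 0ℚ) + 0ℚ ≡ 0ℚ
      zero-sq = trans (ring-73 0ℚ) (*-zeroˡ 0ℚ)
  second (suc n) = begin-equality
    ∑ (all {suc n}) (λ v → sq (deviation v))  ≡⟨ ∑-all-suc n _ ⟩
    ∑ (all {n}) (λ v → sq (deviation (true ∷ v))) + ∑ (all {n}) (λ v → sq (deviation (false ∷ v)))  ≡⟨ sym (∑-+ (all {n}) _ _) ⟩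
    ∑ (all {n}) (λ v → sq (deviation (true ∷ v)) + sq (deviation (false ∷ v)))  ≡⟨ ∑-cong (all {n}) (λ v → trans (cong₂ (λ a b → sq a + sq b) (dev-true v) (dev-false v)) (ring-74 (deviation v))) ⟩
    ∑ (all {n}) (λ v → two * sq (deviation v) + two * 1ℚ)  ≡⟨ trans (∑-+ (all {n}) _ _) (cong₂ _+_ (∑-*ˡ (all {n}) two _) (∑-*ˡ (all {n}) two _)) ⟩
    two * ∑ (all {n}) (λ v → sq (deviation v)) + two * ∑ (all {n}) (λ _ → 1ℚ)  ≡⟨ cong₂ (λ a b → two * a + two * b) (second n) (∑1 n) ⟩
    two * (N n * E n) + two * E n  ≡⟨ ring-75 (N n) (E n) ⟩
    (1ℚ + N n) * (two * E n)  ≡⟨ cong₂ _*_ (sym (N-suc n)) (sym (E-suc n)) ⟩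
    N (suc n) * E (suc n)  ∎

  opaque
    unfolding _+_

    ring-76 : ∀ x → (x - x) * (x - x) * ((x - x) * (x - x)) + 0ℚ ≡ 0ℚ * x
    ring-76 = solve-∀ ℚring

    ring-77 : ∀ x → (x - 1ℚ) * (x - 1ℚ) * ((x - 1ℚ) * (x - 1ℚ)) + (x + 1ℚ) * (x + 1ℚ) * ((x + 1ℚ) * (x + 1ℚ)) ≡ (1ℚ + 1ℚ) * (x * x * (x * x)) + ((1ℚ + 1ℚ + 1ℚ) * ((1ℚ + 1ℚ) * (1ℚ + 1ℚ)) * (x * x) + (1ℚ + 1ℚ) * 1ℚ)
    ring-77 = solve-∀ ℚring

    ring-78 : ∀ m e → (1ℚ + 1ℚ + 1ℚ) * ((1ℚ + m) * (1ℚ + m)) * ((1ℚ + 1ℚ) * e) ≡ (1ℚ + 1ℚ) * ((1ℚ + 1ℚ + 1ℚ) * (m * m) * e) + ((1ℚ + 1ℚ + 1ℚ) * ((1ℚ + 1ℚ) * (1ℚ + 1ℚ)) * (m * e) + (1ℚ + 1ℚ) * e) + (1ℚ + 1ℚ) * (1ℚ + 1ℚ) * e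
    ring-78 = solve-∀ ℚring

  -- Adding a coordinate replaces x^4 by (x - 1)^4 + (x + 1)^4 = 2x^4 + 12x^2 + 2, so the second
  -- moment, known exactly, closes the induction.
  fourth : ∀ n → ∑ (all {n}) (λ v → sq (sq (deviation v))) ≤ three * sq (N n) * E n
  fourth zero = ≤-trans (≤-reflexive (trans (cong (λ z → sq (sq (z - z)) + 0ℚ) ι-0) zero-sq)) (*-nn (*-nn (+-nn (+-nn 0≤1 0≤1) 0≤1) (*-nn (0≤ι 0) (0≤ι 0))) (0≤ι (2 ℕ.^ 0)))
    where
      zero-sq : sq (sq (0ℚ - 0ℚ)) + 0ℚ ≡ 0ℚ
      zero-sq = trans (ring-76 0ℚ) (*-zeroˡ 0ℚ)
  fourth (suc n) = begin
    ∑ (all {suc n}) (λ v → sq (sq (deviation v)))  ≡⟨ ∑-all-suc n _ ⟩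
    ∑ (all {n}) (λ v → sq (sq (deviation (true ∷ v)))) + ∑ (all {n}) (λ v → sq (sq (deviation (false ∷ v))))  ≡⟨ sym (∑-+ (all {n}) _ _) ⟩
    ∑ (all {n}) (λ v → sq (sq (deviation (true ∷ v))) + sq (sq (deviation (false ∷ v))))  ≡⟨ ∑-cong (all {n}) (λ v → trans (cong₂ (λ a b → sq (sq a) + sq (sq b)) (dev-true v) (dev-false v)) (ring-77 (deviation v))) ⟩
    ∑ (all {n}) (λ v → two * sq (sq (deviation v)) + (twelve * sq (deviation v) + two * 1ℚ))  ≡⟨ trans (∑-+ (all {n}) _ _) (cong₂ _+_ (∑-*ˡ (all {n}) two _) (trans (∑-+ (all {n}) _ _) (cong₂ _+_ (∑-*ˡ (all {n}) twelve _) (∑-*ˡ (all {n}) two _)))) ⟩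
    two * ∑ (all {n}) (λ v → sq (sq (deviation v))) + (twelve * ∑ (all {n}) (λ v → sq (deviation v)) + two * ∑ (all {n}) (λ _ → 1ℚ))  ≡⟨ cong₂ (λ a b → two * ∑ (all {n}) (λ v → sq (sq (deviation v))) + (twelve * a + two * b)) (second n) (∑1 n) ⟩
    two * ∑ (all {n}) (λ v → sq (sq (deviation v))) + (twelve * (N n * E n) + two * E n)  ≤⟨ +-mono-≤ (*-monoˡ two (+-nn 0≤1 0≤1) (fourth n)) (≤-refl {twelve * (N n * E n) + two * E n}) ⟩
    two * (three * sq (N n) * E n) + (twelve * (N n * E n) + two * E n)  ≤⟨ ≤-from-diff (two * two * E n) (*-nn (*-nn (+-nn 0≤1 0≤1) (+-nn 0≤1 0≤1)) (0≤ι (2 ℕ.^ n))) (ring-78 (N n) (E n)) ⟩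
    three * sq (1ℚ + N n) * (two * E n)  ≡⟨ cong₂ (λ a b → three * sq a * b) (sym (N-suc n)) (sym (E-suc n)) ⟩
    three * sq (N (suc n)) * E (suc n)  ∎
    where
      twelve : ℚ
      twelve = three * (two * two)

opaque
  unfolding _+_

  ring-79 : ∀ x → (0ℚ - x) * (0ℚ - x) ≡ x * x
  ring-79 = solve-∀ ℚring

  ring-80 : ∀ a b y → a - (b + y) ≡ a - b - y
  ring-80 = solve-∀ ℚring

  ring-81 : ∀ a b → (b - a) * (b - a) ≡ (a - b) * (a - b)
  ring-81 = solve-∀ ℚring

-- The fourth moment, unlike the variance, beats the crude bound 2^n ≤ (n + 1) (n C ⌊n/2⌋) used later.
tail-bound : ∀ {n} (F : Family n) (y : ℕ) → (∀ v → F v ≡ true → Σ Bool λ d → co d v ℕ.+ y ℕ.≤ co (not d) v) →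
  sq (sq (ι y)) * ∑ (all {n}) (λ v → 𝟙 (F v)) ≤ (1ℚ + 1ℚ + 1ℚ) * sq (ι n) * ι (2 ℕ.^ n)
tail-bound {n} F y far = begin
  sq (sq (ι y)) * ∑ (all {n}) (λ v → 𝟙 (F v))  ≡⟨ sym (∑-*ˡ (all {n}) (sq (sq (ι y))) _) ⟩
  ∑ (all {n}) (λ v → sq (sq (ι y)) * 𝟙 (F v))  ≤⟨ ∑-mono (all {n}) term ⟩
  ∑ (all {n}) (λ v → sq (sq (deviation v)))  ≤⟨ Moments.fourth n ⟩
  (1ℚ + 1ℚ + 1ℚ) * sq (ι n) * ι (2 ℕ.^ n)  ∎
  where
    open ℚₚ.≤-Reasoning
    sq-mono : ∀ {a b} → 0ℚ ≤ a → a ≤ b → sq a ≤ sq b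
    sq-mono 0≤a h = *-mono2 (≤-trans 0≤a h) 0≤a h h
    0≤sq : ∀ x → 0ℚ ≤ sq x
    0≤sq x with 0ℚ ≤? x
    ... | yes p = *-nn p p
    ... | no ¬p = subst (0ℚ ≤_) (ring-79 x) (*-nn neg neg)
      where
        neg : 0ℚ ≤ 0ℚ - x
        neg = 0≤diff (ℚₚ.<⇒≤ (ℚₚ.≰⇒> ¬p))
    apart : ∀ a b → b ℕ.+ y ℕ.≤ a → ι y ≤ ι a - ι b
    apart a b h = ≤-of-0≤diff (subst (0ℚ ≤_) (ring-80 (ι a) (ι b) (ι y)) (0≤diff (subst (_≤ ι a) (ι-+ b y) (ι-mono h))))
    dev-sq : ∀ d (v : Subset n) → co d v ℕ.+ y ℕ.≤ co (not d) v → sq (ι y) ≤ sq (deviation v)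
    dev-sq false v h = sq-mono (0≤ι y) (apart (co true v) (co false v) h)
    dev-sq true v h = subst (sq (ι y) ≤_) (ring-81 (ι (co true v)) (ι (co false v))) (sq-mono (0≤ι y) (apart (co false v) (co true v) h))
    term : ∀ v → sq (sq (ι y)) * 𝟙 (F v) ≤ sq (sq (deviation v))
    term v with F v in e
    ... | false = ≤-trans (≤-reflexive (*-zeroʳ _)) (0≤sq (sq (deviation v)))
    ... | true = ≤-trans (≤-reflexive (*-identityʳ _)) (sq-mono (0≤sq (ι y)) (let (d , h) = far v e in dev-sq d v h))

-- Counting small sublists

combos : {X : Set} → ℕ → List X → List (List X)
combos zero xs = [] ∷ []
combos (suc j) [] = []
combos (suc j) (x ∷ xs) = map (x ∷_) (combos j xs) ++ combos (suc j) xs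

small : {X : Set} → ℕ → List X → List (List X)
small zero xs = combos zero xs
small (suc N) xs = small N xs ++ combos (suc N) xs

private
  -- The two leading terms in the expansion of (a + 1)^(j + 1); it matches the Pascal recursion of
  -- `combos`.
  binomial-step : ∀ j a → suc j ℕ.* a ℕ.^ j ℕ.+ a ℕ.^ suc j ℕ.≤ suc a ℕ.^ suc j
  binomial-step zero a = ℕₚ.≤-reflexive (trans (cong suc (ℕₚ.*-identityʳ a)) (sym (ℕₚ.*-identityʳ (suc a))))
  binomial-step (suc j) a = begin
    suc (suc j) ℕ.* (a ℕ.* p) ℕ.+ a ℕ.* (a ℕ.* p)  ≤⟨ ℕₚ.m≤m+n _ (suc j ℕ.* p) ⟩
    suc (suc j) ℕ.* (a ℕ.* p) ℕ.+ a ℕ.* (a ℕ.* p) ℕ.+ suc j ℕ.* p  ≡⟨ lem j a p ⟩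
    suc a ℕ.* (suc j ℕ.* p ℕ.+ a ℕ.* p)  ≤⟨ ℕₚ.*-monoʳ-≤ (suc a) (binomial-step j a) ⟩
    suc a ℕ.* suc a ℕ.^ suc j  ∎
    where
      open ℕₚ.≤-Reasoning
      p = a ℕ.^ j
      lem : ∀ j a p → suc (suc j) ℕ.* (a ℕ.* p) ℕ.+ a ℕ.* (a ℕ.* p) ℕ.+ suc j ℕ.* p ≡ suc a ℕ.* (suc j ℕ.* p ℕ.+ a ℕ.* p)
      lem = ℕRing.solve-∀

length-combos : {X : Set} (j : ℕ) (xs : List X) → length (combos j xs) ℕ.* j ℕ.! ℕ.≤ length xs ℕ.^ j
length-combos zero xs = ℕₚ.≤-refl
length-combos (suc j) [] = z≤n
length-combos (suc j) (x ∷ xs) = begin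
  length (map (x ∷_) (combos j xs) ++ combos (suc j) xs) ℕ.* suc j ℕ.!  ≡⟨ cong (ℕ._* suc j ℕ.!) (trans (Listₚ.length-++ (map (x ∷_) (combos j xs))) (cong (ℕ._+ c') (Listₚ.length-map (x ∷_) (combos j xs)))) ⟩
  (c ℕ.+ c') ℕ.* (suc j ℕ.* j ℕ.!)  ≡⟨ lem c c' j (j ℕ.!) ⟩
  suc j ℕ.* (c ℕ.* j ℕ.!) ℕ.+ c' ℕ.* (suc j ℕ.* j ℕ.!)  ≤⟨ ℕₚ.+-mono-≤ (ℕₚ.*-monoʳ-≤ (suc j) (length-combos j xs)) (length-combos (suc j) xs) ⟩
  suc j ℕ.* length xs ℕ.^ j ℕ.+ length xs ℕ.^ suc j  ≤⟨ binomial-step j (length xs) ⟩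
  suc (length xs) ℕ.^ suc j  ∎
  where
    open ℕₚ.≤-Reasoning
    c = length (combos j xs)
    c' = length (combos (suc j) xs)
    lem : ∀ c c' j f → (c ℕ.+ c') ℕ.* (suc j ℕ.* f) ≡ suc j ℕ.* (c ℕ.* f) ℕ.+ c' ℕ.* (suc j ℕ.* f)
    lem = ℕRing.solve-∀

-- Crude, but enough for the first phase: the ground set has 2^n members, and only the number of
-- picks matters.
length-small : {X : Set} (N : ℕ) (xs : List X) → length (small N xs) ℕ.≤ suc (length xs) ℕ.^ N
length-small zero xs = ℕₚ.≤-refl
length-small (suc N) xs = begin
  length (small N xs ++ combos (suc N) xs)  ≡⟨ Listₚ.length-++ (small N xs) ⟩
  length (small N xs) ℕ.+ length (combos (suc N) xs)  ≤⟨ ℕₚ.+-mono-≤ (length-small N xs) (ℕₚ.≤-trans (ℕₚ.m≤m*n _ (suc N ℕ.!) {{ℕₚ._!≢0 (suc N)}}) (length-combos (suc N) xs)) ⟩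
  suc a ℕ.^ N ℕ.+ a ℕ.* a ℕ.^ N  ≤⟨ ℕₚ.+-monoʳ-≤ (suc a ℕ.^ N) (ℕₚ.*-monoʳ-≤ a (ℕₚ.^-monoˡ-≤ N (ℕₚ.n≤1+n a))) ⟩
  suc a ℕ.^ suc N  ∎
  where
    open ℕₚ.≤-Reasoning
    a = length xs

Chosen : {X : Set} → List X → ℕ → List X → Set
Chosen xs j ys = length ys ≡ j × (∀ {v} → v ∈ ys → v ∈ xs)

combos-chosen : {X : Set} (j : ℕ) (xs : List X) {ys : List X} → ys ∈ combos j xs → Chosen xs j ys
combos-chosen zero xs (here refl) = refl , (λ ())
combos-chosen (suc j) (x ∷ xs) ys∈ with ∈-++⁻ (map (x ∷_) (combos j xs)) ys∈
... | inj₂ h = let (e , s) = combos-chosen (suc j) xs h in e , (λ v∈ → there (s v∈))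
... | inj₁ h with ∈-map⁻ (x ∷_) h
...   | zs , zs∈ , refl = let (e , s) = combos-chosen j xs zs∈ in cong suc e , (λ { (here p) → here p ; (there v∈) → there (s v∈) })

combos-unique : {X : Set} (j : ℕ) (xs : List X) → AllPairs _≢_ xs → ∀ {ys} → ys ∈ combos j xs → AllPairs _≢_ ys
combos-unique zero xs u (here refl) = []
combos-unique (suc j) (x ∷ xs) (x∉ ∷ u) ys∈ with ∈-++⁻ (map (x ∷_) (combos j xs)) ys∈
... | inj₂ h = combos-unique (suc j) xs u h
... | inj₁ h with ∈-map⁻ (x ∷_) h
...   | zs , zs∈ , refl = All.tabulate (λ v∈ → All.lookup x∉ (proj₂ (combos-chosen j xs zs∈) v∈)) ∷ combos-unique j xs u zs∈

small⇒combos : {X : Set} (N : ℕ) (xs : List X) {ys : List X} → ys ∈ small N xs → Σ ℕ λ j → j ℕ.≤ N × ys ∈ combos j xs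
small⇒combos zero xs h = 0 , z≤n , h
small⇒combos (suc N) xs h with ∈-++⁻ (small N xs) h
... | inj₁ p = let (j , j≤N , q) = small⇒combos N xs p in j , ℕₚ.m≤n⇒m≤1+n j≤N , q
... | inj₂ p = suc N , ℕₚ.≤-refl , p

combos⇒small : {X : Set} (N j : ℕ) (xs : List X) {ys : List X} → j ℕ.≤ N → ys ∈ combos j xs → ys ∈ small N xs
combos⇒small zero zero xs _ h = h
combos⇒small (suc N) j xs j≤ h with j ℕ.≟ suc N
... | yes refl = ∈-++⁺ʳ (small N xs) h
... | no j≢ = ∈-++⁺ˡ (combos⇒small N j xs (ℕₚ.≤-pred (ℕₚ.≤∧≢⇒< j≤ j≢)) h)

filterᵇ∈combos : {X : Set} (p : X → Bool) (xs : List X) → filterᵇ p xs ∈ combos (length (filterᵇ p xs)) xs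
filterᵇ∈combos p [] = here refl
filterᵇ∈combos p (x ∷ xs) with p x
... | true = ∈-++⁺ˡ (∈-map⁺ (x ∷_) (filterᵇ∈combos p xs))
... | false with filterᵇ p xs | filterᵇ∈combos p xs
...   | [] | _ = here refl
...   | y ∷ ys | h = ∈-++⁺ʳ (map (x ∷_) (combos (length ys) xs)) h

filterᵇ-unique : {X : Set} (p : X → Bool) (xs : List X) → AllPairs _≢_ xs → AllPairs _≢_ (filterᵇ p xs)
filterᵇ-unique p xs u = combos-unique (length (filterᵇ p xs)) xs u (filterᵇ∈combos p xs)

∑-𝟙-length : {X : Set} (j i : ℕ) (xs : List X) → j ≢ i → ∑ (combos i xs) (λ ys → 𝟙 (does (length ys ℕ.≟ j))) ≡ 0ℚ
∑-𝟙-length j i xs j≢i = trans (∑-cong∈ (combos i xs) (λ ys ys∈ → cong 𝟙 (dec-false (length ys ℕ.≟ j) (λ e → j≢i (trans (sym e) (proj₁ (combos-chosen i xs ys∈))))))) (∑-0 (combos i xs))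

∑-combos-≤ : {X : Set} (j i : ℕ) (xs : List X) → ∑ (combos i xs) (λ ys → 𝟙 (does (length ys ℕ.≟ j))) ≤ ι (length (combos i xs))
∑-combos-≤ j i xs = ≤-trans (∑-mono (combos i xs) (λ ys → 𝟙≤1 (does (length ys ℕ.≟ j)))) (≤-reflexive (trans (∑-const (combos i xs) 1ℚ) (*-identityʳ _)))

∑-small-length : {X : Set} (j N : ℕ) (xs : List X) → ∑ (small N xs) (λ ys → 𝟙 (does (length ys ℕ.≟ j))) ≤ ι (length (combos j xs))
∑-small-length j N xs = ≤-trans (go N) (𝟙*≤ (does (j ℕ.≤? N)) (0≤ι (length (combos j xs))))
  where
    go : ∀ N → ∑ (small N xs) (λ ys → 𝟙 (does (length ys ℕ.≟ j))) ≤ 𝟙 (does (j ℕ.≤? N)) * ι (length (combos j xs))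
    go zero with j ℕ.≟ 0
    ... | yes refl = ≤-trans (∑-combos-≤ 0 0 xs) (≤-reflexive (sym (*-identityˡ _)))
    ... | no j≢0 = ≤-trans (≤-reflexive (∑-𝟙-length j 0 xs j≢0)) (*-nn (0≤𝟙 (does (j ℕ.≤? 0))) (0≤ι (length (combos j xs))))
    go (suc N) with j ℕ.≟ suc N
    ... | no j≢ = ≤-trans (≤-reflexive (trans (∑-++ (small N xs) (combos (suc N) xs) _) (trans (cong (∑ (small N xs) _ +_) (∑-𝟙-length j (suc N) xs j≢)) (+-identityʳ _)))) (≤-trans (go N) (*-monoʳ _ (0≤ι (length (combos j xs))) (𝟙-mono (λ e → dec-true (j ℕ.≤? suc N) (ℕₚ.m≤n⇒m≤1+n (dec-true⁻ (j ℕ.≤? N) e))))))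
    ... | yes refl = ≤-trans (≤-reflexive (∑-++ (small N xs) (combos (suc N) xs) _)) (≤-trans (+-mono-≤ (≤-trans (go N) (≤-reflexive (trans (cong (λ b → 𝟙 b * ι (length (combos (suc N) xs))) (dec-false (suc N ℕ.≤? N) ℕₚ.1+n≰n)) (*-zeroˡ _)))) (∑-combos-≤ (suc N) (suc N) xs)) (≤-reflexive (trans (+-identityˡ _) (sym (trans (cong (λ b → 𝟙 b * ι (length (combos (suc N) xs))) (dec-true (suc N ℕ.≤? suc N) ℕₚ.≤-refl)) (*-identityˡ _))))))

factorial-≤ : ∀ j ℓ → (j ℕ.+ ℓ) ℕ.! ℕ.≤ j ℕ.! ℕ.* (j ℕ.+ ℓ) ℕ.^ ℓ
factorial-≤ j zero = ℕₚ.≤-reflexive (trans (cong ℕ._! (ℕₚ.+-identityʳ j)) (sym (ℕₚ.*-identityʳ (j ℕ.!))))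
factorial-≤ j (suc ℓ) rewrite ℕₚ.+-suc j ℓ = begin
  suc s ℕ.* s ℕ.!  ≤⟨ ℕₚ.*-monoʳ-≤ (suc s) (factorial-≤ j ℓ) ⟩
  suc s ℕ.* (j ℕ.! ℕ.* s ℕ.^ ℓ)  ≤⟨ ℕₚ.*-monoʳ-≤ (suc s) (ℕₚ.*-monoʳ-≤ (j ℕ.!) (ℕₚ.^-monoˡ-≤ ℓ (ℕₚ.n≤1+n s))) ⟩
  suc s ℕ.* (j ℕ.! ℕ.* suc s ℕ.^ ℓ)  ≡⟨ lem (suc s) (j ℕ.!) (suc s ℕ.^ ℓ) ⟩
  j ℕ.! ℕ.* (suc s ℕ.* suc s ℕ.^ ℓ)  ∎
  where
    open ℕₚ.≤-Reasoning
    s = j ℕ.+ ℓ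
    lem : ∀ a b c → a ℕ.* (b ℕ.* c) ≡ b ℕ.* (a ℕ.* c)
    lem = ℕRing.solve-∀

n!≤n^n : ∀ n → n ℕ.! ℕ.≤ n ℕ.^ n
n!≤n^n n = ℕₚ.≤-trans (factorial-≤ 0 n) (ℕₚ.≤-reflexive (ℕₚ.+-identityʳ (n ℕ.^ n)))

factorial-+-≤ : ∀ a b → (a ℕ.+ b) ℕ.! ℕ.≤ 2 ℕ.^ (a ℕ.+ b) ℕ.* (a ℕ.! ℕ.* b ℕ.!)
factorial-+-≤ zero b = ℕₚ.≤-trans (ℕₚ.m≤n*m (b ℕ.!) (2 ℕ.^ b) {{ℕₚ.m^n≢0 2 b}}) (ℕₚ.≤-reflexive (cong (2 ℕ.^ b ℕ.*_) (sym (ℕₚ.+-identityʳ (b ℕ.!)))))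
factorial-+-≤ (suc a) zero rewrite ℕₚ.+-identityʳ a = ℕₚ.≤-trans (ℕₚ.m≤n*m (suc a ℕ.!) (2 ℕ.^ suc a) {{ℕₚ.m^n≢0 2 (suc a)}}) (ℕₚ.≤-reflexive (cong (2 ℕ.^ suc a ℕ.*_) (sym (ℕₚ.*-identityʳ (suc a ℕ.!)))))
factorial-+-≤ (suc a) (suc b) = begin
  (suc a ℕ.+ suc b) ℕ.!  ≡⟨⟩
  (suc a ℕ.+ suc b) ℕ.* (a ℕ.+ suc b) ℕ.!  ≡⟨ ℕₚ.*-distribʳ-+ ((a ℕ.+ suc b) ℕ.!) (suc a) (suc b) ⟩
  suc a ℕ.* (a ℕ.+ suc b) ℕ.! ℕ.+ suc b ℕ.* (a ℕ.+ suc b) ℕ.!  ≤⟨ ℕₚ.+-mono-≤ (ℕₚ.*-monoʳ-≤ (suc a) (factorial-+-≤ a (suc b))) (ℕₚ.*-monoʳ-≤ (suc b) (subst (λ z → z ℕ.! ℕ.≤ 2 ℕ.^ z ℕ.* (suc a ℕ.! ℕ.* b ℕ.!)) (sym (ℕₚ.+-suc a b)) (factorial-+-≤ (suc a) b))) ⟩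
  suc a ℕ.* (p ℕ.* (a ℕ.! ℕ.* (suc b ℕ.* b ℕ.!))) ℕ.+ suc b ℕ.* (p ℕ.* (suc a ℕ.* a ℕ.! ℕ.* b ℕ.!))  ≡⟨ lem (suc a) (suc b) p (a ℕ.!) (b ℕ.!) ⟩
  2 ℕ.* p ℕ.* (suc a ℕ.* a ℕ.! ℕ.* (suc b ℕ.* b ℕ.!))  ∎
  where
    open ℕₚ.≤-Reasoning
    p = 2 ℕ.^ (a ℕ.+ suc b)
    lem : ∀ a b p f g → a ℕ.* (p ℕ.* (f ℕ.* (b ℕ.* g))) ℕ.+ b ℕ.* (p ℕ.* (a ℕ.* f ℕ.* g)) ≡ 2 ℕ.* p ℕ.* (a ℕ.* f ℕ.* (b ℕ.* g))
    lem = ℕRing.solve-∀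

power-factorial : ∀ s k → s ℕ.^ k ℕ.* s ℕ.! ℕ.≤ (s ℕ.+ k) ℕ.!
power-factorial s zero = ℕₚ.≤-reflexive (trans (ℕₚ.+-identityʳ _) (cong ℕ._! (sym (ℕₚ.+-identityʳ s))))
power-factorial s (suc k) rewrite ℕₚ.+-suc s k = begin
  s ℕ.* s ℕ.^ k ℕ.* s ℕ.!  ≡⟨ ℕₚ.*-assoc s (s ℕ.^ k) (s ℕ.!) ⟩
  s ℕ.* (s ℕ.^ k ℕ.* s ℕ.!)  ≤⟨ ℕₚ.*-mono-≤ (ℕₚ.m≤n⇒m≤1+n (ℕₚ.m≤m+n s k)) (power-factorial s k) ⟩
  suc (s ℕ.+ k) ℕ.* (s ℕ.+ k) ℕ.!  ∎
  where open ℕₚ.≤-Reasoning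

-- Through the central binomial coefficient: s^s s! ≤ (2s)! ≤ 4^s s! s!.
n^n≤4^n*n! : ∀ s → s ℕ.^ s ℕ.≤ 4 ℕ.^ s ℕ.* s ℕ.!
n^n≤4^n*n! s = ℕₚ.*-cancelʳ-≤ (s ℕ.^ s) (4 ℕ.^ s ℕ.* s ℕ.!) (s ℕ.!) {{ℕₚ._!≢0 s}} (begin
  s ℕ.^ s ℕ.* s ℕ.!  ≤⟨ power-factorial s s ⟩
  (s ℕ.+ s) ℕ.!  ≤⟨ factorial-+-≤ s s ⟩
  2 ℕ.^ (s ℕ.+ s) ℕ.* (s ℕ.! ℕ.* s ℕ.!)  ≡⟨ cong (ℕ._* (s ℕ.! ℕ.* s ℕ.!)) (trans (cong (2 ℕ.^_) (cong (s ℕ.+_) (sym (ℕₚ.+-identityʳ s)))) (sym (ℕₚ.^-*-assoc 2 2 s))) ⟩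
  4 ℕ.^ s ℕ.* (s ℕ.! ℕ.* s ℕ.!)  ≡⟨ sym (ℕₚ.*-assoc (4 ℕ.^ s) (s ℕ.!) (s ℕ.!)) ⟩
  4 ℕ.^ s ℕ.* s ℕ.! ℕ.* s ℕ.!  ∎)
  where open ℕₚ.≤-Reasoning

-- With j = s - ℓ there are at most M^j / j! second parts, and s! ≤ j! s^ℓ ≤ j! M^ℓ. So a fixed
-- first part of size `ℓ` leaves no more than the M^s / s! allowed for all `s` choices.
∑-small-total : {X : Set} (N ℓ s M : ℕ) (xs : List X) → length xs ℕ.≤ M → s ℕ.≤ M →
  ∑ (small N xs) (λ ys → 𝟙 (does (ℓ ℕ.+ length ys ℕ.≟ s))) * ι (s ℕ.!) ≤ ι (M ℕ.^ s)
∑-small-total {X} N ℓ s M xs xs≤M s≤M with ℓ ℕ.≤? s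
... | no ℓ≰s = ≤-trans (≤-reflexive (trans (cong (_* ι (s ℕ.!)) (trans (∑-cong (small N xs) (λ ys → cong 𝟙 (dec-false (ℓ ℕ.+ length ys ℕ.≟ s) (λ e → ℓ≰s (ℕₚ.≤-trans (ℕₚ.m≤m+n ℓ (length ys)) (ℕₚ.≤-reflexive e)))))) (∑-0 (small N xs)))) (*-zeroˡ _))) (0≤ι (M ℕ.^ s))
... | yes ℓ≤s = ≤-trans (*-monoʳ _ (0≤ι (s ℕ.!)) (≤-trans (∑-mono (small N xs) (λ ys → 𝟙-mono (λ e → dec-true (length ys ℕ.≟ j) (shift (length ys) (dec-true⁻ (ℓ ℕ.+ length ys ℕ.≟ s) e))))) (∑-small-length j N xs))) (≤-trans (≤-reflexive (sym (ι-* c (s ℕ.!)))) (ι-mono count))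
  where
    j = s ∸ ℓ
    c = length (combos j xs)
    j+ℓ : j ℕ.+ ℓ ≡ s
    j+ℓ = ℕₚ.m∸n+n≡m ℓ≤s
    shift : ∀ a → ℓ ℕ.+ a ≡ s → a ≡ j
    shift a e = sym (trans (cong (_∸ ℓ) (sym e)) (ℕₚ.m+n∸m≡n ℓ a))
    open ℕₚ.≤-Reasoning
    count : c ℕ.* s ℕ.! ℕ.≤ M ℕ.^ s
    count = begin
      c ℕ.* s ℕ.!  ≡⟨ cong (λ z → c ℕ.* z ℕ.!) (sym j+ℓ) ⟩
      c ℕ.* (j ℕ.+ ℓ) ℕ.!  ≤⟨ ℕₚ.*-monoʳ-≤ c (factorial-≤ j ℓ) ⟩
      c ℕ.* (j ℕ.! ℕ.* (j ℕ.+ ℓ) ℕ.^ ℓ)  ≡⟨ trans (sym (ℕₚ.*-assoc c (j ℕ.!) _)) (cong (λ z → c ℕ.* j ℕ.! ℕ.* z ℕ.^ ℓ) j+ℓ) ⟩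
      c ℕ.* j ℕ.! ℕ.* s ℕ.^ ℓ  ≤⟨ ℕₚ.*-mono-≤ (ℕₚ.≤-trans (length-combos j xs) (ℕₚ.^-monoˡ-≤ j xs≤M)) (ℕₚ.^-monoˡ-≤ ℓ s≤M) ⟩
      M ℕ.^ j ℕ.* M ℕ.^ ℓ  ≡⟨ sym (ℕₚ.^-distribˡ-+-* M j ℓ) ⟩
      M ℕ.^ (j ℕ.+ ℓ)  ≡⟨ cong (M ℕ.^_) j+ℓ ⟩
      M ℕ.^ s  ∎

allSubsets-unique : ∀ n → AllPairs _≢_ (allSubsets n)
allSubsets-unique zero = [] ∷ []
allSubsets-unique (suc n) = Unique.++⁺ (Unique.map⁺ (λ { refl → refl }) (allSubsets-unique n)) (Unique.map⁺ (λ { refl → refl }) (allSubsets-unique n))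
  (λ (p , q) → let (_ , _ , e) = ∈-map⁻ (true ∷_) p
                   (_ , _ , e') = ∈-map⁻ (false ∷_) q
               in case trans (sym e) e' of λ ())

∑-mem : ∀ {n} (ys : List (Subset n)) → AllPairs _≢_ ys → ∑ all (λ v → 𝟙 (mem ys v)) ≡ ι (length ys)
∑-mem {n} [] _ = trans (∑-cong (all {n}) (λ v → cong 𝟙 (empty v))) (trans (∑-0 (all {n})) (sym ι-0))
  where
    empty : ∀ v → mem [] v ≡ false
    empty v with mem [] v in e
    ... | false = refl
    ... | true = case mem⁻ {xs = []} e of λ ()
∑-mem {n} (y ∷ ys) (y∉ ∷ u) = trans (∑-cong (all {n}) term) (trans (∑-+ (all {n}) _ _) (trans (cong₂ _+_ (trans (∑-δ y (λ _ → 1ℚ)) refl) (∑-mem ys u)) (sym (trans (ι-+ 1 (length ys)) (cong (_+ ι (length ys)) ι-1)))))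
  where
    term : ∀ v → 𝟙 (mem (y ∷ ys) v) ≡ δ v y * 1ℚ + 𝟙 (mem ys v)
    term v with mem ys v in e | v ≟ⱽ y
    ... | true | yes refl = ⊥-elim (All.lookup y∉ (mem⁻ e) refl)
    ... | false | yes refl = trans (cong 𝟙 (mem⁺ {xs = y ∷ ys} (here refl))) (sym (trans (+-identityʳ _) (trans (*-identityʳ _) (δ-refl v))))
    ... | true | no v≢y = trans (cong 𝟙 (mem⁺ {xs = y ∷ ys} (there (mem⁻ e)))) (sym (trans (cong (_+ 1ℚ) (trans (*-identityʳ _) (δ≡0 v≢y))) (+-identityˡ _)))
      where
        δ≡0 : v ≢ y → δ v y ≡ 0ℚ
        δ≡0 h = [ (λ e → ⊥-elim (h e)) , id ]′ (δ-cases v y)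
    ... | false | no v≢y = trans (cong 𝟙 absent) (sym (trans (+-identityʳ _) (trans (*-identityʳ _) ([ (λ e → ⊥-elim (v≢y e)) , id ]′ (δ-cases v y)))))
      where
        absent : mem (y ∷ ys) v ≡ false
        absent with mem (y ∷ ys) v in e'
        ... | false = refl
        ... | true with mem⁻ {xs = y ∷ ys} e'
        ...   | here p = ⊥-elim (v≢y p)
        ...   | there p = case trans (sym e) (mem⁺ p) of λ ()

length-filter-mem≤ : ∀ {n} (ys xs : List (Subset n)) → AllPairs _≢_ xs → ι (length (filterᵇ (mem ys) xs)) ≤ ι (length ys)
length-filter-mem≤ {n} ys xs u = ι-mono (Unique-length (filterᵇ (mem ys) xs) ys (filterᵇ-unique (mem ys) xs u) (λ v∈ → mem⁻ (proj₂ (filterᵇ-∈ (mem ys) xs v∈))))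
  where
    Unique-length : ∀ (as bs : List (Subset n)) → AllPairs _≢_ as → (∀ {v} → v ∈ as → v ∈ bs) → length as ℕ.≤ length bs
    Unique-length as bs u sub = ι-cancel-≤ (≤-trans (≤-reflexive (sym (∑-mem as u))) (≤-trans (∑-mono (all {n}) (λ v → 𝟙-mono (λ e → mem⁺ (sub (mem⁻ e))))) (mem-≤ bs)))
      where
        mem-≤ : ∀ bs → ∑ all (λ v → 𝟙 (mem bs v)) ≤ ι (length bs)
        mem-≤ [] = ≤-reflexive (∑-mem {n} [] [])
        mem-≤ (b ∷ bs) = ≤-trans (∑-mono (all {n}) term) (≤-trans (≤-reflexive (∑-+ (all {n}) _ _)) (≤-trans (+-mono-≤ (≤-reflexive (∑-δ b (λ _ → 1ℚ))) (mem-≤ bs)) (≤-reflexive (sym (trans (ι-+ 1 (length bs)) (cong (_+ ι (length bs)) ι-1))))))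
          where
            term : ∀ v → 𝟙 (mem (b ∷ bs) v) ≤ δ v b * 1ℚ + 𝟙 (mem bs v)
            term v with mem (b ∷ bs) v in e
            ... | false = +-nn (*-nn (0≤δ v b) 0≤1) (0≤𝟙 (mem bs v))
            ... | true with mem⁻ {xs = b ∷ bs} e
            ...   | here refl = ≤-trans (≤-reflexive (sym (trans (*-identityʳ _) (δ-refl v)))) (p≤p+q (0≤𝟙 (mem bs v)))
            ...   | there p = ≤-trans (≤-reflexive (cong 𝟙 (sym (mem⁺ p)))) (q≤p+q (*-nn (0≤δ v b) 0≤1))

-- Powers and the exponential series

^ℚ≡powℚ : ∀ x m → x ^ℚ m ≡ powℚ x m
^ℚ≡powℚ x zero = refl
^ℚ≡powℚ x (suc m) = trans (sym (*-def x (x ^ℚ m))) (cong (x *_) (^ℚ≡powℚ x m))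

powℚ-mono : ∀ {x y} m → 0ℚ ≤ x → x ≤ y → powℚ x m ≤ powℚ y m
powℚ-mono zero 0≤x h = ≤-refl
powℚ-mono {x} {y} (suc m) 0≤x h = *-mono2 (≤-trans 0≤x h) (0≤powℚ m 0≤x) h (powℚ-mono m 0≤x h)
  where
    0≤powℚ : ∀ {x} m → 0ℚ ≤ x → 0ℚ ≤ powℚ x m
    0≤powℚ zero h = 0≤1
    0≤powℚ (suc m) h = *-nn h (0≤powℚ m h)

0≤powℚ : ∀ {x} m → 0ℚ ≤ x → 0ℚ ≤ powℚ x m
0≤powℚ zero h = 0≤1
0≤powℚ (suc m) h = *-nn h (0≤powℚ m h)

powℚ-ι : ∀ a m → powℚ (ι a) m ≡ ι (a ℕ.^ m)
powℚ-ι a zero = sym ι-1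
powℚ-ι a (suc m) = trans (cong (ι a *_) (powℚ-ι a m)) (sym (ι-* a (a ℕ.^ m)))

opaque
  unfolding _+_

  ring-82 : ∀ x y a b → x * y * (a * b) ≡ x * a * (y * b)
  ring-82 = solve-∀ ℚring

powℚ-* : ∀ x y m → powℚ (x * y) m ≡ powℚ x m * powℚ y m
powℚ-* x y zero = sym (*-identityˡ 1ℚ)
powℚ-* x y (suc m) = trans (cong (x * y *_) (powℚ-* x y m)) (ring-82 x y (powℚ x m) (powℚ y m))

expTerm : ℕ → ℚ → ℚ
expTerm q x = powℚ x q * rec (q ℕ.!)

expPartial-suc : ∀ N x → expPartial (suc N) x ≡ expPartial N x + expTerm N x
expPartial-suc N x = trans (sym (+-def _ _)) (cong (expPartial N x +_) (trans (sym (*-def _ _)) (cong₂ _*_ (^ℚ≡powℚ x N) (sym (rec-def (N ℕ.!))))))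

0≤expPartial : ∀ N {x} → 0ℚ ≤ x → 0ℚ ≤ expPartial N x
0≤expPartial zero h = ≤-refl
0≤expPartial (suc N) {x} h = subst (0ℚ ≤_) (sym (expPartial-suc N x)) (+-nn (0≤expPartial N h) (*-nn (0≤powℚ N h) (0≤rec (N ℕ.!))))

expTerm≤expPartial : ∀ {q N x} → 0ℚ ≤ x → q ℕ.< N → expTerm q x ≤ expPartial N x
expTerm≤expPartial {q} {suc N} {x} 0≤x q<N with q ℕ.≟ N
... | yes refl = subst (expTerm q x ≤_) (sym (expPartial-suc N x)) (q≤p+q (0≤expPartial N 0≤x))
... | no q≢N = subst (expTerm q x ≤_) (sym (expPartial-suc N x)) (≤-trans (expTerm≤expPartial 0≤x (ℕₚ.≤∧≢⇒< (ℕₚ.≤-pred q<N) q≢N)) (p≤p+q (*-nn (0≤powℚ N 0≤x) (0≤rec (N ℕ.!)))))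

^-distribʳ : ∀ a b q → (a ℕ.* b) ℕ.^ q ≡ a ℕ.^ q ℕ.* b ℕ.^ q
^-distribʳ a b zero = refl
^-distribʳ a b (suc q) = trans (cong (a ℕ.* b ℕ.*_) (^-distribʳ a b q)) (lem a b (a ℕ.^ q) (b ℕ.^ q))
  where
    lem : ∀ a b x y → a ℕ.* b ℕ.* (x ℕ.* y) ≡ a ℕ.* x ℕ.* (b ℕ.* y)
    lem = ℕRing.solve-∀

opaque
  unfolding _+_

  ring-83 : ∀ a b c → a * (b * c) ≡ b * (a * c)
  ring-83 = solve-∀ ℚring

-- exp x ≥ x^q / q! ≥ (x / q)^q.
2^q≤expPartial : ∀ q N x → ι (2 ℕ.* q) ≤ x → q ℕ.< N → ι (2 ℕ.^ q) ≤ expPartial N x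
2^q≤expPartial q N x h q<N = ≤-trans (*-cancelˡ (ι (q ℕ.!)) (0<ι (1≤! q)) bound) (expTerm≤expPartial 0≤x q<N)
  where
    0≤x : 0ℚ ≤ x
    0≤x = ≤-trans (0≤ι (2 ℕ.* q)) h
    open ℕₚ.≤-Reasoning
    nat : q ℕ.! ℕ.* 2 ℕ.^ q ℕ.≤ (2 ℕ.* q) ℕ.^ q
    nat = begin
      q ℕ.! ℕ.* 2 ℕ.^ q  ≤⟨ ℕₚ.*-monoˡ-≤ (2 ℕ.^ q) (n!≤n^n q) ⟩
      q ℕ.^ q ℕ.* 2 ℕ.^ q  ≡⟨ trans (ℕₚ.*-comm (q ℕ.^ q) (2 ℕ.^ q)) (sym (^-distribʳ 2 q q)) ⟩
      (2 ℕ.* q) ℕ.^ q  ∎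
    bound : ι (q ℕ.!) * ι (2 ℕ.^ q) ≤ ι (q ℕ.!) * expTerm q x
    bound = ≤-trans (≤-reflexive (sym (ι-* (q ℕ.!) (2 ℕ.^ q)))) (≤-trans (ι-mono nat) (≤-trans (≤-reflexive (sym (powℚ-ι (2 ℕ.* q) q))) (≤-trans (powℚ-mono q (0≤ι (2 ℕ.* q)) h) (≤-reflexive (sym (trans (ring-83 (ι (q ℕ.!)) (powℚ x q) (rec (q ℕ.!))) (trans (cong (powℚ x q *_) (ι*rec (q ℕ.!) (1≤! q))) (*-identityʳ _))))))))

-- A single term of the series already reaches 2^q when x ≥ 2q, so all partial sums beyond it work,
-- whatever the tolerance.
LeMulExp-intro : ∀ y a x q → y ≤ a * ι (2 ℕ.^ q) → 0ℚ ≤ a → ι (2 ℕ.* q) ≤ x → LeMulExp y a x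
LeMulExp-intro y a x q h 0≤a hx δ₀ 0<δ = suc q , λ N q<N → subst (y ≤_) (trans (cong (_+ δ₀) (*-def a (expPartial N x))) (+-def _ δ₀)) (≤-trans h (≤-trans (*-monoˡ a 0≤a (2^q≤expPartial q N x hx q<N)) (p≤p+q (ℚₚ.<⇒≤ 0<δ))))

-- Choice of the window and assembly of the fingerprint

quotient-≥ : ∀ a c m .{{_ : ℕ.NonZero c}} → a ℕ.* c ℕ.≤ m → a ℕ.≤ m ℕ./ c
quotient-≥ a c m h = subst (ℕ._≤ m ℕ./ c) (m*n/n≡m a c) (/-monoˡ-≤ c h)

opaque
  unfolding _+_

  ring-84 : ∀ h t b r → h * t * (b * r) ≡ h * b * (t * r)
  ring-84 = solve-∀ ℚring

  ring-85 : ∀ y x → y * y * (y * y) * x ≡ y * (y * y) * (y * x)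
  ring-85 = solve-∀ ℚring

  ring-86 : ∀ a n b m → a * (n * n) * (b * m) ≡ a * (n * n) * m * b
  ring-86 = solve-∀ ℚring

  ring-87 : ∀ h c b → h * c * b ≡ c * (h * b)
  ring-87 = solve-∀ ℚring

-- Since n ≤ 2Dy and n + 1 ≤ 3Dy, the right side is at most 36 D^3 y^3 b. Cancelling y^3 leaves y T
-- ≤ H b, and y ≥ H t finishes.
tail-arithmetic : ∀ (D y n H t : ℕ) (b T : ℚ) → 1 ℕ.≤ y → 1 ℕ.≤ t → 1 ℕ.≤ H → H ≡ 36 ℕ.* (D ℕ.* (D ℕ.* D)) →
  n ℕ.≤ (2 ℕ.* D) ℕ.* y → suc n ℕ.≤ (3 ℕ.* D) ℕ.* y → H ℕ.* t ℕ.≤ y → 0ℚ ≤ b → 0ℚ ≤ T →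
  sq (sq (ι y)) * T ≤ (1ℚ + 1ℚ + 1ℚ) * sq (ι n) * (b * ι (suc n)) → T ≤ b * rec t
tail-arithmetic D y n H t b T 1≤y 1≤t 1≤H H≡ n≤ 1+n≤ Ht≤y 0≤b 0≤T h = *-cancelˡ (ι (H ℕ.* t)) (0<ι (1≤* {H} {t} 1≤H 1≤t)) (begin
  ι (H ℕ.* t) * T  ≤⟨ *-monoʳ T 0≤T (ι-mono Ht≤y) ⟩
  Y * T  ≤⟨ *-cancelˡ (Y * (Y * Y)) (*-pos 0<Y (*-pos 0<Y 0<Y)) cubic ⟩
  ι H * b  ≡⟨ sym (trans (cong (λ z → z * (b * rec t)) (ι-* H t)) (trans (ring-84 (ι H) (ι t) b (rec t)) (trans (cong (ι H * b *_) (ι*rec t 1≤t)) (*-identityʳ _)))) ⟩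
  ι (H ℕ.* t) * (b * rec t)  ∎)
  where
    open ℚₚ.≤-Reasoning
    Y = ι y
    0<Y : 0ℚ < Y
    0<Y = 0<ι 1≤y
    nat : ∀ d y → 3 ℕ.* (((2 ℕ.* d) ℕ.* y) ℕ.* ((2 ℕ.* d) ℕ.* y)) ℕ.* ((3 ℕ.* d) ℕ.* y) ≡ 36 ℕ.* (d ℕ.* (d ℕ.* d)) ℕ.* (y ℕ.* (y ℕ.* y))
    nat = ℕRing.solve-∀
    three≡ : 1ℚ + 1ℚ + 1ℚ ≡ ι 3
    three≡ = sym (trans (ι-+ 2 1) (cong₂ _+_ (trans (ι-+ 1 1) (cong₂ _+_ ι-1 ι-1)) ι-1))
    cubic : Y * (Y * Y) * (Y * T) ≤ Y * (Y * Y) * (ι H * b)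
    cubic = begin
      Y * (Y * Y) * (Y * T)  ≡⟨ sym (ring-85 Y T) ⟩
      sq (sq Y) * T  ≤⟨ h ⟩
      (1ℚ + 1ℚ + 1ℚ) * sq (ι n) * (b * ι (suc n))  ≡⟨ trans (cong (λ z → z * sq (ι n) * (b * ι (suc n))) three≡) (ring-86 (ι 3) (ι n) b (ι (suc n))) ⟩
      ι 3 * (ι n * ι n) * ι (suc n) * b  ≡⟨ cong (_* b) (sym (trans (ι-* (3 ℕ.* (n ℕ.* n)) (suc n)) (cong (_* ι (suc n)) (trans (ι-* 3 (n ℕ.* n)) (cong (ι 3 *_) (ι-* n n)))))) ⟩
      ι (3 ℕ.* (n ℕ.* n) ℕ.* suc n) * b  ≤⟨ *-monoʳ b 0≤b (ι-mono (ℕₚ.≤-trans (ℕₚ.*-mono-≤ (ℕₚ.*-monoʳ-≤ 3 (ℕₚ.*-mono-≤ n≤ n≤)) 1+n≤) (ℕₚ.≤-reflexive (trans (nat D y) (cong (ℕ._* (y ℕ.* (y ℕ.* y))) (sym H≡)))))) ⟩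
      ι (H ℕ.* (y ℕ.* (y ℕ.* y))) * b  ≡⟨ cong (_* b) (trans (ι-* H (y ℕ.* (y ℕ.* y))) (cong (ι H *_) (trans (ι-* y (y ℕ.* y)) (cong (Y *_) (ι-* y y))))) ⟩
      ι H * (Y * (Y * Y)) * b  ≡⟨ ring-87 (ι H) (Y * (Y * Y)) b ⟩
      Y * (Y * Y) * (ι H * b)  ∎

private
  double : ∀ a → a ℕ.* 2 ≡ a ℕ.+ a
  double = ℕRing.solve-∀

  double+1 : ∀ a → 1 ℕ.+ a ℕ.* 2 ≡ a ℕ.+ a ℕ.+ 1
  double+1 = ℕRing.solve-∀

module Assembly (Po : FinPoset) (tree : IsTreePoset Po) (K : ℕ)
    (height : ∀ m (c : Fin m → Fin (FinPoset.size Po)) → IsChain Po m c → m ℕ.≤ suc K)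
    (x₀ : Fin (FinPoset.size Po)) (t : ℕ) (1≤t : 1 ℕ.≤ t) where

  module TC = TreeCode Po tree K height

  opaque
    enc : TC.Encoding
    enc = TC.encoding x₀

  open TC.Encoding enc using (code; ρ; ranked)
  open Phases code ρ K ranked t 1≤t public

  -- Opaque, since unfolded these unary products become enormous terms.
  opaque
    D H c₁ c₂ K̂ Y₀ : ℕ
    D = 4 ℕ.* dN ℕ.+ 2
    H = 36 ℕ.* (D ℕ.* (D ℕ.* D))
    c₁ = (3 ℕ.* D) ℕ.* (ηN ℕ.* (6 ℕ.* Q))
    c₂ = ηN ℕ.* Λ ℕ.* Q
    K̂ = (2 ℕ.* D) ℕ.* (c₁ ℕ.+ c₂) ℕ.+ (12 ℕ.* (D ℕ.* D)) ℕ.* c₁ ℕ.+ 4 ℕ.* Λ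
    Y₀ = suc (6 ℕ.* s₀) ℕ.+ H ℕ.* t ℕ.+ K̂

  n₀ : ℕ
  n₀ = D ℕ.* Y₀

  opaque
    unfolding D

    D-def : D ≡ 4 ℕ.* dN ℕ.+ 2
    D-def = refl

    H-def : H ≡ 36 ℕ.* (D ℕ.* (D ℕ.* D))
    H-def = refl

    c₁-def : c₁ ≡ (3 ℕ.* D) ℕ.* (ηN ℕ.* (6 ℕ.* Q))
    c₁-def = refl

    c₂-def : c₂ ≡ ηN ℕ.* Λ ℕ.* Q
    c₂-def = refl

    K̂-def : K̂ ≡ (2 ℕ.* D) ℕ.* (c₁ ℕ.+ c₂) ℕ.+ (12 ℕ.* (D ℕ.* D)) ℕ.* c₁ ℕ.+ 4 ℕ.* Λ
    K̂-def = refl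

    Y₀-def : Y₀ ≡ suc (6 ℕ.* s₀) ℕ.+ H ℕ.* t ℕ.+ K̂
    Y₀-def = refl

  private
    sum-≥ : ∀ {x} a b c → x ≡ a ℕ.+ b ℕ.+ c → a ℕ.≤ x × b ℕ.≤ x × c ℕ.≤ x
    sum-≥ a b c refl = ℕₚ.≤-trans (ℕₚ.m≤m+n a b) (ℕₚ.m≤m+n (a ℕ.+ b) c) , ℕₚ.≤-trans (ℕₚ.m≤n+m b a) (ℕₚ.m≤m+n (a ℕ.+ b) c) , ℕₚ.m≤n+m c (a ℕ.+ b)

  -- The summands serve, in this order, the size of a fingerprint, the exponent in the count, and
  -- the factor 4Λ left over from the count of second parts.
  K̂-≥ : (2 ℕ.* D) ℕ.* (c₁ ℕ.+ c₂) ℕ.≤ K̂ × (12 ℕ.* (D ℕ.* D)) ℕ.* c₁ ℕ.≤ K̂ × 4 ℕ.* Λ ℕ.≤ K̂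
  K̂-≥ = sum-≥ _ _ _ K̂-def

  -- The summands serve the lower bound on `s`, the tail estimate, and the comparison of the number
  -- of picks with `M`.
  Y₀-≥ : suc (6 ℕ.* s₀) ℕ.≤ Y₀ × H ℕ.* t ℕ.≤ Y₀ × K̂ ℕ.≤ Y₀
  Y₀-≥ = sum-≥ _ _ _ Y₀-def

  1≤D : 1 ℕ.≤ D
  1≤D = subst (1 ℕ.≤_) (sym D-def) (ℕₚ.≤-trans (s≤s z≤n) (ℕₚ.m≤n+m 2 (4 ℕ.* dN)))

  1≤H : 1 ℕ.≤ H
  1≤H = subst (1 ℕ.≤_) (sym H-def) (1≤* {36} (s≤s z≤n) (1≤* 1≤D (1≤* 1≤D 1≤D)))

  1≤K̂ : 1 ℕ.≤ K̂
  1≤K̂ = ℕₚ.≤-trans (s≤s z≤n) (proj₂ (proj₂ K̂-≥))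

  instance
    D≢0 : ℕ.NonZero D
    D≢0 = ℕ.>-nonZero 1≤D

  module AtLarge (n : ℕ) (n₀≤n : n₀ ℕ.≤ n) where

    b : ℕ
    b = central n

    opaque
      -- The window from `lo` to `n - lo` spans about `y`, a fraction 1/D of all levels: narrow
      -- enough for a drift of at most `1/dN`, wide enough to leave at most b/t sets outside.
      y lo : ℕ
      y = n ℕ./ D
      lo = (n ∸ y) ℕ./ 2

    opaque
      unfolding y

      Dy≤n : D ℕ.* y ℕ.≤ n
      Dy≤n = subst (ℕ._≤ n) (ℕₚ.*-comm y D) (m/n*n≤m n D)

      n≤Dy+D : n ℕ.≤ D ℕ.* y ℕ.+ D
      n≤Dy+D = ℕₚ.≤-trans (ℕₚ.≤-reflexive (m≡m%n+[m/n]*n n D)) (ℕₚ.≤-trans (ℕₚ.+-monoˡ-≤ (y ℕ.* D) (ℕₚ.<⇒≤ (m%n<n n D))) (ℕₚ.≤-reflexive (trans (ℕₚ.+-comm D (y ℕ.* D)) (cong (ℕ._+ D) (ℕₚ.*-comm y D)))))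

      Y₀≤y : Y₀ ℕ.≤ y
      Y₀≤y = quotient-≥ Y₀ D n (subst (ℕ._≤ n) (ℕₚ.*-comm D Y₀) n₀≤n)

      1≤y : 1 ℕ.≤ y
      1≤y = ℕₚ.≤-trans (ℕₚ.≤-trans (s≤s z≤n) (proj₁ Y₀-≥)) Y₀≤y

      y≤n : y ℕ.≤ n
      y≤n = ℕₚ.≤-trans (ℕₚ.m≤n*m y D) Dy≤n

      2lo+y≤n : lo ℕ.+ lo ℕ.+ y ℕ.≤ n
      2lo+y≤n = ℕₚ.≤-trans (ℕₚ.+-monoˡ-≤ y (subst (ℕ._≤ n ∸ y) (double lo) (m/n*n≤m (n ∸ y) 2))) (ℕₚ.≤-reflexive (ℕₚ.m∸n+n≡m y≤n))

      n≤2lo+1+y : n ℕ.≤ lo ℕ.+ lo ℕ.+ 1 ℕ.+ y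
      n≤2lo+1+y = ℕₚ.≤-trans (ℕₚ.≤-reflexive (sym (ℕₚ.m∸n+n≡m y≤n))) (ℕₚ.+-monoˡ-≤ y (ℕₚ.≤-trans (ℕₚ.≤-reflexive (m≡m%n+[m/n]*n (n ∸ y) 2)) (ℕₚ.≤-trans (ℕₚ.+-monoˡ-≤ (lo ℕ.* 2) (ℕₚ.≤-pred (m%n<n (n ∸ y) 2))) (ℕₚ.≤-reflexive (double+1 lo)))))

    -- The origin of D = 4 dN + 2: from D y ≤ n ≤ 2 lo + 1 + y and y ≥ 1 one gets 2 dN (y + 1) ≤ 2
    -- lo.
    width≤lo : dN ℕ.* (y ℕ.+ 1) ℕ.≤ lo
    width≤lo = ℕₚ.*-cancelˡ-≤ 2 (ℕₚ.+-cancelʳ-≤ 1 _ _ (ℕₚ.+-cancelʳ-≤ y _ _ (begin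
      2 ℕ.* (dN ℕ.* (y ℕ.+ 1)) ℕ.+ 1 ℕ.+ y  ≡⟨ lem₁ dN y ⟩
      (2 ℕ.* dN ℕ.+ 1) ℕ.* y ℕ.+ (2 ℕ.* dN ℕ.+ 1) ℕ.* 1  ≤⟨ ℕₚ.+-monoʳ-≤ ((2 ℕ.* dN ℕ.+ 1) ℕ.* y) (ℕₚ.*-monoʳ-≤ (2 ℕ.* dN ℕ.+ 1) 1≤y) ⟩
      (2 ℕ.* dN ℕ.+ 1) ℕ.* y ℕ.+ (2 ℕ.* dN ℕ.+ 1) ℕ.* y  ≡⟨ trans (lem₂ dN y) (cong (ℕ._* y) (sym D-def)) ⟩
      D ℕ.* y  ≤⟨ ℕₚ.≤-trans Dy≤n n≤2lo+1+y ⟩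
      lo ℕ.+ lo ℕ.+ 1 ℕ.+ y  ≡⟨ cong (λ z → lo ℕ.+ z ℕ.+ 1 ℕ.+ y) (sym (ℕₚ.+-identityʳ lo)) ⟩
      2 ℕ.* lo ℕ.+ 1 ℕ.+ y  ∎)))
      where
        open ℕₚ.≤-Reasoning
        lem₁ : ∀ d y → 2 ℕ.* (d ℕ.* (y ℕ.+ 1)) ℕ.+ 1 ℕ.+ y ≡ (2 ℕ.* d ℕ.+ 1) ℕ.* y ℕ.+ (2 ℕ.* d ℕ.+ 1) ℕ.* 1
        lem₁ = ℕRing.solve-∀
        lem₂ : ∀ d y → (2 ℕ.* d ℕ.+ 1) ℕ.* y ℕ.+ (2 ℕ.* d ℕ.+ 1) ℕ.* y ≡ (4 ℕ.* d ℕ.+ 2) ℕ.* y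
        lem₂ = ℕRing.solve-∀

    y≤lo : y ℕ.≤ lo
    y≤lo = ℕₚ.≤-trans (ℕₚ.≤-trans (ℕₚ.m≤m+n y 1) (ℕₚ.m≤n*m (y ℕ.+ 1) dN {{ℕ.>-nonZero 1≤dN}})) width≤lo

    opaque
      1≤lo : 1 ℕ.≤ lo
      1≤lo = ℕₚ.≤-trans 1≤y y≤lo

    1≤n : 1 ℕ.≤ n
    1≤n = ℕₚ.≤-trans 1≤y y≤n

    opaque
      small-drift : ι ((n ∸ lo) ∸ lo) * rec lo ≤ rec dN
      small-drift = *-cancelˡ (ι dN) (0<ι 1≤dN) (begin
        ι dN * (ι w * rec lo)  ≡⟨ trans (sym (*-assoc (ι dN) (ι w) (rec lo))) (cong (_* rec lo) (sym (ι-* dN w))) ⟩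
        ι (dN ℕ.* w) * rec lo  ≤⟨ *-monoʳ (rec lo) (0≤rec lo) (ι-mono (ℕₚ.≤-trans (ℕₚ.*-monoʳ-≤ dN w≤) width≤lo)) ⟩
        ι lo * rec lo  ≡⟨ trans (ι*rec lo 1≤lo) (sym (ι*rec dN 1≤dN)) ⟩
        ι dN * rec dN  ∎)
        where
          open ℚₚ.≤-Reasoning
          w : ℕ
          w = (n ∸ lo) ∸ lo
          w≤ : w ℕ.≤ y ℕ.+ 1
          w≤ = ℕₚ.≤-trans (ℕₚ.≤-reflexive (ℕₚ.∸-+-assoc n lo lo)) (ℕₚ.m≤n+o⇒m∸n≤o n (lo ℕ.+ lo) (ℕₚ.≤-trans n≤2lo+1+y (ℕₚ.≤-reflexive (lem lo y))))
            where
              lem : ∀ a y → a ℕ.+ a ℕ.+ 1 ℕ.+ y ≡ a ℕ.+ a ℕ.+ (y ℕ.+ 1)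
              lem = ℕRing.solve-∀

    opaque
      s₀≤lo : 6 ℕ.* s₀ ℕ.≤ lo
      s₀≤lo = ℕₚ.≤-trans (ℕₚ.≤-trans (ℕₚ.≤-trans (ℕₚ.n≤1+n (6 ℕ.* s₀)) (proj₁ Y₀-≥)) Y₀≤y) y≤lo

    open At n lo 1≤lo small-drift s₀≤lo
    open CentralBinomial n using (length≤; ∑𝟙≤)

    n≤2Dy : n ℕ.≤ (2 ℕ.* D) ℕ.* y
    n≤2Dy = begin
      n  ≤⟨ n≤Dy+D ⟩
      D ℕ.* y ℕ.+ D  ≡⟨ cong (D ℕ.* y ℕ.+_) (sym (ℕₚ.*-identityʳ D)) ⟩
      D ℕ.* y ℕ.+ D ℕ.* 1  ≤⟨ ℕₚ.+-monoʳ-≤ (D ℕ.* y) (ℕₚ.*-monoʳ-≤ D 1≤y) ⟩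
      D ℕ.* y ℕ.+ D ℕ.* y  ≡⟨ lem D y ⟩
      (2 ℕ.* D) ℕ.* y  ∎
      where
        open ℕₚ.≤-Reasoning
        lem : ∀ d y → d ℕ.* y ℕ.+ d ℕ.* y ≡ (2 ℕ.* d) ℕ.* y
        lem = ℕRing.solve-∀

    1+n≤3Dy : suc n ℕ.≤ (3 ℕ.* D) ℕ.* y
    1+n≤3Dy = begin
      1 ℕ.+ n  ≤⟨ ℕₚ.+-mono-≤ (1≤* 1≤D 1≤y) n≤2Dy ⟩
      D ℕ.* y ℕ.+ (2 ℕ.* D) ℕ.* y  ≡⟨ lem D y ⟩
      (3 ℕ.* D) ℕ.* y  ∎
      where
        open ℕₚ.≤-Reasoning
        lem : ∀ d y → d ℕ.* y ℕ.+ (2 ℕ.* d) ℕ.* y ≡ (3 ℕ.* d) ℕ.* y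
        lem = ℕRing.solve-∀

    Outer : Family n
    Outer v = not (Mid v)

    outer-far : ∀ v → Outer v ≡ true → Σ Bool λ d → co d v ℕ.+ y ℕ.≤ co (not d) v
    outer-far v e = split (lo ℕ.≤? co true v) (lo ℕ.≤? co false v)
      where
        far : ∀ d → ¬ (lo ℕ.≤ co d v) → co d v ℕ.+ y ℕ.≤ co (not d) v
        far d h = ℕₚ.+-cancelˡ-≤ (co d v) _ _ (ℕₚ.≤-trans (ℕₚ.≤-reflexive (sym (ℕₚ.+-assoc (co d v) (co d v) y))) (ℕₚ.≤-trans (ℕₚ.+-monoˡ-≤ y (ℕₚ.+-mono-≤ (ℕₚ.<⇒≤ (ℕₚ.≰⇒> h)) (ℕₚ.<⇒≤ (ℕₚ.≰⇒> h)))) (ℕₚ.≤-trans 2lo+y≤n (ℕₚ.≤-reflexive (sym (co-not d v))))))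
        split : Dec (lo ℕ.≤ co true v) → Dec (lo ℕ.≤ co false v) → Σ Bool λ d → co d v ℕ.+ y ℕ.≤ co (not d) v
        split (no h) _ = true , far true h
        split (yes _) (no h) = false , far false h
        split (yes p) (yes q) = case trans (sym e) (cong not (Mid-intro v p q)) of λ ()

    outer-size : ∑ all (λ v → 𝟙 (Outer v)) ≤ ι b * rec t
    outer-size = tail-arithmetic D y n H t (ι b) _ 1≤y 1≤t 1≤H H-def n≤2Dy 1+n≤3Dy (ℕₚ.≤-trans (proj₁ (proj₂ Y₀-≥)) Y₀≤y) (0≤ι b)
      (∑-nn (all {n}) (λ v → 0≤𝟙 (Outer v)))
      (≤-trans (tail-bound Outer y outer-far) (*-monoˡ _ (*-nn (+-nn (+-nn 0≤1 0≤1) 0≤1) (*-nn (0≤ι n) (0≤ι n))) (2^n≤ n)))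

    opaque
      -- The bounds that `few` gives for the numbers of picks, rounded down.
      N₁ N₂ : ℕ
      N₁ = ℕ._/_ (b ℕ.* (fuel₁ ℕ.* (6 ℕ.* Q))) lo³ {{ℕ.>-nonZero 1≤lo³}}
      N₂ = ℕ._/_ (b ℕ.* (fuel₂ ℕ.* Q)) lo {{ℕ.>-nonZero 1≤lo}}

      N₁-≤ : N₁ ℕ.* lo³ ℕ.≤ b ℕ.* (fuel₁ ℕ.* (6 ℕ.* Q))
      N₁-≤ = m/n*n≤m _ lo³ {{ℕ.>-nonZero 1≤lo³}}

      N₂-≤ : N₂ ℕ.* lo ℕ.≤ b ℕ.* (fuel₂ ℕ.* Q)
      N₂-≤ = m/n*n≤m _ lo {{ℕ.>-nonZero 1≤lo}}

      N₁-max : ∀ a → a ℕ.* lo³ ℕ.≤ b ℕ.* (fuel₁ ℕ.* (6 ℕ.* Q)) → a ℕ.≤ N₁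
      N₁-max a = quotient-≥ a lo³ _ {{ℕ.>-nonZero 1≤lo³}}

      N₂-max : ∀ a → a ℕ.* lo ℕ.≤ b ℕ.* (fuel₂ ℕ.* Q) → a ℕ.≤ N₂
      N₂-max a = quotient-≥ a lo _ {{ℕ.>-nonZero 1≤lo}}

    opaque
      unfolding _+_

      ring-88 : ∀ b f q r l → b * (f * (q * r)) * l ≡ b * (f * q) * (l * r)
      ring-88 = solve-∀ ℚring

    few : ∀ (xs : List (Subset n)) (f q l : ℕ) → 1 ℕ.≤ l → ∑ xs chainWeight ≤ ι f * (ι q * rec l) → length xs ℕ.* l ℕ.≤ b ℕ.* (f ℕ.* q)
    few xs f q l 1≤l h = ι-cancel-≤ (begin
      ι (length xs ℕ.* l)  ≡⟨ ι-* (length xs) l ⟩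
      ι (length xs) * ι l  ≤⟨ *-monoʳ (ι l) (0≤ι l) (≤-trans (length≤ xs) (*-monoˡ (ι b) (0≤ι b) h)) ⟩
      ι b * (ι f * (ι q * rec l)) * ι l  ≡⟨ ring-88 (ι b) (ι f) (ι q) (rec l) (ι l) ⟩
      ι b * (ι f * ι q) * (ι l * rec l)  ≡⟨ trans (cong (ι b * (ι f * ι q) *_) (ι*rec l 1≤l)) (*-identityʳ _) ⟩
      ι b * (ι f * ι q)  ≡⟨ sym (trans (ι-* b (f ℕ.* q)) (cong (ι b *_) (ι-* f q))) ⟩
      ι (b ℕ.* (f ℕ.* q))  ∎)
      where
        open ℚₚ.≤-Reasoning

    -- The fuel of the first phase is of order `n`, hence of order `lo`, and cancels one of the
    -- three factors `lo` gained from gap 3. The remaining two make `exponent` of order b/n.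
    N₁-bound : N₁ ℕ.* (lo ℕ.* lo) ℕ.≤ c₁ ℕ.* b
    N₁-bound = ℕₚ.*-cancelˡ-≤ lo {{ℕ.>-nonZero 1≤lo}} (begin
      lo ℕ.* (N₁ ℕ.* (lo ℕ.* lo))  ≡⟨ lem₁ lo N₁ ⟩
      N₁ ℕ.* lo³  ≤⟨ N₁-≤ ⟩
      b ℕ.* (ηN ℕ.* suc n ℕ.* (6 ℕ.* Q))  ≤⟨ ℕₚ.*-monoʳ-≤ b (ℕₚ.*-monoˡ-≤ (6 ℕ.* Q) (ℕₚ.*-monoʳ-≤ ηN (ℕₚ.≤-trans 1+n≤3Dy (ℕₚ.*-monoʳ-≤ (3 ℕ.* D) y≤lo)))) ⟩
      b ℕ.* (ηN ℕ.* ((3 ℕ.* D) ℕ.* lo) ℕ.* (6 ℕ.* Q))  ≡⟨ trans (lem₂ b ηN (3 ℕ.* D) lo (6 ℕ.* Q)) (cong (λ z → lo ℕ.* (z ℕ.* b)) (sym c₁-def)) ⟩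
      lo ℕ.* (c₁ ℕ.* b)  ∎)
      where
        open ℕₚ.≤-Reasoning
        lem₁ : ∀ l N → l ℕ.* (N ℕ.* (l ℕ.* l)) ≡ N ℕ.* (l ℕ.* (l ℕ.* l))
        lem₁ = ℕRing.solve-∀
        lem₂ : ∀ b e d l q → b ℕ.* (e ℕ.* (d ℕ.* l) ℕ.* q) ≡ l ℕ.* (d ℕ.* (e ℕ.* q) ℕ.* b)
        lem₂ = ℕRing.solve-∀

    N₂-bound : N₂ ℕ.* lo ℕ.≤ c₂ ℕ.* b
    N₂-bound = ℕₚ.≤-trans N₂-≤ (ℕₚ.≤-reflexive (trans (ℕₚ.*-comm b (fuel₂ ℕ.* Q)) (cong (ℕ._* b) (sym c₂-def))))

    n≤2Dlo : n ℕ.≤ (2 ℕ.* D) ℕ.* lo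
    n≤2Dlo = ℕₚ.≤-trans n≤2Dy (ℕₚ.*-monoʳ-≤ (2 ℕ.* D) y≤lo)

    size-bound : (N₁ ℕ.+ N₂) ℕ.* n ℕ.≤ K̂ ℕ.* b
    size-bound = begin
      (N₁ ℕ.+ N₂) ℕ.* n  ≤⟨ ℕₚ.*-monoʳ-≤ (N₁ ℕ.+ N₂) n≤2Dlo ⟩
      (N₁ ℕ.+ N₂) ℕ.* ((2 ℕ.* D) ℕ.* lo)  ≡⟨ lem N₁ N₂ (2 ℕ.* D) lo ⟩
      (2 ℕ.* D) ℕ.* (N₁ ℕ.* lo ℕ.+ N₂ ℕ.* lo)  ≤⟨ ℕₚ.*-monoʳ-≤ (2 ℕ.* D) (ℕₚ.+-mono-≤ (ℕₚ.≤-trans (ℕₚ.*-monoʳ-≤ N₁ (ℕₚ.m≤m*n lo lo {{ℕ.>-nonZero 1≤lo}})) N₁-bound) N₂-bound) ⟩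
      (2 ℕ.* D) ℕ.* (c₁ ℕ.* b ℕ.+ c₂ ℕ.* b)  ≡⟨ lem2 (2 ℕ.* D) c₁ c₂ b ⟩
      (2 ℕ.* D) ℕ.* (c₁ ℕ.+ c₂) ℕ.* b  ≤⟨ ℕₚ.*-monoˡ-≤ b (proj₁ K̂-≥) ⟩
      K̂ ℕ.* b  ∎
      where
        open ℕₚ.≤-Reasoning
        lem : ∀ p q d l → (p ℕ.+ q) ℕ.* (d ℕ.* l) ≡ d ℕ.* (p ℕ.* l ℕ.+ q ℕ.* l)
        lem = ℕRing.solve-∀
        lem2 : ∀ d p q b → d ℕ.* (p ℕ.* b ℕ.+ q ℕ.* b) ≡ d ℕ.* (p ℕ.+ q) ℕ.* b
        lem2 = ℕRing.solve-∀

    exponent : ℕ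
    exponent = suc n ℕ.* N₁

    exponent-bound : 2 ℕ.* exponent ℕ.* n ℕ.≤ K̂ ℕ.* b
    exponent-bound = begin
      2 ℕ.* (suc n ℕ.* N₁) ℕ.* n  ≤⟨ ℕₚ.*-mono-≤ (ℕₚ.*-monoʳ-≤ 2 (ℕₚ.*-monoˡ-≤ N₁ (ℕₚ.≤-trans 1+n≤3Dy (ℕₚ.*-monoʳ-≤ (3 ℕ.* D) y≤lo)))) n≤2Dlo ⟩
      2 ℕ.* ((3 ℕ.* D) ℕ.* lo ℕ.* N₁) ℕ.* ((2 ℕ.* D) ℕ.* lo)  ≡⟨ lem D lo N₁ ⟩
      (12 ℕ.* (D ℕ.* D)) ℕ.* (N₁ ℕ.* (lo ℕ.* lo))  ≤⟨ ℕₚ.*-monoʳ-≤ (12 ℕ.* (D ℕ.* D)) N₁-bound ⟩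
      (12 ℕ.* (D ℕ.* D)) ℕ.* (c₁ ℕ.* b)  ≡⟨ sym (ℕₚ.*-assoc (12 ℕ.* (D ℕ.* D)) c₁ b) ⟩
      (12 ℕ.* (D ℕ.* D)) ℕ.* c₁ ℕ.* b  ≤⟨ ℕₚ.*-monoˡ-≤ b (proj₁ (proj₂ K̂-≥)) ⟩
      K̂ ℕ.* b  ∎
      where
        open ℕₚ.≤-Reasoning
        lem : ∀ d l N → 2 ℕ.* ((3 ℕ.* d) ℕ.* l ℕ.* N) ℕ.* ((2 ℕ.* d) ℕ.* l) ≡ (12 ℕ.* (d ℕ.* d)) ℕ.* (N ℕ.* (l ℕ.* l))
        lem = ℕRing.solve-∀

    M : ℕ
    M = Λ ℕ.* b

    -- Lets `count` dismiss all sizes above `M`. It follows from `size-bound` once n ≥ K̂, which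
    -- `Y₀` secures.
    N₁+N₂≤M : N₁ ℕ.+ N₂ ℕ.≤ M
    N₁+N₂≤M = ℕₚ.*-cancelʳ-≤ (N₁ ℕ.+ N₂) M n {{ℕ.>-nonZero 1≤n}} (begin
      (N₁ ℕ.+ N₂) ℕ.* n  ≤⟨ size-bound ⟩
      K̂ ℕ.* b  ≤⟨ ℕₚ.*-monoˡ-≤ b (ℕₚ.≤-trans (proj₂ (proj₂ Y₀-≥)) (ℕₚ.≤-trans Y₀≤y y≤n)) ⟩
      n ℕ.* b  ≡⟨ ℕₚ.*-comm n b ⟩
      b ℕ.* n  ≤⟨ ℕₚ.*-monoˡ-≤ n (ℕₚ.m≤n*m b Λ) ⟩
      M ℕ.* n  ∎)
      where open ℕₚ.≤-Reasoning

    decode₁ : Family n → Σ (Family n) (_⊆F Mid)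
    decode₁ f = run f alg₁

    -- The candidates for the second part must be determined by the first part alone. An arbitrary
    -- `F₁` may decode to a heavy family; the empty pool in that case keeps every pool below `M`.
    -- Leaving out `F₁` makes the two parts disjoint.
    pool : List (Subset n) → List (Subset n)
    pool F₁ = if does (weight (proj₁ (decode₁ (mem F₁))) ≤? ι Λ)
      then filterᵇ (λ v → proj₁ (decode₁ (mem F₁)) v ∧ not (mem F₁ v)) all
      else []

    pool-length : ∀ F₁ → length (pool F₁) ℕ.≤ M
    pool-length F₁ with weight (proj₁ (decode₁ (mem F₁))) ≤? ι Λ
    ... | no _ = z≤n
    ... | yes light = ι-cancel-≤ (begin
      ι (length (filterᵇ p all))  ≡⟨ sym (trans (∑-const (filterᵇ p (all {n})) 1ℚ) (*-identityʳ _)) ⟩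
      ∑ (filterᵇ p all) (λ _ → 1ℚ)  ≡⟨ trans (∑-filterᵇ p (all {n}) (λ _ → 1ℚ)) (∑-cong (all {n}) (λ v → *-identityʳ _)) ⟩
      ∑ all (λ v → 𝟙 (p v))  ≤⟨ ∑-mono (all {n}) (λ v → 𝟙-mono (Boolₚ.∧-conicalˡ (A₁ v) _)) ⟩
      ∑ all (λ v → 𝟙 (A₁ v))  ≤⟨ ∑𝟙≤ A₁ ⟩
      ι b * weight A₁  ≤⟨ *-monoˡ (ι b) (0≤ι b) light ⟩
      ι b * ι Λ  ≡⟨ trans (*-comm (ι b) (ι Λ)) (sym (ι-* Λ b)) ⟩
      ι M  ∎)
      where
        open ℚₚ.≤-Reasoning
        A₁ = proj₁ (decode₁ (mem F₁))
        p : Family n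
        p v = A₁ v ∧ not (mem F₁ v)

    pool-∈ : ∀ F₁ v → v ∈ pool F₁ → mem F₁ v ≡ false
    pool-∈ F₁ v v∈ with weight (proj₁ (decode₁ (mem F₁))) ≤? ι Λ
    ... | yes _ with mem F₁ v | Boolₚ.∧-conicalʳ (proj₁ (decode₁ (mem F₁)) v) _ (proj₂ (filterᵇ-∈ _ (all {n}) v∈))
    ...   | false | _ = refl

    pool-∈⁺ : ∀ F₁ v → weight (proj₁ (decode₁ (mem F₁))) ≤ ι Λ → proj₁ (decode₁ (mem F₁)) v ≡ true → mem F₁ v ≡ false → v ∈ pool F₁
    pool-∈⁺ F₁ v light e e' rewrite dec-true (weight (proj₁ (decode₁ (mem F₁))) ≤? ι Λ) light =
      filterᵇ-∈⁺ _ all (∈-allSubsets v) (cong₂ (λ a b → a ∧ not b) e e')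

    pool-unique : ∀ F₁ → AllPairs _≢_ (pool F₁)
    pool-unique F₁ with weight (proj₁ (decode₁ (mem F₁))) ≤? ι Λ
    ... | no _ = []
    ... | yes _ = filterᵇ-unique _ all (allSubsets-unique n)

    pair : List (Subset n) → List (Subset n) → List (Family n)
    pair F₁ F₂ = mem F₁ ∷ mem F₂ ∷ []

    second-parts : List (Subset n) → List (List (Family n))
    second-parts F₁ = map (pair F₁) (small N₂ (pool F₁))

    fingerprints : List (List (Family n))
    fingerprints = concatMap second-parts (small N₁ all)

    record IsPair (T : List (Family n)) : Set where
      field
        F₁ F₂ : List (Subset n)
        T≡ : T ≡ pair F₁ F₂
        F₁∈ : F₁ ∈ small N₁ all
        F₂∈ : F₂ ∈ small N₂ (pool F₁)

    fingerprints⁻ : ∀ T → T ∈ fingerprints → IsPair T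
    fingerprints⁻ T T∈ with find (∈-concatMap⁻ second-parts T∈)
    ... | F₁ , F₁∈ , T∈' with ∈-map⁻ (pair F₁) T∈'
    ...   | F₂ , F₂∈ , e = record { F₁ = F₁ ; F₂ = F₂ ; T≡ = e ; F₁∈ = F₁∈ ; F₂∈ = F₂∈ }

    F₂-outside : ∀ F₁ F₂ → F₂ ∈ small N₂ (pool F₁) → ∀ v → mem F₂ v ≡ true → mem F₁ v ≡ false
    F₂-outside F₁ F₂ F₂∈ v e = let (j , _ , c) = small⇒combos N₂ (pool F₁) F₂∈ in pool-∈ F₁ v (proj₂ (combos-chosen j (pool F₁) c) (mem⁻ e))

    size-pair : ∀ F₁ F₂ → F₁ ∈ small N₁ all → F₂ ∈ small N₂ (pool F₁) → ∣ ⋃ (pair F₁ F₂) ∣F ≡ length F₁ ℕ.+ length F₂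
    size-pair F₁ F₂ F₁∈ F₂∈ = ι-injective (trans (ι-card (⋃ (pair F₁ F₂))) (trans (∑-cong (all {n}) term) (trans (∑-+ (all {n}) _ _) (trans (cong₂ _+_ (∑-mem F₁ u₁) (∑-mem F₂ u₂)) (sym (ι-+ (length F₁) (length F₂)))))))
      where
        ι-injective : ∀ {a b} → ι a ≡ ι b → a ≡ b
        ι-injective e = ℕₚ.≤-antisym (ι-cancel-≤ (≤-reflexive e)) (ι-cancel-≤ (≤-reflexive (sym e)))
        u₁ : AllPairs _≢_ F₁
        u₁ = let (j , _ , c) = small⇒combos N₁ all F₁∈ in combos-unique j all (allSubsets-unique n) c
        u₂ : AllPairs _≢_ F₂
        u₂ = let (j , _ , c) = small⇒combos N₂ (pool F₁) F₂∈ in combos-unique j (pool F₁) (pool-unique F₁) c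
        term : ∀ v → 𝟙 (mem F₁ v ∨ (mem F₂ v ∨ false)) ≡ 𝟙 (mem F₁ v) + 𝟙 (mem F₂ v)
        term v with mem F₁ v in e₁ | mem F₂ v in e₂
        ... | true | true = case trans (sym e₁) (F₂-outside F₁ F₂ F₂∈ v e₂) of λ ()
        ... | true | false = sym (+-identityʳ 1ℚ)
        ... | false | true = sym (+-identityˡ 1ℚ)
        ... | false | false = sym (+-identityˡ 0ℚ)

    length-small-≤ : ∀ {X : Set} N (xs : List X) {ys} → ys ∈ small N xs → length ys ℕ.≤ N
    length-small-≤ N xs ys∈ = let (j , j≤N , c) = small⇒combos N xs ys∈ in subst (ℕ._≤ N) (sym (proj₁ (combos-chosen j xs c))) j≤N

    size≤ : ∀ T → T ∈ fingerprints → ∣ ⋃ T ∣F ℕ.≤ N₁ ℕ.+ N₂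
    size≤ T T∈ with fingerprints⁻ T T∈
    ... | record { F₁ = F₁ ; F₂ = F₂ ; T≡ = refl ; F₁∈ = F₁∈ ; F₂∈ = F₂∈ } =
      subst (ℕ._≤ N₁ ℕ.+ N₂) (sym (size-pair F₁ F₂ F₁∈ F₂∈)) (ℕₚ.+-mono-≤ (length-small-≤ N₁ all F₁∈) (length-small-≤ N₂ (pool F₁) F₂∈))

    ι-countSize : ∀ (𝒯 : List (List (Family n))) s → ι (countSize 𝒯 s) ≡ ∑ 𝒯 (λ T → 𝟙 (does (∣ ⋃ T ∣F ℕ.≟ s)))
    ι-countSize [] s = ι-0
    ι-countSize (T ∷ 𝒯) s with does (∣ ⋃ T ∣F ℕ.≟ s)
    ... | true = trans (ι-+ 1 (countSize 𝒯 s)) (cong₂ _+_ ι-1 (ι-countSize 𝒯 s))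
    ... | false = trans (ι-countSize 𝒯 s) (sym (+-identityˡ _))

    -- There are at most 2^exponent first parts, and `∑-small-total` allows each of them M^s / s!
    -- completions to size `s`.
    count : ∀ s → ι (countSize fingerprints s) * ι (s ℕ.!) ≤ ι (2 ℕ.^ exponent) * ι (M ℕ.^ s)
    count s with s ℕ.≤? M
    ... | no s≰M = ≤-trans (≤-reflexive (trans (cong (_* ι (s ℕ.!)) (trans (ι-countSize fingerprints s) (trans (∑-cong∈ fingerprints (λ T T∈ → cong 𝟙 (dec-false (∣ ⋃ T ∣F ℕ.≟ s) (λ e → s≰M (ℕₚ.≤-trans (ℕₚ.≤-reflexive (sym e)) (ℕₚ.≤-trans (size≤ T T∈) N₁+N₂≤M)))))) (∑-0 fingerprints)))) (*-zeroˡ _))) (*-nn (0≤ι (2 ℕ.^ exponent)) (0≤ι (M ℕ.^ s)))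
    ... | yes s≤M = begin
      ι (countSize fingerprints s) * ι (s ℕ.!)  ≡⟨ cong (_* ι (s ℕ.!)) (trans (ι-countSize fingerprints s) (∑-concatMap second-parts (small N₁ all) _)) ⟩
      ∑ (small N₁ all) (λ F₁ → ∑ (second-parts F₁) χ) * ι (s ℕ.!)  ≡⟨ sym (∑-*ʳ (small N₁ all) (ι (s ℕ.!)) _) ⟩
      ∑ (small N₁ all) (λ F₁ → ∑ (second-parts F₁) χ * ι (s ℕ.!))  ≤⟨ ∑-mono∈ (small N₁ all) each ⟩
      ∑ (small N₁ all) (λ _ → ι (M ℕ.^ s))  ≡⟨ ∑-const (small N₁ all) (ι (M ℕ.^ s)) ⟩
      ι (length (small N₁ (all {n}))) * ι (M ℕ.^ s)  ≤⟨ *-monoʳ (ι (M ℕ.^ s)) (0≤ι (M ℕ.^ s)) (ι-mono number) ⟩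
      ι (2 ℕ.^ exponent) * ι (M ℕ.^ s)  ∎
      where
        open ℚₚ.≤-Reasoning
        χ : List (Family n) → ℚ
        χ T = 𝟙 (does (∣ ⋃ T ∣F ℕ.≟ s))
        each : ∀ F₁ → F₁ ∈ small N₁ all → ∑ (second-parts F₁) χ * ι (s ℕ.!) ≤ ι (M ℕ.^ s)
        each F₁ F₁∈ = ≤-trans (≤-reflexive (cong (_* ι (s ℕ.!)) (trans (∑-map (pair F₁) (small N₂ (pool F₁)) χ) (∑-cong∈ (small N₂ (pool F₁)) (λ F₂ F₂∈ → cong (λ z → 𝟙 (does (z ℕ.≟ s))) (size-pair F₁ F₂ F₁∈ F₂∈))))))
          (∑-small-total N₂ (length F₁) s M (pool F₁) (pool-length F₁) s≤M)
        number : length (small N₁ (all {n})) ℕ.≤ 2 ℕ.^ exponent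
        number = ℕₚ.≤-trans (length-small N₁ (all {n})) (ℕₚ.≤-trans (ℕₚ.^-monoˡ-≤ N₁ (subst (λ z → suc z ℕ.≤ 2 ℕ.^ suc n) (sym (length-allSubsets n)) (ℕₚ.+-mono-≤ (ℕₚ.m^n>0 2 n) (ℕₚ.≤-reflexive (sym (ℕₚ.+-identityʳ (2 ℕ.^ n))))))) (ℕₚ.≤-reflexive (ℕₚ.^-*-assoc 2 (suc n) N₁)))

    opaque
      unfolding _+_

      ring-89 : ∀ a b x → a * b * x ≡ a * (x * b)
      ring-89 = solve-∀ ℚring

      ring-90 : ∀ a b c → a * (b * c) ≡ a * c * b
      ring-90 = solve-∀ ℚring

      ring-91 : ∀ a p r → a * (p * r) ≡ p * (a * r)
      ring-91 = solve-∀ ℚring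

    -- The inequality s^s ≤ 4^s s! turns M^s / s! into (4M/s)^s, and 4M ≤ K̂ b. For s = 0 both
    -- powers are 1, so the value `rec 0 = 0` does no harm.
    count-≤ : ∀ s → ι (countSize fingerprints s) ≤ powℚ (ι K̂ * ι b * rec s) s * ι (2 ℕ.^ exponent)
    count-≤ s = *-cancelˡ (ι (s ℕ.^ s)) (0<ι 1≤s^s) (begin
      ι (s ℕ.^ s) * X  ≤⟨ *-monoʳ X (0≤ι _) (ι-mono (n^n≤4^n*n! s)) ⟩
      ι (4 ℕ.^ s ℕ.* s ℕ.!) * X  ≡⟨ trans (cong (_* X) (ι-* (4 ℕ.^ s) (s ℕ.!))) (ring-89 (ι (4 ℕ.^ s)) (ι (s ℕ.!)) X) ⟩
      ι (4 ℕ.^ s) * (X * ι (s ℕ.!))  ≤⟨ *-monoˡ (ι (4 ℕ.^ s)) (0≤ι (4 ℕ.^ s)) (count s) ⟩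
      ι (4 ℕ.^ s) * (ι (2 ℕ.^ exponent) * ι (M ℕ.^ s))  ≡⟨ trans (ring-90 (ι (4 ℕ.^ s)) (ι (2 ℕ.^ exponent)) (ι (M ℕ.^ s))) (cong (_* ι (2 ℕ.^ exponent)) (trans (sym (ι-* (4 ℕ.^ s) (M ℕ.^ s))) (cong ι (sym (^-distribʳ 4 M s))))) ⟩
      ι ((4 ℕ.* M) ℕ.^ s) * ι (2 ℕ.^ exponent)  ≤⟨ *-monoʳ _ (0≤ι (2 ℕ.^ exponent)) (ι-mono (ℕₚ.^-monoˡ-≤ s 4M≤)) ⟩
      ι ((K̂ ℕ.* b) ℕ.^ s) * ι (2 ℕ.^ exponent)  ≡⟨ cong (_* ι (2 ℕ.^ exponent)) unfold ⟩
      ι (s ℕ.^ s) * powℚ (ι K̂ * ι b * rec s) s * ι (2 ℕ.^ exponent)  ≡⟨ *-assoc _ _ _ ⟩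
      ι (s ℕ.^ s) * (powℚ (ι K̂ * ι b * rec s) s * ι (2 ℕ.^ exponent)) ∎)
      where
        open ℚₚ.≤-Reasoning
        X = ι (countSize fingerprints s)
        1≤s^s : 1 ℕ.≤ s ℕ.^ s
        1≤s^s = ℕₚ.≤-trans (1≤! s) (n!≤n^n s)
        4M≤ : 4 ℕ.* M ℕ.≤ K̂ ℕ.* b
        4M≤ = ℕₚ.≤-trans (ℕₚ.≤-reflexive (sym (ℕₚ.*-assoc 4 Λ b))) (ℕₚ.*-monoˡ-≤ b (proj₂ (proj₂ K̂-≥)))
        unfold : ι ((K̂ ℕ.* b) ℕ.^ s) ≡ ι (s ℕ.^ s) * powℚ (ι K̂ * ι b * rec s) s
        unfold = sym (trans (cong (λ z → ι (s ℕ.^ s) * powℚ (z * rec s) s) (sym (ι-* K̂ b))) (trans (cong (ι (s ℕ.^ s) *_) (trans (powℚ-* (ι (K̂ ℕ.* b)) (rec s) s) (cong₂ _*_ (powℚ-ι (K̂ ℕ.* b) s) (powℚ-rec s s)))) (trans (ring-91 (ι (s ℕ.^ s)) _ _) (trans (cong (ι ((K̂ ℕ.* b) ℕ.^ s) *_) (ι*rec (s ℕ.^ s) 1≤s^s)) (*-identityʳ _)))))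

    opaque
      unfolding _+_

      ring-92 : ∀ k b n r → k * b * (n * r) ≡ n * (k * r * b)
      ring-92 = solve-∀ ℚring

    over-n : ∀ a → a ℕ.* n ℕ.≤ K̂ ℕ.* b → ι a ≤ ι K̂ * rec n * ι b
    over-n a h = *-cancelˡ (ι n) (0<ι 1≤n) (begin
      ι n * ι a  ≡⟨ trans (*-comm (ι n) (ι a)) (sym (ι-* a n)) ⟩
      ι (a ℕ.* n)  ≤⟨ ι-mono h ⟩
      ι (K̂ ℕ.* b)  ≡⟨ ι-* K̂ b ⟩
      ι K̂ * ι b  ≡⟨ sym (trans (cong (ι K̂ * ι b *_) (ι*rec n 1≤n)) (*-identityʳ _)) ⟩
      ι K̂ * ι b * (ι n * rec n)  ≡⟨ ring-92 (ι K̂) (ι b) (ι n) (rec n) ⟩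
      ι n * (ι K̂ * rec n * ι b)  ∎)
      where
        open ℚₚ.≤-Reasoning

    first-part : Family n → List (Subset n)
    first-part I = filterᵇ (mem (picks I alg₁)) all

    -- It starts from the family decoded from the first part, exactly as `container` will, so
    -- membership in `fingerprints` can be shown for arbitrary `I`.
    second-query : Family n → Query (Subset n) (Σ (Family n) (_⊆F Mid))
    second-query I = alg₂ (decode₁ (mem (first-part I)))

    -- Second-phase picks that already belong to the first part are not repeated, since the pool
    -- omits them; `container` therefore answers the second query from the union of both parts.
    second-part : Family n → List (Subset n)
    second-part I = filterᵇ (mem (picks I (second-query I))) (pool (first-part I))

    fingerprint : Family n → List (Family n)
    fingerprint I = pair (first-part I) (second-part I)

    container : List (Family n) → Family n
    container (f₁ ∷ f₂ ∷ []) v = Outer v ∨ proj₁ (run (λ u → f₁ u ∨ f₂ u) (alg₂ (decode₁ f₁))) v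
    container _ _ = true

    fingerprint-∈ : ∀ I → fingerprint I ∈ fingerprints
    fingerprint-∈ I = ∈-concatMap⁺ second-parts (lose F₁∈ (∈-map⁺ (pair F₁) F₂∈))
      where
        F₁ = first-part I
        F₁∈ : F₁ ∈ small N₁ all
        F₁∈ = combos⇒small N₁ (length F₁) all (ℕₚ.≤-trans (ι-cancel-≤ (length-filter-mem≤ (picks I alg₁) all (allSubsets-unique n))) (N₁-max _ (few (picks I alg₁) fuel₁ (6 ℕ.* Q) lo³ 1≤lo³ (alg₁-picks I)))) (filterᵇ∈combos _ all)
        F₂∈ : second-part I ∈ small N₂ (pool F₁)
        F₂∈ = combos⇒small N₂ (length (second-part I)) (pool F₁) (ℕₚ.≤-trans (ι-cancel-≤ (length-filter-mem≤ (picks I (second-query I)) (pool F₁) (pool-unique F₁))) (N₂-max _ (few (picks I (second-query I)) fuel₂ Q lo 1≤lo (alg₂-picks I (decode₁ (mem F₁)))))) (filterᵇ∈combos _ (pool F₁))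

    first-⊆ : ∀ I v → mem (first-part I) v ≡ true → I v ≡ true
    first-⊆ I v e = picks⊆ I alg₁ v (mem⁻ (proj₂ (filterᵇ-∈ (mem (picks I alg₁)) all (mem⁻ e))))

    second-⊆ : ∀ I v → mem (second-part I) v ≡ true → I v ≡ true
    second-⊆ I v e = picks⊆ I (second-query I) v (mem⁻ (proj₂ (filterᵇ-∈ (mem (picks I (second-query I))) (pool (first-part I)) (mem⁻ e))))

    fingerprint-⊆ : ∀ I → ⋃ (fingerprint I) ⊆F I
    fingerprint-⊆ I v e with mem (first-part I) v in e₁ | mem (second-part I) v in e₂
    ... | true | _ = first-⊆ I v e₁
    ... | false | true = second-⊆ I v e₂

    module _ (I : Family n) (free : Free I) where

      replay₁ : decode₁ (mem (first-part I)) ≡ run I alg₁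
      replay₁ = replay I (mem (first-part I)) alg₁ (λ v v∈ → mem⁺ (filterᵇ-∈⁺ _ all (∈-allSubsets v) (mem⁺ v∈))) (first-⊆ I)

      -- The union covers all picks of the second query: a pick outside the first part lies in the
      -- decoded family, which is light because `I` is free, and hence in the pool.
      replay₂ : run (λ u → mem (first-part I) u ∨ mem (second-part I) u) (second-query I) ≡ run I (second-query I)
      replay₂ = replay I _ (second-query I) covered sub
        where
          covered : ∀ v → v ∈ picks I (second-query I) → mem (first-part I) v ∨ mem (second-part I) v ≡ true
          covered v v∈ with mem (first-part I) v in e
          ... | true = refl
          ... | false = mem⁺ (filterᵇ-∈⁺ _ (pool (first-part I)) (pool-∈⁺ (first-part I) v (subst (λ z → weight (proj₁ z) ≤ ι Λ) (sym replay₁) (out₁-light I free)) (alg₂-picks-in I (decode₁ (mem (first-part I))) v v∈) e) (mem⁺ v∈))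
          sub : ∀ v → mem (first-part I) v ∨ mem (second-part I) v ≡ true → I v ≡ true
          sub v e with mem (first-part I) v in e₁ | mem (second-part I) v in e₂
          ... | true | _ = first-⊆ I v e₁
          ... | false | true = second-⊆ I v e₂

      container≡ : ∀ v → container (fingerprint I) v ≡ Outer v ∨ out₂ I free v
      container≡ v = cong (λ z → Outer v ∨ proj₁ z v) (trans replay₂ (cong (λ z → run I (alg₂ z)) replay₁))

      container-⊇ : I ⊆F container (fingerprint I)
      container-⊇ v e rewrite container≡ v with Mid v in m
      ... | false = refl
      ... | true = out₂-⊇ I free v e m

      opaque
        unfolding _+_

        ring-93 : ∀ b r k → b * r + b * (k + r) ≡ (k + (r + r)) * b
        ring-93 = solve-∀ ℚring

      -- One `rec t` accounts for the sets outside the window, the other for the surplus over `K`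
      -- that the second phase may leave.
      container-size : ι ∣ container (fingerprint I) ∣F ≤ (ι K + (rec t + rec t)) * ι b
      container-size = begin
        ι ∣ container (fingerprint I) ∣F  ≡⟨ trans (ι-card (container (fingerprint I))) (∑-cong (all {n}) (λ v → cong 𝟙 (container≡ v))) ⟩
        ∑ all (λ v → 𝟙 (Outer v ∨ out₂ I free v))  ≤⟨ ∑-mono (all {n}) (λ v → 𝟙-∨ (Outer v) (out₂ I free v)) ⟩
        ∑ all (λ v → 𝟙 (Outer v) + 𝟙 (out₂ I free v))  ≡⟨ ∑-+ (all {n}) _ _ ⟩
        ∑ all (λ v → 𝟙 (Outer v)) + ∑ all (λ v → 𝟙 (out₂ I free v))  ≤⟨ +-mono-≤ outer-size (≤-trans (∑𝟙≤ (out₂ I free)) (*-monoˡ (ι b) (0≤ι b) (out₂-light I free))) ⟩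
        ι b * rec t + ι b * (ι K + rec t)  ≡⟨ ring-93 (ι b) (rec t) (ι K) ⟩
        (ι K + (rec t + rec t)) * ι b  ∎
        where
          open ℚₚ.≤-Reasoning
          𝟙-∨ : ∀ a b → 𝟙 (a ∨ b) ≤ 𝟙 a + 𝟙 b
          𝟙-∨ true b = p≤p+q (0≤𝟙 b)
          𝟙-∨ false b = ≤-reflexive (sym (+-identityˡ (𝟙 b)))

    independent⇒free : ∀ (I : Family n) → Independent Po I → Free I
    independent⇒free I ind t h e = ind (TC.embedded-copy enc I t h e)

    theFingerprint : Fingerprint Po n
    theFingerprint = record
      { 𝒯 = fingerprints
      ; 𝒯-disjoint = disjoint
      ; g = fingerprint
      ; g-∈ = λ I _ → fingerprint-∈ I
      ; g-⊆ = λ I _ → fingerprint-⊆ I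
      ; C = container
      ; C-⊇ = λ I ind → container-⊇ I (independent⇒free I ind)
      }
      where
        disjoint : ∀ T → T ∈ fingerprints → AllPairs DisjointF T
        disjoint T T∈ with fingerprints⁻ T T∈
        ... | record { F₁ = F₁ ; F₂ = F₂ ; T≡ = refl ; F₂∈ = F₂∈ } = ((λ v e₁ e₂ → case trans (sym e₁) (F₂-outside F₁ F₂ F₂∈ v e₂) of λ ()) ∷ []) ∷ ([] ∷ [])

open Fingerprint

theorem6p4 : (P : FinPoset) → IsTreePoset P → (k : ℕ) → HasHeight P k → 2 ℕ.≤ k →
    (ε : ℚ) → 0ℚ ℚ.< ε →
    Σ ℚ λ K → 0ℚ ℚ.< K × Σ ℕ λ n₀ → ∀ n → n₀ ℕ.≤ n →
    Σ (Fingerprint P n) λ F →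
    (∀ T → T ∈ 𝒯 F → ℕ→ℚ ∣ ⋃ T ∣F ℚ.≤ (K ℚ.* frac 1 n) ℚ.* B n)
    × (∀ s → LeMulExp (ℕ→ℚ (countSize (𝒯 F) s))
    ((K ℚ.* B n ℚ.* frac 1 s) ^ℚ s)
    ((K ℚ.* frac 1 n) ℚ.* B n))
    × (∀ I → Independent P I →
    ℕ→ℚ ∣ C F (g F I) ∣F ℚ.≤ (ℕ→ℚ (k ∸ 1) ℚ.+ ε) ℚ.* B n)
theorem6p4 Po tree (suc K) ((chain , _) , height) _ ε 0<ε =
  ℕ→ℚ K̂ , subst (0ℚ <_) (ι-def K̂) (0<ι 1≤K̂) , n₀ , λ n n₀≤n →
    let open AtLarge n n₀≤n
        ι-b : ι b ≡ B n
        ι-b = trans (ι-def b) (cong ℕ→ℚ (central-def n))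
        K/n : ι K̂ * rec n * ι b ≡ (ℕ→ℚ K̂ ℚ.* frac 1 n) ℚ.* B n
        K/n = trans (*-def _ _) (cong₂ ℚ._*_ (trans (*-def _ _) (cong₂ ℚ._*_ (ι-def K̂) (rec-def n))) ι-b)
    in theFingerprint
     , (λ T T∈ → subst₂ _≤_ (ι-def _) K/n (over-n ∣ ⋃ T ∣F (ℕₚ.≤-trans (ℕₚ.*-monoˡ-≤ n (size≤ T T∈)) size-bound)))
     , (λ s → let Kb/s : ι K̂ * ι b * rec s ≡ ℕ→ℚ K̂ ℚ.* B n ℚ.* frac 1 s
                  Kb/s = trans (*-def _ _) (cong₂ ℚ._*_ (trans (*-def _ _) (cong₂ ℚ._*_ (ι-def K̂) ι-b)) (rec-def s))
                  a≡ : powℚ (ι K̂ * ι b * rec s) s ≡ (ℕ→ℚ K̂ ℚ.* B n ℚ.* frac 1 s) ^ℚ s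
                  a≡ = trans (sym (^ℚ≡powℚ _ s)) (cong (_^ℚ s) Kb/s)
              in LeMulExp-intro _ _ _ exponent
                   (subst₂ _≤_ (ι-def _) (cong (_* ι (2 ℕ.^ exponent)) a≡) (count-≤ s))
                   (subst (0ℚ ≤_) a≡ (0≤powℚ s (*-nn (*-nn (0≤ι K̂) (0≤ι b)) (0≤rec s))))
                   (subst (ι (2 ℕ.* exponent) ≤_) K/n (over-n (2 ℕ.* exponent) exponent-bound)))
     , (λ I ind → subst₂ _≤_ (ι-def _) (trans (*-def _ _) (cong₂ ℚ._*_ (trans (+-def _ _) (cong (ℚ._+ ε) (ι-def K))) ι-b))
         (≤-trans (container-size I (independent⇒free I ind)) (*-monoʳ (ι b) (0≤ι b) (+-mono-≤ (≤-refl {ι K}) (≤-trans (≤-reflexive (sym (rec-half t₀))) (proj₂ (proj₂ below)))))))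
  where
    below = rec-below ε 0<ε
    t₀ = proj₁ below
    -- The container exceeds `K` by two errors of size 1/t; t = 2 t₀ makes their sum 1/t₀, which is
    -- at most `ε`. The chain of maximal size supplies an element of the poset to start the code
    -- from.
    open Assembly Po tree K height (chain zero) (2 ℕ.* t₀) (1≤* {2} (s≤s z≤n) (proj₁ (proj₂ below)))
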